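{- Let $K$ be an algebraically closed field, complete with respect to a non-archimedean absolute value $|\cdot|$, with valuation ring $\mathcal{O}$, maximal ideal $\mathfrak{m}$ and residue field $k=\mathcal{O}/\mathfrak{m}$. Let $\varphi\in K(z)$ be a rational map of degree $2$, and let $\xi$ be the unique point of $\mathbb{P}^1_{\mathrm{Berk}}$ with $w_\varphi(\xi)>0$ (the unique point of the crucial set of $\varphi$). Let $\lambda_1,\lambda_2,\lambda_3$ be the multipliers of $\varphi$ at its three classical fixed points (listed with multiplicity), $\sigma_1=\lambda_1+\lambda_2+\lambda_3$, $\sigma_2=\lambda_1\lambda_2+\lambda_1\lambda_3+\lambda_2\lambda_3$, and $\mathbf{s}([\varphi])=[\sigma_1:\sigma_2:1]\in\mathbb{P}^2(K)$. Then: (A) $\widetilde{\mathbf{s}([\varphi])}\in\mathbb{A}^2(k)=\{[\tilde x:\tilde y:\tilde 1]\}$ if and only if $\xi$ satisfies (W1); (B) $\widetilde{\mathbf{s}([\varphi])}=[\tilde 1:\tilde x:\tilde 0]$ for some $\tilde x\in k$ with $\tilde x\neq\tilde 2$ if and only if $\xi$ satisfies (W2); in this case $\tilde x=\tilde\lambda+\tilde\lambda^{ -1}$, where $\lambda$ is the multiplier of $\varphi$ at a classical indifferent fixed point; (C) $\widetilde{\mathbf{s}([\varphi])}=[\tilde 1:\tilde 2:\tilde 0]$ if and only if $\xi$ satisfies (W3); (D) $\widetilde{\mathbf{s}([\varphi])}=[\tilde 0:\tilde 1:\tilde 0]$ if and only if $\xi$ satisfies (W4).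
   Context: $\mathbb{P}^1_{\mathrm{Berk}}$ is the Berkovich projective line over $K$; for $a\in K$, $r>0$, $\zeta_{D(a,r)}$ denotes the point corresponding to the sup-norm on the disc $D(a,r)=\{x:|x-a|\le r\}$; it is of type II when $r\in|K^\times|$; $\zeta_G=\zeta_{D(0,1)}$ is the Gauss point. $\varphi$ acts continuously on $\mathbb{P}^1_{\mathrm{Berk}}$. For a rational map $\psi$, a normalized lift is a pair $[F,G]$ of homogeneous polynomials with coefficients in $\mathcal{O}$, at least one a unit, with $\psi=F(z,1)/G(z,1)$; the reduction $\tilde\psi$ is obtained by reducing the coefficients mod $\mathfrak{m}$ and cancelling common factors. For a type II point $P$, choose $\gamma\in\mathrm{PGL}_2(K)$ with $\gamma(\zeta_G)=P$ and set $\tilde\varphi_P:=\widetilde{\gamma^{ -1}\circ\varphi\circ\gamma}$ (well-defined up to $\mathrm{PGL}_2(k)$-conjugacy). A type II point $P$ is fixed by $\varphi$ iff $\tilde\varphi_P$ is nonconstant. The tangent directions at a type II point $P$ correspond to $\mathbb{P}^1(k)$ and $\varphi_*$ acts on them via $\tilde\varphi_P$ when $P$ is fixed. Let $\Gamma_{\mathrm{Fix}}$ be the subtree of $\mathbb{P}^1_{\mathrm{Berk}}$ spanned by the classical fixed points of $\varphi$ and $\Gamma_{\mathrm{Fix,Repel}}$ the tree spanned by the classical fixed points and the type II fixed points $P$ with $\deg\tilde\varphi_P\ge2$; $v(P)$ is the valence of $P$ in $\Gamma_{\mathrm{Fix,Repel}}$ (0 if $P\notin\Gamma_{\mathrm{Fix,Repel}}$).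 Weights: if $P$ is a type II fixed point, $w_\varphi(P)=\deg\tilde\varphi_P-1+N(P)$, where $N(P)$ is the number of tangent directions at $P$ containing classical fixed points that are moved by $\varphi_*$; if $P$ is a branch point of $\Gamma_{\mathrm{Fix}}$ moved by $\varphi$, $w_\varphi(P)=v(P)-2$; otherwise $w_\varphi(P)=0$. The weights sum to $\deg\varphi-1=1$. Conditions on a type II point $P$: (W1) $P$ is fixed and $\deg\tilde\varphi_P\ge2$; (W2) $P$ is fixed, $\tilde\varphi_P$ is conjugate over $k$ to $z\mapsto \tilde c z$ with $\tilde c\in k^\times$, $\tilde c\ne\tilde1$, and $P$ is a branch point of $\Gamma_{\mathrm{Fix}}$; (W3) $P$ is fixed, $\tilde\varphi_P$ is conjugate to $z\mapsto z+\tilde a$ with $\tilde a\in k^\times$, and $P\in\Gamma_{\mathrm{Fix}}$; (W4) $P$ is a branch point of $\Gamma_{\mathrm{Fix}}$ moved by $\varphi$. The multiplier at a fixed point $\alpha$ is $\varphi'(\alpha)$ (computed in a coordinate chart at $\infty$ if needed); $\alpha$ is indifferent if $|\varphi'(\alpha)|=1$. For $P\in\mathbb{P}^2(K)$, $\tilde P\in\mathbb{P}^2(k)$ is its specialization: scale homogeneous coordinates to lie in $\mathcal{O}$ with one a unit and reduce mod $\mathfrak{m}$. -}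

module Defs where

open import Algebra.Bundles using (CommutativeRing)
import Algebra.Construct.NaturalChoice.Max as Max
import Algebra.Properties.Ring as RingProperties
import Algebra.Properties.Semiring.Exp as Exp
import Algebra.Properties.Semiring.Mult as Mult
open import Data.Fin.Base using (Fin)
open import Data.Nat.Base as ℕ using (ℕ; zero; suc)
open import Data.Product using (Σ; ∃; _×_; _,_; proj₁; proj₂; Σ-syntax; ∃-syntax)
open import Data.Sum.Base using (_⊎_; inj₁; inj₂)
open import Data.Vec.Base using (Vec; []; _∷_; _∷ʳ_; _++_; map; zipWith; reverse; head; tail)
open import Data.Vec.Relation.Binary.Pointwise.Inductive using (Pointwise)
open import Data.Vec.Relation.Unary.Any using (Any)
open import Level using (Level; _⊔_) renaming (suc to lsuc)
open import Relation.Binary.Bundles using (TotalOrder)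
open import Relation.Binary.Core using (Rel)
import Relation.Binary.Construct.NonStrictToStrict as Strict
open import Relation.Binary.PropositionalEquality.Core using (_≡_)
open import Relation.Binary.Structures using (IsDecTotalOrder)
open import Relation.Nullary using (¬_; yes; no)
open import Relation.Nullary.Negation using (contradiction)

record Field c ℓ : Set (lsuc (c ⊔ ℓ)) where
  field
    commutativeRing : CommutativeRing c ℓ
  open CommutativeRing commutativeRing public
  field
    0≉1     : 0# ≉ 1#
    inverse : ∀ x → x ≉ 0# → ∃[ y ] x * y ≈ 1#
  open Exp semiring public using (_^_)
  open Mult semiring public using () renaming (_×_ to _×ⁿ_)

-- The real numbers, presented as an Archimedean, Cauchy complete ordered field.
-- These axioms determine ℝ up to isomorphism.  The order is decidable, as it is
-- in classical mathematics.
record RealField c ℓ₁ ℓ₂ : Set (lsuc (c ⊔ ℓ₁ ⊔ ℓ₂)) where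
  field
    realField : Field c ℓ₁
  open Field realField public
  infix 4 _≤_
  field
    _≤_             : Rel Carrier ℓ₂
    isDecTotalOrder : IsDecTotalOrder _≈_ _≤_
    +-mono-≤        : ∀ {x y u v} → x ≤ y → u ≤ v → x + u ≤ y + v
    *-nonneg        : ∀ {x y} → 0# ≤ x → 0# ≤ y → 0# ≤ x * y
    archimedean     : ∀ x → ∃[ n ] x ≤ n ×ⁿ 1#

  module Order = IsDecTotalOrder isDecTotalOrder
  open Strict _≈_ _≤_ public using (_<_)

  totalOrder : TotalOrder c ℓ₁ ℓ₂
  totalOrder = record { isTotalOrder = Order.isTotalOrder }

  open Max totalOrder public using () renaming (_⊔_ to _⊔ᴿ_)

  field
    complete : (u : ℕ → Carrier) →
      (∀ ε → 0# < ε → ∃[ N ] ∀ m n → N ℕ.≤ m → N ℕ.≤ n → u m < u n + ε) →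
      ∃[ x ] ∀ ε → 0# < ε → ∃[ N ] ∀ n → N ℕ.≤ n → u n < x + ε × x < u n + ε

-- `n` is the number of `_~_`-classes of elements of `S`.
record Count {a s r} {A : Set a} (S : A → Set s) (_~_ : Rel A r) (n : ℕ) : Set (a ⊔ s ⊔ r) where
  field
    element    : Fin n → A
    member     : ∀ i → S (element i)
    distinct   : ∀ {i j} → element i ~ element j → i ≡ j
    exhaustive : ∀ x → S x → ∃[ i ] x ~ element i

module Projective {c ℓ} (F : Field c ℓ) where
  open Field F

  -- a₀ ∷ a₁ ∷ … ∷ a_d ∷ []  stands for  Σᵢ aᵢ Xⁱ Yᵈ⁻ⁱ.
  Form : ℕ → Set c
  Form d = Vec Carrier (suc d)

  infix  4 _≋_
  infixl 6 _⊕_ _⊖_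
  infixl 7 _·_ _⊛_

  -- Forms whose degrees are equal only propositionally can be compared.
  _≋_ : ∀ {m n} → Form m → Form n → Set (c ⊔ ℓ)
  _≋_ = Pointwise _≈_

  X Y : Form 1
  X = 0# ∷ 1# ∷ []
  Y = 1# ∷ 0# ∷ []

  _⊕_ _⊖_ : ∀ {d} → Form d → Form d → Form d
  _⊕_ = zipWith _+_
  _⊖_ = zipWith _-_

  _·_ : ∀ {d} → Carrier → Form d → Form d
  a · f = map (a *_) f

  timesX timesY : ∀ {d} → Form d → Form (suc d)
  timesX f = 0# ∷ f
  timesY f = f ∷ʳ 0#

  timesY^ : ∀ m {d} → Form d → Form (m ℕ.+ d)
  timesY^ zero    f = f
  timesY^ (suc m) f = timesY (timesY^ m f)

  -- A form a ∷ f of positive degree m is  a Yᵐ + X f;  the recursions below use this.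
  _⊛_ : ∀ {m n} → Form m → Form n → Form (m ℕ.+ n)
  _⊛_ {zero}  (a ∷ []) g = a · g
  _⊛_ {suc m} (a ∷ f)  g = timesY^ (suc m) (a · g) ⊕ timesX (f ⊛ g)

  power : ∀ {e} → Form e → (n : ℕ) → Form (n ℕ.* e)
  power f zero    = 1# ∷ []
  power f (suc n) = f ⊛ power f n

  eval : ∀ {d} → Form d → Carrier → Carrier → Carrier
  eval {zero}  (a ∷ []) x y = a
  eval {suc d} (a ∷ f)  x y = a * y ^ suc d + x * eval f x y

  -- The derivative at z of the polynomial f(z,1).
  derivative : ∀ {d} → Form d → Carrier → Carrier
  derivative {zero}  (a ∷ []) z = 0#
  derivative {suc d} (a ∷ f)  z = eval f z 1# + z * derivative f z

  AlgebraicallyClosed : Set (c ⊔ ℓ)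
  AlgebraicallyClosed = ∀ {n} (a : Vec Carrier (suc n)) → ∃[ x ] eval (a ∷ʳ 1#) x 1# ≈ 0#

  -- A pair of forms of equal degree, i.e. [X : Y] ↦ [num : den].
  record Lift (d : ℕ) : Set c where
    constructor [_,_]
    field
      num den : Form d

  open Lift public

  substitute : ∀ {d e} → Form d → Lift e → Form (d ℕ.* e)
  substitute {zero}  (a ∷ []) φ = a ∷ []
  substitute {suc d} (a ∷ f)  φ = a · power (den φ) (suc d) ⊕ num φ ⊛ substitute f φ

  record IsReduced {d} (φ : Lift d) : Set (c ⊔ ℓ) where
    field
      nonzero  : Any (_≉ 0#) (num φ) ⊎ Any (_≉ 0#) (den φ)
      noFactor : ∀ {m n} (h : Form m) (f g : Form n) →
                 num φ ≋ h ⊛ f → den φ ≋ h ⊛ g → m ≡ 0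

  -- Rational maps of degree d; d = 0 gives the constant maps.
  record RationalMap (d : ℕ) : Set (c ⊔ ℓ) where
    field
      lift    : Lift d
      reduced : IsReduced lift

  open RationalMap public

  infix 4 _≃_
  _≃_ : ∀ {d e} → Lift d → Lift e → Set (c ⊔ ℓ)
  φ ≃ ψ = num φ ⊛ den ψ ≋ num ψ ⊛ den φ

  -- Matrices representing the elements of PGL₂.
  record GL₂ : Set (c ⊔ ℓ) where
    field
      m₁₁ m₁₂ m₂₁ m₂₂ : Carrier
      det≉0           : m₁₁ * m₂₂ - m₁₂ * m₂₁ ≉ 0#

  möbius : GL₂ → Lift 1
  möbius γ = [ m₁₂ ∷ m₁₁ ∷ [] , m₂₂ ∷ m₂₁ ∷ [] ]
    where open GL₂ γ

  -- γ⁻¹ is represented by the adjugate matrix.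
  conjugate : ∀ {d} → GL₂ → Lift d → Lift (d ℕ.* 1)
  conjugate γ φ = [ m₂₂ · f ⊖ m₁₂ · g , m₁₁ · g ⊖ m₂₁ · f ]
    where
    open GL₂ γ
    f = substitute (num φ) (möbius γ)
    g = substitute (den φ) (möbius γ)

  applyInverse : GL₂ → Vec Carrier 2 → Vec Carrier 2
  applyInverse γ (x ∷ y ∷ []) = m₂₂ * x - m₁₂ * y ∷ m₁₁ * y - m₂₁ * x ∷ []
    where open GL₂ γ

  _conjugateTo_ : ∀ {d e} → RationalMap d → Lift e → Set (c ⊔ ℓ)
  φ conjugateTo ψ = ∃[ γ ] conjugate γ (lift φ) ≃ ψ

  record ℙ (n : ℕ) : Set (c ⊔ ℓ) where
    field
      coords  : Vec Carrier (suc n)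
      nonzero : Any (_≉ 0#) coords

  open ℙ public using (coords)

  Proportional : ∀ {n} → Rel (Vec Carrier n) (c ⊔ ℓ)
  Proportional v w = ∃[ u ] u ≉ 0# × Pointwise (λ x y → u * x ≈ y) v w

  _∼_ : ∀ {n} → Rel (ℙ n) (c ⊔ ℓ)
  α ∼ β = Proportional (coords α) (coords β)

  xᶜ yᶜ : ℙ 1 → Carrier
  xᶜ α = head (coords α)
  yᶜ α = head (tail (coords α))

  Fixes : ∀ {d} → RationalMap d → ℙ 1 → Set ℓ
  Fixes φ α = eval (num (lift φ)) (xᶜ α) (yᶜ α) * yᶜ α ≈ eval (den (lift φ)) (xᶜ α) (yᶜ α) * xᶜ α

  -- The form  yX - xY  vanishing at [x : y].
  vanishingAt : ℙ 1 → Form 1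
  vanishingAt α = - xᶜ α ∷ yᶜ α ∷ []

  -- The fixed points of a quadratic map, listed with multiplicity: the zeros of
  -- num·Y - den·X.
  HasFixedPoints : RationalMap 2 → (α₁ α₂ α₃ : ℙ 1) → Set (c ⊔ ℓ)
  HasFixedPoints φ α₁ α₂ α₃ = ∃[ a ] a ≉ 0# ×
    timesY (num (lift φ)) ⊖ timesX (den (lift φ))
      ≋ a · (vanishingAt α₁ ⊛ (vanishingAt α₂ ⊛ vanishingAt α₃))

  -- λ' is the value at z of the derivative of f/g, by the quotient rule.
  HasDerivative : ∀ {d} → Lift d → Carrier → Carrier → Set ℓ
  HasDerivative [ f , g ] z λ' =
    λ' * (eval g z 1# * eval g z 1#) ≈ derivative f z * eval g z 1# - eval f z 1# * derivative g z

  -- The map  w ↦ 1/φ(1/w).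
  atInfinity : ∀ {d} → Lift d → Lift d
  atInfinity [ f , g ] = [ reverse g , reverse f ]

  data IsMultiplier {d} (φ : RationalMap d) (α : ℙ 1) (λ' : Carrier) : Set (c ⊔ ℓ) where
    finite   : Fixes φ α → yᶜ α ≉ 0# → ∀ z → z * yᶜ α ≈ xᶜ α →
               HasDerivative (lift φ) z λ' → IsMultiplier φ α λ'
    infinite : Fixes φ α → yᶜ α ≈ 0# →
               HasDerivative (atInfinity (lift φ)) 0# λ' → IsMultiplier φ α λ'

record NonArchimedeanField {r ℓ₁ ℓ₂} (ℝ : RealField r ℓ₁ ℓ₂) c ℓ
       : Set (r ⊔ ℓ₁ ⊔ ℓ₂ ⊔ lsuc (c ⊔ ℓ)) where
  private module ℝ = RealField ℝ
  field
    baseField : Field c ℓ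
  open Field baseField
  field
    ∣_∣           : Carrier → ℝ.Carrier
    ∣∣-cong       : ∀ {x y} → x ≈ y → ∣ x ∣ ℝ.≈ ∣ y ∣
    ∣∣-nonneg     : ∀ x → ℝ.0# ℝ.≤ ∣ x ∣
    ∣0∣           : ∣ 0# ∣ ℝ.≈ ℝ.0#
    ∣∣-definite   : ∀ {x} → ∣ x ∣ ℝ.≈ ℝ.0# → x ≈ 0#
    ∣∣-*          : ∀ x y → ∣ x * y ∣ ℝ.≈ ∣ x ∣ ℝ.* ∣ y ∣
    ∣∣-ultra      : ∀ x y → ∣ x + y ∣ ℝ.≤ ∣ x ∣ ℝ.⊔ᴿ ∣ y ∣
    algClosed     : Projective.AlgebraicallyClosed baseField
    complete      : (u : ℕ → Carrier) →
      (∀ ε → ℝ.0# ℝ.< ε → ∃[ N ] ∀ m n → N ℕ.≤ m → N ℕ.≤ n → ∣ u m - u n ∣ ℝ.< ε) →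
      ∃[ x ] ∀ ε → ℝ.0# ℝ.< ε → ∃[ N ] ∀ n → N ℕ.≤ n → ∣ u n - x ∣ ℝ.< ε

module Residue {r ℓ₁ ℓ₂} (ℝ : RealField r ℓ₁ ℓ₂) {c ℓ} (K : NonArchimedeanField ℝ c ℓ) where

  private
    module ℝ = RealField ℝ
    module ≤ = ℝ.Order
    module ℝᴾ = RingProperties ℝ.ring
    module Maxᴾ = Max ℝ.totalOrder
  open NonArchimedeanField K
  open Field baseField
  private module Kᴾ = RingProperties ring

  *-monoʳ : ∀ {x y z} → ℝ.0# ℝ.≤ z → x ℝ.≤ y → x ℝ.* z ℝ.≤ y ℝ.* z
  *-monoʳ {x} {y} {z} 0≤z x≤y =
    ≤.≤-respˡ-≈ (ℝ.+-identityˡ _) (≤.≤-respʳ-≈ eq (ℝ.+-mono-≤ (ℝ.*-nonneg 0≤y-x 0≤z) ≤.refl))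
    where
    0≤y-x : ℝ.0# ℝ.≤ y ℝ.- x
    0≤y-x = ≤.≤-respˡ-≈ (ℝ.-‿inverseʳ x) (ℝ.+-mono-≤ x≤y ≤.refl)
    eq : (y ℝ.- x) ℝ.* z ℝ.+ x ℝ.* z ℝ.≈ y ℝ.* z
    eq = ℝ.trans (ℝ.sym (ℝ.distribʳ z _ x))
           (ℝ.*-congʳ (ℝ.trans (ℝ.+-assoc y _ x)
             (ℝ.trans (ℝ.+-congˡ (ℝ.-‿inverseˡ x)) (ℝ.+-identityʳ y))))

  square≈1 : ∀ {x} → ℝ.0# ℝ.≤ x → x ℝ.* x ℝ.≈ ℝ.1# → x ℝ.≈ ℝ.1#
  square≈1 {x} 0≤x xx≈1 with ≤.total x ℝ.1#
  ... | inj₁ x≤1 = ≤.antisym x≤1 (≤.≤-respˡ-≈ xx≈1 (≤.≤-respʳ-≈ (ℝ.*-identityˡ x) (*-monoʳ 0≤x x≤1)))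
  ... | inj₂ 1≤x = ≤.antisym (≤.≤-respʳ-≈ xx≈1 (≤.≤-respˡ-≈ (ℝ.*-identityˡ x) (*-monoʳ 0≤x 1≤x))) 1≤x

  ∣∣≉0 : ∀ {x} → x ≉ 0# → ∣ x ∣ ℝ.≉ ℝ.0#
  ∣∣≉0 x≉0 e = x≉0 (∣∣-definite e)

  ∣1∣ : ∣ 1# ∣ ℝ.≈ ℝ.1#
  ∣1∣ with ℝ.inverse ∣ 1# ∣ (∣∣≉0 (λ e → 0≉1 (sym e)))
  ... | y , ay≈1 = ℝ.trans (ℝ.sym (ℝ.*-identityʳ _))
        (ℝ.trans (ℝ.*-congˡ (ℝ.sym ay≈1)) (ℝ.trans (ℝ.sym (ℝ.*-assoc _ _ y))
          (ℝ.trans (ℝ.*-congʳ (ℝ.trans (ℝ.sym (∣∣-* 1# 1#)) (∣∣-cong (*-identityˡ 1#)))) ay≈1)))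

  ∣-∣ : ∀ x → ∣ - x ∣ ℝ.≈ ∣ x ∣
  ∣-∣ x = ℝ.trans (∣∣-cong (sym (Kᴾ.-1*x≈-x x)))
          (ℝ.trans (∣∣-* (- 1#) x) (ℝ.trans (ℝ.*-congʳ ∣-1∣) (ℝ.*-identityˡ _)))
    where
    ∣-1∣ : ∣ - 1# ∣ ℝ.≈ ℝ.1#
    ∣-1∣ = square≈1 (∣∣-nonneg _) (ℝ.trans (ℝ.sym (∣∣-* (- 1#) (- 1#)))
             (ℝ.trans (∣∣-cong (trans (Kᴾ.-1*x≈-x (- 1#)) (Kᴾ.-‿involutive 1#))) ∣1∣))

  0≤1 : ℝ.0# ℝ.≤ ℝ.1#
  0≤1 = ≤.≤-respʳ-≈ ∣1∣ (∣∣-nonneg 1#)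

  Integral Small : Carrier → Set _
  Integral x = ∣ x ∣ ℝ.≤ ℝ.1#
  Small x = ∣ x ∣ ℝ.< ℝ.1#

  ⊔-case : ∀ {p} (P : ℝ.Carrier → Set p) → (∀ {x y} → x ℝ.≈ y → P x → P y) →
           ∀ x y → P x → P y → P (x ℝ.⊔ᴿ y)
  ⊔-case P resp x y px py with ≤.total x y
  ... | inj₁ x≤y = resp (ℝ.sym (Maxᴾ.x≤y⇒x⊔y≈y x≤y)) py
  ... | inj₂ y≤x = resp (ℝ.sym (Maxᴾ.x≤y⇒y⊔x≈y y≤x)) px

  <1-resp : ∀ {x y} → x ℝ.≈ y → x ℝ.< ℝ.1# → y ℝ.< ℝ.1#
  <1-resp e (p , q) = ≤.≤-respˡ-≈ e p , λ y≈1 → q (ℝ.trans e y≈1)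

  ≤<1 : ∀ {x y} → x ℝ.≤ y → y ℝ.< ℝ.1# → x ℝ.< ℝ.1#
  ≤<1 x≤y (y≤1 , y≉1) = ≤.trans x≤y y≤1 ,
    λ x≈1 → y≉1 (≤.antisym y≤1 (≤.≤-respˡ-≈ x≈1 x≤y))

  small-cong : ∀ {x y} → x ≈ y → Small x → Small y
  small-cong e = <1-resp (∣∣-cong e)

  integral-+ : ∀ {x y} → Integral x → Integral y → Integral (x + y)
  integral-+ {x} {y} p q = ≤.trans (∣∣-ultra x y) (⊔-case (ℝ._≤ ℝ.1#) ≤.≤-respˡ-≈ _ _ p q)

  small-+ : ∀ {x y} → Small x → Small y → Small (x + y)
  small-+ {x} {y} p q = ≤<1 (∣∣-ultra x y) (⊔-case (ℝ._< ℝ.1#) <1-resp _ _ p q)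

  integral-neg : ∀ {x} → Integral x → Integral (- x)
  integral-neg {x} = ≤.≤-respˡ-≈ (ℝ.sym (∣-∣ x))

  small-neg : ∀ {x} → Small x → Small (- x)
  small-neg {x} = <1-resp (ℝ.sym (∣-∣ x))

  product≤ : ∀ {x y} → Integral x → ∣ x * y ∣ ℝ.≤ ∣ y ∣
  product≤ {x} {y} p = ≤.≤-respˡ-≈ (ℝ.sym (∣∣-* x y))
    (≤.≤-respʳ-≈ (ℝ.*-identityˡ _) (*-monoʳ (∣∣-nonneg y) p))

  integral-* : ∀ {x y} → Integral x → Integral y → Integral (x * y)
  integral-* p q = ≤.trans (product≤ p) q

  small-* : ∀ {x y} → Integral x → Small y → Small (x * y)
  small-* p q = ≤<1 (product≤ p) q

  small-0 : Small 0#
  small-0 = <1-resp (ℝ.sym ∣0∣) (0≤1 , ℝ.0≉1)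

  +-diff : ∀ x y u v → (x - y) + (u - v) ≈ (x + u) - (y + v)
  +-diff x y u v = begin
    (x - y) + (u - v)       ≈⟨ +-assoc x (- y) _ ⟩
    x + (- y + (u - v))     ≈⟨ +-congˡ (sym (+-assoc _ _ _)) ⟩
    x + ((- y + u) - v)     ≈⟨ +-congˡ (+-congʳ (+-comm _ _)) ⟩
    x + ((u - y) - v)       ≈⟨ +-congˡ (+-assoc _ _ _) ⟩
    x + (u + (- y - v))     ≈⟨ sym (+-assoc _ _ _) ⟩
    (x + u) + (- y - v)     ≈⟨ +-congˡ (Kᴾ.-‿+-comm y v) ⟩
    (x + u) - (y + v)       ∎
    where open import Relation.Binary.Reasoning.Setoid setoid

  *-diff : ∀ x y u v → u * (x - y) + y * (u - v) ≈ x * u - y * v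
  *-diff x y u v = begin
    u * (x - y) + y * (u - v)                     ≈⟨ +-cong (Kᴾ.x[y-z]≈xy-xz u x y) (Kᴾ.x[y-z]≈xy-xz y u v) ⟩
    (u * x - u * y) + (y * u - y * v)             ≈⟨ +-cong (+-cong (*-comm u x) (-‿cong (*-comm u y))) refl ⟩
    (x * u - y * u) + (y * u - y * v)             ≈⟨ +-assoc _ _ _ ⟩
    x * u + (- (y * u) + (y * u - y * v))         ≈⟨ +-congˡ (sym (+-assoc _ _ _)) ⟩
    x * u + ((- (y * u) + y * u) - y * v)         ≈⟨ +-congˡ (+-congʳ (-‿inverseˡ _)) ⟩
    x * u + (0# - y * v)                          ≈⟨ +-congˡ (+-identityˡ _) ⟩
    x * u - y * v                                 ∎
    where open import Relation.Binary.Reasoning.Setoid setoid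

  𝒪 : Set _
  𝒪 = Σ[ x ∈ Carrier ] ∣ x ∣ ℝ.≤ ℝ.1#

  value : 𝒪 → Carrier
  value = proj₁

  infix 4 _≡ₘ_
  record _≡ₘ_ (a b : 𝒪) : Set (ℓ₁ ⊔ ℓ₂) where
    constructor congruent
    field
      small : ∣ value a - value b ∣ ℝ.< ℝ.1#

  open _≡ₘ_ public

  ≈⇒≡ₘ : ∀ {a b} → value a ≈ value b → a ≡ₘ b
  ≈⇒≡ₘ {a} {b} e = congruent (small-cong (sym (trans (+-congʳ e) (-‿inverseʳ (value b)))) small-0)

  ≡ₘ-sym : ∀ {a b} → a ≡ₘ b → b ≡ₘ a
  ≡ₘ-sym {a , _} {b , _} (congruent p) = congruent (small-cong
    (trans (sym (Kᴾ.-‿+-comm a (- b)))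
      (trans (+-congˡ (Kᴾ.-‿involutive b)) (+-comm (- a) b)))
    (small-neg p))

  ≡ₘ-trans : ∀ {a b d} → a ≡ₘ b → b ≡ₘ d → a ≡ₘ d
  ≡ₘ-trans {a , _} {b , _} {d , _} (congruent p) (congruent q) = congruent (small-cong
    (trans (+-assoc a (- b) _)
      (+-congˡ (trans (sym (+-assoc (- b) b _))
        (trans (+-congʳ (-‿inverseˡ b)) (+-identityˡ _)))))
    (small-+ p q))

  -- The residue field k = 𝒪/𝔪, as the setoid 𝒪 with congruence modulo 𝔪.
  residueField : Field _ _
  residueField = record
    { commutativeRing = record
      { Carrier = 𝒪
      ; _≈_     = _≡ₘ_
      ; _+_     = λ (x , p) (y , q) → x + y , integral-+ p q
      ; _*_     = mulₖ
      ; -_      = λ (x , p) → - x , integral-neg p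
      ; 0#      = zeroₖ
      ; 1#      = oneₖ
      ; isCommutativeRing = record
        { isRing = record
          { +-isAbelianGroup = record
            { isGroup = record
              { isMonoid = record
                { isSemigroup = record
                  { isMagma = record
                    { isEquivalence = record
                      { refl  = ≈⇒≡ₘ refl
                      ; sym   = ≡ₘ-sym
                      ; trans = ≡ₘ-trans }
                    ; ∙-cong = λ {(x , _)} {(y , _)} {(u , _)} {(v , _)} (congruent p) (congruent q) →
                        congruent (small-cong (+-diff x y u v) (small-+ p q)) }
                  ; assoc = λ (x , _) (y , _) (z , _) → ≈⇒≡ₘ (+-assoc x y z) }
                ; identity = (λ (x , _) → ≈⇒≡ₘ (+-identityˡ x)) , (λ (x , _) → ≈⇒≡ₘ (+-identityʳ x)) }
              ; inverse = (λ (x , _) → ≈⇒≡ₘ (-‿inverseˡ x)) , (λ (x , _) → ≈⇒≡ₘ (-‿inverseʳ x))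
              ; ⁻¹-cong = λ {(x , _)} {(y , _)} (congruent p) →
                  congruent (small-cong (sym (Kᴾ.-‿+-comm x (- y))) (small-neg p)) }
            ; comm = λ (x , _) (y , _) → ≈⇒≡ₘ (+-comm x y) }
          ; *-cong = λ {(x , _)} {(y , q)} {(u , p)} {(v , _)} (congruent s) (congruent t) →
              congruent (small-cong (*-diff x y u v) (small-+ (small-* p s) (small-* q t)))
          ; *-assoc = λ (x , _) (y , _) (z , _) → ≈⇒≡ₘ (*-assoc x y z)
          ; *-identity = (λ (x , _) → ≈⇒≡ₘ (*-identityˡ x)) , (λ (x , _) → ≈⇒≡ₘ (*-identityʳ x))
          ; distrib = (λ (x , _) (y , _) (z , _) → ≈⇒≡ₘ (distribˡ x y z))
                    , (λ (x , _) (y , _) (z , _) → ≈⇒≡ₘ (distribʳ x y z)) }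
        ; *-comm = λ (x , _) (y , _) → ≈⇒≡ₘ (*-comm x y) } }
    ; 0≉1     = λ (congruent s) → proj₂ s (ℝ.trans (∣∣-cong (+-identityˡ _)) (ℝ.trans (∣-∣ 1#) ∣1∣))
    ; inverse = residueInverse }
    where
    zeroₖ oneₖ : 𝒪
    zeroₖ = 0# , proj₁ small-0
    oneₖ  = 1# , ≤.reflexive ∣1∣

    mulₖ : 𝒪 → 𝒪 → 𝒪
    mulₖ (x , p) (y , q) = x * y , integral-* p q

    residueInverse : (a : 𝒪) → ¬ (a ≡ₘ zeroₖ) → Σ[ b ∈ 𝒪 ] (mulₖ a b ≡ₘ oneₖ)
    residueInverse (x , p) x≉0 = (y , ≤.reflexive ∣y∣≈1) , ≈⇒≡ₘ xy≈1
      where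
      x-0 : x - 0# ≈ x
      x-0 = trans (+-congˡ Kᴾ.-0#≈0#) (+-identityʳ x)
      ∣x∣≈1 : ∣ x ∣ ℝ.≈ ℝ.1#
      ∣x∣≈1 with ∣ x ∣ ≤.≟ ℝ.1#
      ... | yes e = e
      ... | no ne = contradiction (congruent (small-cong (sym x-0) (p , ne))) x≉0
      inv : ∃[ y ] x * y ≈ 1#
      inv = inverse x (λ x≈0 → ℝ.0≉1 (ℝ.trans (ℝ.sym ∣0∣) (ℝ.trans (∣∣-cong (sym x≈0)) ∣x∣≈1)))
      y : Carrier
      y = proj₁ inv
      xy≈1 : x * y ≈ 1#
      xy≈1 = proj₂ inv
      ∣y∣≈1 : ∣ y ∣ ℝ.≈ ℝ.1#
      ∣y∣≈1 = ℝ.trans (ℝ.sym (ℝ.*-identityˡ _)) (ℝ.trans (ℝ.*-congʳ (ℝ.sym ∣x∣≈1))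
                (ℝ.trans (ℝ.sym (∣∣-* x y)) (ℝ.trans (∣∣-cong xy≈1) ∣1∣)))

module Berkovich {r ℓ₁ ℓ₂} (ℝ : RealField r ℓ₁ ℓ₂) {c ℓ} (K : NonArchimedeanField ℝ c ℓ) where

  private module ℝ = RealField ℝ
  open NonArchimedeanField K public
  open Field baseField public
  open Projective baseField public
  open Residue ℝ K public using (𝒪; value; residueField)
  module k where
    open Field residueField public
    open Projective residueField public

  private
    L : Level
    L = r ⊔ ℓ₁ ⊔ ℓ₂ ⊔ c ⊔ ℓ

  -- A point of the Berkovich projective line: a multiplicative seminorm on the
  -- homogeneous elements of K[X,Y] which extends ∣_∣ and does not vanish at both X and Y.
  record ℙ¹ᴮᵉʳᵏ : Set L where
    field
      ∥_∥        : ∀ {d} → Form d → ℝ.Carrier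
      ∥∥-cong    : ∀ {d} {f g : Form d} → f ≋ g → ∥ f ∥ ℝ.≈ ∥ g ∥
      ∥∥-nonneg  : ∀ {d} (f : Form d) → ℝ.0# ℝ.≤ ∥ f ∥
      ∥∥-extends : ∀ a → ∥ a ∷ [] ∥ ℝ.≈ ∣ a ∣
      ∥∥-*       : ∀ {m n} (f : Form m) (g : Form n) → ∥ f ⊛ g ∥ ℝ.≈ ∥ f ∥ ℝ.* ∥ g ∥
      ∥∥-ultra   : ∀ {d} (f g : Form d) → ∥ f ⊕ g ∥ ℝ.≤ ∥ f ∥ ℝ.⊔ᴿ ∥ g ∥
      nonzero    : ¬ (∥ X ∥ ℝ.≈ ℝ.0# × ∥ Y ∥ ℝ.≈ ℝ.0#)

  norm : ℙ¹ᴮᵉʳᵏ → ∀ {d} → Form d → ℝ.Carrier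
  norm ξ = ℙ¹ᴮᵉʳᵏ.∥_∥ ξ

  -- Seminorms N, N′ on forms give the same point when N′ = Cᵈ N in degree d.
  Homothetic : (N N′ : ∀ {d} → Form d → ℝ.Carrier) → Set _
  Homothetic N N′ = ∃[ C ] ℝ.0# ℝ.< C × (∀ {d} (f : Form d) → N′ f ℝ.≈ (C ℝ.^ d) ℝ.* N f)

  infix 4 _≈ᴮ_
  _≈ᴮ_ : ℙ¹ᴮᵉʳᵏ → ℙ¹ᴮᵉʳᵏ → Set _
  ξ ≈ᴮ η = Homothetic (norm ξ) (norm η)

  -- φ(ξ) = η, where φ(ξ) is the seminorm f ↦ ∥ f ∘ φ ∥ of ξ.
  Maps : ∀ {d} → Lift d → ℙ¹ᴮᵉʳᵏ → ℙ¹ᴮᵉʳᵏ → Set _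
  Maps φ ξ η = Homothetic (λ f → norm ξ (substitute f φ)) (norm η)

  FixedBy : ∀ {d} → RationalMap d → ℙ¹ᴮᵉʳᵏ → Set _
  FixedBy φ ξ = Maps (lift φ) ξ ξ

  IsClassical : ℙ 1 → ℙ¹ᴮᵉʳᵏ → Set _
  IsClassical α ξ = Homothetic (λ f → ∣ eval f (xᶜ α) (yᶜ α) ∣) (norm ξ)

  IsSupremum : ∀ {i p} {I : Set i} → (I → Set p) → (I → ℝ.Carrier) → ℝ.Carrier → Set _
  IsSupremum P u s =
    (∀ t → P t → u t ℝ.≤ s) × (∀ s′ → (∀ t → P t → u t ℝ.≤ s′) → s ℝ.≤ s′)

  -- ξ = ζ_{D(a,ρ)}.
  IsDiscPoint : Carrier → ℝ.Carrier → ℙ¹ᴮᵉʳᵏ → Set _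
  IsDiscPoint a ρ ξ = ∃[ C ] ℝ.0# ℝ.< C × (∀ {d} (f : Form d) →
    IsSupremum (λ t → ∣ t - a ∣ ℝ.≤ ρ) (λ t → ∣ eval f t 1# ∣) ((C ℝ.^ d) ℝ.* norm ξ f))

  IsTypeII : ℙ¹ᴮᵉʳᵏ → Set _
  IsTypeII ξ = ∃[ a ] ∃[ b ] b ≉ 0# × IsDiscPoint a ∣ b ∣ ξ

  IsGauss : ℙ¹ᴮᵉʳᵏ → Set _
  IsGauss ξ = IsDiscPoint 0# ℝ.1# ξ

  -- The order for which ∞ is the largest point.  With the seminorms normalised by
  -- ∥Y∥ = 1 it says that ∥f∥ at ξ is at most ∥f∥ at η.
  infix 4 _≼_
  _≼_ : ℙ¹ᴮᵉʳᵏ → ℙ¹ᴮᵉʳᵏ → Set _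
  ξ ≼ η = ∀ {d} (f : Form d) → norm ξ f ℝ.* (norm η Y ℝ.^ d) ℝ.≤ norm η f ℝ.* (norm ξ Y ℝ.^ d)

  -- ζ ∈ [ξ,η]: the path runs up from ξ to the join of ξ and η and then down to η.
  OnPath : (ξ η ζ : ℙ¹ᴮᵉʳᵏ) → Set L
  OnPath ξ η ζ = (ξ ≼ ζ ⊎ η ≼ ζ) × (∀ ω → ξ ≼ ω → η ≼ ω → ζ ≼ ω)

  Span : (ℙ¹ᴮᵉʳᵏ → Set L) → ℙ¹ᴮᵉʳᵏ → Set L
  Span S ζ = ∃[ ξ ] ∃[ η ] S ξ × S η × OnPath ξ η ζ

  -- ξ and η lie in the same component of the complement of P.
  SameDirection : (P ξ η : ℙ¹ᴮᵉʳᵏ) → Set L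
  SameDirection P ξ η = ¬ OnPath ξ η P

  Outside : (Γ : ℙ¹ᴮᵉʳᵏ → Set L) (P ξ : ℙ¹ᴮᵉʳᵏ) → Set L
  Outside Γ P ξ = Γ ξ × ¬ (ξ ≈ᴮ P)

  -- The valence of P in the tree Γ: the number of directions at P meeting Γ.
  HasValence : (ℙ¹ᴮᵉʳᵏ → Set L) → ℙ¹ᴮᵉʳᵏ → ℕ → Set L
  HasValence Γ P v = (Γ P × Count (Outside Γ P) (SameDirection P) v) ⊎ (¬ Γ P × v ≡ 0)

  IsBranchPoint : (ℙ¹ᴮᵉʳᵏ → Set L) → ℙ¹ᴮᵉʳᵏ → Set L
  IsBranchPoint Γ P = Γ P × Σ[ ξ ∈ (Fin 3 → ℙ¹ᴮᵉʳᵏ) ]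
    (∀ i → Outside Γ P (ξ i)) × (∀ {i j} → SameDirection P (ξ i) (ξ j) → i ≡ j)

  -- Absolute value 1 says that a coordinate is a unit of 𝒪.
  Normalizes : ∀ {n} → Vec 𝒪 n → Vec Carrier n → Set _
  Normalizes o v = (∃[ a ] a ≉ 0# × Pointwise (λ x y → a * x ≈ value y) v o) ×
    Any (λ y → ∣ value y ∣ ℝ.≈ ℝ.1#) o

  -- The specialization of [v] is [w].
  Specializes : ∀ {n} → Vec Carrier n → Vec 𝒪 n → Set _
  Specializes v w = ∃[ o ] Normalizes o v × k.Proportional o w

  -- ψ is the reduction of φ: a normalized lift reduces to [h·F, h·G], where
  -- ψ = [F : G] has no common factors.
  record ReducesTo {d e} (φ : Lift d) (ψ : k.RationalMap e) : Set L where
    field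
      normalizedLift : k.Lift d
      isNormalized   : Normalizes (k.num normalizedLift ++ k.den normalizedLift) (num φ ++ den φ)
      {degree}       : ℕ
      factor         : k.Form degree
      num-factors    : k.num normalizedLift k.≋ factor k.⊛ k.num (k.lift ψ)
      den-factors    : k.den normalizedLift k.≋ factor k.⊛ k.den (k.lift ψ)

  record Frame (P : ℙ¹ᴮᵉʳᵏ) : Set L where
    field
      γ       : GL₂
      ζᴳ      : ℙ¹ᴮᵉʳᵏ
      isGauss : IsGauss ζᴳ
      maps    : Maps (möbius γ) ζᴳ P

  -- ψ is the reduction of γ⁻¹ ∘ φ ∘ γ.
  ReductionVia : ∀ {P d e} → Frame P → RationalMap d → k.RationalMap e → Set L
  ReductionVia fr φ ψ = ReducesTo (conjugate (Frame.γ fr) (lift φ)) ψ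

  ReductionAt : ∀ {d e} → ℙ¹ᴮᵉʳᵏ → RationalMap d → k.RationalMap e → Set L
  ReductionAt P φ ψ = Σ[ fr ∈ Frame P ] ReductionVia fr φ ψ

  -- Under the identification of tangent directions at P with ℙ¹(k) given by γ, the
  -- direction containing the classical point α is the reduction of γ⁻¹(α).
  InDirection : ∀ {P} → Frame P → k.ℙ 1 → ℙ 1 → Set _
  InDirection fr v α = Specializes (applyInverse (Frame.γ fr) (coords α)) (k.coords v)

  MovedFixedPointDirection : ∀ {P d e} → Frame P → RationalMap d → k.RationalMap e → k.ℙ 1 → Set _
  MovedFixedPointDirection fr φ ψ v = (∃[ α ] Fixes φ α × InDirection fr v α) × ¬ k.Fixes ψ v

  module _ {d} (φ : RationalMap d) where

    IsFixedClassical : ℙ¹ᴮᵉʳᵏ → Set L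
    IsFixedClassical ξ = ∃[ α ] Fixes φ α × IsClassical α ξ

    W1 : ℙ¹ᴮᵉʳᵏ → Set L
    W1 P = IsTypeII P × FixedBy φ P ×
      (∃[ e ] Σ[ ψ ∈ k.RationalMap e ] ReductionAt P φ ψ × 2 ℕ.≤ e)

    ΓFix ΓFixRepel : ℙ¹ᴮᵉʳᵏ → Set L
    ΓFix      = Span IsFixedClassical
    ΓFixRepel = Span (λ ξ → IsFixedClassical ξ ⊎ W1 ξ)

    W2 : ℙ¹ᴮᵉʳᵏ → Set L
    W2 P = IsTypeII P × FixedBy φ P ×
      (Σ[ ψ ∈ k.RationalMap 1 ] ReductionAt P φ ψ ×
        (∃[ b ] b k.≉ k.0# × b k.≉ k.1# × ψ k.conjugateTo k.[ b k.· k.X , k.Y ])) ×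
      IsBranchPoint ΓFix P

    W3 : ℙ¹ᴮᵉʳᵏ → Set L
    W3 P = IsTypeII P × FixedBy φ P ×
      (Σ[ ψ ∈ k.RationalMap 1 ] ReductionAt P φ ψ ×
        (∃[ b ] b k.≉ k.0# × ψ k.conjugateTo k.[ k.X k.⊕ b k.· k.Y , k.Y ])) ×
      ΓFix P

    IsMovedBranchPoint : ℙ¹ᴮᵉʳᵏ → Set L
    IsMovedBranchPoint P = IsBranchPoint ΓFix P × ¬ FixedBy φ P

    W4 : ℙ¹ᴮᵉʳᵏ → Set L
    W4 P = IsTypeII P × IsMovedBranchPoint P

    -- w_φ(P) = w.  The formulas  w = deg ψ - 1 + N  and  w = v - 2  are written
    -- without subtraction.
    data HasWeight (P : ℙ¹ᴮᵉʳᵏ) : ℕ → Set L where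
      fixed : ∀ {e N w} {ψ : k.RationalMap e} → IsTypeII P → FixedBy φ P →
              (fr : Frame P) → ReductionVia fr φ ψ →
              Count (MovedFixedPointDirection fr φ ψ) k._∼_ N →
              suc w ≡ e ℕ.+ N → HasWeight P w
      moved : ∀ {v w} → IsMovedBranchPoint P → HasValence ΓFixRepel P v →
              2 ℕ.+ w ≡ v → HasWeight P w
      other : ¬ (IsTypeII P × FixedBy φ P) → ¬ IsMovedBranchPoint P → HasWeight P 0

    HasPositiveWeight : ℙ¹ᴮᵉʳᵏ → Set L
    HasPositiveWeight P = ∃[ w ] HasWeight P w × 0 ℕ.< w

    IsIndifferent : ℙ 1 → 𝒪 → Set _
    IsIndifferent α l = IsMultiplier φ α (value l) × ∣ value l ∣ ℝ.≈ ℝ.1#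

  -- [σ₁ : σ₂ : 1] for the elementary symmetric functions σ₁, σ₂ of the multipliers.
  sigmaPoint : (λ₁ λ₂ λ₃ : Carrier) → Vec Carrier 3
  sigmaPoint λ₁ λ₂ λ₃ = λ₁ + λ₂ + λ₃ ∷ λ₁ * λ₂ + λ₁ * λ₃ + λ₂ * λ₃ ∷ 1# ∷ []

{-# OPTIONS --safe #-}
module Submission where

-- As K is algebraically closed, forms split into linear factors, so that points of the
-- Berkovich line may be compared on linear forms; a point lies on the path between two
-- classical points exactly when the linear forms vanishing there are orthogonal for it.
--
-- For a lift [f , g] with fixed points b₁, b₂, b₃ write f Y − g X = A ℓ₁ ℓ₂ ℓ₃ and
-- (f , g) (bᵢ) = Mᵢ bᵢ.  Then Mᵢ (λᵢ − 1) = A [bᵢ bⱼ] [bᵢ bₖ], an identity compatible with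
-- conjugation which may therefore be reduced modulo 𝔪 at any type II point ξ.  Over k, no Mᵢ
-- vanishes under (W1), so all multipliers are integral.  Under (W2) and (W3) exactly one
-- vanishes, giving one large multiplier, and the other two have reductions with product 1;
-- they differ from 1 precisely if the other two fixed points reduce to different points,
-- which separates (W2) from (W3).  Under (W4) exactly two vanish.  The symmetric functions
-- of the multipliers then specialize as stated.  The four positions of the specialization
-- exclude each other, while positive weight forces one of (W1)-(W4), so every implication
-- is an equivalence.

open import Defs
open import Algebra.Bundles using (CommutativeRing; RawRing)
import Algebra.Construct.NaturalChoice.Max as Max
import Algebra.Properties.Ring as RingProperties
import Algebra.Properties.Semiring.Mult.TCOptimised as Mult
import Algebra.Solver.Ring as RingSolver
import Algebra.Solver.Ring.AlmostCommutativeRing as ACR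
open import Axiom.ExcludedMiddle using (ExcludedMiddle)
open import Data.Empty using (⊥; ⊥-elim)
open import Data.Fin.Base using (Fin; zero; suc)
open import Data.Integer.Base as ℤ using (ℤ; +_; -[1+_])
import Data.Integer.Properties as ℤₚ
open import Data.List.Base as List using (List; []; _∷_)
open import Data.List.Relation.Unary.All as All using (All; []; _∷_)
import Data.List.Relation.Unary.All.Properties as Allₚ
open import Data.Maybe.Base using (Maybe; just; nothing)
open import Data.Nat.Base as ℕ using (ℕ; zero; suc)
import Data.Nat.Properties as ℕₚ
open import Data.Product using (∃; ∃-syntax; Σ-syntax; _×_; _,_; proj₁; proj₂)
open import Data.Sum.Base using (_⊎_; inj₁; inj₂; [_,_]′)
open import Data.Vec.Base using (Vec; []; _∷_; _∷ʳ_; map; zipWith; initLast; head; tail; _++_; splitAt)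
open import Data.Vec.Relation.Binary.Pointwise.Inductive as Pointwise using (Pointwise; []; _∷_)
open import Data.Vec.Relation.Unary.All as VecAll using ([]; _∷_)
open import Data.Vec.Relation.Unary.Any as Any using (Any; here; there)
import Data.Vec.Relation.Unary.Any.Properties as Anyₚ
open import Function.Base using (id; _∘_)
open import Function.Bundles using (_⇔_; mk⇔)
open import Level using (Level; Setω; _⊔_)
open import Relation.Binary.Bundles using (Poset)
import Relation.Binary.Construct.NonStrictToStrict as Strict
import Relation.Binary.PropositionalEquality as ≡
import Relation.Binary.Reasoning.PartialOrder as PosetReasoning
open import Relation.Nullary using (yes; no; ¬_; Dec)
open import Relation.Nullary.Negation using (contradiction)

-- Integer coefficients let the solver cancel terms in a ring whose own
-- elements cannot be compared.
module IntegerSolver {c ℓ} (R : CommutativeRing c ℓ) where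
  open CommutativeRing R
  open RingProperties ring
  open Mult semiring using () renaming (_×_ to _×′_)
  open Mult semiring using (×1-homo-*; ×-homo-+; 1+×)
  open import Relation.Binary.Reasoning.Setoid setoid

  private
    fromℤ : ℤ → Carrier
    fromℤ (+ n)    = n ×′ 1#
    fromℤ -[1+ n ] = - (suc n ×′ 1#)

    x-0≈x : ∀ x → x - 0# ≈ x
    x-0≈x x = trans (+-congˡ -0#≈0#) (+-identityʳ x)

    shift : ∀ x y → x - y ≈ (1# + x) - (1# + y)
    shift x y = sym (begin
      (1# + x) - (1# + y)     ≈⟨ +-congˡ (-‿+-comm 1# y) ⟨
      (1# + x) + (- 1# - y)   ≈⟨ +-congʳ (+-comm 1# x) ⟩
      (x + 1#) + (- 1# - y)   ≈⟨ +-assoc x 1# _ ⟩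
      x + (1# + (- 1# - y))   ≈⟨ +-congˡ (+-assoc 1# (- 1#) (- y)) ⟨
      x + ((1# - 1#) - y)     ≈⟨ +-congˡ (+-congʳ (-‿inverseʳ 1#)) ⟩
      x + (0# - y)            ≈⟨ +-congˡ (+-identityˡ _) ⟩
      x - y                   ∎)

    ⊖-homo : ∀ m n → fromℤ (m ℤ.⊖ n) ≈ m ×′ 1# - n ×′ 1#
    ⊖-homo m       zero    = sym (x-0≈x _)
    ⊖-homo zero    (suc n) = sym (+-identityˡ _)
    ⊖-homo (suc m) (suc n) = begin
      fromℤ (suc m ℤ.⊖ suc n)    ≡⟨ ≡.cong fromℤ (ℤₚ.[1+m]⊖[1+n]≡m⊖n m n) ⟩
      fromℤ (m ℤ.⊖ n)            ≈⟨ ⊖-homo m n ⟩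
      m ×′ 1# - n ×′ 1#          ≈⟨ shift _ _ ⟩
      (1# + m ×′ 1#) - (1# + n ×′ 1#)  ≈⟨ +-cong (1+× m 1#) (-‿cong (1+× n 1#)) ⟨
      suc m ×′ 1# - suc n ×′ 1#  ∎

    +-homo : ∀ i j → fromℤ (i ℤ.+ j) ≈ fromℤ i + fromℤ j
    +-homo (+ m)    (+ n)    = ×-homo-+ 1# m n
    +-homo (+ m)    -[1+ n ] = ⊖-homo m (suc n)
    +-homo -[1+ m ] (+ n)    = trans (⊖-homo n (suc m)) (+-comm _ _)
    +-homo -[1+ m ] -[1+ n ] = begin
      - (suc (suc (m ℕ.+ n)) ×′ 1#)         ≡⟨ ≡.cong (λ k → - (k ×′ 1#)) (≡.sym (ℕₚ.+-suc (suc m) n)) ⟩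
      - ((suc m ℕ.+ suc n) ×′ 1#)           ≈⟨ -‿cong (×-homo-+ 1# (suc m) (suc n)) ⟩
      - (suc m ×′ 1# + suc n ×′ 1#)          ≈⟨ -‿+-comm _ _ ⟨
      - (suc m ×′ 1#) + - (suc n ×′ 1#)      ∎

    -‿homo : ∀ i → fromℤ (ℤ.- i) ≈ - fromℤ i
    -‿homo (+ zero)  = sym -0#≈0#
    -‿homo (+ suc n) = refl
    -‿homo -[1+ n ]  = sym (-‿involutive _)

    *-homo⁺ : ∀ m j → fromℤ ((+ m) ℤ.* j) ≈ (m ×′ 1#) * fromℤ j
    *-homo⁺ m (+ n)    = trans (reflexive (≡.cong fromℤ (≡.sym (ℤₚ.pos-* m n)))) (×1-homo-* m n)
    *-homo⁺ m -[1+ n ] = begin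
      fromℤ ((+ m) ℤ.* -[1+ n ])        ≡⟨ ≡.cong fromℤ (≡.sym (ℤₚ.neg-distribʳ-* (+ m) (+ suc n))) ⟩
      fromℤ (ℤ.- ((+ m) ℤ.* (+ suc n))) ≈⟨ -‿homo ((+ m) ℤ.* (+ suc n)) ⟩
      - fromℤ ((+ m) ℤ.* (+ suc n))     ≈⟨ -‿cong (*-homo⁺ m (+ suc n)) ⟩
      - ((m ×′ 1#) * (suc n ×′ 1#))       ≈⟨ -‿distribʳ-* _ _ ⟩
      (m ×′ 1#) * - (suc n ×′ 1#)         ∎

    *-homo : ∀ i j → fromℤ (i ℤ.* j) ≈ fromℤ i * fromℤ j
    *-homo (+ m)    j = *-homo⁺ m j
    *-homo -[1+ m ] j = begin
      fromℤ (-[1+ m ] ℤ.* j)            ≡⟨ ≡.cong fromℤ (≡.sym (ℤₚ.neg-distribˡ-* (+ suc m) j)) ⟩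
      fromℤ (ℤ.- ((+ suc m) ℤ.* j))     ≈⟨ -‿homo ((+ suc m) ℤ.* j) ⟩
      - fromℤ ((+ suc m) ℤ.* j)         ≈⟨ -‿cong (*-homo⁺ (suc m) j) ⟩
      - ((suc m ×′ 1#) * fromℤ j)        ≈⟨ -‿distribˡ-* _ _ ⟩
      - (suc m ×′ 1#) * fromℤ j          ∎

    ℤ-raw : RawRing _ _
    ℤ-raw = record
      { Carrier = ℤ ; _≈_ = ≡._≡_ ; _+_ = ℤ._+_ ; _*_ = ℤ._*_ ; -_ = ℤ.-_ ; 0# = ℤ.0ℤ ; 1# = ℤ.1ℤ }

    morphism : ℤ-raw ACR.-Raw-AlmostCommutative⟶ ACR.fromCommutativeRing R
    morphism = record
      { ⟦_⟧    = fromℤ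
      ; +-homo = +-homo
      ; *-homo = *-homo
      ; -‿homo = -‿homo
      ; 0-homo = refl
      ; 1-homo = refl }

    compare : ∀ i j → Maybe (fromℤ i ≈ fromℤ j)
    compare i j with i ℤₚ.≟ j
    ... | yes ≡.refl = just refl
    ... | no _       = nothing

  open RingSolver ℤ-raw (ACR.fromCommutativeRing R) morphism compare public

module FormProperties {c ℓ} (F : Field c ℓ) where
  open Field F
  open Projective F
  open IntegerSolver commutativeRing
  open import Relation.Binary.Reasoning.Setoid setoid

  ^-cong : ∀ n {x y} → x ≈ y → x ^ n ≈ y ^ n
  ^-cong zero    e = refl
  ^-cong (suc n) e = *-cong e (^-cong n e)

  1^ : ∀ n → 1# ^ n ≈ 1#
  1^ zero    = refl
  1^ (suc n) = trans (*-identityˡ _) (1^ n)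

  ≋-refl : ∀ {d} {f : Form d} → f ≋ f
  ≋-refl = Pointwise.refl refl

  ≋-sym : ∀ {m n} {f : Form m} {g : Form n} → f ≋ g → g ≋ f
  ≋-sym = Pointwise.sym sym

  ≋-trans : ∀ {l m n} {f : Form l} {g : Form m} {h : Form n} → f ≋ g → g ≋ h → f ≋ h
  ≋-trans = Pointwise.trans trans

  ≋-degree : ∀ {m n} {f : Form m} {g : Form n} → f ≋ g → m ≡.≡ n
  ≋-degree e = ℕₚ.suc-injective (Pointwise.length-equal e)

  eval-cong : ∀ {d} {f g : Form d} {x y x′ y′} → f ≋ g → x ≈ x′ → y ≈ y′ → eval f x y ≈ eval g x′ y′
  eval-cong {zero}  {_ ∷ []} {_ ∷ []} (e ∷ [])   _  _  = e
  eval-cong {suc d} {_ ∷ _}  {_ ∷ _}  (e ∷ es) ex ey =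
    +-cong (*-cong e (^-cong (suc d) ey)) (*-cong ex (eval-cong es ex ey))

  eval-≋ : ∀ {m n} {f : Form m} {g : Form n} → f ≋ g → ∀ x y → eval f x y ≈ eval g x y
  eval-≋ e x y with ≋-degree e
  ... | ≡.refl = eval-cong e refl refl

  eval-arg : ∀ {d} (f : Form d) {x y x′ y′} → x ≈ x′ → y ≈ y′ → eval f x y ≈ eval f x′ y′
  eval-arg f = eval-cong (≋-refl {f = f})

  eval-⊕ : ∀ {d} (f g : Form d) x y → eval (f ⊕ g) x y ≈ eval f x y + eval g x y
  eval-⊕ {zero}  (a ∷ []) (b ∷ []) x y = refl
  eval-⊕ {suc d} (a ∷ f) (b ∷ g) x y = trans (+-congˡ (*-congˡ (eval-⊕ f g x y)))
    (solve 6 (λ a b p x u v → (a :+ b) :* p :+ x :* (u :+ v) := (a :* p :+ x :* u) :+ (b :* p :+ x :* v))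
      refl a b (y ^ suc d) x (eval f x y) (eval g x y))

  eval-⊖ : ∀ {d} (f g : Form d) x y → eval (f ⊖ g) x y ≈ eval f x y - eval g x y
  eval-⊖ {zero}  (a ∷ []) (b ∷ []) x y = refl
  eval-⊖ {suc d} (a ∷ f) (b ∷ g) x y = trans (+-congˡ (*-congˡ (eval-⊖ f g x y)))
    (solve 6 (λ a b p x u v → (a :- b) :* p :+ x :* (u :- v) := (a :* p :+ x :* u) :- (b :* p :+ x :* v))
      refl a b (y ^ suc d) x (eval f x y) (eval g x y))

  eval-· : ∀ {d} a (f : Form d) x y → eval (a · f) x y ≈ a * eval f x y
  eval-· {zero}  a (b ∷ []) x y = refl
  eval-· {suc d} a (b ∷ f) x y = trans (+-congˡ (*-congˡ (eval-· a f x y)))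
    (solve 5 (λ a b p x u → (a :* b) :* p :+ x :* (a :* u) := a :* (b :* p :+ x :* u))
      refl a b (y ^ suc d) x (eval f x y))

  eval-timesX : ∀ {d} (f : Form d) x y → eval (timesX f) x y ≈ x * eval f x y
  eval-timesX f x y = trans (+-congʳ (zeroˡ _)) (+-identityˡ _)

  eval-timesY : ∀ {d} (f : Form d) x y → eval (timesY f) x y ≈ y * eval f x y
  eval-timesY {zero}  (a ∷ []) x y =
    solve 3 (λ a x y → a :* (y :* con (+ 1)) :+ x :* con (+ 0) := y :* a) refl a x y
  eval-timesY {suc d} (a ∷ f) x y = trans (+-congˡ (*-congˡ (eval-timesY f x y)))
    (solve 5 (λ a p x y u → a :* (y :* p) :+ x :* (y :* u) := y :* (a :* p :+ x :* u))
      refl a (y ^ suc d) x y (eval f x y))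

  eval-timesY^ : ∀ m {d} (f : Form d) x y → eval (timesY^ m f) x y ≈ y ^ m * eval f x y
  eval-timesY^ zero    f x y = sym (*-identityˡ _)
  eval-timesY^ (suc m) f x y = trans (eval-timesY (timesY^ m f) x y)
    (trans (*-congˡ (eval-timesY^ m f x y)) (sym (*-assoc y _ _)))

  eval-⊛ : ∀ {m n} (f : Form m) (g : Form n) x y → eval (f ⊛ g) x y ≈ eval f x y * eval g x y
  eval-⊛ {zero}  (a ∷ []) g x y = eval-· a g x y
  eval-⊛ {suc m} (a ∷ f) g x y = begin
    eval (timesY^ (suc m) (a · g) ⊕ timesX (f ⊛ g)) x y
      ≈⟨ eval-⊕ (timesY^ (suc m) (a · g)) (timesX (f ⊛ g)) x y ⟩
    eval (timesY^ (suc m) (a · g)) x y + eval (timesX (f ⊛ g)) x y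
      ≈⟨ +-cong (eval-timesY^ (suc m) (a · g) x y) (eval-timesX (f ⊛ g) x y) ⟩
    y ^ suc m * eval (a · g) x y + x * eval (f ⊛ g) x y
      ≈⟨ +-cong (*-congˡ (eval-· a g x y)) (*-congˡ (eval-⊛ f g x y)) ⟩
    y ^ suc m * (a * eval g x y) + x * (eval f x y * eval g x y)
      ≈⟨ solve 5 (λ a p x u v → p :* (a :* v) :+ x :* (u :* v) := (a :* p :+ x :* u) :* v)
           refl a (y ^ suc m) x (eval f x y) (eval g x y) ⟩
    eval (a ∷ f) x y * eval g x y ∎

  eval-power : ∀ {e} (f : Form e) n x y → eval (power f n) x y ≈ eval f x y ^ n
  eval-power f zero    x y = refl
  eval-power f (suc n) x y = trans (eval-⊛ f (power f n) x y) (*-congˡ (eval-power f n x y))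

  eval-substitute : ∀ {d e} (f : Form d) (φ : Lift e) x y →
    eval (substitute f φ) x y ≈ eval f (eval (num φ) x y) (eval (den φ) x y)
  eval-substitute {zero}  (a ∷ []) φ x y = refl
  eval-substitute {suc d} (a ∷ f) φ x y = begin
    eval (a · power (den φ) (suc d) ⊕ num φ ⊛ substitute f φ) x y
      ≈⟨ eval-⊕ (a · power (den φ) (suc d)) (num φ ⊛ substitute f φ) x y ⟩
    eval (a · power (den φ) (suc d)) x y + eval (num φ ⊛ substitute f φ) x y
      ≈⟨ +-cong (trans (eval-· a (power (den φ) (suc d)) x y) (*-congˡ (eval-power (den φ) (suc d) x y)))
                (trans (eval-⊛ (num φ) (substitute f φ) x y) (*-congˡ (eval-substitute f φ x y))) ⟩
    eval (a ∷ f) (eval (num φ) x y) (eval (den φ) x y) ∎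

  eval-homogeneous : ∀ {d} (f : Form d) s x y → eval f (s * x) (s * y) ≈ s ^ d * eval f x y
  eval-homogeneous {zero}  (a ∷ []) s x y = sym (*-identityˡ a)
  eval-homogeneous {suc d} (a ∷ f) s x y = begin
    a * (s * y) ^ suc d + (s * x) * eval f (s * x) (s * y)
      ≈⟨ +-cong (*-congˡ (^-distrib (suc d))) (*-congˡ (eval-homogeneous f s x y)) ⟩
    a * (s ^ suc d * y ^ suc d) + (s * x) * (s ^ d * eval f x y)
      ≈⟨ solve 7 (λ a s p q x y u → a :* ((s :* p) :* (y :* q)) :+ (s :* x) :* (p :* u) := (s :* p) :* (a :* (y :* q) :+ x :* u))
           refl a s (s ^ d) (y ^ d) x y (eval f x y) ⟩
    s ^ suc d * eval (a ∷ f) x y ∎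
    where
    ^-distrib : ∀ n → (s * y) ^ n ≈ s ^ n * y ^ n
    ^-distrib zero    = sym (*-identityˡ 1#)
    ^-distrib (suc n) = trans (*-congˡ (^-distrib n))
      (solve 4 (λ s y p q → (s :* y) :* (p :* q) := (s :* p) :* (y :* q)) refl s y (s ^ n) (y ^ n))

  private
    shifted : ∀ {n} → Carrier → Carrier → Carrier → Vec Carrier n → Vec Carrier (suc n)
    shifted p q r g = zipWith _+_ (map (p *_) g ∷ʳ 0#) (r ∷ map (q *_) g)

  -- The coefficients of the quotient of f by X − zY are the values at z of the
  -- tails of f (Horner's scheme).
  quotient : ∀ {d} → Form d → Carrier → Vec Carrier d
  quotient {zero}  (a ∷ []) z = []
  quotient {suc d} (a ∷ f)  z = eval f z 1# ∷ quotient f z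

  private
    horner : ∀ {d} (f : Form d) z r → r ≈ eval f z 1# → Pointwise _≈_ (shifted (- z) 1# r (quotient f z)) f
    horner {zero}  (a ∷ []) z r e = trans (+-identityˡ r) e ∷ []
    horner {suc d} (a ∷ f)  z r e = constant ∷ horner f z _ (*-identityˡ _)
      where
      constant : (- z) * eval f z 1# + r ≈ a
      constant = trans (+-congˡ (trans e (+-congʳ (trans (*-congˡ (1^ (suc d))) (*-identityʳ a)))))
        (solve 3 (λ z u a → (:- z) :* u :+ (a :+ z :* u) := a) refl z (eval f z 1#) a)

  factor-affine : ∀ {d} (f : Form (suc d)) z → eval f z 1# ≈ 0# → f ≋ (- z ∷ 1# ∷ []) ⊛ quotient f z
  factor-affine f z e = ≋-sym (horner f z 0# (sym e))

  private
    Y-shifted : ∀ {n} r (g : Vec Carrier n) → r ≈ 0# → Pointwise _≈_ (g ∷ʳ 0#) (shifted 1# 0# r g)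
    Y-shifted r []      e = sym (trans (+-congˡ e) (+-identityˡ _)) ∷ []
    Y-shifted r (a ∷ g) e = sym (trans (+-cong (*-identityˡ a) e) (+-identityʳ a)) ∷ Y-shifted _ g (zeroˡ a)

  ∷ʳ-cong : ∀ {n} (g : Vec Carrier n) {a b} → a ≈ b → Pointwise _≈_ (g ∷ʳ a) (g ∷ʳ b)
  ∷ʳ-cong []      e = e ∷ []
  ∷ʳ-cong (b ∷ g) e = refl ∷ ∷ʳ-cong g e

  factor-Y : ∀ {d} (g : Form d) {a} → a ≈ 0# → g ∷ʳ a ≋ Y ⊛ g
  factor-Y g e = ≋-trans (∷ʳ-cong g e) (Y-shifted 0# g refl)

  eval-leading : ∀ {d} (g : Vec Carrier d) a x y → y ≈ 0# → eval (g ∷ʳ a) x y ≈ x ^ d * a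
  eval-leading []      a x y e = sym (*-identityˡ a)
  eval-leading {suc d} (b ∷ g) a x y e = begin
    b * (y * y ^ d) + x * eval (g ∷ʳ a) x y
      ≈⟨ +-cong (trans (*-congˡ (trans (*-congʳ e) (zeroˡ _))) (zeroʳ b)) (*-congˡ (eval-leading g a x y e)) ⟩
    0# + x * (x ^ d * a) ≈⟨ trans (+-identityˡ _) (sym (*-assoc x _ a)) ⟩
    x ^ suc d * a ∎

module FieldProperties (em : ∀ {a} → ExcludedMiddle a) {c ℓ} (F : Field c ℓ) where
  open Field F
  open Projective F
  open FormProperties F
  open IntegerSolver commutativeRing
  open import Relation.Binary.Reasoning.Setoid setoid
  open import Algebra.Properties.Ring ring public using (-0#≈0#)

  infix 9 _⁻¹
  _⁻¹ : ∀ {x} → x ≉ 0# → Carrier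
  x≉0 ⁻¹ = proj₁ (inverse _ x≉0)

  x*x⁻¹ : ∀ {x} (x≉0 : x ≉ 0#) → x * x≉0 ⁻¹ ≈ 1#
  x*x⁻¹ x≉0 = proj₂ (inverse _ x≉0)

  x⁻¹≉0 : ∀ {x} (x≉0 : x ≉ 0#) → x≉0 ⁻¹ ≉ 0#
  x⁻¹≉0 x≉0 e = 0≉1 (trans (sym (zeroʳ _)) (trans (*-congˡ (sym e)) (x*x⁻¹ x≉0)))

  x*y≈0⇒y≈0 : ∀ {x y} → x ≉ 0# → x * y ≈ 0# → y ≈ 0#
  x*y≈0⇒y≈0 {x} {y} x≉0 e = begin
    y                    ≈⟨ sym (*-identityˡ y) ⟩
    1# * y               ≈⟨ *-congʳ (sym (x*x⁻¹ x≉0)) ⟩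
    (x * x≉0 ⁻¹) * y     ≈⟨ solve 3 (λ x i y → (x :* i) :* y := i :* (x :* y)) refl x (x≉0 ⁻¹) y ⟩
    x≉0 ⁻¹ * (x * y)     ≈⟨ trans (*-congˡ e) (zeroʳ _) ⟩
    0#                   ∎

  *≉0 : ∀ {x y} → x ≉ 0# → y ≉ 0# → x * y ≉ 0#
  *≉0 x≉0 y≉0 e = y≉0 (x*y≈0⇒y≈0 x≉0 e)

  *≉0ˡ : ∀ {x y} → x * y ≉ 0# → x ≉ 0#
  *≉0ˡ xy≉0 e = xy≉0 (trans (*-congʳ e) (zeroˡ _))

  *≉0ʳ : ∀ {x y} → x * y ≉ 0# → y ≉ 0#
  *≉0ʳ xy≉0 e = xy≉0 (trans (*-congˡ e) (zeroʳ _))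

  zero-product : ∀ {x y} → x * y ≈ 0# → x ≈ 0# ⊎ y ≈ 0#
  zero-product {x} e with em {P = x ≈ 0#}
  ... | yes x≈0 = inj₁ x≈0
  ... | no x≉0  = inj₂ (x*y≈0⇒y≈0 x≉0 e)

  x-y≈0⇒x≈y : ∀ {x y} → x - y ≈ 0# → x ≈ y
  x-y≈0⇒x≈y {x} {y} e = begin
    x           ≈⟨ solve 2 (λ x y → x := (x :- y) :+ y) refl x y ⟩
    (x - y) + y ≈⟨ +-congʳ e ⟩
    0# + y      ≈⟨ +-identityˡ y ⟩
    y           ∎

  x≈y⇒x-y≈0 : ∀ {x y} → x ≈ y → x - y ≈ 0#
  x≈y⇒x-y≈0 {y = y} e = trans (+-congʳ e) (-‿inverseʳ y)

  *-cancelˡ : ∀ {x y z} → x ≉ 0# → x * y ≈ x * z → y ≈ z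
  *-cancelˡ {x} {y} {z} x≉0 e = x-y≈0⇒x≈y (x*y≈0⇒y≈0 x≉0
    (trans (solve 3 (λ x y z → x :* (y :- z) := x :* y :- x :* z) refl x y z) (x≈y⇒x-y≈0 e)))

  1≉0 : 1# ≉ 0#
  1≉0 e = 0≉1 (sym e)

  ^≉0 : ∀ n {x} → x ≉ 0# → x ^ n ≉ 0#
  ^≉0 zero    x≉0 = 1≉0
  ^≉0 (suc n) x≉0 = *≉0 x≉0 (^≉0 n x≉0)

  -‿≉0 : ∀ {x} → x ≉ 0# → - x ≉ 0#
  -‿≉0 {x} x≉0 e = x≉0 (trans (solve 1 (λ x → x := :- (:- x)) refl x) (trans (-‿cong e) -0#≈0#))

  divide : ∀ {x} (x≉0 : x ≉ 0#) y → x * (x≉0 ⁻¹ * y) ≈ y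
  divide {x} x≉0 y = trans (sym (*-assoc x _ y)) (trans (*-congʳ (x*x⁻¹ x≉0)) (*-identityˡ y))

  factor : ∀ x y → x ≉ 0# ⊎ y ≉ 0# → Σ[ l ∈ Form 1 ] (eval l x y ≈ 0# ×
           (∀ {d} (f : Form (suc d)) → eval f x y ≈ 0# → Σ[ g ∈ Form d ] f ≋ l ⊛ g))
  factor x y nz with em {P = y ≈ 0#}
  ... | no y≉0 = (- z ∷ 1# ∷ []) , l≈0 , λ f e → quotient f z , factor-affine f z (fz≈0 f e)
    where
    z : Carrier
    z = x * y≉0 ⁻¹
    yz≈x : y * z ≈ x
    yz≈x = trans (solve 3 (λ y x i → y :* (x :* i) := y :* (i :* x)) refl y x (y≉0 ⁻¹)) (divide y≉0 x)
    fz≈0 : ∀ {d} (f : Form d) → eval f x y ≈ 0# → eval f z 1# ≈ 0#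
    fz≈0 {d} f e = x*y≈0⇒y≈0 (^≉0 d y≉0) (trans (sym (eval-homogeneous f y z 1#))
             (trans (eval-arg f yz≈x (*-identityʳ y)) e))
    l≈0 : - z * (y * 1#) + x * 1# ≈ 0#
    l≈0 = trans (solve 3 (λ x y z → (:- z) :* (y :* con (+ 1)) :+ x :* con (+ 1) := x :- y :* z) refl x y z)
            (x≈y⇒x-y≈0 (sym yz≈x))
  ... | yes y≈0 = Y , l≈0 , divisible
    where
    x≉0 : x ≉ 0#
    x≉0 = [ id , contradiction y≈0 ]′ nz
    l≈0 : 1# * (y * 1#) + x * 0# ≈ 0#
    l≈0 = trans (solve 2 (λ x y → con (+ 1) :* (y :* con (+ 1)) :+ x :* con (+ 0) := y) refl x y) y≈0
    divisible : ∀ {d} (f : Form (suc d)) → eval f x y ≈ 0# → Σ[ g ∈ Form d ] f ≋ Y ⊛ g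
    divisible {d} f e with initLast f
    ... | g , a , ≡.refl = g , factor-Y g
      (x*y≈0⇒y≈0 (^≉0 (suc d) x≉0) (trans (sym (eval-leading g a x y y≈0)) e))

  nonvanishing : ∀ {d} (φ : RationalMap (suc d)) x y → x ≉ 0# ⊎ y ≉ 0# →
                 ¬ (eval (num (lift φ)) x y ≈ 0# × eval (den (lift φ)) x y ≈ 0#)
  nonvanishing φ x y nz (e₁ , e₂) with factor x y nz
  ... | l , _ , divisible =
    ℕₚ.1+n≢0 (IsReduced.noFactor (reduced φ) l _ _ (proj₂ (divisible _ e₁)) (proj₂ (divisible _ e₂)))

  vanishing-form : ∀ {d} (f : Form d) → ¬ Any (_≉ 0#) f → ∀ x y → eval f x y ≈ 0#
  vanishing-form f ¬nz x y = go f (coefficients f ¬nz)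
    where
    coefficients : ∀ {n} (f : Vec Carrier n) → ¬ Any (_≉ 0#) f → Pointwise (λ a _ → a ≈ 0#) f f
    coefficients []      ¬nz = []
    coefficients (a ∷ f) ¬nz with em {P = a ≈ 0#}
    ... | yes a≈0 = a≈0 ∷ coefficients f (¬nz ∘ there)
    ... | no a≉0  = contradiction (here a≉0) ¬nz
    go : ∀ {d} (f : Form d) → Pointwise (λ a _ → a ≈ 0#) f f → eval f x y ≈ 0#
    go {zero}  (a ∷ []) (e ∷ [])  = e
    go {suc d} (a ∷ f)  (e ∷ es) = trans (+-cong (trans (*-congʳ e) (zeroˡ _)) (trans (*-congˡ (go f es)) (zeroʳ x))) (+-identityʳ 0#)

  module _ (closed : AlgebraicallyClosed) where

    factor-closed : ∀ {d} (f : Form (suc d)) → Σ[ l ∈ Form 1 ] Σ[ g ∈ Form d ] f ≋ l ⊛ g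
    factor-closed f with initLast f
    ... | g , a , ≡.refl with em {P = a ≈ 0#}
    ...   | yes a≈0 = Y , g , factor-Y g a≈0
    ...   | no a≉0 = let (z , e) = closed (map (a≉0 ⁻¹ *_) g) ; (l , _ , divisible) = factor z 1# (inj₂ 1≉0)
                         in l , divisible (g ∷ʳ a) (root z e)
      where
      scaled : ∀ {n} (g : Vec Carrier n) → Pointwise _≈_ (map (a≉0 ⁻¹ *_) (g ∷ʳ a)) (map (a≉0 ⁻¹ *_) g ∷ʳ 1#)
      scaled []      = trans (*-comm _ a) (x*x⁻¹ a≉0) ∷ []
      scaled (b ∷ g) = refl ∷ scaled g
      root : ∀ z → eval (map (a≉0 ⁻¹ *_) g ∷ʳ 1#) z 1# ≈ 0# → eval (g ∷ʳ a) z 1# ≈ 0#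
      root z e = x*y≈0⇒y≈0 (x⁻¹≉0 a≉0) (trans (sym (eval-· (a≉0 ⁻¹) (g ∷ʳ a) z 1#)) (trans (eval-cong (scaled g) refl refl) e))

    -- Since forms split into linear factors, a multiplicative property need only be
    -- checked on linear forms.
    form-induction : ∀ {p} (P : ∀ {d} → Form d → Set p) →
      (∀ {d} {f g : Form d} → f ≋ g → P f → P g) →
      (∀ a → P (a ∷ [])) →
      (∀ {d} (l : Form 1) (g : Form d) → P l → P g → P (l ⊛ g)) →
      (∀ (l : Form 1) → P l) → ∀ {d} (f : Form d) → P f
    form-induction P resp const mult lin {zero}  (a ∷ []) = const a
    form-induction P resp const mult lin {suc d} f = let (l , g , eq) = factor-closed f in
      resp (≋-sym eq) (mult l g (lin l) (form-induction P resp const mult lin g))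

module RealProperties (em : ∀ {a} → ExcludedMiddle a) {r ℓ₁ ℓ₂} (ℝ : RealField r ℓ₁ ℓ₂) where
  open RealField ℝ
  open Order public using (total; antisym; ≤-respˡ-≈; ≤-respʳ-≈)
    renaming (refl to ≤-refl; trans to ≤-trans; reflexive to ≤-reflexive)
  open FieldProperties em realField public
  open IntegerSolver commutativeRing public
  open Max totalOrder public
    using (x≤x⊔y; x≤y⊔x; ⊔-lub; x≤y⇒x⊔y≈y; x≤y⇒y⊔x≈y; ⊔-cong; ⊔-comm; ⊔-mono-≤)

  poset : Poset _ _ _
  poset = record { isPartialOrder = Order.isPartialOrder }

  module ≤-Reasoning = PosetReasoning poset

  ≰⇒> : ∀ {x y} → ¬ x ≤ y → y < x
  ≰⇒> = Strict.≰⇒> _≈_ _≤_ sym ≤-reflexive total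

  ≰⇒≥ : ∀ {x y} → ¬ x ≤ y → y ≤ x
  ≰⇒≥ = proj₁ ∘ ≰⇒>

  <⇒≱ : ∀ {x y} → x < y → ¬ y ≤ x
  <⇒≱ = Strict.<⇒≱ _≈_ _≤_ antisym

  *-monoˡ-≤ : ∀ {x y z} → 0# ≤ z → x ≤ y → z * x ≤ z * y
  *-monoˡ-≤ {x} {y} {z} 0≤z x≤y = ≤-respˡ-≈ (+-identityʳ _) (≤-respʳ-≈ eq (+-mono-≤ ≤-refl (*-nonneg 0≤z 0≤y-x)))
    where
    0≤y-x : 0# ≤ y - x
    0≤y-x = ≤-respˡ-≈ (-‿inverseʳ x) (+-mono-≤ x≤y ≤-refl)
    eq : z * x + z * (y - x) ≈ z * y
    eq = solve 3 (λ x y z → z :* x :+ z :* (y :- x) := z :* y) refl x y z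

  *-mono-≤ : ∀ {x y u v} → 0# ≤ y → 0# ≤ u → x ≤ y → u ≤ v → x * u ≤ y * v
  *-mono-≤ {x} {y} {u} {v} 0≤y 0≤u x≤y u≤v = begin
    x * u ≈⟨ *-comm x u ⟩
    u * x ≤⟨ *-monoˡ-≤ 0≤u x≤y ⟩
    u * y ≈⟨ *-comm u y ⟩
    y * u ≤⟨ *-monoˡ-≤ 0≤y u≤v ⟩
    y * v ∎
    where open ≤-Reasoning

  <⇒≉0 : ∀ {x} → 0# < x → x ≉ 0#
  <⇒≉0 (_ , 0≉x) e = 0≉x (sym e)

  *-cancelˡ-≤ : ∀ {x y z} → 0# < z → z * x ≤ z * y → x ≤ y
  *-cancelˡ-≤ {x} {y} 0<z zx≤zy with total x y
  ... | inj₁ x≤y = x≤y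
  ... | inj₂ y≤x = ≤-reflexive (*-cancelˡ (<⇒≉0 0<z) (antisym zx≤zy (*-monoˡ-≤ (proj₁ 0<z) y≤x)))

  *-pos : ∀ {x y} → 0# < x → 0# < y → 0# < x * y
  *-pos (0≤x , 0≉x) (0≤y , 0≉y) = *-nonneg 0≤x 0≤y , λ e → *≉0 (0≉x ∘ sym) (0≉y ∘ sym) (sym e)

  nonneg⇒pos : ∀ {x} → 0# ≤ x → x ≉ 0# → 0# < x
  nonneg⇒pos 0≤x x≉0 = 0≤x , x≉0 ∘ sym

  square-nonneg : ∀ x → 0# ≤ x * x
  square-nonneg x with total 0# x
  ... | inj₁ 0≤x = *-nonneg 0≤x 0≤x
  ... | inj₂ x≤0 = ≤-respʳ-≈ (solve 1 (λ x → (:- x) :* (:- x) := x :* x) refl x) (*-nonneg 0≤-x 0≤-x)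
    where
    0≤-x : 0# ≤ - x
    0≤-x = ≤-respˡ-≈ (-‿inverseʳ x) (≤-respʳ-≈ (+-identityˡ _) (+-mono-≤ x≤0 ≤-refl))

  0≤1 : 0# ≤ 1#
  0≤1 = ≤-respʳ-≈ (*-identityˡ 1#) (square-nonneg 1#)

  0<1 : 0# < 1#
  0<1 = 0≤1 , 0≉1

  ^-pos : ∀ n {x} → 0# < x → 0# < x ^ n
  ^-pos zero    0<x = 0<1
  ^-pos (suc n) 0<x = *-pos 0<x (^-pos n 0<x)

  ^-nonneg : ∀ n {x} → 0# ≤ x → 0# ≤ x ^ n
  ^-nonneg zero    0≤x = 0≤1
  ^-nonneg (suc n) 0≤x = *-nonneg 0≤x (^-nonneg n 0≤x)

  ⁻¹-pos : ∀ {x} (0<x : 0# < x) → 0# < (<⇒≉0 0<x) ⁻¹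
  ⁻¹-pos {x} 0<x with total 0# (<⇒≉0 0<x ⁻¹)
  ... | inj₁ 0≤i = nonneg⇒pos 0≤i (x⁻¹≉0 _)
  ... | inj₂ i≤0 = contradiction
    (antisym 0≤1 (≤-respˡ-≈ (x*x⁻¹ (<⇒≉0 0<x)) (≤-respʳ-≈ (zeroʳ x) (*-monoˡ-≤ (proj₁ 0<x) i≤0)))) 0≉1

  *-distribˡ-⊔ : ∀ {z} x y → 0# ≤ z → z * (x ⊔ᴿ y) ≈ (z * x) ⊔ᴿ (z * y)
  *-distribˡ-⊔ {z} x y 0≤z = antisym below (⊔-lub (*-monoˡ-≤ 0≤z (x≤x⊔y x y)) (*-monoˡ-≤ 0≤z (x≤y⊔x x y)))
    where
    below : z * (x ⊔ᴿ y) ≤ (z * x) ⊔ᴿ (z * y)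
    below with total x y
    ... | inj₁ x≤y = ≤-trans (≤-reflexive (*-congˡ (x≤y⇒x⊔y≈y x≤y))) (x≤y⊔x (z * x) (z * y))
    ... | inj₂ y≤x = ≤-trans (≤-reflexive (*-congˡ (x≤y⇒y⊔x≈y y≤x))) (x≤x⊔y (z * x) (z * y))

  ≤⊔-case : ∀ {x y z} → x ≤ y ⊔ᴿ z → x ≤ y ⊎ x ≤ z
  ≤⊔-case {x} {y} {z} p with total y z
  ... | inj₁ y≤z = inj₂ (≤-respʳ-≈ (x≤y⇒x⊔y≈y y≤z) p)
  ... | inj₂ z≤y = inj₁ (≤-respʳ-≈ (x≤y⇒y⊔x≈y z≤y) p)

module Valuation (em : ∀ {a} → ExcludedMiddle a) {r ℓ₁ ℓ₂} (ℝ : RealField r ℓ₁ ℓ₂)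
                 {c ℓ} (K : NonArchimedeanField ℝ c ℓ) where
  module ℝ where
    open RealField ℝ public
    open RealProperties em ℝ public
  open ℝ using (_≤_; _<_; ≤-trans; ≤-refl; ≤-reflexive; antisym; total; ≤-respˡ-≈; ≤-respʳ-≈; module ≤-Reasoning)
  open NonArchimedeanField K
  open Field baseField
  open Projective baseField
  open FormProperties baseField
  open FieldProperties em baseField
  open IntegerSolver commutativeRing
  open Residue ℝ K hiding (*-monoʳ; 0≤1)
  private
    module k where
      open Field residueField public
      open FieldProperties em residueField public

  ∣∣-pos : ∀ {x} → x ≉ 0# → ℝ.0# < ∣ x ∣
  ∣∣-pos x≉0 = ℝ.nonneg⇒pos (∣∣-nonneg _) (∣∣≉0 x≉0)

  ∣x∣≤0⇒x≈0 : ∀ {x} → ∣ x ∣ ≤ ℝ.0# → x ≈ 0#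
  ∣x∣≤0⇒x≈0 p = ∣∣-definite (antisym p (∣∣-nonneg _))

  ∣≈0∣ : ∀ {x} → x ≈ 0# → ∣ x ∣ ℝ.≈ ℝ.0#
  ∣≈0∣ e = ℝ.trans (∣∣-cong e) ∣0∣

  ∣+∣≤ : ∀ {x y s} → ∣ x ∣ ≤ s → ∣ y ∣ ≤ s → ∣ x + y ∣ ≤ s
  ∣+∣≤ {x} {y} p q = ≤-trans (∣∣-ultra x y) (ℝ.⊔-lub p q)

  ∣-∣≤ : ∀ {x y s} → ∣ x ∣ ≤ s → ∣ y ∣ ≤ s → ∣ x - y ∣ ≤ s
  ∣-∣≤ {x} {y} p q = ∣+∣≤ p (≤-respˡ-≈ (ℝ.sym (∣-∣ y)) q)

  isosceles : ∀ {x y} → ∣ x ∣ < ∣ y ∣ → ∣ x + y ∣ ℝ.≈ ∣ y ∣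
  isosceles {x} {y} x<y = antisym (∣+∣≤ (proj₁ x<y) ≤-refl)
    ([ id , (λ p → contradiction p (ℝ.<⇒≱ x<y)) ]′ (ℝ.≤⊔-case (≤-trans
      (≤-reflexive (∣∣-cong (solve 2 (λ x y → y := (x :+ y) :- x) refl x y)))
      (≤-trans (∣∣-ultra (x + y) (- x)) (≤-reflexive (ℝ.⊔-cong ℝ.refl (∣-∣ x)))))))

  unit : ∀ {x} → Integral x → ¬ Small x → ∣ x ∣ ℝ.≈ ℝ.1#
  unit {x} p ¬s with em {P = ∣ x ∣ ℝ.≈ ℝ.1#}
  ... | yes e = e
  ... | no ne = contradiction (p , ne) ¬s

  small⇒≈0 : ∀ {x : 𝒪} → Small (value x) → x k.≈ k.0#
  small⇒≈0 {x} s = congruent (small-cong (solve 1 (λ x → x := x :- con (+ 0)) refl (value x)) s)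

  ≈0⇒small : ∀ {x : 𝒪} → x k.≈ k.0# → Small (value x)
  ≈0⇒small {x} (congruent s) = small-cong (solve 1 (λ x → x :- con (+ 0) := x) refl (value x)) s

  ≉0⇒unit : ∀ {x : 𝒪} → x k.≉ k.0# → ∣ value x ∣ ℝ.≈ ℝ.1#
  ≉0⇒unit {x} x≉0 = unit (proj₂ x) (x≉0 ∘ small⇒≈0 {x})

  unit⇒≉0 : ∀ {x : 𝒪} → ∣ value x ∣ ℝ.≈ ℝ.1# → x k.≉ k.0#
  unit⇒≉0 {x} e x≈0 = proj₂ (≈0⇒small {x} x≈0) e

  ∣unit*∣ : ∀ {x y} → ∣ x ∣ ℝ.≈ ℝ.1# → ∣ x * y ∣ ℝ.≈ ∣ y ∣
  ∣unit*∣ {x} {y} e = ℝ.trans (∣∣-* x y) (ℝ.trans (ℝ.*-congʳ e) (ℝ.*-identityˡ _))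

  quotient-integral : ∀ {x y} (y≉0 : y ≉ 0#) → ∣ x ∣ ≤ ∣ y ∣ → Integral (y≉0 ⁻¹ * x)
  quotient-integral {x} {y} y≉0 p = ℝ.*-cancelˡ-≤ (∣∣-pos y≉0) (begin
    ∣ y ∣ ℝ.* ∣ y≉0 ⁻¹ * x ∣ ≈⟨ ℝ.sym (∣∣-* y _) ⟩
    ∣ y * (y≉0 ⁻¹ * x) ∣     ≈⟨ ∣∣-cong (divide y≉0 x) ⟩
    ∣ x ∣                    ≤⟨ p ⟩
    ∣ y ∣                    ≈⟨ ℝ.sym (ℝ.*-identityʳ _) ⟩
    ∣ y ∣ ℝ.* ℝ.1#           ∎)
    where open ≤-Reasoning

  -- Residue classes are inexhaustible: a root of ∏ (z - b) + 1 is integral and lies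
  -- in no class of a given finite list.
  private
    IsMonic : ℕ → (Carrier → Carrier) → Set _
    IsMonic n p = Σ[ a ∈ Vec Carrier n ] (∀ z → eval (a ∷ʳ 1#) z 1# ≈ p z)

    eval-+ : ∀ {n} (a b : Vec Carrier (suc n)) z →
             eval (zipWith _+_ a b ∷ʳ 1#) z 1# ≈ eval (a ∷ʳ 1#) z 1# + eval b z 1#
    eval-+ {zero}  (a ∷ []) (b ∷ []) z = solve 3
      (λ a b z → (a :+ b) :* (con (+ 1) :* con (+ 1)) :+ z :* con (+ 1)
        := (a :* (con (+ 1) :* con (+ 1)) :+ z :* con (+ 1)) :+ b) refl a b z
    eval-+ {suc n} (a ∷ as) (b ∷ bs) z = trans
      (+-cong (trans (*-congˡ (1^ (suc (suc n)))) (*-identityʳ _)) (*-congˡ (eval-+ as bs z)))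
      (trans (solve 5 (λ a b z u v → (a :+ b) :+ z :* (u :+ v) := (a :+ z :* u) :+ (b :+ z :* v))
          refl a b z (eval (as ∷ʳ 1#) z 1#) (eval bs z 1#))
        (sym (+-cong (+-congʳ (trans (*-congˡ (1^ (suc (suc n)))) (*-identityʳ a)))
                     (+-congʳ (trans (*-congˡ (1^ (suc n))) (*-identityʳ b))))))

    monic-step : ∀ {n p} b e → IsMonic n p → IsMonic (suc n) (λ z → (z - b) * p z + e)
    monic-step {n} {p} b e (a , h) = zipWith _+_ (e ∷ a) (- b · (a ∷ʳ 1#)) , λ z → begin
      eval (zipWith _+_ (e ∷ a) (- b · (a ∷ʳ 1#)) ∷ʳ 1#) z 1#
        ≈⟨ eval-+ (e ∷ a) (- b · (a ∷ʳ 1#)) z ⟩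
      (e * 1# ^ suc n + z * eval (a ∷ʳ 1#) z 1#) + eval (- b · (a ∷ʳ 1#)) z 1#
        ≈⟨ +-cong (+-cong (trans (*-congˡ (1^ (suc n))) (*-identityʳ e)) (*-congˡ (h z)))
                  (trans (eval-· (- b) (a ∷ʳ 1#) z 1#) (*-congˡ (h z))) ⟩
      (e + z * p z) + (- b) * p z
        ≈⟨ solve 4 (λ e z b p → (e :+ z :* p) :+ (:- b) :* p := (z :- b) :* p :+ e) refl e z b (p z) ⟩
      (z - b) * p z + e ∎
      where open import Relation.Binary.Reasoning.Setoid setoid

    product : List 𝒪 → Carrier → Carrier
    product []       z = 1#
    product (b ∷ bs) z = (z - value b) * product bs z

    product-monic : ∀ bs → IsMonic (List.length bs) (product bs)
    product-monic []       = [] , λ z → refl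
    product-monic (b ∷ bs) =
      let (a , h) = monic-step (value b) 0# (product-monic bs) in a , λ z → trans (h z) (+-identityʳ _)

    product-root : ∀ b bs → ∃[ z ] ∣ product (b ∷ bs) z ∣ ℝ.≈ ℝ.1#
    product-root b bs =
      let (a , h) = monic-step (value b) 1# (product-monic bs)
          (z , e) = algClosed a
      in z , ℝ.trans (∣∣-cong (trans (solve 1 (λ p → p := (p :+ con (+ 1)) :- con (+ 1)) refl (product (b ∷ bs) z))
               (trans (+-congʳ (trans (sym (h z)) e)) (+-identityˡ _))))
             (ℝ.trans (∣-∣ 1#) ∣1∣)

    ∣z∣≤∣z-b∣ : ∀ z (b : 𝒪) → ¬ Integral z → ∣ z ∣ ≤ ∣ z - value b ∣
    ∣z∣≤∣z-b∣ z (b , ∣b∣≤1) ¬i = [ id , (λ p → contradiction (≤-trans p ∣b∣≤1) ¬i) ]′ (ℝ.≤⊔-case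
      (≤-trans (≤-reflexive (∣∣-cong (solve 2 (λ z b → z := (z :- b) :+ b) refl z b))) (∣∣-ultra (z - b) b)))

    1≤∣z-b∣ : ∀ z b → ¬ Integral z → ℝ.1# ≤ ∣ z - value b ∣
    1≤∣z-b∣ z b ¬i = ≤-trans (ℝ.≰⇒≥ ¬i) (∣z∣≤∣z-b∣ z b ¬i)

    1≤product : ∀ bs z → ¬ Integral z → ℝ.1# ≤ ∣ product bs z ∣
    1≤product []       z ¬i = ≤-reflexive (ℝ.sym ∣1∣)
    1≤product (b ∷ bs) z ¬i = ≤-respˡ-≈ (ℝ.*-identityˡ _) (≤-respʳ-≈ (ℝ.sym (∣∣-* _ _))
      (ℝ.*-mono-≤ (∣∣-nonneg _) ℝ.0≤1 (1≤∣z-b∣ z b ¬i) (1≤product bs z ¬i)))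

    root-integral : ∀ b bs z → ∣ product (b ∷ bs) z ∣ ℝ.≈ ℝ.1# → Integral z
    root-integral b bs z e with em {P = Integral z}
    ... | yes i = i
    ... | no ¬i = contradiction (begin
      ∣ z ∣                                    ≤⟨ ∣z∣≤∣z-b∣ z b ¬i ⟩
      ∣ z - value b ∣                          ≈⟨ ℝ.*-identityʳ _ ⟨
      ∣ z - value b ∣ ℝ.* ℝ.1#                 ≤⟨ ℝ.*-monoˡ-≤ (∣∣-nonneg _) (1≤product bs z ¬i) ⟩
      ∣ z - value b ∣ ℝ.* ∣ product bs z ∣     ≈⟨ ∣∣-* _ _ ⟨
      ∣ product (b ∷ bs) z ∣                   ≈⟨ e ⟩
      ℝ.1#                                     ∎) ¬i
      where open ≤-Reasoning

    product-integral : ∀ bs z → Integral z → Integral (product bs z)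
    product-integral []       z i = ≤-reflexive ∣1∣
    product-integral (b ∷ bs) z i = integral-* (integral-+ i (integral-neg (proj₂ b))) (product-integral bs z i)

    off-all : ∀ bs (z : 𝒪) → ¬ Small (product bs (value z)) → All (z k.≉_) bs
    off-all []       z ¬s = []
    off-all (b ∷ bs) z ¬s =
      (λ (congruent s) → ¬s (small-cong (*-comm _ _) (small-* (product-integral bs _ (proj₂ z)) s)))
      ∷ off-all bs z (λ s → ¬s (small-* (integral-+ (proj₂ z) (integral-neg (proj₂ b))) s))

  avoid : ∀ (bs : List 𝒪) → ∃[ t ] All (t k.≉_) bs
  avoid []       = k.0# , []
  avoid (b ∷ bs) =
    let (z , e) = product-root b bs
        i = root-integral b bs z e
    in (z , i) , off-all (b ∷ bs) (z , i) (λ s → proj₂ s e)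

  Generic : ∀ {p} → (𝒪 → Set p) → Set _
  Generic Q = Σ[ bs ∈ List 𝒪 ] (∀ t → All (t k.≉_) bs → Q t)

  always : ∀ {p} {Q : 𝒪 → Set p} → (∀ t → Q t) → Generic Q
  always h = [] , λ t _ → h t

  generic-map : ∀ {p q} {P : 𝒪 → Set p} {Q : 𝒪 → Set q} → (∀ t → P t → Q t) → Generic P → Generic Q
  generic-map h (bs , g) = bs , λ t off → h t (g t off)

  generic-map₂ : ∀ {p q s} {P : 𝒪 → Set p} {Q : 𝒪 → Set q} {S : 𝒪 → Set s} →
                 (∀ t → P t → Q t → S t) → Generic P → Generic Q → Generic S
  generic-map₂ h (as , f) (bs , g) = as List.++ bs , λ t off →
    let (offₐ , off_b) = Allₚ.++⁻ as off in h t (f t offₐ) (g t off_b)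

  generic-witness : ∀ {p} {Q : 𝒪 → Set p} → Generic Q → ∃ Q
  generic-witness (bs , g) = let (t , off) = avoid bs in t , g t off

  affine-upper : ∀ p q (t : 𝒪) → ∣ p * value t + q ∣ ≤ ∣ p ∣ ℝ.⊔ᴿ ∣ q ∣
  affine-upper p q (t , ∣t∣≤1) = ∣+∣≤ (begin
    ∣ p * t ∣           ≈⟨ ∣∣-cong (*-comm p t) ⟩
    ∣ t * p ∣           ≤⟨ product≤ ∣t∣≤1 ⟩
    ∣ p ∣               ≤⟨ ℝ.x≤x⊔y ∣ p ∣ ∣ q ∣ ⟩
    ∣ p ∣ ℝ.⊔ᴿ ∣ q ∣    ∎) (ℝ.x≤y⊔x ∣ p ∣ ∣ q ∣)
    where open ≤-Reasoning

  affine-generic : ∀ p q → Generic (λ t → ∣ p * value t + q ∣ ℝ.≈ ∣ p ∣ ℝ.⊔ᴿ ∣ q ∣)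
  affine-generic p q with em {P = ∣ q ∣ ≤ ∣ p ∣} | em {P = p ≈ 0#}
  ... | _ | yes p≈0 = always λ t → ℝ.trans
    (∣∣-cong (trans (+-congʳ (trans (*-congʳ p≈0) (zeroˡ _))) (+-identityˡ q)))
    (ℝ.sym (ℝ.x≤y⇒x⊔y≈y (≤-trans (≤-reflexive (∣≈0∣ p≈0)) (∣∣-nonneg q))))
  ... | no q≰p | _ = always λ t → ℝ.trans
    (isosceles (Strict.≤-<-trans ℝ._≈_ ℝ._≤_ ≤-trans antisym ≤-respˡ-≈
      (≤-trans (≤-reflexive (∣∣-cong (*-comm p (value t)))) (product≤ (proj₂ t))) (ℝ.≰⇒> q≰p)))
    (ℝ.sym (ℝ.x≤y⇒x⊔y≈y (ℝ.≰⇒≥ q≰p)))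
  ... | yes q≤p | no p≉0 = (b ∷ []) , λ { t (t≉b ∷ []) → begin
      ∣ p * value t + q ∣             ≈⟨ ∣∣-cong (trans (+-congˡ (sym (divide p≉0 q)))
                                           (solve 3 (λ p t i → p :* t :+ p :* i := p :* (t :- (:- i))) refl p (value t) (p≉0 ⁻¹ * q))) ⟩
      ∣ p * (value t - value b) ∣     ≈⟨ ∣∣-* _ _ ⟩
      ∣ p ∣ ℝ.* ∣ value t - value b ∣ ≈⟨ ℝ.*-congˡ (unit (integral-+ (proj₂ t) (integral-neg (proj₂ b))) (t≉b ∘ congruent)) ⟩
      ∣ p ∣ ℝ.* ℝ.1#                  ≈⟨ ℝ.*-identityʳ _ ⟩
      ∣ p ∣                           ≈⟨ ℝ.x≤y⇒y⊔x≈y q≤p ⟨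
      ∣ p ∣ ℝ.⊔ᴿ ∣ q ∣                ∎ }
    where
    open import Relation.Binary.Reasoning.Setoid ℝ.setoid
    b : 𝒪
    b = - (p≉0 ⁻¹ * q) , integral-neg (quotient-integral p≉0 q≤p)

  -- The value of f at the point of the line parametrised by M with parameter t.
  along : ∀ {d} → Lift 1 → Form d → 𝒪 → Carrier
  along M f t = eval f (eval (num M) (value t) 1#) (eval (den M) (value t) 1#)

  linear-max : Lift 1 → Form 1 → ℝ.Carrier
  linear-max [ q₁ ∷ p₁ ∷ [] , q₂ ∷ p₂ ∷ [] ] l = ∣ eval l p₁ p₂ ∣ ℝ.⊔ᴿ ∣ eval l q₁ q₂ ∣

  along-linear : ∀ q₁ p₁ q₂ p₂ (l : Form 1) t →
    along [ q₁ ∷ p₁ ∷ [] , q₂ ∷ p₂ ∷ [] ] l t ≈ eval l p₁ p₂ * value t + eval l q₁ q₂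
  along-linear q₁ p₁ q₂ p₂ (a ∷ b ∷ []) t =
    solve 7 (λ q₁ p₁ q₂ p₂ a b t → let I = con (+ 1) in
      a :* ((q₂ :* (I :* I) :+ t :* p₂) :* I) :+ (q₁ :* (I :* I) :+ t :* p₁) :* b
        := (a :* (p₂ :* I) :+ p₁ :* b) :* t :+ (a :* (q₂ :* I) :+ q₁ :* b))
      refl q₁ p₁ q₂ p₂ a b (value t)

  linear-upper : ∀ M (l : Form 1) t → ∣ along M l t ∣ ≤ linear-max M l
  linear-upper [ q₁ ∷ p₁ ∷ [] , q₂ ∷ p₂ ∷ [] ] l t =
    ≤-respˡ-≈ (∣∣-cong (sym (along-linear q₁ p₁ q₂ p₂ l t))) (affine-upper _ _ t)

  linear-generic : ∀ M (l : Form 1) → Generic (λ t → ∣ along M l t ∣ ℝ.≈ linear-max M l)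
  linear-generic [ q₁ ∷ p₁ ∷ [] , q₂ ∷ p₂ ∷ [] ] l = generic-map
    (λ t e → ℝ.trans (∣∣-cong (along-linear q₁ p₁ q₂ p₂ l t)) e) (affine-generic _ _)

  along-⊛ : ∀ {m n} M (f : Form m) (g : Form n) t → ∣ along M (f ⊛ g) t ∣ ℝ.≈ ∣ along M f t ∣ ℝ.* ∣ along M g t ∣
  along-⊛ M f g t = ℝ.trans (∣∣-cong (eval-⊛ f g _ _)) (∣∣-* _ _)

  -- The supremum norm of f on the image of 𝒪 under M.
  record GenericValue (M : Lift 1) {d} (f : Form d) : Set (r ⊔ ℓ₁ ⊔ ℓ₂ ⊔ c ⊔ ℓ) where
    field
      height  : ℝ.Carrier
      upper   : ∀ t → ∣ along M f t ∣ ≤ height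
      generic : Generic (λ t → ∣ along M f t ∣ ℝ.≈ height)

    nonneg : ℝ.0# ≤ height
    nonneg = ≤-trans (∣∣-nonneg _) (upper k.0#)

  open GenericValue public

  genericValue : ∀ M {d} (f : Form d) → GenericValue M f
  genericValue M = form-induction algClosed (GenericValue M) resp const mult lin
    where
    resp : ∀ {d} {f g : Form d} → f ≋ g → GenericValue M f → GenericValue M g
    resp e v = record
      { height  = height v
      ; upper   = λ t → ≤-respˡ-≈ (∣∣-cong (eval-cong e refl refl)) (upper v t)
      ; generic = generic-map (λ t h → ℝ.trans (∣∣-cong (eval-cong (≋-sym e) refl refl)) h) (generic v) }
    const : ∀ a → GenericValue M (a ∷ [])
    const a = record { height = ∣ a ∣ ; upper = λ t → ≤-refl ; generic = always λ t → ℝ.refl }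
    mult : ∀ {d} (l : Form 1) (g : Form d) → GenericValue M l → GenericValue M g → GenericValue M (l ⊛ g)
    mult l g v w = record
      { height  = height v ℝ.* height w
      ; upper   = λ t → ≤-respˡ-≈ (ℝ.sym (along-⊛ M l g t))
                    (ℝ.*-mono-≤ (nonneg v) (∣∣-nonneg _) (upper v t) (upper w t))
      ; generic = generic-map₂ (λ t e₁ e₂ → ℝ.trans (along-⊛ M l g t) (ℝ.*-cong e₁ e₂)) (generic v) (generic w) }
    lin : ∀ l → GenericValue M l
    lin l = record { height = linear-max M l ; upper = linear-upper M l ; generic = linear-generic M l }

module QuadraticMaps (em : ∀ {a} → ExcludedMiddle a) {c ℓ} (F : Field c ℓ) where
  open Field F
  open Projective F
  open FormProperties F
  open FieldProperties em F
  open IntegerSolver commutativeRing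

  Point : Set c
  Point = Carrier × Carrier

  cross : Point → Point → Carrier
  cross (x , y) (x′ , y′) = y′ * x - x′ * y

  Nonzero : Point → Set ℓ
  Nonzero (x , y) = x ≉ 0# ⊎ y ≉ 0#

  evalAt : ∀ {d} → Form d → Point → Carrier
  evalAt f (x , y) = eval f x y

  -- fY − gX = A (y₁X − x₁Y) (y₂X − x₂Y) (y₃X − x₃Y), compared coefficientwise.
  HasFixedForm : Form 2 → Form 2 → Carrier → Point → Point → Point → Set ℓ
  HasFixedForm (f₀ ∷ f₁ ∷ f₂ ∷ []) (g₀ ∷ g₁ ∷ g₂ ∷ []) A (x₁ , y₁) (x₂ , y₂) (x₃ , y₃) =
    f₀ ≈ - (A * (x₁ * (x₂ * x₃))) ×
    f₁ - g₀ ≈ A * (x₁ * (x₂ * y₃) + x₁ * (y₂ * x₃) + y₁ * (x₂ * x₃)) ×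
    f₂ - g₁ ≈ - (A * (x₁ * (y₂ * y₃) + y₁ * (x₂ * y₃) + y₁ * (y₂ * x₃))) ×
    g₂ ≈ - (A * (y₁ * (y₂ * y₃)))

  line : Point → Form 1
  line (x , y) = - x ∷ y ∷ []

  fixedForm : ∀ (f g : Form 2) {A} p₁ p₂ p₃ →
    timesY f ⊖ timesX g ≋ A · (line p₁ ⊛ (line p₂ ⊛ line p₃)) → HasFixedForm f g A p₁ p₂ p₃
  fixedForm (f₀ ∷ f₁ ∷ f₂ ∷ []) (g₀ ∷ g₁ ∷ g₂ ∷ []) {A} (x₁ , y₁) (x₂ , y₂) (x₃ , y₃) (e₀ ∷ e₁ ∷ e₂ ∷ e₃ ∷ []) =
      trans (solve 1 (λ f → f := f :- O) refl f₀) (trans e₀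
        (solve 4 (λ A x y z → A :* ((:- x) :* ((:- y) :* (:- z) :+ O) :+ O) := :- (A :* (x :* (y :* z)))) refl A x₁ x₂ x₃))
    , trans e₁ (solve 7 (λ A x₁ y₁ x₂ y₂ x₃ y₃ →
        A :* ((:- x₁) :* ((:- x₂) :* y₃ :+ y₂ :* (:- x₃)) :+ y₁ :* ((:- x₂) :* (:- x₃) :+ O)) :=
        A :* (x₁ :* (x₂ :* y₃) :+ x₁ :* (y₂ :* x₃) :+ y₁ :* (x₂ :* x₃))) refl A x₁ y₁ x₂ y₂ x₃ y₃)
    , trans e₂ (solve 7 (λ A x₁ y₁ x₂ y₂ x₃ y₃ →
        A :* ((:- x₁) :* (O :+ y₂ :* y₃) :+ y₁ :* ((:- x₂) :* y₃ :+ y₂ :* (:- x₃))) :=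
        :- (A :* (x₁ :* (y₂ :* y₃) :+ y₁ :* (x₂ :* y₃) :+ y₁ :* (y₂ :* x₃)))) refl A x₁ y₁ x₂ y₂ x₃ y₃)
    , trans (solve 1 (λ g → g := :- (O :- g)) refl g₂) (-‿cong (trans e₃
        (solve 4 (λ A x y z → A :* (O :+ x :* (O :+ y :* z)) := A :* (x :* (y :* z))) refl A y₁ y₂ y₃)))
    where
    O : ∀ {n} → Polynomial n
    O = con (+ 0)

  rescale : ∀ (f g : Form 2) {A B} p₁ p₂ s x y → A * s ≈ B →
    HasFixedForm f g A p₁ p₂ (s * x , s * y) → HasFixedForm f g B p₁ p₂ (x , y)
  rescale (f₀ ∷ f₁ ∷ f₂ ∷ []) (g₀ ∷ g₁ ∷ g₂ ∷ []) {A} {B} (x₁ , y₁) (x₂ , y₂) s x y eB (e₀ , e₁ , e₂ , e₃) =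
      trans e₀ (-‿cong (third (solve 5 (λ A s a b c → A :* (a :* (b :* (s :* c))) := (A :* s) :* (a :* (b :* c))) refl A s x₁ x₂ x)))
    , trans e₁ (third (solve 8 (λ A s x₁ y₁ x₂ y₂ x₃ y₃ → A :* (x₁ :* (x₂ :* (s :* y₃)) :+ x₁ :* (y₂ :* (s :* x₃)) :+ y₁ :* (x₂ :* (s :* x₃)))
        := (A :* s) :* (x₁ :* (x₂ :* y₃) :+ x₁ :* (y₂ :* x₃) :+ y₁ :* (x₂ :* x₃))) refl A s x₁ y₁ x₂ y₂ x y))
    , trans e₂ (-‿cong (third (solve 8 (λ A s x₁ y₁ x₂ y₂ x₃ y₃ → A :* (x₁ :* (y₂ :* (s :* y₃)) :+ y₁ :* (x₂ :* (s :* y₃)) :+ y₁ :* (y₂ :* (s :* x₃)))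
        := (A :* s) :* (x₁ :* (y₂ :* y₃) :+ y₁ :* (x₂ :* y₃) :+ y₁ :* (y₂ :* x₃))) refl A s x₁ y₁ x₂ y₂ x y)))
    , trans e₃ (-‿cong (third (solve 5 (λ A s a b c → A :* (a :* (b :* (s :* c))) := (A :* s) :* (a :* (b :* c))) refl A s y₁ y₂ y)))
    where
    third : ∀ {u v} → u ≈ (A * s) * v → u ≈ B * v
    third e = trans e (*-congʳ eB)

  module _ (f g : Form 2) {A : Carrier} where

    swap₁₂ : ∀ p₁ p₂ p₃ → HasFixedForm f g A p₁ p₂ p₃ → HasFixedForm f g A p₂ p₁ p₃
    swap₁₂ (x₁ , y₁) (x₂ , y₂) (x₃ , y₃) = go f g
      where
      go : ∀ (f g : Form 2) → HasFixedForm f g A (x₁ , y₁) (x₂ , y₂) (x₃ , y₃) → HasFixedForm f g A (x₂ , y₂) (x₁ , y₁) (x₃ , y₃)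
      go (f₀ ∷ f₁ ∷ f₂ ∷ []) (g₀ ∷ g₁ ∷ g₂ ∷ []) (e₀ , e₁ , e₂ , e₃) =
          trans e₀ (-‿cong (*-congˡ (swap x₁ x₂ x₃)))
        , trans e₁ (*-congˡ (solve 6 (λ x₁ y₁ x₂ y₂ x₃ y₃ → x₁ :* (x₂ :* y₃) :+ x₁ :* (y₂ :* x₃) :+ y₁ :* (x₂ :* x₃)
            := x₂ :* (x₁ :* y₃) :+ x₂ :* (y₁ :* x₃) :+ y₂ :* (x₁ :* x₃)) refl x₁ y₁ x₂ y₂ x₃ y₃))
        , trans e₂ (-‿cong (*-congˡ (solve 6 (λ x₁ y₁ x₂ y₂ x₃ y₃ → x₁ :* (y₂ :* y₃) :+ y₁ :* (x₂ :* y₃) :+ y₁ :* (y₂ :* x₃)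
            := x₂ :* (y₁ :* y₃) :+ y₂ :* (x₁ :* y₃) :+ y₂ :* (y₁ :* x₃)) refl x₁ y₁ x₂ y₂ x₃ y₃)))
        , trans e₃ (-‿cong (*-congˡ (swap y₁ y₂ y₃)))
        where
        swap : ∀ a b c → a * (b * c) ≈ b * (a * c)
        swap = solve 3 (λ a b c → a :* (b :* c) := b :* (a :* c)) refl

    swap₂₃ : ∀ p₁ p₂ p₃ → HasFixedForm f g A p₁ p₂ p₃ → HasFixedForm f g A p₁ p₃ p₂
    swap₂₃ (x₁ , y₁) (x₂ , y₂) (x₃ , y₃) = go f g
      where
      go : ∀ (f g : Form 2) → HasFixedForm f g A (x₁ , y₁) (x₂ , y₂) (x₃ , y₃) → HasFixedForm f g A (x₁ , y₁) (x₃ , y₃) (x₂ , y₂)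
      go (f₀ ∷ f₁ ∷ f₂ ∷ []) (g₀ ∷ g₁ ∷ g₂ ∷ []) (e₀ , e₁ , e₂ , e₃) =
          trans e₀ (-‿cong (*-congˡ (*-congˡ (*-comm x₂ x₃))))
        , trans e₁ (*-congˡ (solve 6 (λ x₁ y₁ x₂ y₂ x₃ y₃ → x₁ :* (x₂ :* y₃) :+ x₁ :* (y₂ :* x₃) :+ y₁ :* (x₂ :* x₃)
            := x₁ :* (x₃ :* y₂) :+ x₁ :* (y₃ :* x₂) :+ y₁ :* (x₃ :* x₂)) refl x₁ y₁ x₂ y₂ x₃ y₃))
        , trans e₂ (-‿cong (*-congˡ (solve 6 (λ x₁ y₁ x₂ y₂ x₃ y₃ → x₁ :* (y₂ :* y₃) :+ y₁ :* (x₂ :* y₃) :+ y₁ :* (y₂ :* x₃)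
            := x₁ :* (y₃ :* y₂) :+ y₁ :* (x₃ :* y₂) :+ y₁ :* (y₃ :* x₂)) refl x₁ y₁ x₂ y₂ x₃ y₃)))
        , trans e₃ (-‿cong (*-congˡ (*-congˡ (*-comm y₂ y₃))))

  -- The factor by which (f , g) scales the fixed vector p₁.
  scaling : Form 2 → Carrier → Point → Point → Point → Carrier
  scaling (g₀ ∷ g₁ ∷ g₂ ∷ []) A (x₁ , y₁) (x₂ , y₂) (x₃ , y₃) = g₁ * x₁ + g₀ * y₁ - A * ((y₂ * y₃) * (x₁ * x₁))

  num-scaling : ∀ (f g : Form 2) {A} p₁ p₂ p₃ → HasFixedForm f g A p₁ p₂ p₃ →
                evalAt f p₁ ≈ scaling g A p₁ p₂ p₃ * proj₁ p₁
  num-scaling (f₀ ∷ f₁ ∷ f₂ ∷ []) (g₀ ∷ g₁ ∷ g₂ ∷ []) {A} (x₁ , y₁) (x₂ , y₂) (x₃ , y₃) (e₀ , e₁ , e₂ , e₃) =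
    trans (+-cong (*-congʳ e₀) (*-congˡ (+-cong (*-congʳ f₁≈) (*-congˡ f₂≈))))
      (solve 9 (λ g₀ g₁ A x₁ y₁ x₂ y₂ x₃ y₃ → let I = con (+ 1) in
        (:- (A :* (x₁ :* (x₂ :* x₃)))) :* (y₁ :* (y₁ :* I)) :+
          x₁ :* ((A :* (x₁ :* (x₂ :* y₃) :+ x₁ :* (y₂ :* x₃) :+ y₁ :* (x₂ :* x₃)) :+ g₀) :* (y₁ :* I) :+
            x₁ :* ((:- (A :* (x₁ :* (y₂ :* y₃) :+ y₁ :* (x₂ :* y₃) :+ y₁ :* (y₂ :* x₃)))) :+ g₁))
        := (g₁ :* x₁ :+ g₀ :* y₁ :- A :* ((y₂ :* y₃) :* (x₁ :* x₁))) :* x₁) refl g₀ g₁ A x₁ y₁ x₂ y₂ x₃ y₃)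
    where
    f₁≈ : f₁ ≈ A * (x₁ * (x₂ * y₃) + x₁ * (y₂ * x₃) + y₁ * (x₂ * x₃)) + g₀
    f₁≈ = trans (solve 2 (λ f g → f := (f :- g) :+ g) refl f₁ g₀) (+-congʳ e₁)
    f₂≈ : f₂ ≈ - (A * (x₁ * (y₂ * y₃) + y₁ * (x₂ * y₃) + y₁ * (y₂ * x₃))) + g₁
    f₂≈ = trans (solve 2 (λ f g → f := (f :- g) :+ g) refl f₂ g₁) (+-congʳ e₂)

  den-scaling : ∀ (f g : Form 2) {A} p₁ p₂ p₃ → HasFixedForm f g A p₁ p₂ p₃ →
                evalAt g p₁ ≈ scaling g A p₁ p₂ p₃ * proj₂ p₁
  den-scaling (f₀ ∷ f₁ ∷ f₂ ∷ []) (g₀ ∷ g₁ ∷ g₂ ∷ []) {A} (x₁ , y₁) (x₂ , y₂) (x₃ , y₃) (e₀ , e₁ , e₂ , e₃) =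
    trans (+-congˡ (*-congˡ (+-congˡ (*-congˡ e₃))))
      (solve 7 (λ g₀ g₁ A x₁ y₁ y₂ y₃ → let I = con (+ 1) in
        g₀ :* (y₁ :* (y₁ :* I)) :+ x₁ :* (g₁ :* (y₁ :* I) :+ x₁ :* (:- (A :* (y₁ :* (y₂ :* y₃)))))
        := (g₁ :* x₁ :+ g₀ :* y₁ :- A :* ((y₂ :* y₃) :* (x₁ :* x₁))) :* y₁) refl g₀ g₁ A x₁ y₁ y₂ y₃)

  scaling-relation : ∀ (g : Form 2) A p₁ p₂ p₃ →
    scaling g A p₁ p₂ p₃ * cross p₂ p₃ - scaling g A p₂ p₁ p₃ * cross p₁ p₃ + scaling g A p₃ p₁ p₂ * cross p₁ p₂
      ≈ - (A * (cross p₁ p₂ * (cross p₁ p₃ * cross p₂ p₃)))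
  scaling-relation (g₀ ∷ g₁ ∷ g₂ ∷ []) A (x₁ , y₁) (x₂ , y₂) (x₃ , y₃) =
    solve 9 (λ g₀ g₁ A x₁ y₁ x₂ y₂ x₃ y₃ →
      let s = λ x₁ y₁ y₂ y₃ → g₁ :* x₁ :+ g₀ :* y₁ :- A :* ((y₂ :* y₃) :* (x₁ :* x₁))
          d₁₂ = y₂ :* x₁ :- x₂ :* y₁ ; d₁₃ = y₃ :* x₁ :- x₃ :* y₁ ; d₂₃ = y₃ :* x₂ :- x₃ :* y₂
      in s x₁ y₁ y₂ y₃ :* d₂₃ :- s x₂ y₂ y₁ y₃ :* d₁₃ :+ s x₃ y₃ y₁ y₂ :* d₁₂ := :- (A :* (d₁₂ :* (d₁₃ :* d₂₃))))
      refl g₀ g₁ A x₁ y₁ x₂ y₂ x₃ y₃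

  fixed-equation : ∀ (f g : Form 2) {A} p₁ p₂ p₃ → HasFixedForm f g A p₁ p₂ p₃ → ∀ p →
    evalAt f p * proj₂ p - evalAt g p * proj₁ p ≈ A * (cross p p₁ * (cross p p₂ * cross p p₃))
  fixed-equation (f₀ ∷ f₁ ∷ f₂ ∷ []) (g₀ ∷ g₁ ∷ g₂ ∷ []) {A} (x₁ , y₁) (x₂ , y₂) (x₃ , y₃) (e₀ , e₁ , e₂ , e₃) (x , y) =
    trans (solve 8 (λ f₀ f₁ f₂ g₀ g₁ g₂ x y → let I = con (+ 1) in
        (f₀ :* (y :* (y :* I)) :+ x :* (f₁ :* (y :* I) :+ x :* f₂)) :* y :- (g₀ :* (y :* (y :* I)) :+ x :* (g₁ :* (y :* I) :+ x :* g₂)) :* x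
        := f₀ :* (y :* y :* y) :+ (f₁ :- g₀) :* (x :* y :* y) :+ (f₂ :- g₁) :* (x :* x :* y) :- g₂ :* (x :* x :* x)) refl f₀ f₁ f₂ g₀ g₁ g₂ x y)
      (trans (+-cong (+-cong (+-cong (*-congʳ e₀) (*-congʳ e₁)) (*-congʳ e₂)) (-‿cong (*-congʳ e₃)))
        (solve 9 (λ A x₁ y₁ x₂ y₂ x₃ y₃ x y →
          (:- (A :* (x₁ :* (x₂ :* x₃)))) :* (y :* y :* y)
            :+ (A :* (x₁ :* (x₂ :* y₃) :+ x₁ :* (y₂ :* x₃) :+ y₁ :* (x₂ :* x₃))) :* (x :* y :* y)
            :+ (:- (A :* (x₁ :* (y₂ :* y₃) :+ y₁ :* (x₂ :* y₃) :+ y₁ :* (y₂ :* x₃)))) :* (x :* x :* y)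
            :- (:- (A :* (y₁ :* (y₂ :* y₃)))) :* (x :* x :* x)
          := A :* ((y₁ :* x :- x₁ :* y) :* ((y₂ :* x :- x₂ :* y) :* (y₃ :* x :- x₃ :* y)))) refl A x₁ y₁ x₂ y₂ x₃ y₃ x y))

  -- Differentiate fY − gX at the fixed point p₁, in the affine chart containing it.
  finite-multiplier : ∀ (f g : Form 2) {A} p₁ p₂ p₃ → HasFixedForm f g A p₁ p₂ p₃ → ∀ z λ′ →
    z * proj₂ p₁ ≈ proj₁ p₁ → proj₂ p₁ ≉ 0# → eval g z 1# ≉ 0# → HasDerivative [ f , g ] z λ′ →
    scaling g A p₁ p₂ p₃ * (λ′ - 1#) ≈ A * (cross p₁ p₂ * cross p₁ p₃)
  finite-multiplier f@(f₀ ∷ f₁ ∷ f₂ ∷ []) g@(g₀ ∷ g₁ ∷ g₂ ∷ []) {A} p₁@(x₁ , y₁) p₂@(x₂ , y₂) p₃@(x₃ , y₃) h@(e₀ , e₁ , e₂ , e₃) z l zy≈x y≉0 gz≉0 der =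
    *-cancelˡ y≉0 (begin
      y₁ * (s * (l - 1#))                         ≈⟨ solve 3 (λ y s l → y :* (s :* l) := (s :* y) :* l) refl y₁ s (l - 1#) ⟩
      (s * y₁) * (l - 1#)                         ≈⟨ *-congʳ (trans (sym (den-scaling f g p₁ p₂ p₃ h)) (trans (eval-arg g (sym zy≈x) refl) (trans (eval-arg g (*-comm z y₁) (sym (*-identityʳ y₁))) (eval-homogeneous g y₁ z 1#)))) ⟩
      (y₁ ^ 2 * G) * (l - 1#)                     ≈⟨ solve 3 (λ y G l → (y :* (y :* con (+ 1)) :* G) :* (l :- con (+ 1)) := y :* y :* (l :* G :- G)) refl y₁ G l ⟩
      y₁ * y₁ * (l * G - G)                       ≈⟨ *-congˡ (trans (+-congʳ lG≈) residual) ⟩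
      y₁ * y₁ * (A * (y₁ * ((y₂ * z - x₂) * (y₃ * z - x₃)))) ≈⟨ solve 6 (λ y A u v x₂ x₃ → y :* y :* (A :* (y :* ((u :- x₂) :* (v :- x₃)))) := y :* (A :* ((u :* y :- x₂ :* y) :* (v :* y :- x₃ :* y)))) refl y₁ A (y₂ * z) (y₃ * z) x₂ x₃ ⟩
      y₁ * (A * ((y₂ * z * y₁ - x₂ * y₁) * (y₃ * z * y₁ - x₃ * y₁))) ≈⟨ *-congˡ (*-congˡ (*-cong (+-congʳ (trans (*-assoc _ _ _) (*-congˡ zy≈x))) (+-congʳ (trans (*-assoc _ _ _) (*-congˡ zy≈x))))) ⟩
      y₁ * (A * (cross p₁ p₂ * cross p₁ p₃))      ∎)
    where
    open import Relation.Binary.Reasoning.Setoid setoid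
    s = scaling g A p₁ p₂ p₃
    Fz = eval f z 1#
    G = eval g z 1#
    F′ = derivative f z
    G′ = derivative g z
    cross₁ : cross (z , 1#) p₁ ≈ 0#
    cross₁ = trans (solve 3 (λ z x y → y :* z :- x :* con (+ 1) := z :* y :- x) refl z x₁ y₁) (x≈y⇒x-y≈0 zy≈x)
    F≈zG : Fz ≈ z * G
    F≈zG = x-y≈0⇒x≈y (trans (solve 3 (λ F z G → F :- z :* G := F :* con (+ 1) :- G :* z) refl Fz z G)
      (trans (fixed-equation f g p₁ p₂ p₃ h (z , 1#)) (trans (*-congˡ (trans (*-congʳ cross₁) (zeroˡ _))) (zeroʳ A))))
    lG≈ : l * G ≈ F′ - z * G′
    lG≈ = *-cancelˡ gz≉0 (begin
      G * (l * G)           ≈⟨ solve 2 (λ G l → G :* (l :* G) := l :* (G :* G)) refl G l ⟩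
      l * (G * G)           ≈⟨ der ⟩
      F′ * G - Fz * G′      ≈⟨ +-congˡ (-‿cong (*-congʳ F≈zG)) ⟩
      F′ * G - (z * G) * G′ ≈⟨ solve 4 (λ F′ G z G′ → F′ :* G :- (z :* G) :* G′ := G :* (F′ :- z :* G′)) refl F′ G z G′ ⟩
      G * (F′ - z * G′)     ∎)
    residual : (F′ - z * G′) - G ≈ A * (y₁ * ((y₂ * z - x₂) * (y₃ * z - x₃)))
    residual = begin
      (F′ - z * G′) - G
        ≈⟨ solve 7 (λ f₀ f₁ f₂ g₀ g₁ g₂ z → let I = con (+ 1) ; O = con (+ 0) in
             (((f₁ :* (I :* I) :+ z :* f₂) :+ z :* (f₂ :+ z :* O)) :- z :* ((g₁ :* (I :* I) :+ z :* g₂) :+ z :* (g₂ :+ z :* O)))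
               :- (g₀ :* (I :* (I :* I)) :+ z :* (g₁ :* (I :* I) :+ z :* g₂))
             := (f₁ :- g₀) :+ (I :+ I) :* (f₂ :- g₁) :* z :- (I :+ I :+ I) :* g₂ :* (z :* z)) refl f₀ f₁ f₂ g₀ g₁ g₂ z ⟩
      (f₁ - g₀) + (1# + 1#) * (f₂ - g₁) * z - (1# + 1# + 1#) * g₂ * (z * z)
        ≈⟨ +-cong (+-cong e₁ (*-congʳ (*-congˡ e₂))) (-‿cong (*-congʳ (*-congˡ e₃))) ⟩
      _ ≈⟨ +-cong (+-cong (*-congˡ (+-cong (+-cong (*-congʳ x≈) (*-congʳ x≈)) refl)) (*-congʳ (*-congˡ (-‿cong (*-congˡ (+-congʳ (+-congʳ (*-congʳ x≈)))))))) refl ⟩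
      _ ≈⟨ solve 7 (λ A z y₁ x₂ y₂ x₃ y₃ → let I = con (+ 1) ; x₁ = z :* y₁ in
             A :* (x₁ :* (x₂ :* y₃) :+ x₁ :* (y₂ :* x₃) :+ y₁ :* (x₂ :* x₃))
               :+ (I :+ I) :* (:- (A :* (x₁ :* (y₂ :* y₃) :+ y₁ :* (x₂ :* y₃) :+ y₁ :* (y₂ :* x₃)))) :* z
               :- (I :+ I :+ I) :* (:- (A :* (y₁ :* (y₂ :* y₃)))) :* (z :* z)
             := A :* (y₁ :* ((y₂ :* z :- x₂) :* (y₃ :* z :- x₃)))) refl A z y₁ x₂ y₂ x₃ y₃ ⟩
      A * (y₁ * ((y₂ * z - x₂) * (y₃ * z - x₃))) ∎
      where
      x≈ : x₁ ≈ z * y₁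
      x≈ = sym zy≈x

  infinite-multiplier : ∀ (f g : Form 2) {A} p₁ p₂ p₃ → HasFixedForm f g A p₁ p₂ p₃ → ∀ λ′ →
    proj₂ p₁ ≈ 0# → eval f 1# 0# ≉ 0# → HasDerivative (atInfinity [ f , g ]) 0# λ′ →
    scaling g A p₁ p₂ p₃ * (λ′ - 1#) ≈ A * (cross p₁ p₂ * cross p₁ p₃)
  infinite-multiplier f@(f₀ ∷ f₁ ∷ f₂ ∷ []) g@(g₀ ∷ g₁ ∷ g₂ ∷ []) {A} p₁@(x₁ , y₁) p₂@(x₂ , y₂) p₃@(x₃ , y₃) (e₀ , e₁ , e₂ , e₃) l y≈0 f1≉0 der = begin
    (g₁ * x₁ + g₀ * y₁ - A * ((y₂ * y₃) * (x₁ * x₁))) * (l - 1#)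
      ≈⟨ *-congʳ (+-cong (+-congˡ (trans (*-congˡ y≈0) (zeroʳ g₀))) refl) ⟩
    (g₁ * x₁ + 0# - A * ((y₂ * y₃) * (x₁ * x₁))) * (l - 1#)
      ≈⟨ solve 6 (λ g₁ x₁ A y₂ y₃ l → (g₁ :* x₁ :+ con (+ 0) :- A :* ((y₂ :* y₃) :* (x₁ :* x₁))) :* (l :- con (+ 1))
           := x₁ :* ((g₁ :- A :* (x₁ :* (y₂ :* y₃))) :* l :- (g₁ :- A :* (x₁ :* (y₂ :* y₃))))) refl g₁ x₁ A y₂ y₃ l ⟩
    x₁ * ((g₁ - A * (x₁ * (y₂ * y₃))) * l - (g₁ - A * (x₁ * (y₂ * y₃))))
      ≈⟨ *-congˡ (+-cong (trans (*-congʳ (sym f₂≈)) f₂l≈g₁) refl) ⟩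
    x₁ * (g₁ - (g₁ - A * (x₁ * (y₂ * y₃))))
      ≈⟨ solve 5 (λ g₁ x₁ A y₂ y₃ → x₁ :* (g₁ :- (g₁ :- A :* (x₁ :* (y₂ :* y₃)))) :=
           A :* ((y₂ :* x₁ :- con (+ 0)) :* (y₃ :* x₁ :- con (+ 0)))) refl g₁ x₁ A y₂ y₃ ⟩
    A * ((y₂ * x₁ - 0#) * (y₃ * x₁ - 0#))
      ≈⟨ *-congˡ (*-cong (+-congˡ (-‿cong (sym (kill x₂)))) (+-congˡ (-‿cong (sym (kill x₃))))) ⟩
    A * (cross p₁ p₂ * cross p₁ p₃) ∎
    where
    open import Relation.Binary.Reasoning.Setoid setoid
    kill : ∀ u → u * y₁ ≈ 0#
    kill u = trans (*-congˡ y≈0) (zeroʳ u)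
    f₂≉0 : f₂ ≉ 0#
    f₂≉0 e = f1≉0 (trans (solve 3 (λ f₀ f₁ f₂ → let I = con (+ 1) ; O = con (+ 0) in
      f₀ :* (O :* (O :* I)) :+ I :* (f₁ :* (O :* I) :+ I :* f₂) := f₂) refl f₀ f₁ f₂) e)
    g₂≈0 : g₂ ≈ 0#
    g₂≈0 = trans e₃ (trans (-‿cong (trans (*-congˡ (trans (*-congʳ y≈0) (zeroˡ _))) (zeroʳ A))) -0#≈0#)
    f₂≈ : f₂ ≈ g₁ - A * (x₁ * (y₂ * y₃))
    f₂≈ = trans (solve 2 (λ f g → f := (f :- g) :+ g) refl f₂ g₁) (trans (+-congʳ (trans e₂ (-‿cong (*-congˡ
            (trans (+-cong (+-congˡ (trans (*-congʳ y≈0) (zeroˡ _))) (trans (*-congʳ y≈0) (zeroˡ _))) (trans (+-identityʳ _) (+-identityʳ _)))))))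
          (+-comm _ _))
    f₂l≈g₁ : f₂ * l ≈ g₁
    f₂l≈g₁ = *-cancelˡ f₂≉0 (begin
      f₂ * (f₂ * l)
        ≈⟨ solve 4 (λ f₀ f₁ f₂ l → let I = con (+ 1) ; O = con (+ 0) ; v = f₂ :* (I :* (I :* I)) :+ O :* (f₁ :* (I :* I) :+ O :* f₀) in
             f₂ :* (f₂ :* l) := l :* (v :* v)) refl f₀ f₁ f₂ l ⟩
      _ ≈⟨ der ⟩
      _ ≈⟨ solve 6 (λ f₀ f₁ f₂ g₀ g₁ g₂ → let I = con (+ 1) ; O = con (+ 0)
                                              v = λ f₀ f₁ f₂ → f₂ :* (I :* (I :* I)) :+ O :* (f₁ :* (I :* I) :+ O :* f₀)
                                              v′ = λ f₀ f₁ → (f₁ :* (I :* I) :+ O :* f₀) :+ O :* (f₀ :+ O :* O) in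
             v′ g₀ g₁ :* v f₀ f₁ f₂ :- v g₀ g₁ g₂ :* v′ f₀ f₁ := f₂ :* g₁ :- g₂ :* f₁) refl f₀ f₁ f₂ g₀ g₁ g₂ ⟩
      f₂ * g₁ - g₂ * f₁ ≈⟨ +-congˡ (-‿cong (trans (*-congʳ g₂≈0) (zeroˡ f₁))) ⟩
      f₂ * g₁ - 0#      ≈⟨ solve 2 (λ f g → f :* g :- con (+ 0) := f :* g) refl f₂ g₁ ⟩
      f₂ * g₁           ∎)

  cross-flip : ∀ p q → cross q p ≈ - cross p q
  cross-flip (x , y) (x′ , y′) = solve 4 (λ x y x′ y′ → y :* x′ :- x :* y′ := :- (y′ :* x :- x′ :* y)) refl x y x′ y′

  cross-flip≉0 : ∀ p q → cross p q ≉ 0# → cross q p ≉ 0#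
  cross-flip≉0 p q ne e = -‿≉0 ne (trans (sym (cross-flip p q)) e)

  cross-flip≈0 : ∀ p q → cross p q ≈ 0# → cross q p ≈ 0#
  cross-flip≈0 p q e = trans (cross-flip p q) (trans (-‿cong e) -0#≈0#)

  cross-self : ∀ p → cross p p ≈ 0#
  cross-self (x , y) = -‿inverseʳ′ where
    -‿inverseʳ′ : y * x - x * y ≈ 0#
    -‿inverseʳ′ = solve 2 (λ x y → y :* x :- x :* y := con (+ 0)) refl x y

  by-coordinates : ∀ p → Nonzero p → ∀ {s} → proj₁ p * s ≈ 0# → proj₂ p * s ≈ 0# → s ≈ 0#
  by-coordinates p (inj₁ x≉0) e _ = x*y≈0⇒y≈0 x≉0 e
  by-coordinates p (inj₂ y≉0) _ e = x*y≈0⇒y≈0 y≉0 e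

  private
    combination≈0 : ∀ {u s t a b} → u ≈ s * a - t * b → a ≈ 0# → b ≈ 0# → u ≈ 0#
    combination≈0 {s = s} {t} e a≈0 b≈0 = trans e (trans (+-cong (trans (*-congˡ a≈0) (zeroʳ s)) (-‿cong (trans (*-congˡ b≈0) (zeroʳ t))))
      (trans (+-congˡ -0#≈0#) (+-identityʳ 0#)))

  cross-trans : ∀ p r q → Nonzero r → cross p r ≈ 0# → cross q r ≈ 0# → cross p q ≈ 0#
  cross-trans (a , b) r@(x , y) (a′ , b′) nz e e′ = by-coordinates r nz
    (combination≈0 (solve 6 (λ a b x y a′ b′ → x :* (b′ :* a :- a′ :* b) := a :* (x :* b′ :- y :* a′) :- a′ :* (x :* b :- y :* a)) refl a b x y a′ b′)
      (flip′ e′) (flip′ e))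
    (combination≈0 (solve 6 (λ a b x y a′ b′ → y :* (b′ :* a :- a′ :* b) := b :* (x :* b′ :- y :* a′) :- b′ :* (x :* b :- y :* a)) refl a b x y a′ b′)
      (flip′ e′) (flip′ e))
    where
    flip′ : ∀ {a b} → y * a - x * b ≈ 0# → x * b - y * a ≈ 0#
    flip′ {a} {b} e = trans (solve 4 (λ x y a b → x :* b :- y :* a := :- (y :* a :- x :* b)) refl x y a b) (trans (-‿cong e) -0#≈0#)

  evalAt-linear : ∀ (l : Form 1) p → evalAt l p ≈ head l * proj₂ p + head (tail l) * proj₁ p
  evalAt-linear (a ∷ b ∷ []) (x , y) = solve 4 (λ a b x y → a :* (y :* con (+ 1)) :+ x :* b := a :* y :+ b :* x) refl a b x y

  quadratic-ext : ∀ {f g : Form 2} → (∀ x y → eval f x y ≈ eval g x y) → f ≋ g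
  quadratic-ext {f₀ ∷ f₁ ∷ f₂ ∷ []} {g₀ ∷ g₁ ∷ g₂ ∷ []} h = e₀ ∷ e₁ ∷ e₂ ∷ []
    where
    at₀ : ∀ f₀ f₁ f₂ → eval (f₀ ∷ f₁ ∷ f₂ ∷ []) 0# 1# ≈ f₀
    at₀ = solve 3 (λ f₀ f₁ f₂ → let I = con (+ 1) ; O = con (+ 0) in f₀ :* (I :* (I :* I)) :+ O :* (f₁ :* (I :* I) :+ O :* f₂) := f₀) refl
    at₂ : ∀ f₀ f₁ f₂ → eval (f₀ ∷ f₁ ∷ f₂ ∷ []) 1# 0# ≈ f₂
    at₂ = solve 3 (λ f₀ f₁ f₂ → let I = con (+ 1) ; O = con (+ 0) in f₀ :* (O :* (O :* I)) :+ I :* (f₁ :* (O :* I) :+ I :* f₂) := f₂) refl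
    at₁ : ∀ f₀ f₁ f₂ → eval (f₀ ∷ f₁ ∷ f₂ ∷ []) 1# 1# - f₀ - f₂ ≈ f₁
    at₁ = solve 3 (λ f₀ f₁ f₂ → let I = con (+ 1) in (f₀ :* (I :* (I :* I)) :+ I :* (f₁ :* (I :* I) :+ I :* f₂)) :- f₀ :- f₂ := f₁) refl
    e₀ : f₀ ≈ g₀
    e₀ = trans (sym (at₀ f₀ f₁ f₂)) (trans (h 0# 1#) (at₀ g₀ g₁ g₂))
    e₂ : f₂ ≈ g₂
    e₂ = trans (sym (at₂ f₀ f₁ f₂)) (trans (h 1# 0#) (at₂ g₀ g₁ g₂))
    e₁ : f₁ ≈ g₁
    e₁ = trans (sym (at₁ f₀ f₁ f₂)) (trans (+-cong (+-cong (h 1# 1#) (-‿cong e₀)) (-‿cong e₂)) (at₁ g₀ g₁ g₂))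

  -- det (N p , q) for the matrix N with rows u and v.
  pairing : Form 1 → Form 1 → Point → Point → Carrier
  pairing u v p q = evalAt u p * proj₂ q - evalAt v p * proj₁ q

  -- The data of a map of degree 2 whose reduction is the linear map [u : v], the common
  -- factor of numerator and denominator vanishing at p₃.
  record Special (h u v : Form 1) (A : Carrier) (p₁ p₂ p₃ : Point) : Set (c ⊔ ℓ) where
    field
      s        : Carrier
      s≉0      : s ≉ 0#
      common   : ∀ p → evalAt h p ≈ s * cross p p₃
      polar    : ∀ p q → s * (pairing u v p q + pairing u v q p) ≈ A * (cross p p₁ * cross q p₂ + cross q p₁ * cross p p₂)
      diagonal : ∀ p → s * pairing u v p p ≈ A * (cross p p₁ * cross p p₂)

  special : ∀ (h u v : Form 1) (f g : Form 2) {A} p₁ p₂ p₃ → Nonzero p₃ → HasFixedForm f g A p₁ p₂ p₃ →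
    ¬ (h ≋ 0# ∷ 0# ∷ []) → f ≋ h ⊛ u → g ≋ h ⊛ v → pairing u v p₃ p₃ ≉ 0# → Special h u v A p₁ p₂ p₃
  special h@(h₀ ∷ h₁ ∷ []) u@(u₀ ∷ u₁ ∷ []) v@(v₀ ∷ v₁ ∷ []) f@(f₀ ∷ f₁ ∷ f₂ ∷ []) g@(g₀ ∷ g₁ ∷ g₂ ∷ []) {A}
    p₁@(x₁ , y₁) p₂@(x₂ , y₂) p₃@(x₃ , y₃) nz ff@(e₀ , e₁ , e₂ , e₃) h≉0 (ef₀ ∷ ef₁ ∷ ef₂ ∷ []) (eg₀ ∷ eg₁ ∷ eg₂ ∷ []) w≉0 = record
      { s = s ; s≉0 = s≉0 ; common = common ; polar = polar ; diagonal = diagonal }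
    where
    hp : evalAt h p₃ * pairing u v p₃ p₃ ≈ 0#
    hp = trans (trans (solve 4 (λ h u v w → h :* (u :* w :- v) := (h :* u) :* w :- h :* v) refl (evalAt h p₃) (evalAt u p₃) (evalAt v p₃ * x₃) y₃) 
           (trans (+-cong (*-congʳ (trans (sym (eval-⊛ h u x₃ y₃)) (sym (eval-≋ (ef₀ ∷ ef₁ ∷ ef₂ ∷ []) x₃ y₃))))
                          (-‿cong (trans (sym (*-assoc _ _ _)) (*-congʳ (trans (sym (eval-⊛ h v x₃ y₃)) (sym (eval-≋ (eg₀ ∷ eg₁ ∷ eg₂ ∷ []) x₃ y₃)))))))
            (fixed-equation f g p₁ p₂ p₃ ff p₃)))
         (trans (*-congˡ (trans (*-congˡ (trans (*-congˡ (cross-self p₃)) (zeroʳ _))) (zeroʳ _))) (zeroʳ A))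
    h≈0 : h₀ * y₃ + h₁ * x₃ ≈ 0#
    h≈0 = trans (sym (evalAt-linear h p₃)) ([ id , (λ e → contradiction e w≉0) ]′ (zero-product hp))
    factorisation : Nonzero p₃ → ∃[ s ] (h₀ ≈ - (s * x₃) × h₁ ≈ s * y₃)
    factorisation (inj₂ y≉0) = y≉0 ⁻¹ * h₁ , *-cancelˡ y≉0 (trans (trans (solve 4 (λ h₀ h₁ x y → y :* h₀ := (h₀ :* y :+ h₁ :* x) :- x :* h₁) refl h₀ h₁ x₃ y₃)
              (trans (+-cong h≈0 (-‿cong (*-congˡ (sym (divide y≉0 h₁)))))
                (solve 3 (λ x y s → con (+ 0) :- x :* (y :* s) := y :* (:- (s :* x))) refl x₃ y₃ (y≉0 ⁻¹ * h₁)))) refl)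
          , trans (sym (divide y≉0 h₁)) (*-comm _ _)
    factorisation (inj₁ x≉0) = - (x≉0 ⁻¹ * h₀) , trans (sym (divide x≉0 h₀)) (solve 2 (λ x s → x :* s := :- ((:- s) :* x)) refl x₃ (x≉0 ⁻¹ * h₀))
          , *-cancelˡ x≉0 (trans (solve 4 (λ h₀ h₁ x y → x :* h₁ := (h₀ :* y :+ h₁ :* x) :- h₀ :* y) refl h₀ h₁ x₃ y₃)
              (trans (+-cong h≈0 (-‿cong (*-congʳ (sym (divide x≉0 h₀)))))
                (solve 3 (λ x y s → con (+ 0) :- (x :* s) :* y := x :* ((:- s) :* y)) refl x₃ y₃ (x≉0 ⁻¹ * h₀))))
    s : Carrier
    s = proj₁ (factorisation nz)
    h₀≈ : h₀ ≈ - (s * x₃)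
    h₀≈ = proj₁ (proj₂ (factorisation nz))
    h₁≈ : h₁ ≈ s * y₃
    h₁≈ = proj₂ (proj₂ (factorisation nz))
    common : ∀ p → evalAt h p ≈ s * cross p p₃
    common (x , y) = trans (evalAt-linear h (x , y)) (trans (+-cong (*-congʳ h₀≈) (*-congʳ h₁≈))
      (solve 5 (λ s x y x′ y′ → (:- (s :* x′)) :* y :+ (s :* y′) :* x := s :* (y′ :* x :- x′ :* y)) refl s x y x₃ y₃))
    s≉0 : s ≉ 0#
    s≉0 s≈0 = h≉0 (trans h₀≈ (trans (-‿cong (trans (*-congʳ s≈0) (zeroˡ _))) -0#≈0#) ∷ trans h₁≈ (trans (*-congʳ s≈0) (zeroˡ _)) ∷ [])
    r₀ r₁ r₂ : Carrier
    r₀ = s * u₀ - A * (x₁ * x₂)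
    r₁ = s * (u₁ - v₀) + A * (x₁ * y₂ + y₁ * x₂)
    r₂ = - (s * v₁) - A * (y₁ * y₂)
    x₃r₀ : x₃ * r₀ ≈ 0#
    x₃r₀ = trans (solve 6 (λ A s u x₁ x₂ x₃ → x₃ :* (s :* u :- A :* (x₁ :* x₂)) := (:- (A :* (x₁ :* (x₂ :* x₃)))) :- ((:- (s :* x₃)) :* u :+ con (+ 0)))
      refl A s u₀ x₁ x₂ x₃) (x≈y⇒x-y≈0 (trans (sym e₀) (trans ef₀ (+-congʳ (*-congʳ h₀≈)))))
    y₃r₀ : y₃ * r₀ - x₃ * r₁ ≈ 0#
    y₃r₀ = trans (solve 11 (λ A s u₀ u₁ v₀ x₁ y₁ x₂ y₂ x₃ y₃ →
        y₃ :* (s :* u₀ :- A :* (x₁ :* x₂)) :- x₃ :* (s :* (u₁ :- v₀) :+ A :* (x₁ :* y₂ :+ y₁ :* x₂))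
        := (((:- (s :* x₃)) :* u₁ :+ (s :* y₃) :* u₀) :- ((:- (s :* x₃)) :* v₀ :+ con (+ 0))) :- A :* (x₁ :* (x₂ :* y₃) :+ x₁ :* (y₂ :* x₃) :+ y₁ :* (x₂ :* x₃)))
      refl A s u₀ u₁ v₀ x₁ y₁ x₂ y₂ x₃ y₃)
      (x≈y⇒x-y≈0 (trans (sym (trans (+-cong ef₁ (-‿cong eg₀)) (+-cong (+-cong (*-congʳ h₀≈) (*-congʳ h₁≈)) (-‿cong (+-congʳ (*-congʳ h₀≈)))))) e₁))
    y₃r₁ : y₃ * r₁ - x₃ * r₂ ≈ 0#
    y₃r₁ = trans (solve 11 (λ A s u₁ v₀ v₁ x₁ y₁ x₂ y₂ x₃ y₃ →
        y₃ :* (s :* (u₁ :- v₀) :+ A :* (x₁ :* y₂ :+ y₁ :* x₂)) :- x₃ :* ((:- (s :* v₁)) :- A :* (y₁ :* y₂))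
        := ((con (+ 0) :+ (s :* y₃) :* u₁) :- ((:- (s :* x₃)) :* v₁ :+ (s :* y₃) :* v₀)) :- (:- (A :* (x₁ :* (y₂ :* y₃) :+ y₁ :* (x₂ :* y₃) :+ y₁ :* (y₂ :* x₃)))))
      refl A s u₁ v₀ v₁ x₁ y₁ x₂ y₂ x₃ y₃)
      (x≈y⇒x-y≈0 (trans (sym (trans (+-cong ef₂ (-‿cong eg₁)) (+-cong (+-congˡ (*-congʳ h₁≈)) (-‿cong (+-cong (*-congʳ h₀≈) (*-congʳ h₁≈)))))) e₂))
    y₃r₂ : y₃ * r₂ ≈ 0#
    y₃r₂ = trans (solve 6 (λ A s v y₁ y₂ y₃ → y₃ :* ((:- (s :* v)) :- A :* (y₁ :* y₂)) := (:- (A :* (y₁ :* (y₂ :* y₃)))) :- (con (+ 0) :+ (s :* y₃) :* v))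
      refl A s v₁ y₁ y₂ y₃) (x≈y⇒x-y≈0 (trans (sym e₃) (trans eg₂ (+-congˡ (*-congʳ h₁≈)))))
    step : ∀ {a b t} → a * t - b ≈ 0# → b ≈ 0# → a ≉ 0# → t ≈ 0#
    step e b≈0 a≉0 = x*y≈0⇒y≈0 a≉0 (trans (x-y≈0⇒x≈y e) b≈0)
    step′ : ∀ {a b t} → b - a * t ≈ 0# → b ≈ 0# → a ≉ 0# → t ≈ 0#
    step′ e b≈0 a≉0 = x*y≈0⇒y≈0 a≉0 (trans (sym (x-y≈0⇒x≈y e)) b≈0)
    times0 : ∀ {a t} → t ≈ 0# → a * t ≈ 0#
    times0 e = trans (*-congˡ e) (zeroʳ _)
    r≈0 : Nonzero p₃ → r₀ ≈ 0# × r₁ ≈ 0# × r₂ ≈ 0#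
    r≈0 (inj₁ x≉0) = let z₀ = x*y≈0⇒y≈0 x≉0 x₃r₀ ; z₁ = step′ y₃r₀ (times0 z₀) x≉0 in z₀ , z₁ , step′ y₃r₁ (times0 z₁) x≉0
    r≈0 (inj₂ y≉0) = let z₂ = x*y≈0⇒y≈0 y≉0 y₃r₂ ; z₁ = step y₃r₁ (times0 z₂) y≉0 in step y₃r₀ (times0 z₁) y≉0 , z₁ , z₂
    reduce : ∀ {u v a b d} → u - v ≈ a * r₀ + b * r₁ + d * r₂ → u ≈ v
    reduce e = let (z₀ , z₁ , z₂) = r≈0 nz in x-y≈0⇒x≈y (trans e (trans (+-cong (+-cong (times0 z₀) (times0 z₁)) (times0 z₂))
      (trans (+-congʳ (+-identityˡ _)) (+-identityˡ _))))
    polar : ∀ p q → s * (pairing u v p q + pairing u v q p) ≈ A * (cross p p₁ * cross q p₂ + cross q p₁ * cross p p₂)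
    polar p@(x , y) q@(x′ , y′) = trans (*-congˡ (+-cong
        (+-cong (*-congʳ (evalAt-linear u p)) (-‿cong (*-congʳ (evalAt-linear v p))))
        (+-cong (*-congʳ (evalAt-linear u q)) (-‿cong (*-congʳ (evalAt-linear v q))))))
      (reduce (solve 14 (λ A s u₀ u₁ v₀ v₁ x₁ y₁ x₂ y₂ x y x′ y′ →
        s :* (((u₀ :* y :+ u₁ :* x) :* y′ :- (v₀ :* y :+ v₁ :* x) :* x′) :+ ((u₀ :* y′ :+ u₁ :* x′) :* y :- (v₀ :* y′ :+ v₁ :* x′) :* x))
          :- A :* ((y₁ :* x :- x₁ :* y) :* (y₂ :* x′ :- x₂ :* y′) :+ (y₁ :* x′ :- x₁ :* y′) :* (y₂ :* x :- x₂ :* y))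
        := (con (+ 2) :* y :* y′) :* (s :* u₀ :- A :* (x₁ :* x₂))
           :+ (x :* y′ :+ x′ :* y) :* (s :* (u₁ :- v₀) :+ A :* (x₁ :* y₂ :+ y₁ :* x₂))
           :+ (con (+ 2) :* x :* x′) :* ((:- (s :* v₁)) :- A :* (y₁ :* y₂)))
        refl A s u₀ u₁ v₀ v₁ x₁ y₁ x₂ y₂ x y x′ y′))
    diagonal : ∀ p → s * pairing u v p p ≈ A * (cross p p₁ * cross p p₂)
    diagonal p@(x , y) = trans (*-congˡ
        (+-cong (*-congʳ (evalAt-linear u p)) (-‿cong (*-congʳ (evalAt-linear v p)))))
      (reduce (solve 12 (λ A s u₀ u₁ v₀ v₁ x₁ y₁ x₂ y₂ x y →
        s :* ((u₀ :* y :+ u₁ :* x) :* y :- (v₀ :* y :+ v₁ :* x) :* x)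
          :- A :* ((y₁ :* x :- x₁ :* y) :* (y₂ :* x :- x₂ :* y))
        := (y :* y) :* (s :* u₀ :- A :* (x₁ :* x₂))
           :+ (x :* y) :* (s :* (u₁ :- v₀) :+ A :* (x₁ :* y₂ :+ y₁ :* x₂))
           :+ (x :* x) :* ((:- (s :* v₁)) :- A :* (y₁ :* y₂)))
        refl A s u₀ u₁ v₀ v₁ x₁ y₁ x₂ y₂ x y))

  module _ {h u v A p₁ p₂ p₃} (S : Special h u v A p₁ p₂ p₃) (w≉0 : pairing u v p₃ p₃ ≉ 0#) where
    open Special S

    private
      product≉0 : A * (cross p₃ p₁ * cross p₃ p₂) ≉ 0#
      product≉0 e = *≉0 s≉0 w≉0 (trans (diagonal p₃) e)

    special-A : A ≉ 0#
    special-A = *≉0ˡ product≉0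

    special-distinct₁ : cross p₁ p₃ ≉ 0#
    special-distinct₁ = cross-flip≉0 p₃ p₁ (*≉0ˡ (*≉0ʳ product≉0))

    special-distinct₂ : cross p₂ p₃ ≉ 0#
    special-distinct₂ = cross-flip≉0 p₃ p₂ (*≉0ʳ (*≉0ʳ product≉0))

  scalar≈0 : ∀ p → Nonzero p → ∀ {m a b} → a ≈ m * proj₁ p → b ≈ m * proj₂ p → a ≈ 0# → b ≈ 0# → m ≈ 0#
  scalar≈0 p nz ea eb a≈0 b≈0 = by-coordinates p nz
    (trans (*-comm _ _) (trans (sym ea) a≈0)) (trans (*-comm _ _) (trans (sym eb) b≈0))

  module _ (ψ : RationalMap 1) where
    private
      u = num (lift ψ)
      v = den (lift ψ)

    pairing-nondegenerate : ∀ p q r → Nonzero p → cross q r ≉ 0# → pairing u v p q ≈ 0# → ¬ pairing u v p r ≈ 0#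
    pairing-nondegenerate p (x , y) (x′ , y′) nz qr≉0 e e′ = nonvanishing ψ (proj₁ p) (proj₂ p) nz
      ( x*y≈0⇒y≈0 qr≉0 (combination≈0 (solve 6 (λ u v x y x′ y′ → (y′ :* x :- x′ :* y) :* u := x :* (u :* y′ :- v :* x′) :- x′ :* (u :* y :- v :* x))
          refl (evalAt u p) (evalAt v p) x y x′ y′) e′ e)
      , x*y≈0⇒y≈0 qr≉0 (combination≈0 (solve 6 (λ u v x y x′ y′ → (y′ :* x :- x′ :* y) :* v := y :* (u :* y′ :- v :* x′) :- y′ :* (u :* y :- v :* x))
          refl (evalAt u p) (evalAt v p) x y x′ y′) e′ e))

    columns : ∀ p q → cross p q ≉ 0# → GL₂
    columns (x , y) (x′ , y′) ne = record { m₁₁ = x ; m₁₂ = x′ ; m₂₁ = y ; m₂₂ = y′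
      ; det≉0 = λ e → ne (trans (solve 4 (λ x y x′ y′ → y′ :* x :- x′ :* y := x :* y′ :- x′ :* y) refl x y x′ y′) e) }

    column₁ column₂ : GL₂ → Point
    column₁ γ = GL₂.m₁₁ γ , GL₂.m₂₁ γ
    column₂ γ = GL₂.m₁₂ γ , GL₂.m₂₂ γ

    private
      along-columns : ∀ γ (l : Form 1) x y → eval (substitute l (möbius γ)) x y ≈ evalAt l (column₂ γ) * y + evalAt l (column₁ γ) * x
      along-columns γ l x y = trans (eval-substitute l (möbius γ) x y) (trans (evalAt-linear l _)
        (trans (solve 8 (λ a b m n p q x y → let I = con (+ 1) in
            a :* (q :* (y :* I) :+ x :* p) :+ b :* (n :* (y :* I) :+ x :* m)
            := (a :* q :+ b :* n) :* y :+ (a :* p :+ b :* m) :* x) refl (head l) (head (tail l)) m₁₁ m₁₂ m₂₁ m₂₂ x y)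
          (+-cong (*-congʳ (sym (evalAt-linear l (column₂ γ)))) (*-congʳ (sym (evalAt-linear l (column₁ γ)))))))
        where open GL₂ γ

    conjugate-num : ∀ γ x y → eval (num (conjugate γ (lift ψ))) x y ≈
      pairing u v (column₂ γ) (column₂ γ) * y + pairing u v (column₁ γ) (column₂ γ) * x
    conjugate-num γ x y = trans (eval-⊖ (m₂₂ · U) (m₁₂ · V) x y) (trans
      (+-cong (trans (eval-· m₂₂ U x y) (*-congˡ (along-columns γ u x y)))
              (-‿cong (trans (eval-· m₁₂ V x y) (*-congˡ (along-columns γ v x y)))))
      (solve 8 (λ q n a b a′ b′ x y → q :* (a :* y :+ b :* x) :- n :* (a′ :* y :+ b′ :* x) := (a :* q :- a′ :* n) :* y :+ (b :* q :- b′ :* n) :* x)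
        refl m₂₂ m₁₂ _ _ _ _ x y))
      where
      open GL₂ γ
      U = substitute u (möbius γ)
      V = substitute v (möbius γ)

    conjugate-den : ∀ γ x y → eval (den (conjugate γ (lift ψ))) x y ≈
      - (pairing u v (column₂ γ) (column₁ γ) * y + pairing u v (column₁ γ) (column₁ γ) * x)
    conjugate-den γ x y = trans (eval-⊖ (m₁₁ · V) (m₂₁ · U) x y) (trans
      (+-cong (trans (eval-· m₁₁ V x y) (*-congˡ (along-columns γ v x y)))
              (-‿cong (trans (eval-· m₂₁ U x y) (*-congˡ (along-columns γ u x y)))))
      (solve 8 (λ m p a b a′ b′ x y → m :* (a′ :* y :+ b′ :* x) :- p :* (a :* y :+ b :* x) := :- ((a :* p :- a′ :* m) :* y :+ (b :* p :- b′ :* m) :* x))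
        refl m₁₁ m₂₁ _ _ _ _ x y))
      where
      open GL₂ γ
      U = substitute u (möbius γ)
      V = substitute v (möbius γ)

    -- ψ ∘ γ = γ ∘ χ, written out in the coordinates given by the columns of γ.
    IsConjugate : GL₂ → Lift 1 → Set (c ⊔ ℓ)
    IsConjugate γ χ = ∀ x y →
      (pairing u v (column₂ γ) (column₂ γ) * y + pairing u v (column₁ γ) (column₂ γ) * x) * eval (den χ) x y ≈
      eval (num χ) x y * - (pairing u v (column₂ γ) (column₁ γ) * y + pairing u v (column₁ γ) (column₁ γ) * x)

    isConjugate⇒≃ : ∀ γ (χ : Lift 1) → IsConjugate γ χ → conjugate γ (lift ψ) ≃ χ
    isConjugate⇒≃ γ χ h = quadratic-ext λ x y → trans (eval-⊛ (num (conjugate γ (lift ψ))) (den χ) x y)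
      (trans (*-congʳ (conjugate-num γ x y)) (trans (h x y)
        (trans (*-congˡ (sym (conjugate-den γ x y))) (sym (eval-⊛ (num χ) (den (conjugate γ (lift ψ))) x y)))))

    ≃⇒isConjugate : ∀ γ (χ : Lift 1) → conjugate γ (lift ψ) ≃ χ → IsConjugate γ χ
    ≃⇒isConjugate γ χ h x y = trans (*-congʳ (sym (conjugate-num γ x y)))
      (trans (sym (eval-⊛ (num (conjugate γ (lift ψ))) (den χ) x y)) (trans (eval-≋ h x y)
        (trans (eval-⊛ (num χ) (den (conjugate γ (lift ψ))) x y) (*-congˡ (conjugate-den γ x y)))))

    private
      γ-independent : ∀ γ → cross (column₁ γ) (column₂ γ) ≉ 0#
      γ-independent γ e = det≉0 (trans (solve 4 (λ m n p q → m :* q :- n :* p := q :* m :- n :* p) refl m₁₁ m₁₂ m₂₁ m₂₂) e)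
        where open GL₂ γ

      column₁-nonzero : ∀ γ → Nonzero (column₁ γ)
      column₁-nonzero γ with em {P = GL₂.m₁₁ γ ≈ 0#}
      ... | no x≉0  = inj₁ x≉0
      ... | yes x≈0 = inj₂ λ y≈0 → γ-independent γ
        (trans (+-cong (trans (*-congˡ x≈0) (zeroʳ _)) (-‿cong (trans (*-congˡ y≈0) (zeroʳ _)))) (trans (+-congˡ -0#≈0#) (+-identityʳ 0#)))

      pairing-expand : ∀ p a b → (cross a b * cross a b) * pairing u v p p ≈
        (cross p b * cross p b) * pairing u v a a - (cross p b * cross p a) * (pairing u v a b + pairing u v b a)
          + (cross p a * cross p a) * pairing u v b b
      pairing-expand p@(x , y) a@(x₁ , y₁) b@(x₂ , y₂) = trans
        (*-congˡ (pair p p)) (trans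
        (solve 10 (λ u₀ u₁ v₀ v₁ x y x₁ y₁ x₂ y₂ →
          let B = λ x y x′ y′ → (u₀ :* y :+ u₁ :* x) :* y′ :- (v₀ :* y :+ v₁ :* x) :* x′
              D = λ x y x′ y′ → y′ :* x :- x′ :* y
              ab = D x₁ y₁ x₂ y₂ ; pb = D x y x₂ y₂ ; pa = D x y x₁ y₁
          in (ab :* ab) :* B x y x y := (pb :* pb) :* B x₁ y₁ x₁ y₁ :- (pb :* pa) :* (B x₁ y₁ x₂ y₂ :+ B x₂ y₂ x₁ y₁) :+ (pa :* pa) :* B x₂ y₂ x₂ y₂)
          refl (head u) (head (tail u)) (head v) (head (tail v)) x y x₁ y₁ x₂ y₂)
        (sym (+-cong (+-cong (*-congˡ (pair a a)) (-‿cong (*-congˡ (+-cong (pair a b) (pair b a))))) (*-congˡ (pair b b)))))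
        where
        pair : ∀ p q → pairing u v p q ≈ (head u * proj₂ p + head (tail u) * proj₁ p) * proj₂ q - (head v * proj₂ p + head (tail v) * proj₁ p) * proj₁ q
        pair p q = +-cong (*-congʳ (evalAt-linear u p)) (-‿cong (*-congʳ (evalAt-linear v p)))

      square≈0 : ∀ {x} → x * x ≈ 0# → x ≈ 0#
      square≈0 e = [ id , id ]′ (zero-product e)

    -- The equation IsConjugate at (1 , 0), (0 , 1) and (1 , 1).
    parabolic-columns : ∀ γ b → IsConjugate γ [ X ⊕ b · Y , Y ] →
      pairing u v (column₁ γ) (column₁ γ) ≈ 0# ×
      pairing u v (column₁ γ) (column₂ γ) + pairing u v (column₂ γ) (column₁ γ) ≈ 0# ×
      pairing u v (column₂ γ) (column₂ γ) ≈ - (b * pairing u v (column₂ γ) (column₁ γ))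
    parabolic-columns γ b h = w₁≈0 , sum≈0 , w₂≈
      where
      w₁ = pairing u v (column₁ γ) (column₁ γ)
      w₂ = pairing u v (column₂ γ) (column₂ γ)
      B₁₂ = pairing u v (column₁ γ) (column₂ γ)
      B₂₁ = pairing u v (column₂ γ) (column₁ γ)
      equation : ∀ x y → (w₂ * y + B₁₂ * x) * y ≈ (x + b * y) * - (B₂₁ * y + w₁ * x)
      equation x y = trans (*-congˡ (solve 2 (λ x y → y := con (+ 1) :* (y :* con (+ 1)) :+ x :* con (+ 0)) refl x y))
        (trans (h x y) (*-congʳ (solve 3 (λ b x y → let I = con (+ 1) ; O = con (+ 0) in
          (O :+ b :* I) :* (y :* I) :+ x :* (I :+ b :* O) := x :+ b :* y) refl b x y)))
      w₁≈0 : w₁ ≈ 0#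
      w₁≈0 = trans (solve 4 (λ w₁ w₂ B₁₂ B₂₁ → let I = con (+ 1) ; O = con (+ 0) in
          w₁ := (w₂ :* O :+ B₁₂ :* I) :* O :- I :* (:- (B₂₁ :* O :+ w₁ :* I))) refl w₁ w₂ B₁₂ B₂₁)
        (x≈y⇒x-y≈0 (trans (equation 1# 0#) (*-congʳ (solve 1 (λ b → con (+ 1) :+ b :* con (+ 0) := con (+ 1)) refl b))))
      w₂≈ : w₂ ≈ - (b * B₂₁)
      w₂≈ = trans (solve 2 (λ w₂ B₁₂ → let I = con (+ 1) ; O = con (+ 0) in w₂ := (w₂ :* I :+ B₁₂ :* O) :* I) refl w₂ B₁₂)
        (trans (equation 0# 1#) (solve 3 (λ b w₁ B₂₁ → let I = con (+ 1) ; O = con (+ 0) in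
          (O :+ b :* I) :* (:- (B₂₁ :* I :+ w₁ :* O)) := :- (b :* B₂₁)) refl b w₁ B₂₁))
      sum≈0 : B₁₂ + B₂₁ ≈ 0#
      sum≈0 = trans (solve 5 (λ w₁ w₂ B₁₂ B₂₁ b → let I = con (+ 1) in
          B₁₂ :+ B₂₁ := ((w₂ :* I :+ B₁₂ :* I) :* I :- (I :+ b :* I) :* (:- (B₂₁ :* I :+ w₁ :* I))) :- (w₂ :- (:- (b :* B₂₁))) :- (I :+ b) :* w₁)
          refl w₁ w₂ B₁₂ B₂₁ b)
        (trans (+-cong (+-cong (x≈y⇒x-y≈0 (equation 1# 1#)) (-‿cong (x≈y⇒x-y≈0 w₂≈))) (-‿cong (trans (*-congˡ w₁≈0) (zeroʳ _))))
          (solve 0 (con (+ 0) :- con (+ 0) :- con (+ 0) := con (+ 0)) refl))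

    parabolic-moves : ∀ b → b ≉ 0# → ψ conjugateTo [ X ⊕ b · Y , Y ] → ∀ p q → cross p q ≉ 0# →
      pairing u v p p ≉ 0# ⊎ pairing u v q q ≉ 0#
    parabolic-moves b b≉0 (γ , conj) p q pq≉0 with em {P = pairing u v p p ≈ 0#} | em {P = pairing u v q q ≈ 0#}
    ... | no w≉0 | _      = inj₁ w≉0
    ... | _      | no w≉0 = inj₂ w≉0
    ... | yes wp | yes wq = contradiction (cross-trans p a q (column₁-nonzero γ) (on-axis p wp) (on-axis q wq)) pq≉0
      where
      a = column₁ γ
      columns≈ = parabolic-columns γ b (≃⇒isConjugate γ [ X ⊕ b · Y , Y ] conj)
      w₂≉0 : pairing u v (column₂ γ) (column₂ γ) ≉ 0#
      w₂≉0 e = pairing-nondegenerate a a (column₂ γ) (column₁-nonzero γ) (γ-independent γ) (proj₁ columns≈) B₁₂≈0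
        where
        B₂₁≈0 : pairing u v (column₂ γ) a ≈ 0#
        B₂₁≈0 = x*y≈0⇒y≈0 b≉0 (trans (solve 1 (λ x → x := :- (:- x)) refl _)
          (trans (-‿cong (trans (sym (proj₂ (proj₂ columns≈))) e)) -0#≈0#))
        B₁₂≈0 : pairing u v a (column₂ γ) ≈ 0#
        B₁₂≈0 = trans (solve 2 (λ x y → x := (x :+ y) :- y) refl _ _)
          (trans (+-cong (proj₁ (proj₂ columns≈)) (-‿cong B₂₁≈0)) (trans (+-congˡ -0#≈0#) (+-identityʳ 0#)))
      on-axis : ∀ p → pairing u v p p ≈ 0# → cross p a ≈ 0#
      on-axis p wp = square≈0 (x*y≈0⇒y≈0 w₂≉0 (trans (*-comm _ _) (trans
        (solve 5 (λ t s a b d → t := (s :* a :- b :* d :+ t) :- s :* a :+ b :* d) refl _ (cross p (column₂ γ) * cross p (column₂ γ)) (pairing u v a a) (cross p (column₂ γ) * cross p a) (pairing u v a (column₂ γ) + pairing u v (column₂ γ) a))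
        (trans (+-cong (+-cong (trans (sym (pairing-expand p a (column₂ γ))) (trans (*-congˡ wp) (zeroʳ _)))
                               (-‿cong (trans (*-congˡ (proj₁ columns≈)) (zeroʳ _))))
                       (trans (*-congˡ (proj₁ (proj₂ columns≈))) (zeroʳ _)))
          (solve 0 (con (+ 0) :- con (+ 0) :+ con (+ 0) := con (+ 0)) refl)))))

    parabolic-double : ∀ b → ψ conjugateTo [ X ⊕ b · Y , Y ] → ∀ {h A p₁ p₂ p₃} → Nonzero p₁ → Nonzero p₂ →
      A ≉ 0# → Special h u v A p₁ p₂ p₃ → cross p₁ p₂ ≈ 0#
    parabolic-double b (γ , conj) {h} {A} {p₁} {p₂} {p₃} nz₁ nz₂ A≉0 S =
      [ (λ e → cross-trans p₁ a p₂ (column₁-nonzero γ) (cross-flip≈0 a p₁ e) (cross-flip≈0 a p₂ (other e)))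
      , (λ e → cross-trans p₁ a p₂ (column₁-nonzero γ) (cross-flip≈0 a p₁ (other′ e)) (cross-flip≈0 a p₂ e)) ]′
        (zero-product (x*y≈0⇒y≈0 A≉0 (trans (sym (diagonal a)) (trans (*-congˡ (proj₁ columns≈)) (zeroʳ s)))))
      where
      open Special S
      a = column₁ γ
      d = column₂ γ
      columns≈ = parabolic-columns γ b (≃⇒isConjugate γ [ X ⊕ b · Y , Y ] conj)
      sum≈0 : cross a p₁ * cross d p₂ + cross d p₁ * cross a p₂ ≈ 0#
      sum≈0 = x*y≈0⇒y≈0 A≉0 (trans (sym (polar a d)) (trans (*-congˡ (proj₁ (proj₂ columns≈))) (zeroʳ s)))
      independent : ∀ p → Nonzero p → cross a p ≈ 0# → cross d p ≉ 0#
      independent p nz e e′ = γ-independent γ (cross-trans a p d nz e e′)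
      other : cross a p₁ ≈ 0# → cross a p₂ ≈ 0#
      other e = x*y≈0⇒y≈0 (independent p₁ nz₁ e) (trans (sym (trans (+-congʳ (trans (*-congʳ e) (zeroˡ _))) (+-identityˡ _))) sum≈0)
      other′ : cross a p₂ ≈ 0# → cross a p₁ ≈ 0#
      other′ e = x*y≈0⇒y≈0 (independent p₂ nz₂ e) (trans (*-comm _ _) (trans (sym (trans (+-congˡ (trans (*-congˡ e) (zeroʳ _))) (+-identityʳ _))) sum≈0))

    hyperbolic-moves : ∀ b → b ≉ 0# → b ≉ 1# → ψ conjugateTo [ b · X , Y ] → ∀ p₁ p₂ p₃ →
      cross p₁ p₂ ≉ 0# → cross p₁ p₃ ≉ 0# → cross p₂ p₃ ≉ 0# →
      pairing u v p₁ p₁ ≉ 0# ⊎ pairing u v p₂ p₂ ≉ 0# ⊎ pairing u v p₃ p₃ ≉ 0#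
    hyperbolic-moves b b≉0 b≉1 (γ , conj) p₁ p₂ p₃ n₁₂ n₁₃ n₂₃
      with em {P = pairing u v p₁ p₁ ≈ 0#} | em {P = pairing u v p₂ p₂ ≈ 0#} | em {P = pairing u v p₃ p₃ ≈ 0#}
    ... | no w≉0 | _ | _ = inj₁ w≉0
    ... | _ | no w≉0 | _ = inj₂ (inj₁ w≉0)
    ... | _ | _ | no w≉0 = inj₂ (inj₂ w≉0)
    ... | yes e₁ | yes e₂ | yes e₃ = ⊥-elim (pigeonhole (on-axes p₁ e₁) (on-axes p₂ e₂) (on-axes p₃ e₃))
      where
      a = column₁ γ
      d = column₂ γ
      w₁ = pairing u v a a
      w₂ = pairing u v d d
      B₁₂ = pairing u v a d
      B₂₁ = pairing u v d a
      equation : ∀ x y → (w₂ * y + B₁₂ * x) * y ≈ (b * x) * - (B₂₁ * y + w₁ * x)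
      equation x y = trans (*-congˡ (solve 2 (λ x y → y := con (+ 1) :* (y :* con (+ 1)) :+ x :* con (+ 0)) refl x y))
        (trans (≃⇒isConjugate γ [ b · X , Y ] conj x y) (*-congʳ (solve 3 (λ b x y → let I = con (+ 1) ; O = con (+ 0) in
          (b :* O) :* (y :* I) :+ x :* (b :* I) := b :* x) refl b x y)))
      w₁≈0 : w₁ ≈ 0#
      w₁≈0 = x*y≈0⇒y≈0 b≉0 (trans (solve 5 (λ b w₁ w₂ B₁₂ B₂₁ → let I = con (+ 1) ; O = con (+ 0) in
          b :* w₁ := (w₂ :* O :+ B₁₂ :* I) :* O :- (b :* I) :* (:- (B₂₁ :* O :+ w₁ :* I))) refl b w₁ w₂ B₁₂ B₂₁)
        (x≈y⇒x-y≈0 (equation 1# 0#)))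
      w₂≈0 : w₂ ≈ 0#
      w₂≈0 = trans (solve 5 (λ b w₁ w₂ B₁₂ B₂₁ → let I = con (+ 1) ; O = con (+ 0) in
          w₂ := (w₂ :* I :+ B₁₂ :* O) :* I :- (b :* O) :* (:- (B₂₁ :* I :+ w₁ :* O))) refl b w₁ w₂ B₁₂ B₂₁)
        (x≈y⇒x-y≈0 (equation 0# 1#))
      B₁₂≈ : B₁₂ ≈ - (b * B₂₁)
      B₁₂≈ = x-y≈0⇒x≈y (trans (solve 5 (λ w₁ w₂ B₁₂ B₂₁ b → let I = con (+ 1) in
          B₁₂ :- (:- (b :* B₂₁)) := ((w₂ :* I :+ B₁₂ :* I) :* I :- (b :* I) :* (:- (B₂₁ :* I :+ w₁ :* I))) :- w₂ :- b :* w₁)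
          refl w₁ w₂ B₁₂ B₂₁ b)
        (trans (+-cong (+-cong (x≈y⇒x-y≈0 (equation 1# 1#)) (-‿cong w₂≈0)) (-‿cong (trans (*-congˡ w₁≈0) (zeroʳ _))))
          (solve 0 (con (+ 0) :- con (+ 0) :- con (+ 0) := con (+ 0)) refl)))
      B₂₁≉0 : B₂₁ ≉ 0#
      B₂₁≉0 e = pairing-nondegenerate a a d (column₁-nonzero γ) (γ-independent γ) w₁≈0
        (trans B₁₂≈ (trans (-‿cong (trans (*-congˡ e) (zeroʳ b))) -0#≈0#))
      sum≉0 : B₁₂ + B₂₁ ≉ 0#
      sum≉0 e = *≉0 (λ e′ → b≉1 (sym (x-y≈0⇒x≈y e′))) B₂₁≉0
        (trans (solve 2 (λ b B → (con (+ 1) :- b) :* B := (:- (b :* B)) :+ B) refl b B₂₁) (trans (+-congʳ (sym B₁₂≈)) e))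
      on-axes : ∀ p → pairing u v p p ≈ 0# → cross p d ≈ 0# ⊎ cross p a ≈ 0#
      on-axes p wp = zero-product (x*y≈0⇒y≈0 sum≉0 (trans (*-comm _ _) (trans
        (solve 5 (λ t s a b d → t := (s :* a :+ b :* d) :- (s :* a :- t :+ b :* d)) refl _ (cross p d * cross p d) w₁ (cross p a * cross p a) w₂)
        (trans (+-cong (+-cong (trans (*-congˡ w₁≈0) (zeroʳ _)) (trans (*-congˡ w₂≈0) (zeroʳ _)))
                       (-‿cong (trans (sym (pairing-expand p a d)) (trans (*-congˡ wp) (zeroʳ _)))))
          (solve 0 (con (+ 0) :+ con (+ 0) :- con (+ 0) := con (+ 0)) refl)))))
      d-nonzero : Nonzero d
      d-nonzero with em {P = proj₁ d ≈ 0#}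
      ... | no x≉0  = inj₁ x≉0
      ... | yes x≈0 = inj₂ λ y≈0 → γ-independent γ
        (trans (+-cong (trans (*-congʳ y≈0) (zeroˡ _)) (-‿cong (trans (*-congʳ x≈0) (zeroˡ _)))) (trans (+-congˡ -0#≈0#) (+-identityʳ 0#)))
      meet : ∀ {p q r} → Nonzero r → cross p q ≉ 0# → cross p r ≈ 0# → cross q r ≈ 0# → ⊥
      meet {p} {q} {r} nz ne e e′ = ne (cross-trans p r q nz e e′)
      pigeonhole : cross p₁ d ≈ 0# ⊎ cross p₁ a ≈ 0# → cross p₂ d ≈ 0# ⊎ cross p₂ a ≈ 0# → cross p₃ d ≈ 0# ⊎ cross p₃ a ≈ 0# → ⊥
      pigeonhole (inj₁ s) (inj₁ t) _        = meet d-nonzero n₁₂ s t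
      pigeonhole (inj₁ s) (inj₂ _) (inj₁ t) = meet d-nonzero n₁₃ s t
      pigeonhole (inj₁ _) (inj₂ s) (inj₂ t) = meet (column₁-nonzero γ) n₂₃ s t
      pigeonhole (inj₂ _) (inj₁ s) (inj₁ t) = meet d-nonzero n₂₃ s t
      pigeonhole (inj₂ s) (inj₁ _) (inj₂ t) = meet (column₁-nonzero γ) n₁₃ s t
      pigeonhole (inj₂ s) (inj₂ t) _        = meet (column₁-nonzero γ) n₁₂ s t

    module _ {h A p₁ p₂ p₃} (S : Special h u v A p₁ p₂ p₃) (w≉0 : pairing u v p₃ p₃ ≉ 0#) (nz₁ : Nonzero p₁) (nz₂ : Nonzero p₂) where
      open Special S

      private
        fixed₁ : pairing u v p₁ p₁ ≈ 0#
        fixed₁ = x*y≈0⇒y≈0 s≉0 (trans (diagonal p₁) (trans (*-congˡ (trans (*-congʳ (cross-self p₁)) (zeroˡ _))) (zeroʳ A)))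
        fixed₂ : pairing u v p₂ p₂ ≈ 0#
        fixed₂ = x*y≈0⇒y≈0 s≉0 (trans (diagonal p₂) (trans (*-congˡ (trans (*-congˡ (cross-self p₂)) (zeroʳ _))) (zeroʳ A)))
        A≉0 : A ≉ 0#
        A≉0 = special-A S w≉0

      hyperbolic-conjugate : cross p₁ p₂ ≉ 0# → ∃[ b ] (b ≉ 0# × b ≉ 1# × ψ conjugateTo [ b · X , Y ])
      hyperbolic-conjugate ne = b , b≉0 , b≉1 , γ , isConjugate⇒≃ γ [ b · X , Y ] equation
        where
        γ = columns p₁ p₂ ne
        B₁₂ = pairing u v p₁ p₂
        B₂₁ = pairing u v p₂ p₁
        B₂₁≉0 : B₂₁ ≉ 0#
        B₂₁≉0 = pairing-nondegenerate p₂ p₂ p₁ nz₂ (cross-flip≉0 p₁ p₂ ne) fixed₂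
        B₁₂≉0 : B₁₂ ≉ 0#
        B₁₂≉0 = pairing-nondegenerate p₁ p₁ p₂ nz₁ ne fixed₁
        b = B₂₁≉0 ⁻¹ * - B₁₂
        B₂₁b : B₂₁ * b ≈ - B₁₂
        B₂₁b = divide B₂₁≉0 (- B₁₂)
        b≉0 : b ≉ 0#
        b≉0 = *≉0 (x⁻¹≉0 B₂₁≉0) (-‿≉0 B₁₂≉0)
        b≉1 : b ≉ 1#
        b≉1 b≈1 = *≉0 A≉0 (*≉0 (cross-flip≉0 p₁ p₂ ne) ne)
          (trans (trans (solve 3 (λ A s t → A :* (s :* t) := A :* (con (+ 0) :* con (+ 0) :+ s :* t)) refl A (cross p₂ p₁) (cross p₁ p₂))
            (*-congˡ (+-congʳ (sym (*-cong (cross-self p₁) (cross-self p₂))))))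
          (trans (sym (polar p₁ p₂)) (trans (*-congˡ (trans (+-congˡ (trans (sym (*-identityʳ B₂₁)) (trans (*-congˡ (sym b≈1)) B₂₁b))) (-‿inverseʳ B₁₂))) (zeroʳ s))))
        equation : IsConjugate γ [ b · X , Y ]
        equation x y = trans (*-congʳ (+-congʳ (trans (*-congʳ fixed₂) (zeroˡ y))))
          (trans (trans (solve 3 (λ B x y → let I = con (+ 1) ; O = con (+ 0) in (O :+ B :* x) :* (I :* (y :* I) :+ x :* O) := (x :* y) :* (:- (:- B))) refl B₁₂ x y)
            (*-congˡ (-‿cong (sym B₂₁b))))
          (trans (solve 4 (λ b B x y → let I = con (+ 1) ; O = con (+ 0) in (x :* y) :* (:- (B :* b)) := ((b :* O) :* (y :* I) :+ x :* (b :* I)) :* (:- (B :* y :+ O))) refl b B₂₁ x y)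
            (*-congˡ (-‿cong (+-congˡ (sym (trans (*-congʳ fixed₁) (zeroˡ x))))))))

      parabolic-conjugate : cross p₁ p₂ ≈ 0# → ∃[ b ] (b ≉ 0# × ψ conjugateTo [ X ⊕ b · Y , Y ])
      parabolic-conjugate p₁≈p₂ = b , b≉0 , γ , isConjugate⇒≃ γ [ X ⊕ b · Y , Y ] equation
        where
        ne = special-distinct₁ S w≉0
        γ = columns p₁ p₃ ne
        B₁₃ = pairing u v p₁ p₃
        B₃₁ = pairing u v p₃ p₁
        w₃ = pairing u v p₃ p₃
        B₁₃≉0 : B₁₃ ≉ 0#
        B₁₃≉0 = pairing-nondegenerate p₁ p₁ p₃ nz₁ ne fixed₁
        sum≈0 : B₁₃ + B₃₁ ≈ 0#
        sum≈0 = x*y≈0⇒y≈0 s≉0 (trans (polar p₁ p₃) (trans (*-congˡ (trans (+-cong (trans (*-congʳ (cross-self p₁)) (zeroˡ _))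
          (trans (*-congˡ p₁≈p₂) (zeroʳ _))) (+-identityˡ 0#))) (zeroʳ A)))
        B₃₁≈ : B₃₁ ≈ - B₁₃
        B₃₁≈ = trans (solve 2 (λ s t → t := (s :+ t) :- s) refl B₁₃ B₃₁) (trans (+-congʳ sum≈0) (+-identityˡ _))
        b = B₁₃≉0 ⁻¹ * w₃
        b≉0 : b ≉ 0#
        b≉0 = *≉0 (x⁻¹≉0 B₁₃≉0) w≉0
        equation : IsConjugate γ [ X ⊕ b · Y , Y ]
        equation x y = trans (*-congʳ (+-congʳ (*-congʳ (sym (divide B₁₃≉0 w₃)))))
          (trans (solve 4 (λ b B x y → let I = con (+ 1) ; O = con (+ 0) in
              ((B :* b) :* y :+ B :* x) :* (I :* (y :* I) :+ x :* O) := ((O :+ b :* I) :* (y :* I) :+ x :* (I :+ b :* O)) :* (:- ((:- B) :* y :+ O))) refl b B₁₃ x y)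
            (*-congˡ (-‿cong (+-cong (*-congʳ (sym B₃₁≈)) (sym (trans (*-congʳ fixed₁) (zeroˡ x)))))))

  point : ℙ 1 → Point
  point α = xᶜ α , yᶜ α

  point-nonzero : ∀ α → Nonzero (point α)
  point-nonzero α = go (coords α) (ℙ.nonzero α)
    where
    go : ∀ (v : Vec Carrier 2) → Any (_≉ 0#) v → Nonzero (head v , head (tail v))
    go (x ∷ y ∷ []) (here x≉0)         = inj₁ x≉0
    go (x ∷ y ∷ []) (there (here y≉0)) = inj₂ y≉0

  proportional : ∀ p q → Nonzero p → Nonzero q → cross p q ≈ 0# →
    ∃[ s ] (s ≉ 0# × proj₁ q ≈ s * proj₁ p × proj₂ q ≈ s * proj₂ p)
  proportional (x , y) q@(x′ , y′) (inj₁ x≉0) nz e = s , s≉0 , x′≈ , y′≈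
    where
    s = x≉0 ⁻¹ * x′
    x′≈ : x′ ≈ s * x
    x′≈ = trans (sym (divide x≉0 x′)) (*-comm _ _)
    y′≈ : y′ ≈ s * y
    y′≈ = *-cancelˡ x≉0 (trans (*-comm x y′) (trans (x-y≈0⇒x≈y e)
      (trans (*-congʳ x′≈) (solve 3 (λ s x y → (s :* x) :* y := x :* (s :* y)) refl s x y))))
    s≉0 : s ≉ 0#
    s≉0 s≈0 = [ (λ ne → ne (trans x′≈ (trans (*-congʳ s≈0) (zeroˡ x)))) , (λ ne → ne (trans y′≈ (trans (*-congʳ s≈0) (zeroˡ y)))) ]′ nz
  proportional (x , y) q@(x′ , y′) (inj₂ y≉0) nz e = s , s≉0 , x′≈ , y′≈
    where
    s = y≉0 ⁻¹ * y′
    y′≈ : y′ ≈ s * y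
    y′≈ = trans (sym (divide y≉0 y′)) (*-comm _ _)
    x′≈ : x′ ≈ s * x
    x′≈ = *-cancelˡ y≉0 (trans (*-comm y x′) (trans (sym (x-y≈0⇒x≈y e))
      (trans (*-congʳ y′≈) (solve 3 (λ s x y → (s :* y) :* x := y :* (s :* x)) refl s x y))))
    s≉0 : s ≉ 0#
    s≉0 s≈0 = [ (λ ne → ne (trans x′≈ (trans (*-congʳ s≈0) (zeroˡ x)))) , (λ ne → ne (trans y′≈ (trans (*-congʳ s≈0) (zeroˡ y)))) ]′ nz

  respect₃ : ∀ (f g : Form 2) {A} p₁ p₂ x y {x′ y′} → x ≈ x′ → y ≈ y′ →
    HasFixedForm f g A p₁ p₂ (x , y) → HasFixedForm f g A p₁ p₂ (x′ , y′)
  respect₃ f g {A} p₁ p₂ x y {x′} {y′} ex ey h = rescale f g p₁ p₂ 1# x′ y′ (*-identityʳ A) (go f g h)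
    where
    go : ∀ (f g : Form 2) → HasFixedForm f g A p₁ p₂ (x , y) → HasFixedForm f g A p₁ p₂ (1# * x′ , 1# * y′)
    go (_ ∷ _ ∷ _ ∷ []) (_ ∷ _ ∷ _ ∷ []) (e₀ , e₁ , e₂ , e₃) =
        trans e₀ (-‿cong (*-congˡ (*-congˡ (*-congˡ ex′))))
      , trans e₁ (*-congˡ (+-cong (+-cong (*-congˡ (*-congˡ ey′)) (*-congˡ (*-congˡ ex′))) (*-congˡ (*-congˡ ex′))))
      , trans e₂ (-‿cong (*-congˡ (+-cong (+-cong (*-congˡ (*-congˡ ey′)) (*-congˡ (*-congˡ ey′))) (*-congˡ (*-congˡ ex′)))))
      , trans e₃ (-‿cong (*-congˡ (*-congˡ (*-congˡ ey′))))
      where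
      ex′ = trans ex (sym (*-identityˡ x′))
      ey′ = trans ey (sym (*-identityˡ y′))

  module _ (φ : RationalMap 2) where
    private
      f = num (lift φ)
      g = den (lift φ)

    multiplier-formula : ∀ {a} α₁ α₂ α₃ → HasFixedForm f g a (point α₁) (point α₂) (point α₃) → ∀ {λ′} →
      IsMultiplier φ α₁ λ′ → scaling g a (point α₁) (point α₂) (point α₃) * (λ′ - 1#) ≈
                             a * (cross (point α₁) (point α₂) * cross (point α₁) (point α₃))
    multiplier-formula α₁ α₂ α₃ h {l} (finite fixes y≉0 z zy≈x der) =
      finite-multiplier f g (point α₁) (point α₂) (point α₃) h z l zy≈x y≉0 gz≉0 der
      where
      at-z : ∀ {d} (h : Form d) → eval h (xᶜ α₁) (yᶜ α₁) ≈ yᶜ α₁ ^ d * eval h z 1#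
      at-z h = trans (eval-arg h (trans (sym zy≈x) (*-comm _ _)) (sym (*-identityʳ _))) (eval-homogeneous h (yᶜ α₁) z 1#)
      gz≉0 : eval g z 1# ≉ 0#
      gz≉0 e = nonvanishing φ (xᶜ α₁) (yᶜ α₁) (point-nonzero α₁)
        ( x*y≈0⇒y≈0 y≉0 (trans (*-comm _ _) (trans fixes (trans (*-congʳ g≈0) (zeroˡ _))))
        , g≈0 )
        where
        g≈0 : eval g (xᶜ α₁) (yᶜ α₁) ≈ 0#
        g≈0 = trans (at-z g) (trans (*-congˡ e) (zeroʳ _))
    multiplier-formula α₁ α₂ α₃ h {l} (infinite fixes y≈0 der) =
      infinite-multiplier f g (point α₁) (point α₂) (point α₃) h l y≈0 f1≉0 der
      where
      x≉0 : xᶜ α₁ ≉ 0#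
      x≉0 = [ id , contradiction y≈0 ]′ (point-nonzero α₁)
      at-1 : ∀ {d} (h : Form d) → eval h (xᶜ α₁) (yᶜ α₁) ≈ xᶜ α₁ ^ d * eval h 1# 0#
      at-1 h = trans (eval-arg h (sym (*-identityʳ _)) (trans y≈0 (sym (zeroʳ _)))) (eval-homogeneous h (xᶜ α₁) 1# 0#)
      f1≉0 : eval f 1# 0# ≉ 0#
      f1≉0 e = nonvanishing φ (xᶜ α₁) (yᶜ α₁) (point-nonzero α₁)
        ( trans (at-1 f) (trans (*-congˡ e) (zeroʳ _))
        , x*y≈0⇒y≈0 x≉0 (trans (*-comm _ _) (trans (sym fixes) (trans (*-congˡ y≈0) (zeroʳ _)))) )

    fixes : ∀ {α λ′} → IsMultiplier φ α λ′ → Fixes φ α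
    fixes (finite h _ _ _ _) = h
    fixes (infinite h _ _)   = h

    multiplier-transport : ∀ α β {λ′} → Fixes φ β → cross (point α) (point β) ≈ 0# → IsMultiplier φ α λ′ → IsMultiplier φ β λ′
    multiplier-transport α β fix e m with proportional (point α) (point β) (point-nonzero α) (point-nonzero β) e
    multiplier-transport α β fix e (finite _ y≉0 z zy≈x der) | s , s≉0 , x≈ , y≈ =
      finite fix (λ y′≈0 → *≉0 s≉0 y≉0 (trans (sym y≈) y′≈0)) z
        (trans (*-congˡ y≈) (trans (solve 3 (λ z s y → z :* (s :* y) := s :* (z :* y)) refl z s (yᶜ α)) (trans (*-congˡ zy≈x) (sym x≈)))) der
    multiplier-transport α β fix e (infinite _ y≈0 der) | s , s≉0 , x≈ , y≈ =
      infinite fix (trans y≈ (trans (*-congˡ y≈0) (zeroʳ s))) der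

    record Marked (λ₁ λ₂ λ₃ : Carrier) : Set (c ⊔ ℓ) where
      field
        α₁ α₂ α₃ : ℙ 1
        a        : Carrier
        a≉0      : a ≉ 0#
        form     : HasFixedForm f g a (point α₁) (point α₂) (point α₃)
        mult₁    : IsMultiplier φ α₁ λ₁
        mult₂    : IsMultiplier φ α₂ λ₂
        mult₃    : IsMultiplier φ α₃ λ₃

    module _ {λ₁ λ₂ λ₃} (M : Marked λ₁ λ₂ λ₃) where
      open Marked M

      transpose₁₂ : Marked λ₂ λ₁ λ₃
      transpose₁₂ = record { α₁ = α₂ ; α₂ = α₁ ; α₃ = α₃ ; a = a ; a≉0 = a≉0
        ; form = swap₁₂ f g (point α₁) (point α₂) (point α₃) form ; mult₁ = mult₂ ; mult₂ = mult₁ ; mult₃ = mult₃ }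

      transpose₂₃ : Marked λ₁ λ₃ λ₂
      transpose₂₃ = record { α₁ = α₁ ; α₂ = α₃ ; α₃ = α₂ ; a = a ; a≉0 = a≉0
        ; form = swap₂₃ f g (point α₁) (point α₂) (point α₃) form ; mult₁ = mult₁ ; mult₂ = mult₃ ; mult₃ = mult₂ }

      fixed-is-marked : ∀ α → Fixes φ α →
        cross (point α) (point α₁) ≈ 0# ⊎ cross (point α) (point α₂) ≈ 0# ⊎ cross (point α) (point α₃) ≈ 0#
      fixed-is-marked α fix = [ inj₁ , inj₂ ∘ zero-product ]′ (zero-product (x*y≈0⇒y≈0 a≉0
        (trans (sym (fixed-equation f g (point α₁) (point α₂) (point α₃) form (point α))) (x≈y⇒x-y≈0 fix))))

      replace₃ : ∀ β {λ′} → IsMultiplier φ β λ′ → cross (point β) (point α₃) ≈ 0# → Marked λ₁ λ₂ λ′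
      replace₃ β m e with proportional (point β) (point α₃) (point-nonzero β) (point-nonzero α₃) e
      ... | s , s≉0 , x≈ , y≈ = record
        { α₁ = α₁ ; α₂ = α₂ ; α₃ = β ; a = a * s ; a≉0 = *≉0 a≉0 s≉0
        ; form = rescale f g (point α₁) (point α₂) s (xᶜ β) (yᶜ β) refl (respect₃ f g (point α₁) (point α₂) _ _ x≈ y≈ form)
        ; mult₁ = mult₁ ; mult₂ = mult₂ ; mult₃ = m }

    -- A property of the multipliers that does not depend on their order may be proved
    -- after moving given fixed points to chosen places.
    module Symmetric {p} (P : Carrier → Carrier → Carrier → Set p)
                     (sym₁₂ : ∀ {λ₁ λ₂ λ₃} → P λ₂ λ₁ λ₃ → P λ₁ λ₂ λ₃)
                     (sym₂₃ : ∀ {λ₁ λ₂ λ₃} → P λ₁ λ₃ λ₂ → P λ₁ λ₂ λ₃) where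

      with-third : ∀ β → Fixes φ β →
        (∀ {λ₁ λ₂ λ₃} (M : Marked λ₁ λ₂ λ₃) → Marked.α₃ M ≡.≡ β → P λ₁ λ₂ λ₃) →
        ∀ {λ₁ λ₂ λ₃} → Marked λ₁ λ₂ λ₃ → P λ₁ λ₂ λ₃
      with-third β fix k {λ₁} {λ₂} {λ₃} M = [ sym₁₂ ∘ sym₂₃ ∘ place (transpose₂₃ (transpose₁₂ M)) ,
          [ sym₂₃ ∘ place (transpose₂₃ M) , place M ]′ ]′ (fixed-is-marked M β fix)
        where
        place : ∀ {λ₁ λ₂ λ₃} (M : Marked λ₁ λ₂ λ₃) → cross (point β) (point (Marked.α₃ M)) ≈ 0# → P λ₁ λ₂ λ₃
        place M e = k (replace₃ M β (multiplier-transport (Marked.α₃ M) β fix (cross-flip≈0 (point β) _ e) (Marked.mult₃ M)) e) ≡.refl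

      with-pair : ∀ β γ → Fixes φ β → Fixes φ γ → cross (point β) (point γ) ≉ 0# →
        (∀ {λ₁ λ₂ λ₃} (M : Marked λ₁ λ₂ λ₃) → Marked.α₂ M ≡.≡ γ → Marked.α₃ M ≡.≡ β → P λ₁ λ₂ λ₃) →
        ∀ {λ₁ λ₂ λ₃} → Marked λ₁ λ₂ λ₃ → P λ₁ λ₂ λ₃
      with-pair β γ fixβ fixγ ne k = with-third β fixβ λ { M ≡.refl →
          [ sym₁₂ ∘ second (transpose₁₂ M) ≡.refl , [ second M ≡.refl , (λ e → contradiction (cross-flip≈0 (point γ) (point β) e) ne) ]′ ]′
            (fixed-is-marked M γ fixγ) }
        where
        second : ∀ {λ₁ λ₂ λ₃} (M : Marked λ₁ λ₂ λ₃) → Marked.α₃ M ≡.≡ β → cross (point γ) (point (Marked.α₂ M)) ≈ 0# → P λ₁ λ₂ λ₃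
        second M eq e = k (transpose₂₃ (replace₃ (transpose₂₃ M) γ
          (multiplier-transport (Marked.α₂ M) γ fixγ (cross-flip≈0 (point γ) _ e) (Marked.mult₂ M)) e)) ≡.refl eq

      with-triple : ∀ β γ δ → Fixes φ β → Fixes φ γ → Fixes φ δ →
        cross (point β) (point γ) ≉ 0# → cross (point β) (point δ) ≉ 0# → cross (point γ) (point δ) ≉ 0# →
        (∀ {λ₁ λ₂ λ₃} (M : Marked λ₁ λ₂ λ₃) → Marked.α₁ M ≡.≡ δ → Marked.α₂ M ≡.≡ γ → Marked.α₃ M ≡.≡ β → P λ₁ λ₂ λ₃) →
        ∀ {λ₁ λ₂ λ₃} → Marked λ₁ λ₂ λ₃ → P λ₁ λ₂ λ₃
      with-triple β γ δ fixβ fixγ fixδ ne₁ ne₂ ne₃ k = with-pair β γ fixβ fixγ ne₁ λ { M ≡.refl ≡.refl →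
          [ first M ≡.refl ≡.refl
          , [ (λ e → contradiction (cross-flip≈0 (point δ) (point γ) e) ne₃) , (λ e → contradiction (cross-flip≈0 (point δ) (point β) e) ne₂) ]′ ]′
            (fixed-is-marked M δ fixδ) }
        where
        first : ∀ {λ₁ λ₂ λ₃} (M : Marked λ₁ λ₂ λ₃) → Marked.α₂ M ≡.≡ γ → Marked.α₃ M ≡.≡ β → cross (point δ) (point (Marked.α₁ M)) ≈ 0# → P λ₁ λ₂ λ₃
        first M eq₂ eq₃ e = k (transpose₁₂ (transpose₂₃ (replace₃ (transpose₂₃ (transpose₁₂ M)) δ
          (multiplier-transport (Marked.α₁ M) δ fixδ (cross-flip≈0 (point δ) _ e) (Marked.mult₁ M)) e))) ≡.refl eq₂ eq₃

  transfer-proportion : ∀ c₁ c₂ t y y′ w w′ (c₁≉0 : c₁ ≉ 0#) → t * y ≈ y′ → c₁ * y ≈ w → c₂ * y′ ≈ w′ →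
    ((c₂ * t) * c₁≉0 ⁻¹) * w ≈ w′
  transfer-proportion c₁ c₂ t y y′ w w′ c₁≉0 e p p′ = trans (*-congˡ (sym p)) (trans
    (solve 5 (λ c t i d y → ((c :* t) :* i) :* (d :* y) := d :* (i :* (c :* (t :* y)))) refl c₂ t (c₁≉0 ⁻¹) c₁ y)
    (trans (divide c₁≉0 _) (trans (*-congˡ e) p′)))

  pairing-scale : ∀ (u v : Form 1) s p x y → x ≈ s * proj₁ p → y ≈ s * proj₂ p → pairing u v p p ≈ 0# →
    eval u x y * y ≈ eval v x y * x
  pairing-scale u v s p x y ex ey e = x-y≈0⇒x≈y (trans
    (+-cong (*-cong (at-scaled u) ey) (-‿cong (*-cong (at-scaled v) ex)))
    (trans (solve 5 (λ s a b x y → (s :* a) :* (s :* y) :- (s :* b) :* (s :* x) := (s :* s) :* (a :* y :- b :* x)) refl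
        s (evalAt u p) (evalAt v p) (proj₁ p) (proj₂ p))
      (trans (*-congˡ e) (zeroʳ _))))
    where
    at-scaled : ∀ l → eval l x y ≈ s * evalAt l p
    at-scaled l = trans (eval-arg l ex ey) (trans (eval-homogeneous l s _ _) (*-congʳ (*-identityʳ s)))

  off-axis : ∀ p c {m a b} → a ≈ m * proj₁ p → b ≈ m * proj₂ p → proj₂ c * a ≈ proj₁ c * b → cross p c ≉ 0# → m ≈ 0#
  off-axis p c {m} ef eg dep ne = x*y≈0⇒y≈0 ne (trans
    (solve 5 (λ m x y a b → (b :* x :- a :* y) :* m := b :* (m :* x) :- a :* (m :* y)) refl m (proj₁ p) (proj₂ p) (proj₁ c) (proj₂ c))
    (x≈y⇒x-y≈0 (trans (*-congˡ (sym ef)) (trans dep (*-congˡ eg)))))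

  double-root : ∀ a b → a + b ≈ 1# + 1# → a * b ≈ 1# → a - 1# ≈ 0#
  double-root a b s p = [ id , id ]′ (zero-product (trans
    (solve 2 (λ a b → (a :- con (+ 1)) :* (a :- con (+ 1)) :=
       a :* ((a :+ b) :- (con (+ 1) :+ con (+ 1))) :- (a :* b :- con (+ 1))) refl a b)
    (trans (+-cong (trans (*-congˡ (x≈y⇒x-y≈0 s)) (zeroʳ a)) (-‿cong (x≈y⇒x-y≈0 p))) (-‿inverseʳ 0#))))

  scalings-reciprocal : ∀ (g : Form 2) A p₁ p₂ p₃ l₁ l₂ →
    scaling g A p₁ p₂ p₃ ≉ 0# → scaling g A p₂ p₁ p₃ ≉ 0# → scaling g A p₃ p₁ p₂ ≈ 0# →
    cross p₁ p₃ ≉ 0# → cross p₂ p₃ ≉ 0# →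
    scaling g A p₁ p₂ p₃ * (l₁ - 1#) ≈ A * (cross p₁ p₂ * cross p₁ p₃) →
    scaling g A p₂ p₁ p₃ * (l₂ - 1#) ≈ A * (cross p₂ p₁ * cross p₂ p₃) → l₁ * l₂ ≈ 1#
  scalings-reciprocal g A p₁ p₂ p₃ l₁ l₂ M₁≉0 M₂≉0 M₃≈0 c₁₃≉0 c₂₃≉0 M₁l₁ M₂l₂ =
    *-cancelˡ (*≉0 (*≉0 M₁≉0 c₂₃≉0) (*≉0 M₂≉0 c₁₃≉0)) (trans
      (solve 6 (λ m n x y a b → ((m :* x) :* (n :* y)) :* (a :* b) := ((m :* a) :* x) :* ((n :* b) :* y)) refl M₁ M₂ c₂₃ c₁₃ l₁ l₂)
      (trans (*-cong first second) (trans (*-comm _ _) (sym (*-identityʳ _)))))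
    where
    M₁ M₂ M₃ c₁₂ c₁₃ c₂₃ : Carrier
    M₁ = scaling g A p₁ p₂ p₃
    M₂ = scaling g A p₂ p₁ p₃
    M₃ = scaling g A p₃ p₁ p₂
    c₁₂ = cross p₁ p₂
    c₁₃ = cross p₁ p₃
    c₂₃ = cross p₂ p₃
    difference : M₁ * c₂₃ + A * (c₁₂ * (c₁₃ * c₂₃)) ≈ M₂ * c₁₃
    difference = x-y≈0⇒x≈y (trans (solve 4 (λ a b m t → (a :+ t) :- b := ((a :- b :+ m) :- (:- t)) :- m) refl
        (M₁ * c₂₃) (M₂ * c₁₃) (M₃ * c₁₂) (A * (c₁₂ * (c₁₃ * c₂₃))))
      (trans (+-cong (x≈y⇒x-y≈0 (scaling-relation g A p₁ p₂ p₃)) (-‿cong (trans (*-congʳ M₃≈0) (zeroˡ c₁₂)))) (-‿inverseʳ 0#)))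
    split-off : ∀ m l c → (m * l) * c ≈ m * c + (m * (l - 1#)) * c
    split-off = solve 3 (λ m l c → (m :* l) :* c := m :* c :+ (m :* (l :- con (+ 1))) :* c) refl
    first : (M₁ * l₁) * c₂₃ ≈ M₂ * c₁₃
    first = trans (split-off M₁ l₁ c₂₃) (trans (+-congˡ (*-congʳ M₁l₁)) (trans
      (+-congˡ (solve 4 (λ a x y z → (a :* (x :* y)) :* z := a :* (x :* (y :* z))) refl A c₁₂ c₁₃ c₂₃)) difference))
    second : (M₂ * l₂) * c₁₃ ≈ M₁ * c₂₃
    second = trans (split-off M₂ l₂ c₁₃)
      (trans (+-cong (sym difference) (*-congʳ (trans M₂l₂ (*-congˡ (*-congʳ (cross-flip p₁ p₂))))))
        (solve 5 (λ m a x y z → (m :* z :+ a :* (x :* (y :* z))) :+ (a :* ((:- x) :* z)) :* y := m :* z) refl M₁ A c₁₂ c₁₃ c₂₃))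

  module _ (f g : Form 2) {A : Carrier} (p₁ p₂ p₃ : Point) (ff : HasFixedForm f g A p₁ p₂ p₃) where
    private
      ff₂ = swap₁₂ f g p₁ p₂ p₃ ff
      ff₃ = swap₁₂ f g p₁ p₃ p₂ (swap₂₃ f g p₁ p₂ p₃ ff)

      multiple≉0 : ∀ {p m} → evalAt f p ≈ m * proj₁ p → evalAt g p ≈ m * proj₂ p → ¬ (evalAt f p ≈ 0# × evalAt g p ≈ 0#) → m ≉ 0#
      multiple≉0 ef eg ne m≈0 = ne (trans ef (trans (*-congʳ m≈0) (zeroˡ _)) , trans eg (trans (*-congʳ m≈0) (zeroˡ _)))

    scaling₁≉0 : ¬ (evalAt f p₁ ≈ 0# × evalAt g p₁ ≈ 0#) → scaling g A p₁ p₂ p₃ ≉ 0#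
    scaling₁≉0 = multiple≉0 (num-scaling f g p₁ p₂ p₃ ff) (den-scaling f g p₁ p₂ p₃ ff)

    scaling₂≉0 : ¬ (evalAt f p₂ ≈ 0# × evalAt g p₂ ≈ 0#) → scaling g A p₂ p₁ p₃ ≉ 0#
    scaling₂≉0 = multiple≉0 (num-scaling f g p₂ p₁ p₃ ff₂) (den-scaling f g p₂ p₁ p₃ ff₂)

    scaling₃≉0 : ¬ (evalAt f p₃ ≈ 0# × evalAt g p₃ ≈ 0#) → scaling g A p₃ p₁ p₂ ≉ 0#
    scaling₃≉0 = multiple≉0 (num-scaling f g p₃ p₁ p₂ ff₃) (den-scaling f g p₃ p₁ p₂ ff₃)

    module _ (c : Point) (dep : ∀ x y → proj₂ c * eval f x y ≈ proj₁ c * eval g x y) where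

      constant-scaling₁ : cross p₁ c ≉ 0# → scaling g A p₁ p₂ p₃ ≈ 0#
      constant-scaling₁ = off-axis p₁ c (num-scaling f g p₁ p₂ p₃ ff) (den-scaling f g p₁ p₂ p₃ ff) (dep (proj₁ p₁) (proj₂ p₁))

      constant-scaling₂ : cross p₂ c ≉ 0# → scaling g A p₂ p₁ p₃ ≈ 0#
      constant-scaling₂ = off-axis p₂ c (num-scaling f g p₂ p₁ p₃ ff₂) (den-scaling f g p₂ p₁ p₃ ff₂) (dep (proj₁ p₂) (proj₂ p₂))

    module _ (c₁₂≉0 : cross p₁ p₂ ≉ 0#) (c₁₃≉0 : cross p₁ p₃ ≉ 0#) (c₂₃≉0 : cross p₂ p₃ ≉ 0#)
             (M₁≈0 : scaling g A p₁ p₂ p₃ ≈ 0#) (M₂≈0 : scaling g A p₂ p₁ p₃ ≈ 0#)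
             (nonzero : Any (_≉ 0#) f ⊎ Any (_≉ 0#) g) where
      private
        M₃ : Carrier
        M₃ = scaling g A p₃ p₁ p₂

        product : M₃ * cross p₁ p₂ ≈ - (A * (cross p₁ p₂ * (cross p₁ p₃ * cross p₂ p₃)))
        product = trans (sym (trans (+-congʳ (trans (+-cong (trans (*-congʳ M₁≈0) (zeroˡ _))
          (-‿cong (trans (*-congʳ M₂≈0) (zeroˡ _)))) (-‿inverseʳ 0#))) (+-identityˡ _))) (scaling-relation g A p₁ p₂ p₃)

        all-zero : ∀ (f g : Form 2) → HasFixedForm f g A p₁ p₂ p₃ → scaling g A p₁ p₂ p₃ ≈ 0# → scaling g A p₂ p₁ p₃ ≈ 0# →
          A ≈ 0# → ¬ (Any (_≉ 0#) f ⊎ Any (_≉ 0#) g)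
        all-zero (f₀ ∷ f₁ ∷ f₂ ∷ []) (g₀ ∷ g₁ ∷ g₂ ∷ []) (e₀ , e₁ , e₂ , e₃) s₁ s₂ A≈0 = λ where
            (inj₁ (here ne))                 → ne f₀≈0
            (inj₁ (there (here ne)))         → ne (trans (equal e₁ (kill _)) g₀≈0)
            (inj₁ (there (there (here ne)))) → ne (trans (equal e₂ (trans (-‿cong (kill _)) -0#≈0#)) g₁≈0)
            (inj₂ (here ne))                 → ne g₀≈0
            (inj₂ (there (here ne)))         → ne g₁≈0
            (inj₂ (there (there (here ne)))) → ne (trans e₃ (trans (-‿cong (kill _)) -0#≈0#))
          where
          kill : ∀ t → A * t ≈ 0#
          kill t = trans (*-congʳ A≈0) (zeroˡ t)
          equal : ∀ {s t w} → s - t ≈ w → w ≈ 0# → s ≈ t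
          equal e z = x-y≈0⇒x≈y (trans e z)
          f₀≈0 : f₀ ≈ 0#
          f₀≈0 = trans e₀ (trans (-‿cong (kill _)) -0#≈0#)
          linear : ∀ x y {t} → g₁ * x + g₀ * y - A * t ≈ 0# → g₁ * x + g₀ * y ≈ 0#
          linear x y e = trans (x-y≈0⇒x≈y e) (kill _)
          vanishes : ∀ {a b s t} → s ≈ 0# → t ≈ 0# → a * s - b * t ≈ 0#
          vanishes s≈0 t≈0 = trans (+-cong (trans (*-congˡ s≈0) (zeroʳ _)) (-‿cong (trans (*-congˡ t≈0) (zeroʳ _)))) (-‿inverseʳ 0#)
          g₁≈0 : g₁ ≈ 0#
          g₁≈0 = x*y≈0⇒y≈0 c₁₂≉0 (trans
            (solve 6 (λ g₁ g₀ x y x′ y′ → (y′ :* x :- x′ :* y) :* g₁ := y′ :* (g₁ :* x :+ g₀ :* y) :- y :* (g₁ :* x′ :+ g₀ :* y′))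
              refl g₁ g₀ (proj₁ p₁) (proj₂ p₁) (proj₁ p₂) (proj₂ p₂))
            (vanishes (linear _ _ s₁) (linear _ _ s₂)))
          g₀≈0 : g₀ ≈ 0#
          g₀≈0 = x*y≈0⇒y≈0 c₁₂≉0 (trans
            (solve 6 (λ g₁ g₀ x y x′ y′ → (y′ :* x :- x′ :* y) :* g₀ := x :* (g₁ :* x′ :+ g₀ :* y′) :- x′ :* (g₁ :* x :+ g₀ :* y))
              refl g₁ g₀ (proj₁ p₁) (proj₂ p₁) (proj₁ p₂) (proj₂ p₂))
            (vanishes (linear _ _ s₂) (linear _ _ s₁)))

      vertex-scaling₃≉0 : scaling g A p₃ p₁ p₂ ≉ 0#
      vertex-scaling₃≉0 M₃≈0 = all-zero f g ff M₁≈0 M₂≈0 A≈0 nonzero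
        where
        A≈0 : A ≈ 0#
        A≈0 = x*y≈0⇒y≈0 (*≉0 c₁₂≉0 (*≉0 c₁₃≉0 c₂₃≉0)) (trans (*-comm _ A)
          (trans (solve 1 (λ x → x := :- (:- x)) refl _) (trans (-‿cong (trans (sym product) (trans (*-congʳ M₃≈0) (zeroˡ _)))) -0#≈0#)))

      vertex-A≉0 : A ≉ 0#
      vertex-A≉0 A≈0 = *≉0 vertex-scaling₃≉0 c₁₂≉0 (trans product (trans (-‿cong (trans (*-congʳ A≈0) (zeroˡ _))) -0#≈0#))

  common-factor≉0 : ∀ {f g : Form 2} {h u v : Form 1} → Any (_≉ 0#) f ⊎ Any (_≉ 0#) g → f ≋ h ⊛ u → g ≋ h ⊛ v → ¬ (h ≋ 0# ∷ 0# ∷ [])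
  common-factor≉0 nonzero num-factor den-factor e = [ lift-zero e num-factor , lift-zero e den-factor ]′ nonzero
    where
    lift-zero : ∀ {f : Form 2} {h u : Form 1} → h ≋ 0# ∷ 0# ∷ [] → f ≋ h ⊛ u → ¬ Any (_≉ 0#) f
    lift-zero {f₀ ∷ f₁ ∷ f₂ ∷ []} {h₀ ∷ h₁ ∷ []} {u₀ ∷ u₁ ∷ []} (z₀ ∷ z₁ ∷ []) (e₀ ∷ e₁ ∷ e₂ ∷ []) = λ where
        (here ne)                 → ne (trans e₀ (trans (+-identityʳ _) (kill z₀ u₀)))
        (there (here ne))         → ne (trans e₁ (trans (+-cong (kill z₀ u₁) (kill z₁ u₀)) (+-identityˡ 0#)))
        (there (there (here ne))) → ne (trans e₂ (trans (+-identityˡ _) (kill z₁ u₁)))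
      where
      kill : ∀ {h} → h ≈ 0# → ∀ u → h * u ≈ 0#
      kill z u = trans (*-congʳ z) (zeroˡ u)

  module _ (ψ : RationalMap 1) (f g : Form 2) (h : Form 1) {A : Carrier} (p₁ p₂ p₃ : Point)
           (nz₁ : Nonzero p₁) (nz₂ : Nonzero p₂) (nz₃ : Nonzero p₃) (ff : HasFixedForm f g A p₁ p₂ p₃)
           (num-factor : f ≋ h ⊛ num (lift ψ)) (den-factor : g ≋ h ⊛ den (lift ψ))
           (S : Special h (num (lift ψ)) (den (lift ψ)) A p₁ p₂ p₃)
           (moved : pairing (num (lift ψ)) (den (lift ψ)) p₃ p₃ ≉ 0#) where
    private
      u = num (lift ψ)
      v = den (lift ψ)
      open Special S

      factor-eval : ∀ p → evalAt f p ≈ evalAt h p * evalAt u p × evalAt g p ≈ evalAt h p * evalAt v p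
      factor-eval (x , y) = trans (eval-≋ num-factor x y) (eval-⊛ h u x y) , trans (eval-≋ den-factor x y) (eval-⊛ h v x y)

      regular : ∀ p → Nonzero p → cross p p₃ ≉ 0# → ¬ (evalAt f p ≈ 0# × evalAt g p ≈ 0#)
      regular p nz ne (ef , eg) = nonvanishing ψ (proj₁ p) (proj₂ p) nz
          ( x*y≈0⇒y≈0 h≉0 (trans (sym (proj₁ (factor-eval p))) ef)
          , x*y≈0⇒y≈0 h≉0 (trans (sym (proj₂ (factor-eval p))) eg) )
        where
        h≉0 : evalAt h p ≉ 0#
        h≉0 e = *≉0 s≉0 ne (trans (sym (common p)) e)

    special-scaling₁≉0 : scaling g A p₁ p₂ p₃ ≉ 0#
    special-scaling₁≉0 = scaling₁≉0 f g p₁ p₂ p₃ ff (regular p₁ nz₁ (special-distinct₁ S moved))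

    special-scaling₂≉0 : scaling g A p₂ p₁ p₃ ≉ 0#
    special-scaling₂≉0 = scaling₂≉0 f g p₁ p₂ p₃ ff (regular p₂ nz₂ (special-distinct₂ S moved))

    special-scaling₃≈0 : scaling g A p₃ p₁ p₂ ≈ 0#
    special-scaling₃≈0 = scalar≈0 p₃ nz₃ (num-scaling f g p₃ p₁ p₂ ff₃) (den-scaling f g p₃ p₁ p₂ ff₃)
        (trans (proj₁ (factor-eval p₃)) (kill (evalAt u p₃))) (trans (proj₂ (factor-eval p₃)) (kill (evalAt v p₃)))
      where
      ff₃ = swap₁₂ f g p₁ p₃ p₂ (swap₂₃ f g p₁ p₂ p₃ ff)
      kill : ∀ w → evalAt h p₃ * w ≈ 0#
      kill w = trans (*-congʳ (trans (common p₃) (trans (*-congˡ (cross-self p₃)) (zeroʳ s)))) (zeroˡ w)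

  module _ (m A x y l l′ : Carrier) (m≉0 : m ≉ 0#) (A≉0 : A ≉ 0#) (y≉0 : y ≉ 0#) (ll′≈1 : l * l′ ≈ 1#)
           (ml : m * (l - 1#) ≈ A * (x * y)) where

    distinct⇒sum≉2 : x ≉ 0# → l + l′ ≉ 1# + 1#
    distinct⇒sum≉2 x≉0 e = *≉0 A≉0 (*≉0 x≉0 y≉0) (trans (sym ml) (trans (*-congˡ (double-root l l′ e ll′≈1)) (zeroʳ m)))

    double⇒sum≈2 : x ≈ 0# → l + l′ ≈ 1# + 1#
    double⇒sum≈2 x≈0 = +-cong l≈1 (trans (trans (sym (*-identityˡ l′)) (*-congʳ (sym l≈1))) ll′≈1)
      where
      l≈1 : l ≈ 1#
      l≈1 = x-y≈0⇒x≈y (x*y≈0⇒y≈0 m≉0 (trans ml (trans (*-congˡ (trans (*-congʳ x≈0) (zeroˡ y))) (zeroʳ A))))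

-- One parameter instead of eight: the elaborated terms, abstracted over their context, stay smaller.
record Setting : Setω where
  field
    em         : ∀ {a} → ExcludedMiddle a
    {r ℓ₁ ℓ₂}  : Level
    ℝ′         : RealField r ℓ₁ ℓ₂
    {c ℓ}      : Level
    K          : NonArchimedeanField ℝ′ c ℓ

module Classification (S : Setting) where
  open Setting S
  open Berkovich ℝ′ K hiding (zero)
  open Valuation em ℝ′ K
  open ℝ using (_≤_; _<_; ≤-trans; ≤-refl; ≤-reflexive; antisym; total; ≤-respˡ-≈; ≤-respʳ-≈; module ≤-Reasoning)
  open Residue ℝ′ K using (∣∣≉0; ∣1∣; ∣-∣; product≤; ≈⇒≡ₘ; Integral)
  open FormProperties baseField
  open FieldProperties em baseField
  open IntegerSolver commutativeRing
  open QuadraticMaps em baseField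

  module _ (ξ : ℙ¹ᴮᵉʳᵏ) where
    open ℙ¹ᴮᵉʳᵏ ξ

    ∥·∥ : ∀ a {d} (f : Form d) → ∥ a · f ∥ ℝ.≈ ∣ a ∣ ℝ.* ∥ f ∥
    ∥·∥ a f = ℝ.trans (∥∥-* (a ∷ []) f) (ℝ.*-congʳ (∥∥-extends a))

    ∥⊕∥≤ : ∀ {d} (f g : Form d) {s} → ∥ f ∥ ≤ s → ∥ g ∥ ≤ s → ∥ f ⊕ g ∥ ≤ s
    ∥⊕∥≤ f g p q = ≤-trans (∥∥-ultra f g) (ℝ.⊔-lub p q)

    linear-≋ : ∀ v u → v ∷ u ∷ [] ≋ u · X ⊕ v · Y
    linear-≋ v u = solve 2 (λ v u → v := u :* con (+ 0) :+ v :* con (+ 1)) refl v u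
                 ∷ solve 2 (λ v u → u := u :* con (+ 1) :+ v :* con (+ 0)) refl v u ∷ []

    ∥X∥-pos : ∥ Y ∥ ℝ.≈ ℝ.0# → ℝ.0# < ∥ X ∥
    ∥X∥-pos e = ℝ.nonneg⇒pos (∥∥-nonneg X) (λ e′ → nonzero (e′ , e))

    Y-dichotomy : ∥ Y ∥ ℝ.≈ ℝ.0# ⊎ ℝ.0# < ∥ Y ∥
    Y-dichotomy with em {P = ∥ Y ∥ ℝ.≈ ℝ.0#}
    ... | yes e = inj₁ e
    ... | no ne = inj₂ (ℝ.nonneg⇒pos (∥∥-nonneg Y) ne)

    at-∞ : ∥ Y ∥ ℝ.≈ ℝ.0# → ∀ v u → ∥ v ∷ u ∷ [] ∥ ℝ.≈ ∣ u ∣ ℝ.* ∥ X ∥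
    at-∞ e v u = antisym
      (≤-respˡ-≈ (ℝ.sym (∥∥-cong (linear-≋ v u)))
        (∥⊕∥≤ (u · X) (v · Y) (≤-reflexive (∥·∥ u X)) (≤-trans (≤-reflexive (vY≈0 v)) (ℝ.*-nonneg (∣∣-nonneg u) (∥∥-nonneg X)))))
      (≤-trans (≤-reflexive (ℝ.trans (ℝ.sym (∥·∥ u X)) (∥∥-cong uX≋)))
        (∥⊕∥≤ (v ∷ u ∷ []) ((- v) · Y) ≤-refl (≤-trans (≤-reflexive (vY≈0 (- v))) (∥∥-nonneg (v ∷ u ∷ [])))))
      where
      vY≈0 : ∀ v → ∥ v · Y ∥ ℝ.≈ ℝ.0#
      vY≈0 v = ℝ.trans (∥·∥ v Y) (ℝ.trans (ℝ.*-congˡ e) (ℝ.zeroʳ _))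
      uX≋ : u · X ≋ (v ∷ u ∷ []) ⊕ (- v) · Y
      uX≋ = solve 2 (λ v u → u :* con (+ 0) := v :+ (:- v) :* con (+ 1)) refl v u
          ∷ solve 2 (λ v u → u :* con (+ 1) := u :+ (:- v) :* con (+ 0)) refl v u ∷ []

  ≼-linear : ∀ {ξ η} → (∀ (l : Form 1) → norm ξ l ℝ.* norm η Y ≤ norm η l ℝ.* norm ξ Y) → ξ ≼ η
  ≼-linear {ξ} {η} h = form-induction algClosed
    (λ {d} f → norm ξ f ℝ.* (norm η Y ℝ.^ d) ≤ norm η f ℝ.* (norm ξ Y ℝ.^ d)) resp const mult lin
    where
    module ξ = ℙ¹ᴮᵉʳᵏ ξ
    module η = ℙ¹ᴮᵉʳᵏ η
    resp : ∀ {d} {f g : Form d} → f ≋ g → norm ξ f ℝ.* (norm η Y ℝ.^ d) ≤ norm η f ℝ.* (norm ξ Y ℝ.^ d) →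
           norm ξ g ℝ.* (norm η Y ℝ.^ d) ≤ norm η g ℝ.* (norm ξ Y ℝ.^ d)
    resp e p = ≤-respˡ-≈ (ℝ.*-congʳ (ξ.∥∥-cong e)) (≤-respʳ-≈ (ℝ.*-congʳ (η.∥∥-cong e)) p)
    const : ∀ a → norm ξ (a ∷ []) ℝ.* ℝ.1# ≤ norm η (a ∷ []) ℝ.* ℝ.1#
    const a = ≤-reflexive (ℝ.*-congʳ (ℝ.trans (ξ.∥∥-extends a) (ℝ.sym (η.∥∥-extends a))))
    mult : ∀ {d} (l : Form 1) (g : Form d) →
      norm ξ l ℝ.* (norm η Y ℝ.^ 1) ≤ norm η l ℝ.* (norm ξ Y ℝ.^ 1) →
      norm ξ g ℝ.* (norm η Y ℝ.^ d) ≤ norm η g ℝ.* (norm ξ Y ℝ.^ d) →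
      norm ξ (l ⊛ g) ℝ.* (norm η Y ℝ.^ suc d) ≤ norm η (l ⊛ g) ℝ.* (norm ξ Y ℝ.^ suc d)
    mult {d} l g p q = ≤-respˡ-≈ (rearrange ξ.∥∥-* (norm η Y)) (≤-respʳ-≈ (rearrange η.∥∥-* (norm ξ Y))
      (ℝ.*-mono-≤ (ℝ.*-nonneg (η.∥∥-nonneg l) (ℝ.^-nonneg 1 (ξ.∥∥-nonneg Y)))
        (ℝ.*-nonneg (ξ.∥∥-nonneg g) (ℝ.^-nonneg d (η.∥∥-nonneg Y))) p q))
      where
      rearrange : ∀ {N : ∀ {d} → Form d → ℝ.Carrier} → (∀ {m n} (f : Form m) (g : Form n) → N (f ⊛ g) ℝ.≈ N f ℝ.* N g) →
        ∀ y → (N l ℝ.* y ℝ.^ 1) ℝ.* (N g ℝ.* y ℝ.^ d) ℝ.≈ N (l ⊛ g) ℝ.* y ℝ.^ suc d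
      rearrange {N} hom y = ℝ.trans
        (ℝ.solve 4 (λ a b y z → (a ℝ.:* (y ℝ.:* ℝ.con (+ 1))) ℝ.:* (b ℝ.:* z) ℝ.:= (a ℝ.:* b) ℝ.:* (y ℝ.:* z))
          ℝ.refl (N l) (N g) y (y ℝ.^ d))
        (ℝ.*-congʳ (ℝ.sym (hom l g)))
    lin : ∀ (l : Form 1) → norm ξ l ℝ.* (norm η Y ℝ.^ 1) ≤ norm η l ℝ.* (norm ξ Y ℝ.^ 1)
    lin l = ≤-respˡ-≈ (ℝ.*-congˡ (ℝ.sym (ℝ.*-identityʳ _))) (≤-respʳ-≈ (ℝ.*-congˡ (ℝ.sym (ℝ.*-identityʳ _))) (h l))

  -- The order of points, tested on linear forms.
  infix 4 _⊑_
  record _⊑_ (ξ η : ℙ¹ᴮᵉʳᵏ) : Set (r ⊔ ℓ₁ ⊔ ℓ₂ ⊔ c ⊔ ℓ) where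
    constructor onLines
    field
      lines : ∀ (l : Form 1) → norm ξ l ℝ.* norm η Y ≤ norm η l ℝ.* norm ξ Y

  open _⊑_ public

  ≼⇒⊑ : ∀ {ξ η} → ξ ≼ η → ξ ⊑ η
  ≼⇒⊑ {ξ} {η} p = onLines λ l → ≤-respˡ-≈ (ℝ.*-congˡ (ℝ.*-identityʳ _)) (≤-respʳ-≈ (ℝ.*-congˡ (ℝ.*-identityʳ _)) (p l))

  ⊑⇒≼ : ∀ {ξ η} → ξ ⊑ η → ξ ≼ η
  ⊑⇒≼ {ξ} {η} (onLines h) = ≼-linear {ξ} {η} h

  ≈ᴮ-linear : ∀ {ξ η} C → ℝ.0# < C → (∀ (l : Form 1) → norm η l ℝ.≈ C ℝ.* norm ξ l) → ξ ≈ᴮ η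
  ≈ᴮ-linear {ξ} {η} C 0<C h = C , 0<C , form-induction algClosed
    (λ {d} f → norm η f ℝ.≈ (C ℝ.^ d) ℝ.* norm ξ f)
    (λ e p → ℝ.trans (η.∥∥-cong (≋-sym e)) (ℝ.trans p (ℝ.*-congˡ (ξ.∥∥-cong e))))
    (λ a → ℝ.trans (η.∥∥-extends a) (ℝ.sym (ℝ.trans (ℝ.*-identityˡ _) (ξ.∥∥-extends a))))
    (λ {d} l g p q → ℝ.trans (η.∥∥-* l g) (ℝ.trans (ℝ.*-cong p q) (ℝ.trans
      (ℝ.solve 4 (λ a b y z → (y ℝ.:* ℝ.con (+ 1)) ℝ.:* a ℝ.:* (z ℝ.:* b) ℝ.:= (y ℝ.:* z) ℝ.:* (a ℝ.:* b))
        ℝ.refl (norm ξ l) (norm ξ g) C (C ℝ.^ d))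
      (ℝ.*-congˡ (ℝ.sym (ξ.∥∥-* l g))))))
    (λ l → ℝ.trans (h l) (ℝ.*-congʳ (ℝ.sym (ℝ.*-identityʳ C))))
    where
    module ξ = ℙ¹ᴮᵉʳᵏ ξ
    module η = ℙ¹ᴮᵉʳᵏ η

  ⊑-refl : ∀ {ξ} → ξ ⊑ ξ
  ⊑-refl = onLines λ l → ≤-refl

  ∞-maximal : ∀ {ξ η} → ξ ⊑ η → norm ξ Y ℝ.≈ ℝ.0# → norm η Y ℝ.≈ ℝ.0#
  ∞-maximal {ξ} {η} p e = antisym
    (ℝ.*-cancelˡ-≤ (∥X∥-pos ξ e) (begin
      norm ξ X ℝ.* norm η Y  ≤⟨ lines p X ⟩
      norm η X ℝ.* norm ξ Y  ≈⟨ ℝ.*-congˡ e ⟩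
      norm η X ℝ.* ℝ.0#      ≈⟨ ℝ.trans (ℝ.zeroʳ _) (ℝ.sym (ℝ.zeroʳ _)) ⟩
      norm ξ X ℝ.* ℝ.0#      ∎))
    (ℙ¹ᴮᵉʳᵏ.∥∥-nonneg η Y)
    where open ≤-Reasoning

  ⊑-∞ : ∀ {ξ η} → norm η Y ℝ.≈ ℝ.0# → ξ ⊑ η
  ⊑-∞ {ξ} {η} e = onLines λ l → ≤-trans (≤-reflexive (ℝ.trans (ℝ.*-congˡ e) (ℝ.zeroʳ _)))
    (ℝ.*-nonneg (ℙ¹ᴮᵉʳᵏ.∥∥-nonneg η l) (ℙ¹ᴮᵉʳᵏ.∥∥-nonneg ξ Y))

  ⊑-trans : ∀ {ξ η ζ} → ξ ⊑ η → η ⊑ ζ → ξ ⊑ ζ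
  ⊑-trans {ξ} {η} {ζ} p q with Y-dichotomy η
  ... | inj₁ e = ⊑-∞ (∞-maximal q e)
  ... | inj₂ 0<ηY = onLines λ l → ℝ.*-cancelˡ-≤ 0<ηY (begin
      norm η Y ℝ.* (norm ξ l ℝ.* norm ζ Y)
        ≈⟨ ℝ.solve 3 (λ a b c → a ℝ.:* (b ℝ.:* c) ℝ.:= c ℝ.:* (b ℝ.:* a)) ℝ.refl _ _ _ ⟩
      norm ζ Y ℝ.* (norm ξ l ℝ.* norm η Y)
        ≤⟨ ℝ.*-monoˡ-≤ (ζ.∥∥-nonneg Y) (lines p l) ⟩
      norm ζ Y ℝ.* (norm η l ℝ.* norm ξ Y)
        ≈⟨ ℝ.solve 3 (λ a b c → a ℝ.:* (b ℝ.:* c) ℝ.:= c ℝ.:* (b ℝ.:* a)) ℝ.refl _ _ _ ⟩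
      norm ξ Y ℝ.* (norm η l ℝ.* norm ζ Y)
        ≤⟨ ℝ.*-monoˡ-≤ (ℙ¹ᴮᵉʳᵏ.∥∥-nonneg ξ Y) (lines q l) ⟩
      norm ξ Y ℝ.* (norm ζ l ℝ.* norm η Y)
        ≈⟨ ℝ.solve 3 (λ a b c → a ℝ.:* (b ℝ.:* c) ℝ.:= c ℝ.:* (b ℝ.:* a)) ℝ.refl _ _ _ ⟩
      norm η Y ℝ.* (norm ζ l ℝ.* norm ξ Y) ∎)
    where
    open ≤-Reasoning
    module ζ = ℙ¹ᴮᵉʳᵏ ζ

  ⊑-antisym : ∀ {ξ η} → ξ ⊑ η → η ⊑ ξ → ξ ≈ᴮ η
  ⊑-antisym {ξ} {η} p q with Y-dichotomy ξ
  ... | inj₁ e = ≈ᴮ-linear {ξ} {η} (norm η X ℝ.* ξX≉0 ℝ.⁻¹)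
          (ℝ.*-pos (∥X∥-pos η e′) (ℝ.⁻¹-pos (∥X∥-pos ξ e)))
          λ { (v ∷ u ∷ []) → ℝ.trans (at-∞ η e′ v u) (ℝ.sym (ℝ.trans (ℝ.*-congˡ (at-∞ ξ e v u))
            (ℝ.trans (ℝ.solve 4 (λ a i u x → (a ℝ.:* i) ℝ.:* (u ℝ.:* x) ℝ.:= x ℝ.:* (i ℝ.:* (u ℝ.:* a))) ℝ.refl _ _ _ _)
              (ℝ.divide ξX≉0 _)))) }
    where
    e′ = ∞-maximal p e
    ξX≉0 = ℝ.<⇒≉0 (∥X∥-pos ξ e)
  ... | inj₂ 0<ξY = ≈ᴮ-linear {ξ} {η} (norm η Y ℝ.* ξY≉0 ℝ.⁻¹)
          (ℝ.*-pos 0<ηY (ℝ.⁻¹-pos 0<ξY))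
          λ l → ℝ.sym (ℝ.trans (ℝ.trans (ℝ.solve 3 (λ a i x → (a ℝ.:* i) ℝ.:* x ℝ.:= i ℝ.:* (x ℝ.:* a)) ℝ.refl _ _ _)
              (ℝ.*-congˡ (ℝ.trans (antisym (lines p l) (lines q l)) (ℝ.*-comm _ _))))
            (ℝ.trans (ℝ.solve 3 (λ i y x → i ℝ.:* (y ℝ.:* x) ℝ.:= y ℝ.:* (i ℝ.:* x)) ℝ.refl _ _ _) (ℝ.divide ξY≉0 _)))
    where
    ξY≉0 = ℝ.<⇒≉0 0<ξY
    0<ηY : ℝ.0# < norm η Y
    0<ηY = [ (λ e → contradiction (∞-maximal q e) ξY≉0) , id ]′ (Y-dichotomy η)

  private
    record NormOnLines (N : Form 1 → ℝ.Carrier) : Set (r ⊔ ℓ₁ ⊔ ℓ₂ ⊔ c ⊔ ℓ) where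
      field
        scale : ∀ a l → N (a · l) ℝ.≈ ∣ a ∣ ℝ.* N l
        ultra : ∀ l a → N (l ⊕ a · Y) ≤ N l ℝ.⊔ᴿ ∣ a ∣
        shift : ∀ l a → ∣ a ∣ ≤ N (l ⊕ a · Y) ℝ.⊔ᴿ N l
        const : ∀ v u → u ≈ 0# → N (v ∷ u ∷ []) ℝ.≈ ∣ v ∣
        cong  : ∀ {f g : Form 1} → f ≋ g → N f ℝ.≈ N g
    open NormOnLines

    -- Above x a norm N is max (x , r), where r is its smallest value on X − aY.
    minimal : ∀ {N x} → NormOnLines N → NormOnLines x → ∀ g a →
      ¬ N (g ⊕ a · Y) ≤ x (g ⊕ a · Y) → x g ≤ N g → N (g ⊕ a · Y) ≤ N g
    minimal {N} {x} nN nx g a Nf≰xf xg≤Ng with ℝ.≤⊔-case (ultra nN g a)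
    ... | inj₁ p = p
    ... | inj₂ p with ℝ.≤⊔-case (shift nx g a)
    ...   | inj₁ q = contradiction (≤-trans p q) Nf≰xf
    ...   | inj₂ q = ≤-trans p (≤-trans q xg≤Ng)

    unscale-≤ : ∀ {N M} → NormOnLines N → NormOnLines M → ∀ {a} l → a ≉ 0# → N (a · l) ≤ M (a · l) → N l ≤ M l
    unscale-≤ nN nM {a} l a≉0 p = ℝ.*-cancelˡ-≤ (∣∣-pos a≉0)
      (≤-respˡ-≈ (scale nN a l) (≤-respʳ-≈ (scale nM a l) p))

    compare-norms : ∀ {x p q} → NormOnLines x → NormOnLines p → NormOnLines q →
      (∀ l → x l ≤ p l) → (∀ l → x l ≤ q l) → ∀ f g → ¬ p f ≤ q f → ¬ q g ≤ p g → ∀ {w} {W : Set w} → W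
    compare-norms {x} {p} {q} nx np nq x≤p x≤q f@(v ∷ u ∷ []) g@(v′ ∷ u′ ∷ []) pf≰qf qg≰pg =
      contradiction (≤-trans pf≤pg (≤-trans (ℝ.≰⇒≥ qg≰pg′) qg≤qf)) pf≰qf′
      where
      nonconstant : ∀ {p q} → NormOnLines p → NormOnLines q → ∀ {v u} → ¬ p (v ∷ u ∷ []) ≤ q (v ∷ u ∷ []) → u ≉ 0#
      nonconstant np nq {v} {u} ne u≈0 = ne (≤-reflexive (ℝ.trans (const np v u u≈0) (ℝ.sym (const nq v u u≈0))))
      u≉0 = nonconstant np nq pf≰qf
      u′≉0 = nonconstant nq np qg≰pg
      f′ g′ : Form 1
      f′ = u′ · f
      g′ = u · g
      a : Carrier
      a = u′ * v - u * v′
      f′≋ : g′ ⊕ a · Y ≋ f′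
      f′≋ = solve 4 (λ u v u′ v′ → u :* v′ :+ (u′ :* v :- u :* v′) :* con (+ 1) := u′ :* v) refl u v u′ v′
          ∷ solve 4 (λ u v u′ v′ → u :* u′ :+ (u′ :* v :- u :* v′) :* con (+ 0) := u′ :* u) refl u v u′ v′ ∷ []
      g′≋ : f′ ⊕ (- a) · Y ≋ g′
      g′≋ = solve 4 (λ u v u′ v′ → u′ :* v :+ (:- (u′ :* v :- u :* v′)) :* con (+ 1) := u :* v′) refl u v u′ v′
          ∷ solve 4 (λ u v u′ v′ → u′ :* u :+ (:- (u′ :* v :- u :* v′)) :* con (+ 0) := u :* u′) refl u v u′ v′ ∷ []
      pf≰qf′ : ¬ p f′ ≤ q f′
      pf≰qf′ = pf≰qf ∘ unscale-≤ np nq f u′≉0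
      qg≰pg′ : ¬ q g′ ≤ p g′
      qg≰pg′ = qg≰pg ∘ unscale-≤ nq np g u≉0
      pf≤pg : p f′ ≤ p g′
      pf≤pg = ≤-respˡ-≈ (cong np f′≋) (minimal np nx g′ a
        (λ le → pf≰qf′ (≤-trans (≤-respˡ-≈ (cong np f′≋) (≤-respʳ-≈ (cong nx f′≋) le)) (x≤q f′))) (x≤p g′))
      qg≤qf : q g′ ≤ q f′
      qg≤qf = ≤-respˡ-≈ (cong nq g′≋) (minimal nq nx f′ (- a)
        (λ le → qg≰pg′ (≤-trans (≤-respˡ-≈ (cong nq g′≋) (≤-respʳ-≈ (cong nx g′≋) le)) (x≤p g′))) (x≤q f′))

    hat : ∀ ξ → ℝ.0# < norm ξ Y → Form 1 → ℝ.Carrier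
    hat ξ pos l = norm ξ l ℝ.* (ℝ.<⇒≉0 pos) ℝ.⁻¹

    module _ ξ (pos : ℝ.0# < norm ξ Y) where
      open ℙ¹ᴮᵉʳᵏ ξ
      i : ℝ.Carrier
      i = (ℝ.<⇒≉0 pos) ℝ.⁻¹
      0≤i : ℝ.0# ≤ i
      0≤i = proj₁ (ℝ.⁻¹-pos pos)
      Y-norm : ∀ a → ∥ a · Y ∥ ℝ.* i ℝ.≈ ∣ a ∣
      Y-norm a = ℝ.trans (ℝ.*-congʳ (∥·∥ ξ a Y)) (ℝ.trans (ℝ.*-assoc _ _ _)
        (ℝ.trans (ℝ.*-congˡ (ℝ.x*x⁻¹ (ℝ.<⇒≉0 pos))) (ℝ.*-identityʳ _)))
      ⊔-distrib : ∀ x y → (x ℝ.⊔ᴿ y) ℝ.* i ℝ.≈ (x ℝ.* i) ℝ.⊔ᴿ (y ℝ.* i)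
      ⊔-distrib x y = ℝ.trans (ℝ.*-comm _ _) (ℝ.trans (ℝ.*-distribˡ-⊔ x y 0≤i) (ℝ.⊔-cong (ℝ.*-comm _ _) (ℝ.*-comm _ _)))
      mono : ∀ {x y z} → x ≤ y ℝ.⊔ᴿ z → x ℝ.* i ≤ (y ℝ.* i) ℝ.⊔ᴿ (z ℝ.* i)
      mono {x} {y} {z} le = ≤-respˡ-≈ (ℝ.*-comm _ _) (≤-trans (ℝ.*-monoˡ-≤ 0≤i le)
        (≤-reflexive (ℝ.trans (ℝ.*-comm _ _) (⊔-distrib y z))))

      hat-norm : NormOnLines (hat ξ pos)
      hat-norm = record
        { scale = λ a l → ℝ.trans (ℝ.*-congʳ (∥·∥ ξ a l)) (ℝ.*-assoc _ _ _)
        ; ultra = λ l a → ≤-trans (mono (∥∥-ultra l (a · Y))) (≤-reflexive (ℝ.⊔-cong ℝ.refl (Y-norm a)))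
        ; shift = λ { l@(v ∷ u ∷ []) a → ≤-trans (≤-reflexive (ℝ.sym (Y-norm a)))
            (mono (≤-trans (≤-reflexive (∥∥-cong (aY≋ v u a))) (≤-trans (∥∥-ultra _ _)
              (≤-reflexive (ℝ.⊔-cong ℝ.refl (ℝ.trans (∥·∥ ξ (- 1#) l)
                (ℝ.trans (ℝ.*-congʳ (ℝ.trans (∣-∣ 1#) ∣1∣)) (ℝ.*-identityˡ _)))))))) }
        ; const = λ v u u≈0 → ℝ.trans (ℝ.*-congʳ (∥∥-cong (solve 1 (λ v → v := v :* con (+ 1)) refl v
              ∷ trans u≈0 (sym (zeroʳ v)) ∷ []))) (Y-norm v)
        ; cong  = λ e → ℝ.*-congʳ (∥∥-cong e) }
        where
        aY≋ : ∀ v u a → a · Y ≋ ((v ∷ u ∷ []) ⊕ a · Y) ⊕ (- 1#) · (v ∷ u ∷ [])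
        aY≋ v u a = solve 2 (λ v a → a :* con (+ 1) := (v :+ a :* con (+ 1)) :+ (:- con (+ 1)) :* v) refl v a
                  ∷ solve 2 (λ u a → a :* con (+ 0) := (u :+ a :* con (+ 0)) :+ (:- con (+ 1)) :* u) refl u a ∷ []

    hat-≤ : ∀ ξ η pξ pη (l : Form 1) → norm ξ l ℝ.* norm η Y ≤ norm η l ℝ.* norm ξ Y → hat ξ pξ l ≤ hat η pη l
    hat-≤ ξ η pξ pη l le = ℝ.*-cancelˡ-≤ pξ (ℝ.*-cancelˡ-≤ pη (begin
      norm η Y ℝ.* (norm ξ Y ℝ.* (norm ξ l ℝ.* i ξ pξ)) ≈⟨ ℝ.*-congˡ (ℝ.trans (ℝ.*-congˡ (ℝ.*-comm _ _)) (ℝ.divide (ℝ.<⇒≉0 pξ) _)) ⟩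
      norm η Y ℝ.* norm ξ l                             ≈⟨ ℝ.*-comm _ _ ⟩
      norm ξ l ℝ.* norm η Y                             ≤⟨ le ⟩
      norm η l ℝ.* norm ξ Y                             ≈⟨ ℝ.*-comm _ _ ⟩
      norm ξ Y ℝ.* norm η l                             ≈⟨ ℝ.*-congˡ (ℝ.trans (ℝ.*-congˡ (ℝ.*-comm _ _)) (ℝ.divide (ℝ.<⇒≉0 pη) _)) ⟨
      norm ξ Y ℝ.* (norm η Y ℝ.* (norm η l ℝ.* i η pη)) ≈⟨ ℝ.solve 3 (λ a b c → a ℝ.:* (b ℝ.:* c) ℝ.:= b ℝ.:* (a ℝ.:* c)) ℝ.refl _ _ _ ⟩
      norm η Y ℝ.* (norm ξ Y ℝ.* (norm η l ℝ.* i η pη)) ∎))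
      where open ≤-Reasoning

    ≤-hat : ∀ ξ η pξ pη (l : Form 1) → hat ξ pξ l ≤ hat η pη l → norm ξ l ℝ.* norm η Y ≤ norm η l ℝ.* norm ξ Y
    ≤-hat ξ η pξ pη l le = begin
      norm ξ l ℝ.* norm η Y                             ≈⟨ ℝ.*-comm _ _ ⟩
      norm η Y ℝ.* norm ξ l                             ≈⟨ ℝ.*-congˡ (ℝ.trans (ℝ.*-congˡ (ℝ.*-comm _ _)) (ℝ.divide (ℝ.<⇒≉0 pξ) _)) ⟨
      norm η Y ℝ.* (norm ξ Y ℝ.* (norm ξ l ℝ.* i ξ pξ)) ≤⟨ ℝ.*-monoˡ-≤ (proj₁ pη) (ℝ.*-monoˡ-≤ (proj₁ pξ) le) ⟩
      norm η Y ℝ.* (norm ξ Y ℝ.* (norm η l ℝ.* i η pη)) ≈⟨ ℝ.solve 3 (λ a b c → b ℝ.:* (a ℝ.:* c) ℝ.:= a ℝ.:* (b ℝ.:* c)) ℝ.refl _ _ _ ⟩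
      norm ξ Y ℝ.* (norm η Y ℝ.* (norm η l ℝ.* i η pη)) ≈⟨ ℝ.*-congˡ (ℝ.trans (ℝ.*-congˡ (ℝ.*-comm _ _)) (ℝ.divide (ℝ.<⇒≉0 pη) _)) ⟩
      norm ξ Y ℝ.* norm η l                             ≈⟨ ℝ.*-comm _ _ ⟩
      norm η l ℝ.* norm ξ Y                             ∎
      where open ≤-Reasoning

  ⊑-comparable : ∀ {ξ η ζ} → ξ ⊑ η → ξ ⊑ ζ → η ⊑ ζ ⊎ ζ ⊑ η
  ⊑-comparable {ξ} {η} {ζ} p q with Y-dichotomy η | Y-dichotomy ζ
  ... | inj₁ e | _      = inj₂ (⊑-∞ e)
  ... | _      | inj₁ e = inj₁ (⊑-∞ e)
  ... | inj₂ pη | inj₂ pζ with em {P = ∀ l → hat η pη l ≤ hat ζ pζ l} | em {P = ∀ l → hat ζ pζ l ≤ hat η pη l}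
  ...   | yes h | _     = inj₁ (onLines λ l → ≤-hat η ζ pη pζ l (h l))
  ...   | no _  | yes h = inj₂ (onLines λ l → ≤-hat ζ η pζ pη l (h l))
  ...   | no ¬h | no ¬h′ = let (f , f≰) = counterexample ¬h ; (g , g≰) = counterexample ¬h′ in
    compare-norms (hat-norm ξ pξ) (hat-norm η pη) (hat-norm ζ pζ)
      (λ l → hat-≤ ξ η pξ pη l (lines p l)) (λ l → hat-≤ ξ ζ pξ pζ l (lines q l)) f g f≰ g≰
    where
    pξ : ℝ.0# < norm ξ Y
    pξ = [ (λ e → contradiction (∞-maximal p e) (ℝ.<⇒≉0 pη)) , id ]′ (Y-dichotomy ξ)
    counterexample : ∀ {M N : Form 1 → ℝ.Carrier} → ¬ (∀ l → M l ≤ N l) → ∃[ l ] ¬ M l ≤ N l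
    counterexample {M} {N} ¬h with em {P = ∃[ l ] ¬ M l ≤ N l}
    ... | yes w = w
    ... | no ¬w = contradiction (λ l → stable l (em {P = M l ≤ N l})) ¬h
      where
      stable : ∀ l → Dec (M l ≤ N l) → M l ≤ N l
      stable l (yes le) = le
      stable l (no nle) = contradiction (l , nle) ¬w

  Between : (ξ η ζ : ℙ¹ᴮᵉʳᵏ) → Set (r ⊔ ℓ₁ ⊔ ℓ₂ ⊔ c ⊔ ℓ)
  Between ξ η ζ = (ξ ⊑ ζ ⊎ η ⊑ ζ) × (∀ ω → ξ ⊑ ω → η ⊑ ω → ζ ⊑ ω)

  OnPath⇒Between : ∀ {ξ η ζ} → OnPath ξ η ζ → Between ξ η ζ
  OnPath⇒Between {ξ} {η} {ζ} (inj₁ p , above) =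
    inj₁ (≼⇒⊑ {ξ} {ζ} p) , λ ω p q → ≼⇒⊑ (above ω (⊑⇒≼ p) (⊑⇒≼ q))
  OnPath⇒Between {ξ} {η} {ζ} (inj₂ p , above) =
    inj₂ (≼⇒⊑ {η} {ζ} p) , λ ω p q → ≼⇒⊑ (above ω (⊑⇒≼ p) (⊑⇒≼ q))

  Between⇒OnPath : ∀ {ξ η ζ} → Between ξ η ζ → OnPath ξ η ζ
  Between⇒OnPath {ξ} {η} (inj₁ p , above) =
    inj₁ (⊑⇒≼ p) , λ ω p q → ⊑⇒≼ (above ω (≼⇒⊑ {ξ} {ω} p) (≼⇒⊑ {η} {ω} q))
  Between⇒OnPath {ξ} {η} (inj₂ p , above) =
    inj₂ (⊑⇒≼ p) , λ ω p q → ⊑⇒≼ (above ω (≼⇒⊑ {ξ} {ω} p) (≼⇒⊑ {η} {ω} q))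

  Between-sym : ∀ {ξ η ζ} → Between ξ η ζ → Between η ξ ζ
  Between-sym (below , above) = [ inj₂ , inj₁ ]′ below , λ ω p q → above ω q p

  Between-split : ∀ {ξ η ζ ω} → Between ξ ζ ω → Between ξ η ω ⊎ Between η ζ ω
  Between-split {ξ} {η} {ζ} {ω} (inj₁ ξ⊑ω , above) = split ξ⊑ω above
    where
    split : ∀ {ξ η ζ} → ξ ⊑ ω → (∀ τ → ξ ⊑ τ → ζ ⊑ τ → ω ⊑ τ) → Between ξ η ω ⊎ Between η ζ ω
    split {ξ} {η} {ζ} ξ⊑ω above with em {P = ∀ τ → ξ ⊑ τ → η ⊑ τ → ω ⊑ τ}
    ... | yes h = inj₁ (inj₁ ξ⊑ω , h)
    ... | no ¬h with em {P = ∃[ τ ] (ξ ⊑ τ × η ⊑ τ × ¬ ω ⊑ τ)}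
    ...   | no ¬w = contradiction (λ τ p q → stable τ p q (em {P = ω ⊑ τ})) ¬h
      where
      stable : ∀ τ → ξ ⊑ τ → η ⊑ τ → Dec (ω ⊑ τ) → ω ⊑ τ
      stable τ p q (yes le) = le
      stable τ p q (no nle) = contradiction (τ , p , q , nle) ¬w
    ...   | yes (τ , ξ⊑τ , η⊑τ , ω⋢τ) = inj₂ (inj₁ (⊑-trans η⊑τ τ⊑ω) , above′)
      where
      τ⊑ω : τ ⊑ ω
      τ⊑ω = [ (λ le → contradiction le ω⋢τ) , id ]′ (⊑-comparable ξ⊑ω ξ⊑τ)
      above′ : ∀ σ → η ⊑ σ → ζ ⊑ σ → ω ⊑ σ
      above′ σ η⊑σ ζ⊑σ with ⊑-comparable η⊑σ η⊑τ
      ... | inj₁ σ⊑τ = contradiction (above τ ξ⊑τ (⊑-trans ζ⊑σ σ⊑τ)) ω⋢τ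
      ... | inj₂ τ⊑σ = above σ (⊑-trans ξ⊑τ τ⊑σ) ζ⊑σ
  Between-split {ξ} {η} {ζ} {ω} (inj₂ ζ⊑ω , above) =
    [ inj₂ ∘ Between-sym , inj₁ ∘ Between-sym ]′
      (Between-split {ζ} {η} {ξ} {ω} (inj₁ ζ⊑ω , λ τ p q → above τ q p))

  stable : ∀ {p} {P : Set p} → ¬ ¬ P → P
  stable {P = P} ¬¬p with em {P = P}
  ... | yes p = p
  ... | no ¬p = contradiction ¬p ¬¬p

  -- Twice the area of the triangle (0 , α , β); its vanishing means α = β in ℙ¹.
  bracket : ℙ 1 → ℙ 1 → Carrier
  bracket α β = yᶜ β * xᶜ α - xᶜ β * yᶜ α

  at : ∀ {d} → ℙ 1 → Form d → Carrier
  at α f = eval f (xᶜ α) (yᶜ α)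

  private
    linear-at : ∀ α v u → at α (v ∷ u ∷ []) ≈ v * yᶜ α + u * xᶜ α
    linear-at α v u = solve 4 (λ v u x y → v :* (y :* con (+ 1)) :+ x :* u := v :* y :+ u :* x) refl v u (xᶜ α) (yᶜ α)

    at-Y : ∀ α → at α Y ≈ yᶜ α
    at-Y α = trans (linear-at α 1# 0#) (solve 2 (λ x y → con (+ 1) :* y :+ con (+ 0) :* x := y) refl (xᶜ α) (yᶜ α))

  at-vanishing : ∀ α β → at α (vanishingAt β) ≈ bracket α β
  at-vanishing α β = solve 4 (λ x y x′ y′ → (:- x′) :* (y :* con (+ 1)) :+ x :* y′ := y′ :* x :- x′ :* y)
    refl (xᶜ α) (yᶜ α) (xᶜ β) (yᶜ β)

  bracket-flip : ∀ α β → ∣ bracket α β ∣ ℝ.≈ ∣ bracket β α ∣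
  bracket-flip α β = ℝ.trans (∣∣-cong (solve 4 (λ x y x′ y′ → y′ :* x :- x′ :* y := :- (y :* x′ :- x :* y′))
    refl (xᶜ α) (yᶜ α) (xᶜ β) (yᶜ β))) (∣-∣ _)

  private
    bracket-expand : ∀ α β v u → bracket α β · (v ∷ u ∷ []) ≋
      at α (v ∷ u ∷ []) · vanishingAt β ⊕ (- at β (v ∷ u ∷ [])) · vanishingAt α
    bracket-expand α β v u =
        solve 6 (λ x y x′ y′ v u → let I = con (+ 1) in (y′ :* x :- x′ :* y) :* v :=
          (v :* (y :* I) :+ x :* u) :* (:- x′) :+ (:- (v :* (y′ :* I) :+ x′ :* u)) :* (:- x)) refl (xᶜ α) (yᶜ α) (xᶜ β) (yᶜ β) v u
      ∷ solve 6 (λ x y x′ y′ v u → let I = con (+ 1) in (y′ :* x :- x′ :* y) :* u :=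
          (v :* (y :* I) :+ x :* u) :* y′ :+ (:- (v :* (y′ :* I) :+ x′ :* u)) :* y) refl (xᶜ α) (yᶜ α) (xᶜ β) (yᶜ β) v u
      ∷ []

    bracket-solve : ∀ α β v u → at α (v ∷ u ∷ []) · vanishingAt β ≋
      bracket α β · (v ∷ u ∷ []) ⊕ at β (v ∷ u ∷ []) · vanishingAt α
    bracket-solve α β v u =
        solve 6 (λ x y x′ y′ v u → let I = con (+ 1) in (v :* (y :* I) :+ x :* u) :* (:- x′) :=
          (y′ :* x :- x′ :* y) :* v :+ (v :* (y′ :* I) :+ x′ :* u) :* (:- x)) refl (xᶜ α) (yᶜ α) (xᶜ β) (yᶜ β) v u
      ∷ solve 6 (λ x y x′ y′ v u → let I = con (+ 1) in (v :* (y :* I) :+ x :* u) :* y′ :=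
          (y′ :* x :- x′ :* y) :* u :+ (v :* (y′ :* I) :+ x′ :* u) :* y) refl (xᶜ α) (yᶜ α) (xᶜ β) (yᶜ β) v u
      ∷ []

  module _ (ξ : ℙ¹ᴮᵉʳᵏ) where
    open ℙ¹ᴮᵉʳᵏ ξ

    bracket-upper : ∀ α β (f : Form 1) {s} → ∣ at α f ∣ ℝ.* ∥ vanishingAt β ∥ ≤ s →
      ∣ at β f ∣ ℝ.* ∥ vanishingAt α ∥ ≤ s → ∣ bracket α β ∣ ℝ.* ∥ f ∥ ≤ s
    bracket-upper α β f@(v ∷ u ∷ []) p q =
      ≤-respˡ-≈ (ℝ.trans (ℝ.sym (∥∥-cong (bracket-expand α β v u))) (∥·∥ ξ (bracket α β) f))
        (∥⊕∥≤ ξ (at α f · vanishingAt β) ((- at β f) · vanishingAt α)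
          (≤-respˡ-≈ (ℝ.sym (∥·∥ ξ (at α f) (vanishingAt β))) p)
          (≤-respˡ-≈ (ℝ.sym (ℝ.trans (∥·∥ ξ (- at β f) (vanishingAt α)) (ℝ.*-congʳ (∣-∣ _)))) q))

    vanishing-upper : ∀ α β (f : Form 1) {s} → ∣ bracket α β ∣ ℝ.* ∥ f ∥ ≤ s →
      ∣ at β f ∣ ℝ.* ∥ vanishingAt α ∥ ≤ s → ∣ at α f ∣ ℝ.* ∥ vanishingAt β ∥ ≤ s
    vanishing-upper α β f@(v ∷ u ∷ []) p q =
      ≤-respˡ-≈ (ℝ.trans (ℝ.sym (∥∥-cong (bracket-solve α β v u))) (∥·∥ ξ (at α f) (vanishingAt β)))
        (∥⊕∥≤ ξ (bracket α β · f) (at β f · vanishingAt α)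
          (≤-respˡ-≈ (ℝ.sym (∥·∥ ξ (bracket α β) f)) p)
          (≤-respˡ-≈ (ℝ.sym (∥·∥ ξ (at β f) (vanishingAt α))) q))

  -- The forms vanishing at α and β are an orthogonal basis for the norm of ξ; for
  -- α ≠ β this means that ξ lies on the path from α to β.
  Orthogonal : ℙ¹ᴮᵉʳᵏ → ℙ 1 → ℙ 1 → Set _
  Orthogonal ξ α β = ∀ (f : Form 1) →
    ∣ at α f ∣ ℝ.* norm ξ (vanishingAt β) ≤ ∣ bracket α β ∣ ℝ.* norm ξ f ×
    ∣ at β f ∣ ℝ.* norm ξ (vanishingAt α) ≤ ∣ bracket α β ∣ ℝ.* norm ξ f

  orthogonal-sym : ∀ {ξ α β} → Orthogonal ξ α β → Orthogonal ξ β α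
  orthogonal-sym {ξ} {α} {β} o f =
    ≤-respʳ-≈ (ℝ.*-congʳ (bracket-flip α β)) (proj₂ (o f)) , ≤-respʳ-≈ (ℝ.*-congʳ (bracket-flip α β)) (proj₁ (o f))

  Below : ℙ 1 → ℙ¹ᴮᵉʳᵏ → Set _
  Below α ξ = ∀ (f : Form 1) → ∣ at α f ∣ ℝ.* norm ξ Y ≤ ∣ yᶜ α ∣ ℝ.* norm ξ f

  below⇒⊑ : ∀ α {η ξ} → IsClassical α η → Below α ξ → η ⊑ ξ
  below⇒⊑ α {η} {ξ} (C , 0<C , h) b = onLines λ l → begin
    norm η l ℝ.* norm ξ Y                        ≈⟨ ℝ.*-congʳ (h l) ⟩
    (C ℝ.^ 1 ℝ.* ∣ at α l ∣) ℝ.* norm ξ Y        ≈⟨ ℝ.*-assoc _ _ _ ⟩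
    C ℝ.^ 1 ℝ.* (∣ at α l ∣ ℝ.* norm ξ Y)        ≤⟨ ℝ.*-monoˡ-≤ (ℝ.^-nonneg 1 (proj₁ 0<C)) (b l) ⟩
    C ℝ.^ 1 ℝ.* (∣ yᶜ α ∣ ℝ.* norm ξ l)          ≈⟨ ℝ.solve 3 (λ x y z → x ℝ.:* (y ℝ.:* z) ℝ.:= z ℝ.:* (x ℝ.:* y)) ℝ.refl _ _ _ ⟩
    norm ξ l ℝ.* (C ℝ.^ 1 ℝ.* ∣ yᶜ α ∣)          ≈⟨ ℝ.*-congˡ (ℝ.*-congˡ (∣∣-cong (at-Y α))) ⟨
    norm ξ l ℝ.* (C ℝ.^ 1 ℝ.* ∣ at α Y ∣)        ≈⟨ ℝ.*-congˡ (h Y) ⟨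
    norm ξ l ℝ.* norm η Y                        ∎
    where open ≤-Reasoning

  ⊑⇒below : ∀ α {η ξ} → IsClassical α η → η ⊑ ξ → Below α ξ
  ⊑⇒below α {η} {ξ} (C , 0<C , h) (onLines p) f = ℝ.*-cancelˡ-≤ (ℝ.^-pos 1 0<C) (begin
    C ℝ.^ 1 ℝ.* (∣ at α f ∣ ℝ.* norm ξ Y)        ≈⟨ ℝ.*-assoc _ _ _ ⟨
    (C ℝ.^ 1 ℝ.* ∣ at α f ∣) ℝ.* norm ξ Y        ≈⟨ ℝ.*-congʳ (h f) ⟨
    norm η f ℝ.* norm ξ Y                        ≤⟨ p f ⟩
    norm ξ f ℝ.* norm η Y                        ≈⟨ ℝ.*-congˡ (h Y) ⟩
    norm ξ f ℝ.* (C ℝ.^ 1 ℝ.* ∣ at α Y ∣)        ≈⟨ ℝ.*-congˡ (ℝ.*-congˡ (∣∣-cong (at-Y α))) ⟩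
    norm ξ f ℝ.* (C ℝ.^ 1 ℝ.* ∣ yᶜ α ∣)          ≈⟨ ℝ.solve 3 (λ x y z → x ℝ.:* (y ℝ.:* z) ℝ.:= z ℝ.:* (x ℝ.:* y)) ℝ.refl _ _ _ ⟨
    C ℝ.^ 1 ℝ.* (∣ yᶜ α ∣ ℝ.* norm ξ f)          ∎)
    where open ≤-Reasoning

  orthogonal⇒between : ∀ α β {η ζ ξ} → IsClassical α η → IsClassical β ζ → bracket α β ≉ 0# →
    Orthogonal ξ α β → Between η ζ ξ
  orthogonal⇒between α β {η} {ζ} {ξ} cα cβ nz o =
    lower (total (∣ at β Y ∣ ℝ.* norm ξ (vanishingAt α)) (∣ at α Y ∣ ℝ.* norm ξ (vanishingAt β))) , upper′
    where
    open ≤-Reasoning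
    module ξ = ℙ¹ᴮᵉʳᵏ ξ
    D = ∣ bracket α β ∣
    0<D : ℝ.0# < D
    0<D = ∣∣-pos nz
    lower-from : ∀ γ δ → D ℝ.* norm ξ Y ≤ ∣ at γ Y ∣ ℝ.* norm ξ (vanishingAt δ) →
      (∀ f → ∣ at γ f ∣ ℝ.* norm ξ (vanishingAt δ) ≤ D ℝ.* norm ξ f) → Below γ ξ
    lower-from γ δ p q f = ℝ.*-cancelˡ-≤ 0<D (begin
      D ℝ.* (∣ at γ f ∣ ℝ.* norm ξ Y)                                    ≈⟨ ℝ.solve 3 (λ x y z → x ℝ.:* (y ℝ.:* z) ℝ.:= y ℝ.:* (x ℝ.:* z)) ℝ.refl _ _ _ ⟩
      ∣ at γ f ∣ ℝ.* (D ℝ.* norm ξ Y)                                    ≤⟨ ℝ.*-monoˡ-≤ (∣∣-nonneg _) p ⟩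
      ∣ at γ f ∣ ℝ.* (∣ at γ Y ∣ ℝ.* norm ξ (vanishingAt δ))             ≈⟨ ℝ.solve 3 (λ x y z → x ℝ.:* (y ℝ.:* z) ℝ.:= y ℝ.:* (x ℝ.:* z)) ℝ.refl _ _ _ ⟩
      ∣ at γ Y ∣ ℝ.* (∣ at γ f ∣ ℝ.* norm ξ (vanishingAt δ))             ≤⟨ ℝ.*-monoˡ-≤ (∣∣-nonneg _) (q f) ⟩
      ∣ at γ Y ∣ ℝ.* (D ℝ.* norm ξ f)                                    ≈⟨ ℝ.*-congʳ (∣∣-cong (at-Y γ)) ⟩
      ∣ yᶜ γ ∣ ℝ.* (D ℝ.* norm ξ f)                                      ≈⟨ ℝ.solve 3 (λ x y z → x ℝ.:* (y ℝ.:* z) ℝ.:= y ℝ.:* (x ℝ.:* z)) ℝ.refl _ _ _ ⟩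
      D ℝ.* (∣ yᶜ γ ∣ ℝ.* norm ξ f)                                      ∎)
    lower : _ → η ⊑ ξ ⊎ ζ ⊑ ξ
    lower (inj₁ β≤α) = inj₁ (below⇒⊑ α cα (lower-from α β (bracket-upper ξ α β Y ≤-refl β≤α) (proj₁ ∘ o)))
    lower (inj₂ α≤β) = inj₂ (below⇒⊑ β cβ (lower-from β α (bracket-upper ξ α β Y α≤β ≤-refl) (proj₂ ∘ o)))
    upper′ : ∀ ω → η ⊑ ω → ζ ⊑ ω → ξ ⊑ ω
    upper′ ω η⊑ω ζ⊑ω = onLines λ f → ℝ.*-cancelˡ-≤ 0<D (begin
      D ℝ.* (norm ξ f ℝ.* norm ω Y)   ≈⟨ ℝ.solve 3 (λ x y z → x ℝ.:* (y ℝ.:* z) ℝ.:= z ℝ.:* (x ℝ.:* y)) ℝ.refl _ _ _ ⟩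
      norm ω Y ℝ.* (D ℝ.* norm ξ f)   ≤⟨ ℝ.*-monoˡ-≤ (ω.∥∥-nonneg Y) (bracket-upper ξ α β f (ℝ.x≤x⊔y _ _) (ℝ.x≤y⊔x _ _)) ⟩
      norm ω Y ℝ.* ((∣ at α f ∣ ℝ.* norm ξ (vanishingAt β)) ℝ.⊔ᴿ (∣ at β f ∣ ℝ.* norm ξ (vanishingAt α)))
                                      ≈⟨ ℝ.*-distribˡ-⊔ _ _ (ω.∥∥-nonneg Y) ⟩
      (norm ω Y ℝ.* (∣ at α f ∣ ℝ.* norm ξ (vanishingAt β))) ℝ.⊔ᴿ (norm ω Y ℝ.* (∣ at β f ∣ ℝ.* norm ξ (vanishingAt α)))
                                      ≤⟨ ℝ.⊔-lub (bound f α β (⊑⇒below α cα η⊑ω) (proj₁ (o Y))) (bound f β α (⊑⇒below β cβ ζ⊑ω) (proj₂ (o Y))) ⟩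
      D ℝ.* (norm ω f ℝ.* norm ξ Y)   ∎)
      where
      module ω = ℙ¹ᴮᵉʳᵏ ω
      bound : ∀ f γ δ → Below γ ω → ∣ at γ Y ∣ ℝ.* norm ξ (vanishingAt δ) ≤ D ℝ.* norm ξ Y →
        norm ω Y ℝ.* (∣ at γ f ∣ ℝ.* norm ξ (vanishingAt δ)) ≤ D ℝ.* (norm ω f ℝ.* norm ξ Y)
      bound f γ δ b q = begin
        norm ω Y ℝ.* (∣ at γ f ∣ ℝ.* norm ξ (vanishingAt δ)) ≈⟨ ℝ.solve 3 (λ x y z → x ℝ.:* (y ℝ.:* z) ℝ.:= z ℝ.:* (y ℝ.:* x)) ℝ.refl _ _ _ ⟩
        norm ξ (vanishingAt δ) ℝ.* (∣ at γ f ∣ ℝ.* norm ω Y) ≤⟨ ℝ.*-monoˡ-≤ (ξ.∥∥-nonneg (vanishingAt δ)) (b f) ⟩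
        norm ξ (vanishingAt δ) ℝ.* (∣ yᶜ γ ∣ ℝ.* norm ω f)   ≈⟨ ℝ.*-congˡ (ℝ.*-congʳ (∣∣-cong (at-Y γ))) ⟨
        norm ξ (vanishingAt δ) ℝ.* (∣ at γ Y ∣ ℝ.* norm ω f) ≈⟨ ℝ.solve 3 (λ x y z → x ℝ.:* (y ℝ.:* z) ℝ.:= z ℝ.:* (y ℝ.:* x)) ℝ.refl _ _ _ ⟩
        norm ω f ℝ.* (∣ at γ Y ∣ ℝ.* norm ξ (vanishingAt δ)) ≤⟨ ℝ.*-monoˡ-≤ (ω.∥∥-nonneg f) q ⟩
        norm ω f ℝ.* (D ℝ.* norm ξ Y)                        ≈⟨ ℝ.solve 3 (λ x y z → x ℝ.:* (y ℝ.:* z) ℝ.:= y ℝ.:* (x ℝ.:* z)) ℝ.refl _ _ _ ⟩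
        D ℝ.* (norm ω f ℝ.* norm ξ Y)                        ∎

  classicalPoint : ℙ 1 → ℙ¹ᴮᵉʳᵏ
  classicalPoint α = record
    { ∥_∥        = λ f → ∣ at α f ∣
    ; ∥∥-cong    = λ e → ∣∣-cong (eval-cong e refl refl)
    ; ∥∥-nonneg  = λ f → ∣∣-nonneg _
    ; ∥∥-extends = λ a → ℝ.refl
    ; ∥∥-*       = λ f g → ℝ.trans (∣∣-cong (eval-⊛ f g _ _)) (∣∣-* _ _)
    ; ∥∥-ultra   = λ f g → ≤-respˡ-≈ (∣∣-cong (sym (eval-⊕ f g _ _))) (∣∣-ultra _ _)
    ; nonzero    = λ (eX , eY) → nonzero-coordinates (coords α) (ℙ.nonzero α)
        (trans (sym (at-X α)) (∣∣-definite eX)) (trans (sym (at-Y α)) (∣∣-definite eY)) }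
    where
    at-X : ∀ α → at α X ≈ xᶜ α
    at-X α = trans (linear-at α 0# 1#) (solve 2 (λ x y → con (+ 0) :* y :+ con (+ 1) :* x := x) refl (xᶜ α) (yᶜ α))
    nonzero-coordinates : ∀ (v : Vec Carrier 2) → Any (_≉ 0#) v →
      head v ≈ 0# → ¬ head (tail v) ≈ 0#
    nonzero-coordinates (x ∷ y ∷ []) (here x≉0)         ex ey = x≉0 ex
    nonzero-coordinates (x ∷ y ∷ []) (there (here y≉0)) ex ey = y≉0 ey

  classicalPoint-classical : ∀ α → IsClassical α (classicalPoint α)
  classicalPoint-classical α = ℝ.1# , ℝ.0<1 , λ {d} f → ℝ.sym (ℝ.trans (ℝ.*-congʳ (1ᴿ^ d)) (ℝ.*-identityˡ _))
    where
    1ᴿ^ : ∀ n → ℝ.1# ℝ.^ n ℝ.≈ ℝ.1#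
    1ᴿ^ = FormProperties.1^ ℝ.realField

  private
    unique : ∀ {x y} {u v : 𝒪 → ℝ.Carrier} → Generic (λ t → u t ℝ.≈ x) → Generic (λ t → v t ℝ.≈ y) →
             (∀ t → u t ℝ.≈ v t) → x ℝ.≈ y
    unique g h e = proj₂ (generic-witness (generic-map₂ (λ t p q → ℝ.trans (ℝ.sym p) (ℝ.trans (e t) q)) g h))

  pointAlong : (M : Lift 1) → ¬ (linear-max M X ℝ.≈ ℝ.0# × linear-max M Y ℝ.≈ ℝ.0#) → ℙ¹ᴮᵉʳᵏ
  pointAlong M nz = record
    { ∥_∥        = λ f → height (genericValue M f)
    ; ∥∥-cong    = λ {_} {f} {g} e → unique (generic (genericValue M f)) (generic (genericValue M g))
                     (λ t → ∣∣-cong (eval-cong e refl refl))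
    ; ∥∥-nonneg  = λ f → nonneg (genericValue M f)
    ; ∥∥-extends = λ a → ℝ.refl
    ; ∥∥-*       = λ f g → unique (generic (genericValue M (f ⊛ g)))
                     (generic-map₂ (λ t → ℝ.*-cong) (generic (genericValue M f)) (generic (genericValue M g))) (along-⊛ M f g)
    ; ∥∥-ultra   = height-ultra
    ; nonzero    = λ (eX , eY) → nz (ℝ.trans (ℝ.sym (linear X)) eX , ℝ.trans (ℝ.sym (linear Y)) eY) }
    where
    sum-upper : ∀ {d} (f g : Form d) t →
      ∣ along M (f ⊕ g) t ∣ ≤ height (genericValue M f) ℝ.⊔ᴿ height (genericValue M g)
    sum-upper f g t = ≤-respˡ-≈ (∣∣-cong (sym (eval-⊕ f g _ _))) (≤-trans (∣∣-ultra _ _)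
      (ℝ.⊔-mono-≤ (upper (genericValue M f) t) (upper (genericValue M g) t)))
    height-ultra : ∀ {d} (f g : Form d) →
      height (genericValue M (f ⊕ g)) ≤ height (genericValue M f) ℝ.⊔ᴿ height (genericValue M g)
    height-ultra f g = let (t , e) = generic-witness (generic (genericValue M (f ⊕ g))) in ≤-respˡ-≈ e (sum-upper f g t)
    linear : ∀ (l : Form 1) → height (genericValue M l) ℝ.≈ linear-max M l
    linear l = unique (generic (genericValue M l)) (linear-generic M l) (λ t → ℝ.refl)

  pointAlong-linear : ∀ M nz (l : Form 1) → norm (pointAlong M nz) l ℝ.≈ linear-max M l
  pointAlong-linear M nz l = unique (generic (genericValue M l)) (linear-generic M l) (λ t → ℝ.refl)

  disc : Carrier → Carrier → Lift 1
  disc a b = [ a ∷ b ∷ [] , 1# ∷ 0# ∷ [] ]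

  disc-max : ∀ a b v u → linear-max (disc a b) (v ∷ u ∷ []) ℝ.≈ ∣ u * b ∣ ℝ.⊔ᴿ ∣ v + u * a ∣
  disc-max a b v u = ℝ.⊔-cong
    (∣∣-cong (solve 3 (λ v u b → v :* (con (+ 0) :* con (+ 1)) :+ b :* u := u :* b) refl v u b))
    (∣∣-cong (solve 3 (λ v u a → v :* (con (+ 1) :* con (+ 1)) :+ a :* u := v :+ u :* a) refl v u a))

  private
    Y-max : ∀ a b → linear-max (disc a b) Y ℝ.≈ ℝ.1#
    Y-max a b = ℝ.trans (disc-max a b 1# 0#) (ℝ.trans (ℝ.⊔-cong (∣≈0∣ (zeroˡ b))
      (ℝ.trans (∣∣-cong (solve 1 (λ a → con (+ 1) :+ con (+ 0) :* a := con (+ 1)) refl a)) ∣1∣)) (ℝ.x≤y⇒x⊔y≈y ℝ.0≤1))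

    disc-nonzero : ∀ a b → ¬ (linear-max (disc a b) X ℝ.≈ ℝ.0# × linear-max (disc a b) Y ℝ.≈ ℝ.0#)
    disc-nonzero a b (_ , e) = ℝ.1≉0 (ℝ.trans (ℝ.sym (Y-max a b)) e)

  discPoint : Carrier → Carrier → ℙ¹ᴮᵉʳᵏ
  discPoint a b = pointAlong (disc a b) (disc-nonzero a b)

  above⇒orthogonal : ∀ α β {η ζ ξ} → IsClassical α η → IsClassical β ζ → bracket α β ≉ 0# →
    η ⊑ ξ → (∀ ω → η ⊑ ω → ζ ⊑ ω → ξ ⊑ ω) → Orthogonal ξ α β
  above⇒orthogonal α β {η} {ζ} {ξ} cα cβ nz η⊑ξ above f =
    main f , flip f (main f)
    where
    open ≤-Reasoning
    module ξ = ℙ¹ᴮᵉʳᵏ ξ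
    D = ∣ bracket α β ∣
    below-ξ : Below α ξ
    below-ξ = ⊑⇒below α cα η⊑ξ
    flip : ∀ (f : Form 1) → ∣ at α f ∣ ℝ.* norm ξ (vanishingAt β) ≤ D ℝ.* norm ξ f →
           ∣ at β f ∣ ℝ.* norm ξ (vanishingAt α) ≤ D ℝ.* norm ξ f
    flip f le = vanishing-upper ξ β α f (≤-reflexive (ℝ.*-congʳ (bracket-flip β α))) le
    main : ∀ (f : Form 1) → ∣ at α f ∣ ℝ.* norm ξ (vanishingAt β) ≤ D ℝ.* norm ξ f
    main f@(v ∷ u ∷ []) with em {P = yᶜ α ≈ 0#}
    ... | yes yα≈0 = ≤-reflexive (ℝ.trans (ℝ.*-congˡ (at-∞ ξ ξY≈0 (- xᶜ β) (yᶜ β)))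
        (ℝ.trans (ℝ.*-congʳ (ℝ.trans (∣∣-cong at-f) (∣∣-* _ _)))
        (ℝ.trans (ℝ.solve 4 (λ u x y z → (u ℝ.:* x) ℝ.:* (y ℝ.:* z) ℝ.:= (y ℝ.:* x) ℝ.:* (u ℝ.:* z)) ℝ.refl _ _ _ _)
        (ℝ.*-cong (ℝ.trans (ℝ.sym (∣∣-* _ _)) (∣∣-cong (sym bracket≈))) (ℝ.sym (at-∞ ξ ξY≈0 v u))))))
      where
      ηY≈0 : norm η Y ℝ.≈ ℝ.0#
      ηY≈0 = let (C , _ , h) = cα in ℝ.trans (h Y) (ℝ.trans (ℝ.*-congˡ (∣≈0∣ (trans (at-Y α) yα≈0))) (ℝ.zeroʳ _))
      ξY≈0 : norm ξ Y ℝ.≈ ℝ.0#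
      ξY≈0 = ∞-maximal η⊑ξ ηY≈0
      at-f : at α f ≈ u * xᶜ α
      at-f = trans (linear-at α v u) (trans (+-congʳ (trans (*-congˡ yα≈0) (zeroʳ v))) (+-identityˡ _))
      bracket≈ : bracket α β ≈ yᶜ β * xᶜ α
      bracket≈ = trans (+-congˡ (-‿cong (trans (*-congˡ yα≈0) (zeroʳ _)))) (trans (+-congˡ -0#≈0#) (+-identityʳ _))
    ... | no yα≉0 = ℝ.*-cancelˡ-≤ (∣∣-pos yα≉0) (begin
        ∣ yᶜ α ∣ ℝ.* (∣ at α f ∣ ℝ.* norm ξ (vanishingAt β)) ≈⟨ ℝ.solve 3 (λ x y z → x ℝ.:* (y ℝ.:* z) ℝ.:= y ℝ.:* (x ℝ.:* z)) ℝ.refl _ _ _ ⟩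
        ∣ at α f ∣ ℝ.* (∣ yᶜ α ∣ ℝ.* norm ξ (vanishingAt β)) ≤⟨ ℝ.*-monoˡ-≤ (∣∣-nonneg _) radius ⟩
        ∣ at α f ∣ ℝ.* (D ℝ.* norm ξ Y)                      ≈⟨ ℝ.solve 3 (λ x y z → x ℝ.:* (y ℝ.:* z) ℝ.:= y ℝ.:* (x ℝ.:* z)) ℝ.refl _ _ _ ⟩
        D ℝ.* (∣ at α f ∣ ℝ.* norm ξ Y)                      ≤⟨ ℝ.*-monoˡ-≤ (∣∣-nonneg _) (below-ξ f) ⟩
        D ℝ.* (∣ yᶜ α ∣ ℝ.* norm ξ f)                        ≈⟨ ℝ.solve 3 (λ x y z → x ℝ.:* (y ℝ.:* z) ℝ.:= y ℝ.:* (x ℝ.:* z)) ℝ.refl _ _ _ ⟩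
        ∣ yᶜ α ∣ ℝ.* (D ℝ.* norm ξ f)                        ∎)
      where
      -- Compare ξ with the smallest disc containing α and β.
      radius : ∣ yᶜ α ∣ ℝ.* norm ξ (vanishingAt β) ≤ D ℝ.* norm ξ Y
      radius with em {P = yᶜ β ≈ 0#}
      ... | yes yβ≈0 = ≤-reflexive (ℝ.trans (ℝ.*-congˡ (ℝ.trans (ξ.∥∥-cong β≋) (∥·∥ ξ (- xᶜ β) Y)))
          (ℝ.trans (ℝ.sym (ℝ.*-assoc _ _ _)) (ℝ.*-congʳ (ℝ.trans (ℝ.sym (∣∣-* _ _)) (∣∣-cong y*x≈)))))
        where
        β≋ : vanishingAt β ≋ (- xᶜ β) · Y
        β≋ = sym (*-identityʳ _) ∷ trans yβ≈0 (sym (zeroʳ _)) ∷ []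
        y*x≈ : yᶜ α * (- xᶜ β) ≈ bracket α β
        y*x≈ = trans (solve 2 (λ y x → y :* (:- x) := con (+ 0) :- x :* y) refl (yᶜ α) (xᶜ β))
                 (+-congʳ (sym (trans (*-congʳ yβ≈0) (zeroˡ _))))
      ... | no yβ≉0 = begin
          ∣ yᶜ α ∣ ℝ.* norm ξ (vanishingAt β)                   ≈⟨ ℝ.*-congˡ (ℝ.*-identityʳ _) ⟨
          ∣ yᶜ α ∣ ℝ.* (norm ξ (vanishingAt β) ℝ.* ℝ.1#)        ≈⟨ ℝ.*-congˡ (ℝ.*-congˡ ωY) ⟨
          ∣ yᶜ α ∣ ℝ.* (norm ξ (vanishingAt β) ℝ.* norm ω Y)    ≤⟨ ℝ.*-monoˡ-≤ (∣∣-nonneg _) (lines (above ω (below⇒⊑ α cα below-α) (below⇒⊑ β cβ below-β)) (vanishingAt β)) ⟩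
          ∣ yᶜ α ∣ ℝ.* (norm ω (vanishingAt β) ℝ.* norm ξ Y)    ≈⟨ ℝ.*-assoc _ _ _ ⟨
          (∣ yᶜ α ∣ ℝ.* norm ω (vanishingAt β)) ℝ.* norm ξ Y    ≈⟨ ℝ.*-congʳ ωβ ⟩
          D ℝ.* norm ξ Y                                        ∎
        where
        a b b′ : Carrier
        a  = yα≉0 ⁻¹ * xᶜ α
        b′ = yβ≉0 ⁻¹ * xᶜ β
        b  = a - b′
        ω : ℙ¹ᴮᵉʳᵏ
        ω = discPoint a b
        ω-linear : ∀ v u → norm ω (v ∷ u ∷ []) ℝ.≈ ∣ u * b ∣ ℝ.⊔ᴿ ∣ v + u * a ∣
        ω-linear v u = ℝ.trans (pointAlong-linear (disc a b) (disc-nonzero a b) (v ∷ u ∷ [])) (disc-max a b v u)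
        ωY : norm ω Y ℝ.≈ ℝ.1#
        ωY = ℝ.trans (pointAlong-linear (disc a b) (disc-nonzero a b) Y) (Y-max a b)
        ya≈x : yᶜ α * a ≈ xᶜ α
        ya≈x = divide yα≉0 (xᶜ α)
        yb≈x : yᶜ β * b′ ≈ xᶜ β
        yb≈x = divide yβ≉0 (xᶜ β)
        at-α : ∀ v u → at α (v ∷ u ∷ []) ≈ yᶜ α * (v + u * a)
        at-α v u = trans (linear-at α v u) (trans (+-congˡ (*-congˡ (sym ya≈x)))
          (solve 4 (λ v u y a → v :* y :+ u :* (y :* a) := y :* (v :+ u :* a)) refl v u (yᶜ α) a))
        at-β : ∀ v u → at β (v ∷ u ∷ []) ≈ yᶜ β * ((v + u * a) - u * b)
        at-β v u = trans (linear-at β v u) (trans (+-congˡ (*-congˡ (sym yb≈x)))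
          (solve 5 (λ v u y a b′ → v :* y :+ u :* (y :* b′) := y :* ((v :+ u :* a) :- u :* (a :- b′))) refl v u (yᶜ β) a b′))
        below-α : Below α ω
        below-α f@(v ∷ u ∷ []) = ≤-respˡ-≈ (ℝ.sym (ℝ.trans (ℝ.*-congˡ ωY) (ℝ.trans (ℝ.*-identityʳ _)
            (ℝ.trans (∣∣-cong (at-α v u)) (∣∣-* _ _)))))
          (ℝ.*-monoˡ-≤ (∣∣-nonneg _) (≤-respʳ-≈ (ℝ.sym (ω-linear v u)) (ℝ.x≤y⊔x _ _)))
        below-β : Below β ω
        below-β f@(v ∷ u ∷ []) = ≤-respˡ-≈ (ℝ.sym (ℝ.trans (ℝ.*-congˡ ωY) (ℝ.trans (ℝ.*-identityʳ _)
            (ℝ.trans (∣∣-cong (at-β v u)) (∣∣-* _ _)))))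
          (ℝ.*-monoˡ-≤ (∣∣-nonneg _) (≤-respʳ-≈ (ℝ.sym (ω-linear v u)) (∣-∣≤ (ℝ.x≤y⊔x _ _) (ℝ.x≤x⊔y _ _))))
        β-at-a : - xᶜ β + yᶜ β * a ≈ yᶜ β * b
        β-at-a = trans (+-congʳ (-‿cong (sym yb≈x)))
          (solve 3 (λ y a b′ → (:- (y :* b′)) :+ y :* a := y :* (a :- b′)) refl (yᶜ β) a b′)
        bracket≈ : yᶜ α * (yᶜ β * b) ≈ bracket α β
        bracket≈ = trans (solve 4 (λ y y′ a b′ → y :* (y′ :* (a :- b′)) := y′ :* (y :* a) :- (y′ :* b′) :* y) refl (yᶜ α) (yᶜ β) a b′)
          (+-cong (*-congˡ ya≈x) (-‿cong (*-congʳ yb≈x)))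
        ωβ : ∣ yᶜ α ∣ ℝ.* norm ω (vanishingAt β) ℝ.≈ D
        ωβ = ℝ.trans (ℝ.*-congˡ (ℝ.trans (ω-linear (- xᶜ β) (yᶜ β))
               (ℝ.trans (ℝ.⊔-cong ℝ.refl (∣∣-cong β-at-a)) (ℝ.x≤y⇒x⊔y≈y ≤-refl))))
             (ℝ.trans (ℝ.sym (∣∣-* _ _)) (∣∣-cong bracket≈))
  between⇒orthogonal : ∀ α β {η ζ ξ} → IsClassical α η → IsClassical β ζ → bracket α β ≉ 0# →
    Between η ζ ξ → Orthogonal ξ α β
  between⇒orthogonal α β cα cβ nz (inj₁ η⊑ξ , above) = above⇒orthogonal α β cα cβ nz η⊑ξ above
  between⇒orthogonal α β {ξ = ξ} cα cβ nz (inj₂ ζ⊑ξ , above) =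
    orthogonal-sym {ξ} {β} {α} (above⇒orthogonal β α cβ cα
      (λ e → nz (∣∣-definite (ℝ.trans (bracket-flip α β) (∣≈0∣ e)))) ζ⊑ξ (λ ω p q → above ω q p))

  -- Spanned subtrees

  classical-⊑ : ∀ α β {η ζ} → bracket α β ≈ 0# → IsClassical α η → IsClassical β ζ → η ⊑ ζ
  classical-⊑ α β {η} {ζ} e (C , 0<C , h) (D , 0<D , g) = onLines λ l → ≤-reflexive (begin
    norm η l ℝ.* norm ζ Y                                            ≈⟨ ℝ.*-cong (h l) (g Y) ⟩
    (C ℝ.^ 1 ℝ.* ∣ at α l ∣) ℝ.* (D ℝ.^ 1 ℝ.* ∣ at β Y ∣)            ≈⟨ ℝ.solve 4 (λ a b c d → (a ℝ.:* b) ℝ.:* (c ℝ.:* d) ℝ.:= (a ℝ.:* c) ℝ.:* (b ℝ.:* d)) ℝ.refl _ _ _ _ ⟩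
    (C ℝ.^ 1 ℝ.* D ℝ.^ 1) ℝ.* (∣ at α l ∣ ℝ.* ∣ at β Y ∣)            ≈⟨ ℝ.*-congˡ (ℝ.trans (ℝ.sym (∣∣-* _ _)) (ℝ.trans (∣∣-cong (values-proportional l)) (∣∣-* _ _))) ⟩
    (C ℝ.^ 1 ℝ.* D ℝ.^ 1) ℝ.* (∣ at β l ∣ ℝ.* ∣ at α Y ∣)            ≈⟨ ℝ.solve 4 (λ a b c d → (a ℝ.:* c) ℝ.:* (b ℝ.:* d) ℝ.:= (c ℝ.:* b) ℝ.:* (a ℝ.:* d)) ℝ.refl _ _ _ _ ⟩
    (D ℝ.^ 1 ℝ.* ∣ at β l ∣) ℝ.* (C ℝ.^ 1 ℝ.* ∣ at α Y ∣)            ≈⟨ ℝ.*-cong (g l) (h Y) ⟨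
    norm ζ l ℝ.* norm η Y                                            ∎)
    where
    open import Relation.Binary.Reasoning.Setoid ℝ.setoid
    values-proportional : ∀ (l : Form 1) → at α l * at β Y ≈ at β l * at α Y
    values-proportional (v ∷ u ∷ []) = x-y≈0⇒x≈y (trans
      (solve 6 (λ x y x′ y′ v u → let I = con (+ 1) ; O = con (+ 0) in
        (v :* (y :* I) :+ x :* u) :* (I :* (y′ :* I) :+ x′ :* O) :- (v :* (y′ :* I) :+ x′ :* u) :* (I :* (y :* I) :+ x :* O)
          := u :* (y′ :* x :- x′ :* y)) refl (xᶜ α) (yᶜ α) (xᶜ β) (yᶜ β) v u)
      (trans (*-congˡ e) (zeroʳ u)))

  module _ {S : ℙ¹ᴮᵉʳᵏ → Set (r ⊔ ℓ₁ ⊔ ℓ₂ ⊔ c ⊔ ℓ)} where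

    span-direction : ∀ {ξ P} → Span S ξ → ¬ (ξ ≈ᴮ P) → ∃[ η ] (S η × ¬ Between ξ η P)
    span-direction {ξ} {P} (η , ζ , Sη , Sζ , path) ξ≉P with em {P = Between ξ η P} | em {P = Between ξ ζ P}
    ... | no ¬b | _     = η , Sη , ¬b
    ... | yes _ | no ¬b = ζ , Sζ , ¬b
    ... | yes b | yes b′ = contradiction (⊑-antisym ξ⊑P P⊑ξ) ξ≉P
      where
      from : ∀ {η ζ} → η ⊑ ξ → (∀ ω → η ⊑ ω → ζ ⊑ ω → ξ ⊑ ω) → Between ξ η P → Between ξ ζ P → ξ ⊑ P × P ⊑ ξ
      from η⊑ξ above (inj₁ p , h) _            = p , h ξ ⊑-refl η⊑ξ
      from η⊑ξ above (inj₂ p , h) (inj₁ q , _) = q , h ξ ⊑-refl η⊑ξ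
      from η⊑ξ above (inj₂ p , h) (inj₂ q , _) = above P p q , h ξ ⊑-refl η⊑ξ
      both : ξ ⊑ P × P ⊑ ξ
      both with OnPath⇒Between {η} {ζ} {ξ} path
      ... | inj₁ p , above = from p above b b′
      ... | inj₂ p , above = from p (λ ω s t → above ω t s) b′ b
      ξ⊑P = proj₁ both
      P⊑ξ = proj₂ both

  -- Three fixed points in different directions at P.
  record Trident {d} (φ : RationalMap d) (P : ℙ¹ᴮᵉʳᵏ) : Set (r ⊔ ℓ₁ ⊔ ℓ₂ ⊔ c ⊔ ℓ) where
    field
      α₁ α₂ α₃ : ℙ 1
      fixes₁   : Fixes φ α₁
      fixes₂   : Fixes φ α₂
      fixes₃   : Fixes φ α₃
      distinct₁₂ : bracket α₁ α₂ ≉ 0#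
      distinct₁₃ : bracket α₁ α₃ ≉ 0#
      distinct₂₃ : bracket α₂ α₃ ≉ 0#
      orthogonal₁₂ : Orthogonal P α₁ α₂
      orthogonal₁₃ : Orthogonal P α₁ α₃
      orthogonal₂₃ : Orthogonal P α₂ α₃

  branch⇒trident : ∀ {d} (φ : RationalMap d) {P} → IsBranchPoint (ΓFix φ) P → Trident φ P
  branch⇒trident φ {P} (_ , ξ , outside , distinct) = record
    { α₁ = α zero ; α₂ = α (suc zero) ; α₃ = α (suc (suc zero))
    ; fixes₁ = fixes-end zero ; fixes₂ = fixes-end (suc zero) ; fixes₃ = fixes-end (suc (suc zero))
    ; distinct₁₂ = bracket≉0 zero (suc zero) (λ ()) ; distinct₁₃ = bracket≉0 zero (suc (suc zero)) (λ ())
    ; distinct₂₃ = bracket≉0 (suc zero) (suc (suc zero)) (λ ())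
    ; orthogonal₁₂ = orthogonal zero (suc zero) (λ ()) ; orthogonal₁₃ = orthogonal zero (suc (suc zero)) (λ ())
    ; orthogonal₂₃ = orthogonal (suc zero) (suc (suc zero)) (λ ()) }
    where
    end : ∀ i → ∃[ η ] (IsFixedClassical φ η × ¬ Between (ξ i) η P)
    end i = span-direction {S = IsFixedClassical φ} (proj₁ (outside i)) (proj₂ (outside i))
    η : Fin 3 → ℙ¹ᴮᵉʳᵏ
    η i = proj₁ (end i)
    α : Fin 3 → ℙ 1
    α i = proj₁ (proj₁ (proj₂ (end i)))
    fixes-end : ∀ i → Fixes φ (α i)
    fixes-end i = proj₁ (proj₂ (proj₁ (proj₂ (end i))))
    classical : ∀ i → IsClassical (α i) (η i)
    classical i = proj₂ (proj₂ (proj₁ (proj₂ (end i))))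
    between : ∀ i j → i ≡.≢ j → Between (η i) (η j) P
    between i j i≢j
      with Between-split {η = η i} (OnPath⇒Between {ξ i} {ξ j} {P} (stable (λ same → i≢j (distinct same))))
    ... | inj₁ b = contradiction b (proj₂ (proj₂ (end i)))
    ... | inj₂ b with Between-split {η = η j} b
    ...   | inj₁ b′ = b′
    ...   | inj₂ b′ = contradiction (Between-sym b′) (proj₂ (proj₂ (end j)))
    bracket≉0 : ∀ i j → i ≡.≢ j → bracket (α i) (α j) ≉ 0#
    bracket≉0 i j i≢j e = proj₂ (proj₂ (end i)) (inj₂ ηi⊑P , λ ω _ ηi⊑ω → ⊑-trans P⊑ηj (⊑-trans ηj⊑ηi ηi⊑ω))
      where
      ηi⊑ηj : η i ⊑ η j
      ηi⊑ηj = classical-⊑ (α i) (α j) e (classical i) (classical j)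
      ηj⊑ηi : η j ⊑ η i
      ηj⊑ηi = classical-⊑ (α j) (α i)
        (∣∣-definite (ℝ.trans (bracket-flip (α j) (α i)) (∣≈0∣ e))) (classical j) (classical i)
      P⊑ηj : P ⊑ η j
      P⊑ηj = proj₂ (between i j i≢j) (η j) ηi⊑ηj ⊑-refl
      ηi⊑P : η i ⊑ P
      ηi⊑P = [ id , ⊑-trans ηi⊑ηj ]′ (proj₁ (between i j i≢j))
    orthogonal : ∀ i j → i ≡.≢ j → Orthogonal P (α i) (α j)
    orthogonal i j i≢j = between⇒orthogonal (α i) (α j) (classical i) (classical j) (bracket≉0 i j i≢j) (between i j i≢j)

  -- ξ is the sup-norm over the image of 𝒪 under M.
  record GaussAlong (M : Lift 1) (ξ : ℙ¹ᴮᵉʳᵏ) : Set (r ⊔ ℓ₁ ⊔ ℓ₂ ⊔ c ⊔ ℓ) where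
    field
      C      : ℝ.Carrier
      C-pos  : ℝ.0# < C
      linear : ∀ (l : Form 1) → C ℝ.* norm ξ l ℝ.≈ linear-max M l

    open ℙ¹ᴮᵉʳᵏ ξ

    private
      split : ∀ {d} (l : Form 1) (g : Form d) →
        (C ℝ.^ 1 ℝ.* ∥ l ∥) ℝ.* (C ℝ.^ d ℝ.* ∥ g ∥) ℝ.≈ C ℝ.^ suc d ℝ.* ∥ l ⊛ g ∥
      split {d} l g = ℝ.trans
        (ℝ.solve 4 (λ y z a b → ((y ℝ.:* ℝ.con (+ 1)) ℝ.:* a) ℝ.:* (z ℝ.:* b) ℝ.:= (y ℝ.:* z) ℝ.:* (a ℝ.:* b)) ℝ.refl _ _ _ _)
        (ℝ.*-congˡ (ℝ.sym (∥∥-* l g)))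

      linear¹ : ∀ (l : Form 1) → C ℝ.^ 1 ℝ.* ∥ l ∥ ℝ.≈ linear-max M l
      linear¹ l = ℝ.trans (ℝ.*-congʳ (ℝ.*-identityʳ C)) (linear l)

    along-norm : ∀ {d} (f : Form d) → (∀ t → ∣ along M f t ∣ ≤ C ℝ.^ d ℝ.* ∥ f ∥) ×
                                      Generic (λ t → ∣ along M f t ∣ ℝ.≈ C ℝ.^ d ℝ.* ∥ f ∥)
    along-norm = form-induction algClosed
      (λ {d} f → (∀ t → ∣ along M f t ∣ ≤ C ℝ.^ d ℝ.* ∥ f ∥) × Generic (λ t → ∣ along M f t ∣ ℝ.≈ C ℝ.^ d ℝ.* ∥ f ∥))
      (λ e (u , g) →
        (λ t → ≤-respˡ-≈ (∣∣-cong (eval-cong e refl refl)) (≤-respʳ-≈ (ℝ.*-congˡ (∥∥-cong e)) (u t))) ,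
        generic-map (λ t p → ℝ.trans (∣∣-cong (eval-cong (≋-sym e) refl refl)) (ℝ.trans p (ℝ.*-congˡ (∥∥-cong e)))) g)
      (λ a → (λ t → ≤-reflexive (norm-const a)) , always λ t → norm-const a)
      (λ l g (u₁ , g₁) (u₂ , g₂) →
        (λ t → ≤-respˡ-≈ (ℝ.sym (along-⊛ M l g t)) (≤-respʳ-≈ (split l g)
          (ℝ.*-mono-≤ (≤-trans (∣∣-nonneg _) (u₁ t)) (∣∣-nonneg _) (u₁ t) (u₂ t)))) ,
        generic-map₂ (λ t p q → ℝ.trans (along-⊛ M l g t) (ℝ.trans (ℝ.*-cong p q) (split l g))) g₁ g₂)
      (λ l → (λ t → ≤-respʳ-≈ (ℝ.sym (linear¹ l)) (linear-upper M l t)) ,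
             generic-map (λ t p → ℝ.trans p (ℝ.sym (linear¹ l))) (linear-generic M l))
      where
      norm-const : ∀ a → ∣ a ∣ ℝ.≈ ℝ.1# ℝ.* ∥ a ∷ [] ∥
      norm-const a = ℝ.sym (ℝ.trans (ℝ.*-identityˡ _) (∥∥-extends a))

  module _ (γ : GL₂) where
    open GL₂ γ

    det : Carrier
    det = m₁₁ * m₂₂ - m₁₂ * m₂₁

    frame⇒gauss : ∀ {ζ P} → IsGauss ζ → Maps (möbius γ) ζ P → GaussAlong (möbius γ) P
    frame⇒gauss {ζ} {P} (C , 0<C , sup) (D , 0<D , maps) = record
      { C = D≉0 ℝ.⁻¹ ℝ.* C
      ; C-pos = ℝ.*-pos (ℝ.⁻¹-pos 0<D) 0<C
      ; linear = λ l → begin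
          (D≉0 ℝ.⁻¹ ℝ.* C) ℝ.* norm P l                                  ≈⟨ ℝ.*-congˡ (maps l) ⟩
          (D≉0 ℝ.⁻¹ ℝ.* C) ℝ.* (D ℝ.^ 1 ℝ.* norm ζ (substitute l (möbius γ)))
            ≈⟨ ℝ.solve 4 (λ i c d n → (i ℝ.:* c) ℝ.:* ((d ℝ.:* ℝ.con (+ 1)) ℝ.:* n) ℝ.:= d ℝ.:* (i ℝ.:* ((c ℝ.:* ℝ.con (+ 1)) ℝ.:* n))) ℝ.refl _ _ _ _ ⟩
          D ℝ.* (D≉0 ℝ.⁻¹ ℝ.* (C ℝ.^ 1 ℝ.* norm ζ (substitute l (möbius γ)))) ≈⟨ ℝ.divide D≉0 _ ⟩
          C ℝ.^ 1 ℝ.* norm ζ (substitute l (möbius γ))                   ≈⟨ value-of l ⟩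
          linear-max (möbius γ) l                                        ∎ }
      where
      open import Relation.Binary.Reasoning.Setoid ℝ.setoid
      D≉0 = ℝ.<⇒≉0 0<D
      x-0≈x : ∀ x → x - 0# ≈ x
      x-0≈x x = trans (+-congˡ -0#≈0#) (+-identityʳ x)
      value-of : ∀ (l : Form 1) → C ℝ.^ 1 ℝ.* norm ζ (substitute l (möbius γ)) ℝ.≈ linear-max (möbius γ) l
      value-of l = antisym
        (proj₂ (sup (substitute l (möbius γ))) _ λ t ∣t∣≤1 →
          ≤-respˡ-≈ (∣∣-cong (sym (eval-substitute l (möbius γ) t 1#)))
            (linear-upper (möbius γ) l (t , ≤-respˡ-≈ (∣∣-cong (x-0≈x t)) ∣t∣≤1)))
        (let ((t , ∣t∣≤1) , e) = generic-witness (linear-generic (möbius γ) l) in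
          ≤-respˡ-≈ (ℝ.trans (∣∣-cong (eval-substitute l (möbius γ) t 1#)) e)
            (proj₁ (sup (substitute l (möbius γ))) t (≤-respˡ-≈ (∣∣-cong (sym (x-0≈x t))) ∣t∣≤1)))

    linear-max≉0 : ∀ v u → v ≉ 0# ⊎ u ≉ 0# → linear-max (möbius γ) (v ∷ u ∷ []) ℝ.≉ ℝ.0#
    linear-max≉0 v u nz e = [ (λ v≉0 → v≉0 (x*y≈0⇒y≈0 det≉0 det*v)) , (λ u≉0 → u≉0 (x*y≈0⇒y≈0 det≉0 det*u)) ]′ nz
      where
      l : Form 1
      l = v ∷ u ∷ []
      e₁ : eval l m₁₁ m₂₁ ≈ 0#
      e₁ = ∣x∣≤0⇒x≈0 (≤-respʳ-≈ e (ℝ.x≤x⊔y _ _))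
      e₂ : eval l m₁₂ m₂₂ ≈ 0#
      e₂ = ∣x∣≤0⇒x≈0 (≤-respʳ-≈ e (ℝ.x≤y⊔x _ _))
      combine : ∀ s t → s * eval l m₁₁ m₂₁ + t * eval l m₁₂ m₂₂ ≈ 0#
      combine s t = trans (+-cong (trans (*-congˡ e₁) (zeroʳ s)) (trans (*-congˡ e₂) (zeroʳ t))) (+-identityˡ 0#)
      det*v : det * v ≈ 0#
      det*v = trans (solve 6 (λ a b c d v u → (a :* d :- b :* c) :* v :=
        (:- b) :* (v :* (c :* con (+ 1)) :+ a :* u) :+ a :* (v :* (d :* con (+ 1)) :+ b :* u)) refl m₁₁ m₁₂ m₂₁ m₂₂ v u)
        (combine _ _)
      det*u : det * u ≈ 0#
      det*u = trans (solve 6 (λ a b c d v u → (a :* d :- b :* c) :* u :=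
        d :* (v :* (c :* con (+ 1)) :+ a :* u) :+ (:- c) :* (v :* (d :* con (+ 1)) :+ b :* u)) refl m₁₁ m₁₂ m₂₁ m₂₂ v u)
        (combine _ _)

  -- Type II points

  gaussDisc⇒typeII : ∀ {ξ a b} → b ≉ 0# → GaussAlong (disc a b) ξ → IsTypeII ξ
  gaussDisc⇒typeII {ξ} {a} {b} b≉0 G = a , b , b≉0 , C , C-pos , λ f →
      (λ t p → ≤-respˡ-≈ (∣∣-cong (eval-arg f (parameter t) one)) (proj₁ (along-norm f) (s t p)))
    , (λ s′ h → let (t , e) = generic-witness (proj₂ (along-norm f)) in
        ≤-respˡ-≈ e (≤-respˡ-≈ (∣∣-cong (sym (eval-arg f (shifted-value t) one))) (h _ (inside t))))
    where
    open GaussAlong G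
    s : ∀ t → ∣ t - a ∣ ≤ ∣ b ∣ → 𝒪
    s t p = b≉0 ⁻¹ * (t - a) , quotient-integral b≉0 p
    shifted-value : ∀ (t : 𝒪) → a * (1# * 1#) + value t * b ≈ a + value t * b
    shifted-value (t , _) = solve 3 (λ a t b → a :* (con (+ 1) :* con (+ 1)) :+ t :* b := a :+ t :* b) refl a t b
    parameter : ∀ t → a * (1# * 1#) + (b≉0 ⁻¹ * (t - a)) * b ≈ t
    parameter t = trans (solve 4 (λ a q′⁻¹ t b → a :* (con (+ 1) :* con (+ 1)) :+ (q′⁻¹ :* (t :- a)) :* b := a :+ b :* (q′⁻¹ :* (t :- a)))
      refl a (b≉0 ⁻¹) t b) (trans (+-congˡ (divide b≉0 (t - a))) (solve 2 (λ a t → a :+ (t :- a) := t) refl a t))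
    one : ∀ {s} → 1# * (1# * 1#) + s * 0# ≈ 1#
    one {s} = solve 1 (λ s → con (+ 1) :* (con (+ 1) :* con (+ 1)) :+ s :* con (+ 0) := con (+ 1)) refl s
    inside : ∀ (t : 𝒪) → ∣ (a + value t * b) - a ∣ ≤ ∣ b ∣
    inside (t , ∣t∣≤1) = ≤-respˡ-≈ (∣∣-cong (solve 3 (λ a t b → t :* b := (a :+ t :* b) :- a) refl a t b)) (product≤ ∣t∣≤1)

  private
    -- A column operation makes the second row (0 , q′).
    tilt : ∀ {ξ C} → ℝ.0# < C → ∀ p p′ q q′ → p * q′ - p′ * q ≉ 0# → ∣ q ∣ ≤ ∣ q′ ∣ →
      (∀ (l : Form 1) → C ℝ.* norm ξ l ℝ.≈ ∣ eval l p q ∣ ℝ.⊔ᴿ ∣ eval l p′ q′ ∣) → IsTypeII ξ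
    tilt {ξ} {C} C-pos p p′ q q′ det≉0 q≤q′ lin = gaussDisc⇒typeII {ξ} {q′≉0 ⁻¹ * p′} {b} b≉0 record
      { C = ∣q′∣≉0 ℝ.⁻¹ ℝ.* C
      ; C-pos = ℝ.*-pos (ℝ.⁻¹-pos (∣∣-pos q′≉0)) C-pos
      ; linear = λ { l@(v ∷ u ∷ []) → begin
          (∣q′∣≉0 ℝ.⁻¹ ℝ.* C) ℝ.* norm ξ l          ≈⟨ ℝ.*-assoc _ _ _ ⟩
          ∣q′∣≉0 ℝ.⁻¹ ℝ.* (C ℝ.* norm ξ l)          ≈⟨ ℝ.*-congˡ (ℝ.trans (lin l) (column v u)) ⟩
          ∣q′∣≉0 ℝ.⁻¹ ℝ.* (∣ q′ ∣ ℝ.* M v u)        ≈⟨ ℝ.solve 3 (λ q′⁻¹ q m → q′⁻¹ ℝ.:* (q ℝ.:* m) ℝ.:= q ℝ.:* (q′⁻¹ ℝ.:* m)) ℝ.refl _ _ _ ⟩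
          ∣ q′ ∣ ℝ.* (∣q′∣≉0 ℝ.⁻¹ ℝ.* M v u)        ≈⟨ ℝ.divide ∣q′∣≉0 _ ⟩
          M v u                                     ≈⟨ disc-max a b v u ⟨
          linear-max (disc a b) l                   ∎ } }
      where
      open import Relation.Binary.Reasoning.Setoid ℝ.setoid
      q′≉0 : q′ ≉ 0#
      q′≉0 e = det≉0 (trans (+-cong (trans (*-congˡ e) (zeroʳ p))
        (-‿cong (trans (*-congˡ (∣x∣≤0⇒x≈0 (≤-respʳ-≈ (∣≈0∣ e) q≤q′))) (zeroʳ p′)))) (trans (+-identityˡ _) -0#≈0#))
      ∣q′∣≉0 = ∣∣≉0 q′≉0
      q′⁻¹ = q′≉0 ⁻¹
      a = q′⁻¹ * p′
      b = q′⁻¹ * (p - (q′⁻¹ * q) * p′)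
      M : Carrier → Carrier → ℝ.Carrier
      M v u = ∣ u * b ∣ ℝ.⊔ᴿ ∣ v + u * a ∣
      det≈ : q′ * (p - (q′⁻¹ * q) * p′) ≈ p * q′ - p′ * q
      det≈ = trans (solve 5 (λ p p′ q q′ q′⁻¹ → q′ :* (p :- (q′⁻¹ :* q) :* p′) := p :* q′ :- p′ :* (q′ :* (q′⁻¹ :* q))) refl p p′ q q′ q′⁻¹)
        (+-congˡ (-‿cong (*-congˡ (divide q′≉0 q))))
      b≉0 : b ≉ 0#
      b≉0 = *≉0 (x⁻¹≉0 q′≉0) (*≉0ʳ (λ e → det≉0 (trans (sym det≈) e)))
      q′b : ∀ u → q′ * (u * b) ≈ u * (p - (q′⁻¹ * q) * p′)
      q′b u = trans (solve 4 (λ q′ u q′⁻¹ r → q′ :* (u :* (q′⁻¹ :* r)) := q′ :* (q′⁻¹ :* (u :* r))) refl q′ u q′⁻¹ (p - (q′⁻¹ * q) * p′))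
        (divide q′≉0 _)
      second : ∀ v u → q′ * (v + u * a) ≈ eval (v ∷ u ∷ []) p′ q′
      second v u = trans (solve 5 (λ q′ v u q′⁻¹ p′ → q′ :* (v :+ u :* (q′⁻¹ :* p′)) := v :* q′ :+ q′ :* (q′⁻¹ :* (u :* p′))) refl q′ v u q′⁻¹ p′)
        (trans (+-congˡ (divide q′≉0 (u * p′))) (solve 4 (λ v u p′ q′ → v :* q′ :+ u :* p′ := v :* (q′ :* con (+ 1)) :+ p′ :* u) refl v u p′ q′))
      first : ∀ v u → q′ * (u * b) ≈ eval (v ∷ u ∷ []) p q - (q′⁻¹ * q) * eval (v ∷ u ∷ []) p′ q′
      first v u = trans (q′b u) (trans
        (solve 7 (λ v u p q q′⁻¹ p′ x → u :* (p :- (q′⁻¹ :* q) :* p′) :=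
            ((v :* q :+ u :* p) :- v :* x :- (q′⁻¹ :* q) :* (u :* p′)) :+ v :* (x :- q)) refl v u p q q′⁻¹ p′ (q′ * (q′⁻¹ * q)))
        (trans (+-congˡ (trans (*-congˡ (x≈y⇒x-y≈0 (divide q′≉0 q))) (zeroʳ v)))
          (solve 7 (λ v u p q q′⁻¹ p′ q′ → ((v :* q :+ u :* p) :- v :* (q′ :* (q′⁻¹ :* q)) :- (q′⁻¹ :* q) :* (u :* p′)) :+ con (+ 0)
            := (v :* (q :* con (+ 1)) :+ p :* u) :- (q′⁻¹ :* q) :* (v :* (q′ :* con (+ 1)) :+ p′ :* u)) refl v u p q q′⁻¹ p′ q′)))
      ∣iq∣≤1 : ∣ q′⁻¹ * q ∣ ≤ ℝ.1#
      ∣iq∣≤1 = quotient-integral q′≉0 q≤q′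
      column : ∀ v u → ∣ eval (v ∷ u ∷ []) p q ∣ ℝ.⊔ᴿ ∣ eval (v ∷ u ∷ []) p′ q′ ∣ ℝ.≈ ∣ q′ ∣ ℝ.* M v u
      column v u = ℝ.trans (antisym
          (ℝ.⊔-lub (≤-respˡ-≈ (∣∣-cong (solve 2 (λ s t → (s :- t) :+ t := s) refl l₁ (q′⁻¹ * q * l₂)))
              (∣+∣≤ (≤-trans (≤-reflexive (∣∣-cong (sym (first v u)))) (ℝ.x≤x⊔y _ _))
                (≤-trans (product≤ ∣iq∣≤1) (≤-trans (≤-reflexive (∣∣-cong (sym (second v u)))) (ℝ.x≤y⊔x _ _)))))
            (≤-trans (≤-reflexive (∣∣-cong (sym (second v u)))) (ℝ.x≤y⊔x _ _)))
          (ℝ.⊔-lub (≤-respˡ-≈ (∣∣-cong (sym (first v u))) (∣-∣≤ (ℝ.x≤x⊔y _ _) (≤-trans (product≤ ∣iq∣≤1) (ℝ.x≤y⊔x _ _))))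
            (≤-respˡ-≈ (∣∣-cong (sym (second v u))) (ℝ.x≤y⊔x _ _))))
        (ℝ.sym (ℝ.trans (ℝ.*-distribˡ-⊔ _ _ (∣∣-nonneg q′)) (ℝ.⊔-cong (ℝ.sym (∣∣-* _ _)) (ℝ.sym (∣∣-* _ _)))))
        where
        l₁ = eval (v ∷ u ∷ []) p q
        l₂ = eval (v ∷ u ∷ []) p′ q′

  gauss⇒typeII : ∀ γ {ξ} → GaussAlong (möbius γ) ξ → IsTypeII ξ
  gauss⇒typeII γ {ξ} G with total ∣ GL₂.m₂₁ γ ∣ ∣ GL₂.m₂₂ γ ∣
  ... | inj₁ le = tilt {ξ} C-pos m₁₁ m₁₂ m₂₁ m₂₂ det≉0 le linear
    where
    open GL₂ γ
    open GaussAlong G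
  ... | inj₂ le = tilt {ξ} C-pos m₁₂ m₁₁ m₂₂ m₂₁
      (λ e → -‿≉0 det≉0 (trans (solve 4 (λ a b c d → :- (a :* d :- b :* c) := b :* c :- a :* d) refl m₁₁ m₁₂ m₂₁ m₂₂) e))
      le (λ l → ℝ.trans (linear l) (ℝ.⊔-comm _ _))
    where
    open GL₂ γ
    open GaussAlong G

  trident⇒gauss : ∀ {d} {φ : RationalMap d} {P} → Trident φ P → ∃[ γ ] GaussAlong (möbius γ) P
  trident⇒gauss {P = P} T = γ , record { C = C ; C-pos = C-pos ; linear = linear }
    where
    open Trident T
    open ℙ¹ᴮᵉʳᵏ P
    open import Relation.Binary.Reasoning.Setoid ℝ.setoid
    d₁₂ d₁₃ d₂₃ : Carrier
    d₁₂ = bracket α₁ α₂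
    d₁₃ = bracket α₁ α₃
    d₂₃ = bracket α₂ α₃
    γ : GL₂
    γ = record
      { m₁₁ = d₁₃ * xᶜ α₂ ; m₁₂ = d₂₃ * xᶜ α₁
      ; m₂₁ = d₁₃ * yᶜ α₂ ; m₂₂ = d₂₃ * yᶜ α₁
      ; det≉0 = λ e → -‿≉0 (*≉0 (*≉0 distinct₁₃ distinct₂₃) distinct₁₂)
          (trans (solve 6 (λ d e x y x′ y′ → :- ((d :* e) :* (y′ :* x :- x′ :* y)) := (d :* x′) :* (e :* y) :- (e :* x) :* (d :* y′))
            refl d₁₃ d₂₃ (xᶜ α₁) (yᶜ α₁) (xᶜ α₂) (yᶜ α₂)) e) }
    R : ℝ.Carrier
    R = ∣ d₂₃ ∣ ℝ.* ∥ vanishingAt α₁ ∥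
    R≈ : ∣ d₁₃ ∣ ℝ.* ∥ vanishingAt α₂ ∥ ℝ.≈ R
    R≈ = antisym
      (≤-respˡ-≈ (ℝ.*-congʳ (ℝ.trans (∣∣-cong (at-vanishing α₃ α₁)) (bracket-flip α₃ α₁))) (proj₂ (orthogonal₂₃ (vanishingAt α₁))))
      (≤-respˡ-≈ (ℝ.*-congʳ (ℝ.trans (∣∣-cong (at-vanishing α₃ α₂)) (bracket-flip α₃ α₂))) (proj₂ (orthogonal₁₃ (vanishingAt α₂))))
    exact : ∀ (f : Form 1) → ∣ d₁₂ ∣ ℝ.* ∥ f ∥ ℝ.≈
      (∣ at α₂ f ∣ ℝ.* ∥ vanishingAt α₁ ∥) ℝ.⊔ᴿ (∣ at α₁ f ∣ ℝ.* ∥ vanishingAt α₂ ∥)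
    exact f = antisym (bracket-upper P α₁ α₂ f (ℝ.x≤y⊔x _ _) (ℝ.x≤x⊔y _ _))
      (ℝ.⊔-lub (proj₂ (orthogonal₁₂ f)) (proj₁ (orthogonal₁₂ f)))
    scaled : ∀ (f : Form 1) → ∣ d₁₃ * d₂₃ ∣ ℝ.* (∣ d₁₂ ∣ ℝ.* ∥ f ∥) ℝ.≈ R ℝ.* linear-max (möbius γ) f
    scaled f = begin
      ∣ d₁₃ * d₂₃ ∣ ℝ.* (∣ d₁₂ ∣ ℝ.* ∥ f ∥)
        ≈⟨ ℝ.*-cong (∣∣-* _ _) (exact f) ⟩
      (∣ d₁₃ ∣ ℝ.* ∣ d₂₃ ∣) ℝ.* ((∣ at α₂ f ∣ ℝ.* ∥ vanishingAt α₁ ∥) ℝ.⊔ᴿ (∣ at α₁ f ∣ ℝ.* ∥ vanishingAt α₂ ∥))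
        ≈⟨ ℝ.*-distribˡ-⊔ _ _ (ℝ.*-nonneg (∣∣-nonneg _) (∣∣-nonneg _)) ⟩
      _ ≈⟨ ℝ.⊔-cong
             (ℝ.trans (ℝ.solve 4 (λ s t a n → (s ℝ.:* t) ℝ.:* (a ℝ.:* n) ℝ.:= (t ℝ.:* n) ℝ.:* (s ℝ.:* a)) ℝ.refl _ _ _ _)
               (ℝ.*-congˡ (ℝ.trans (ℝ.sym (∣∣-* _ _)) (∣∣-cong (column f d₁₃ α₂)))))
             (ℝ.trans (ℝ.solve 4 (λ s t a n → (s ℝ.:* t) ℝ.:* (a ℝ.:* n) ℝ.:= (s ℝ.:* n) ℝ.:* (t ℝ.:* a)) ℝ.refl _ _ _ _)
               (ℝ.*-cong R≈ (ℝ.trans (ℝ.sym (∣∣-* _ _)) (∣∣-cong (column f d₂₃ α₁))))) ⟩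
      _ ≈⟨ ℝ.*-distribˡ-⊔ _ _ 0≤R ⟨
      R ℝ.* linear-max (möbius γ) f ∎
      where
      0≤R : ℝ.0# ≤ R
      0≤R = ℝ.*-nonneg (∣∣-nonneg _) (∥∥-nonneg (vanishingAt α₁))
      column : ∀ f s α → s * at α f ≈ eval f (s * xᶜ α) (s * yᶜ α)
      column f s α = sym (trans (eval-homogeneous f s (xᶜ α) (yᶜ α)) (*-congʳ (*-identityʳ s)))
    R-pos : ℝ.0# < R
    R-pos = ℝ.nonneg⇒pos (ℝ.*-nonneg (∣∣-nonneg _) (∥∥-nonneg (vanishingAt α₁))) λ R≈0 →
      nonzero (vanish R≈0 X , vanish R≈0 Y)
      where
      vanish : R ℝ.≈ ℝ.0# → ∀ (f : Form 1) → ∥ f ∥ ℝ.≈ ℝ.0#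
      vanish R≈0 f = ℝ.x*y≈0⇒y≈0 (∣∣≉0 distinct₁₂) (ℝ.x*y≈0⇒y≈0 (∣∣≉0 (*≉0 distinct₁₃ distinct₂₃))
        (ℝ.trans (scaled f) (ℝ.trans (ℝ.*-congʳ R≈0) (ℝ.zeroˡ _))))
    R≉0 = ℝ.<⇒≉0 R-pos
    C : ℝ.Carrier
    C = R≉0 ℝ.⁻¹ ℝ.* (∣ d₁₃ * d₂₃ ∣ ℝ.* ∣ d₁₂ ∣)
    C-pos : ℝ.0# < C
    C-pos = ℝ.*-pos (ℝ.⁻¹-pos R-pos) (ℝ.*-pos (∣∣-pos (*≉0 distinct₁₃ distinct₂₃)) (∣∣-pos distinct₁₂))
    linear : ∀ (f : Form 1) → C ℝ.* ∥ f ∥ ℝ.≈ linear-max (möbius γ) f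
    linear f = begin
      C ℝ.* ∥ f ∥                                        ≈⟨ ℝ.solve 4 (λ q′⁻¹ s t n → (q′⁻¹ ℝ.:* (s ℝ.:* t)) ℝ.:* n ℝ.:= q′⁻¹ ℝ.:* (s ℝ.:* (t ℝ.:* n))) ℝ.refl _ _ _ _ ⟩
      R≉0 ℝ.⁻¹ ℝ.* (∣ d₁₃ * d₂₃ ∣ ℝ.* (∣ d₁₂ ∣ ℝ.* ∥ f ∥)) ≈⟨ ℝ.*-congˡ (scaled f) ⟩
      R≉0 ℝ.⁻¹ ℝ.* (R ℝ.* linear-max (möbius γ) f)       ≈⟨ ℝ.solve 3 (λ q′⁻¹ q m → q′⁻¹ ℝ.:* (q ℝ.:* m) ℝ.:= q ℝ.:* (q′⁻¹ ℝ.:* m)) ℝ.refl _ _ _ ⟩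
      R ℝ.* (R≉0 ℝ.⁻¹ ℝ.* linear-max (möbius γ) f)       ≈⟨ ℝ.divide R≉0 _ ⟩
      linear-max (möbius γ) f                            ∎

  module _ (γ : GL₂) where
    open GL₂ γ

    private
      module 𝕜 = FieldProperties em residueField

    -- γ⁻¹(α) in homogeneous coordinates in 𝒪 without common factor, up to the scalar d.
    record Normalised (α : ℙ 1) : Set (r ⊔ ℓ₁ ⊔ ℓ₂ ⊔ c ⊔ ℓ) where
      field
        xₙ yₙ      : 𝒪
        unimodular : xₙ k.≉ k.0# ⊎ yₙ k.≉ k.0#
        dₙ         : Carrier
        dₙ≉0       : dₙ ≉ 0#
        x-coord    : m₂₂ * xᶜ α - m₁₂ * yᶜ α ≈ dₙ * value xₙ
        y-coord    : m₁₁ * yᶜ α - m₂₁ * xᶜ α ≈ dₙ * value yₙ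

    open Normalised public

    abstract
      normalForm : ∀ α → Normalised α
      normalForm α = [ small-u , small-w ]′ (total ∣ u ∣ ∣ w ∣)
        where
        u w : Carrier
        u = m₂₂ * xᶜ α - m₁₂ * yᶜ α
        w = m₁₁ * yᶜ α - m₂₁ * xᶜ α
        not-both : u ≈ 0# → w ≈ 0# → ∀ {p} {A : Set p} → A
        not-both u≈0 w≈0 = impossible (coords α) (ℙ.nonzero α)
          (x*y≈0⇒y≈0 det≉0 (trans (solve 6 (λ a b c d x y → (a :* d :- b :* c) :* x := a :* (d :* x :- b :* y) :+ b :* (a :* y :- c :* x)) refl m₁₁ m₁₂ m₂₁ m₂₂ (xᶜ α) (yᶜ α)) (kill m₁₁ m₁₂)))
          (x*y≈0⇒y≈0 det≉0 (trans (solve 6 (λ a b c d x y → (a :* d :- b :* c) :* y := c :* (d :* x :- b :* y) :+ d :* (a :* y :- c :* x)) refl m₁₁ m₁₂ m₂₁ m₂₂ (xᶜ α) (yᶜ α)) (kill m₂₁ m₂₂)))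
          where
          kill : ∀ s t → s * u + t * w ≈ 0#
          kill s t = trans (+-cong (trans (*-congˡ u≈0) (zeroʳ s)) (trans (*-congˡ w≈0) (zeroʳ t))) (+-identityˡ 0#)
          impossible : ∀ (v : Vec Carrier 2) → Any (_≉ 0#) v → head v ≈ 0# → head (tail v) ≈ 0# → ∀ {p} {A : Set p} → A
          impossible (x ∷ y ∷ []) (here x≉0)         ex ey = contradiction ex x≉0
          impossible (x ∷ y ∷ []) (there (here y≉0)) ex ey = contradiction ey y≉0
        small-u : ∣ u ∣ ≤ ∣ w ∣ → Normalised α
        small-u u≤w = record
          { xₙ = w≉0 ⁻¹ * u , quotient-integral w≉0 u≤w ; yₙ = k.1#
          ; unimodular = inj₂ 𝕜.1≉0 ; dₙ = w ; dₙ≉0 = w≉0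
          ; x-coord = sym (divide w≉0 u) ; y-coord = sym (*-identityʳ w) }
          where
          w≉0 : w ≉ 0#
          w≉0 w≈0 = not-both (∣x∣≤0⇒x≈0 (≤-respʳ-≈ (∣≈0∣ w≈0) u≤w)) w≈0
        small-w : ∣ w ∣ ≤ ∣ u ∣ → Normalised α
        small-w w≤u = record
          { xₙ = k.1# ; yₙ = u≉0 ⁻¹ * w , quotient-integral u≉0 w≤u
          ; unimodular = inj₁ 𝕜.1≉0 ; dₙ = u ; dₙ≉0 = u≉0
          ; x-coord = sym (*-identityʳ u) ; y-coord = sym (divide u≉0 w) }
          where
          u≉0 : u ≉ 0#
          u≉0 u≈0 = not-both u≈0 (∣x∣≤0⇒x≈0 (≤-respʳ-≈ (∣≈0∣ u≈0) w≤u))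

    bracketₖ : ∀ {α β} → Normalised α → Normalised β → 𝒪
    bracketₖ a b = yₙ b k.* xₙ a k.- xₙ b k.* yₙ a

    det-bracket : ∀ {α β} (a : Normalised α) (b : Normalised β) →
      det γ * bracket α β ≈ (dₙ a * dₙ b) * value (bracketₖ a b)
    det-bracket {α} {β} a b = trans
      (solve 8 (λ m n p q x y x′ y′ → (m :* q :- n :* p) :* (y′ :* x :- x′ :* y) :=
         (m :* y′ :- p :* x′) :* (q :* x :- n :* y) :- (q :* x′ :- n :* y′) :* (m :* y :- p :* x))
        refl m₁₁ m₁₂ m₂₁ m₂₂ (xᶜ α) (yᶜ α) (xᶜ β) (yᶜ β))
      (trans (+-cong (*-cong (y-coord b) (x-coord a)) (-‿cong (*-cong (x-coord b) (y-coord a))))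
        (solve 6 (λ d e x y x′ y′ → (e :* y′) :* (d :* x) :- (e :* x′) :* (d :* y) := (d :* e) :* (y′ :* x :- x′ :* y))
          refl (dₙ a) (dₙ b) (value (xₙ a)) (value (yₙ a)) (value (xₙ b)) (value (yₙ b))))

    ∣det-bracket∣ : ∀ {α β} (a : Normalised α) (b : Normalised β) →
      ∣ det γ ∣ ℝ.* ∣ bracket α β ∣ ℝ.≈ (∣ dₙ a ∣ ℝ.* ∣ dₙ b ∣) ℝ.* ∣ value (bracketₖ a b) ∣
    ∣det-bracket∣ a b = ℝ.trans (ℝ.sym (∣∣-* _ _)) (ℝ.trans (∣∣-cong (det-bracket a b))
      (ℝ.trans (∣∣-* _ _) (ℝ.*-congʳ (∣∣-* _ _))))

    max-unit : ∀ {p q : 𝒪} → p k.≉ k.0# ⊎ q k.≉ k.0# → ∣ value q ∣ ℝ.⊔ᴿ ∣ value p ∣ ℝ.≈ ℝ.1#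
    max-unit {p} {q} (inj₁ p≉0) = ℝ.trans (ℝ.⊔-cong ℝ.refl (≉0⇒unit {p} p≉0)) (ℝ.x≤y⇒x⊔y≈y (proj₂ q))
    max-unit {p} {q} (inj₂ q≉0) = ℝ.trans (ℝ.⊔-cong (≉0⇒unit {q} q≉0) ℝ.refl) (ℝ.x≤y⇒y⊔x≈y (proj₂ p))

    vanishing-max : ∀ {α} (a : Normalised α) → linear-max (möbius γ) (vanishingAt α) ℝ.≈ ∣ dₙ a ∣
    vanishing-max {α} a = begin
      ∣ eval (vanishingAt α) m₁₁ m₂₁ ∣ ℝ.⊔ᴿ ∣ eval (vanishingAt α) m₁₂ m₂₂ ∣
        ≈⟨ ℝ.⊔-cong
             (ℝ.trans (∣∣-cong (trans (solve 4 (λ m p x y → (:- x) :* (p :* con (+ 1)) :+ m :* y := m :* y :- p :* x) refl m₁₁ m₂₁ (xᶜ α) (yᶜ α)) (y-coord a))) (∣∣-* _ _))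
             (ℝ.trans (∣∣-cong (trans (solve 4 (λ n q x y → (:- x) :* (q :* con (+ 1)) :+ n :* y := :- (q :* x :- n :* y)) refl m₁₂ m₂₂ (xᶜ α) (yᶜ α)) (-‿cong (x-coord a)))) (ℝ.trans (∣-∣ _) (∣∣-* _ _))) ⟩
      (∣ dₙ a ∣ ℝ.* ∣ value (yₙ a) ∣) ℝ.⊔ᴿ (∣ dₙ a ∣ ℝ.* ∣ value (xₙ a) ∣)
        ≈⟨ ℝ.*-distribˡ-⊔ _ _ (∣∣-nonneg _) ⟨
      ∣ dₙ a ∣ ℝ.* (∣ value (yₙ a) ∣ ℝ.⊔ᴿ ∣ value (xₙ a) ∣)
        ≈⟨ ℝ.trans (ℝ.*-congˡ (max-unit (unimodular a))) (ℝ.*-identityʳ _) ⟩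
      ∣ dₙ a ∣ ∎
      where open import Relation.Binary.Reasoning.Setoid ℝ.setoid

    module _ {ξ} (G : GaussAlong (möbius γ) ξ) where
      open GaussAlong G
      open ℙ¹ᴮᵉʳᵏ ξ

      private
        det-pos : ℝ.0# < ∣ det γ ∣
        det-pos = ∣∣-pos det≉0

      orthogonal⇒distinct : ∀ {α β} (a : Normalised α) (b : Normalised β) →
        Orthogonal ξ α β → bracketₖ a b k.≉ k.0#
      orthogonal⇒distinct {α} {β} a b o = unit⇒≉0 {bracketₖ a b} (antisym (proj₂ (bracketₖ a b))
        (≤-trans (≤-reflexive (ℝ.sym (max-unit (unimodular b))))
          (ℝ.⊔-lub
            (coordinate (m₁₁ ∷ - m₂₁ ∷ []) (yₙ b) (trans (solve 4 (λ m p x y → m :* (y :* con (+ 1)) :+ x :* (:- p) := m :* y :- p :* x) refl m₁₁ m₂₁ (xᶜ β) (yᶜ β)) (y-coord b))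
              (ℝ.trans (ℝ.⊔-cong
                  (∣≈0∣ (solve 2 (λ m p → m :* (p :* con (+ 1)) :+ m :* (:- p) := con (+ 0)) refl m₁₁ m₂₁))
                  (∣∣-cong (solve 4 (λ m n p q → m :* (q :* con (+ 1)) :+ n :* (:- p) := m :* q :- n :* p) refl m₁₁ m₁₂ m₂₁ m₂₂)))
                (ℝ.x≤y⇒x⊔y≈y (∣∣-nonneg _))))
            (coordinate (- m₁₂ ∷ m₂₂ ∷ []) (xₙ b) (trans (solve 4 (λ n q x y → (:- n) :* (y :* con (+ 1)) :+ x :* q := q :* x :- n :* y) refl m₁₂ m₂₂ (xᶜ β) (yᶜ β)) (x-coord b))
              (ℝ.trans (ℝ.⊔-cong
                  (∣∣-cong (solve 4 (λ m n p q → (:- n) :* (p :* con (+ 1)) :+ m :* q := m :* q :- n :* p) refl m₁₁ m₁₂ m₂₁ m₂₂))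
                  (∣≈0∣ (solve 2 (λ n q → (:- n) :* (q :* con (+ 1)) :+ n :* q := con (+ 0)) refl m₁₂ m₂₂)))
                (ℝ.x≤y⇒y⊔x≈y (∣∣-nonneg _)))))))
        where
        open ≤-Reasoning
        coordinate : ∀ (f : Form 1) (z : 𝒪) → at β f ≈ dₙ b * value z → linear-max (möbius γ) f ℝ.≈ ∣ det γ ∣ →
          ∣ value z ∣ ≤ ∣ value (bracketₖ a b) ∣
        coordinate f z ez em′ = ℝ.*-cancelˡ-≤ (ℝ.*-pos (∣∣-pos (dₙ≉0 a)) (∣∣-pos (dₙ≉0 b))) (begin
          (∣ dₙ a ∣ ℝ.* ∣ dₙ b ∣) ℝ.* ∣ value z ∣
            ≈⟨ ℝ.solve 3 (λ p q z → (p ℝ.:* q) ℝ.:* z ℝ.:= (q ℝ.:* z) ℝ.:* p) ℝ.refl _ _ _ ⟩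
          (∣ dₙ b ∣ ℝ.* ∣ value z ∣) ℝ.* ∣ dₙ a ∣
            ≈⟨ ℝ.*-cong (ℝ.trans (∣∣-cong ez) (∣∣-* _ _)) (ℝ.trans (linear (vanishingAt α)) (vanishing-max a)) ⟨
          ∣ at β f ∣ ℝ.* (C ℝ.* ∥ vanishingAt α ∥)
            ≈⟨ ℝ.solve 3 (λ p q z → p ℝ.:* (q ℝ.:* z) ℝ.:= q ℝ.:* (p ℝ.:* z)) ℝ.refl _ _ _ ⟩
          C ℝ.* (∣ at β f ∣ ℝ.* ∥ vanishingAt α ∥)
            ≤⟨ ℝ.*-monoˡ-≤ (proj₁ C-pos) (proj₂ (o f)) ⟩
          C ℝ.* (∣ bracket α β ∣ ℝ.* ∥ f ∥)
            ≈⟨ ℝ.solve 3 (λ p q z → p ℝ.:* (q ℝ.:* z) ℝ.:= (p ℝ.:* z) ℝ.:* q) ℝ.refl _ _ _ ⟩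
          (C ℝ.* ∥ f ∥) ℝ.* ∣ bracket α β ∣
            ≈⟨ ℝ.*-congʳ (ℝ.trans (linear f) em′) ⟩
          ∣ det γ ∣ ℝ.* ∣ bracket α β ∣
            ≈⟨ ∣det-bracket∣ a b ⟩
          (∣ dₙ a ∣ ℝ.* ∣ dₙ b ∣) ℝ.* ∣ value (bracketₖ a b) ∣ ∎)

      distinct⇒orthogonal : ∀ {α β} (a : Normalised α) (b : Normalised β) →
        bracketₖ a b k.≉ k.0# → Orthogonal ξ α β
      distinct⇒orthogonal {α} {β} a b ne f =
        ≤-respʳ-≈ (ℝ.*-congʳ (bracket-flip β α)) (half b a (ℝ.trans (∣∣-cong swap) (ℝ.trans (∣-∣ _) (≉0⇒unit {bracketₖ a b} ne))) f) ,
        half a b (≉0⇒unit {bracketₖ a b} ne) f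
        where
        open ≤-Reasoning
        swap : value (bracketₖ b a) ≈ - value (bracketₖ a b)
        swap = solve 4 (λ x y x′ y′ → y :* x′ :- x :* y′ := :- (y′ :* x :- x′ :* y)) refl (value (xₙ a)) (value (yₙ a)) (value (xₙ b)) (value (yₙ b))
        half : ∀ {α β} (a : Normalised α) (b : Normalised β) → ∣ value (bracketₖ a b) ∣ ℝ.≈ ℝ.1# →
          ∀ (f : Form 1) → ∣ at β f ∣ ℝ.* ∥ vanishingAt α ∥ ≤ ∣ bracket α β ∣ ℝ.* ∥ f ∥
        half {α} {β} a b u f@(s ∷ t ∷ []) = ℝ.*-cancelˡ-≤ (ℝ.*-pos det-pos C-pos) (begin
          (∣ det γ ∣ ℝ.* C) ℝ.* (∣ at β f ∣ ℝ.* ∥ vanishingAt α ∥)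
            ≈⟨ ℝ.solve 4 (λ p q z w → (p ℝ.:* q) ℝ.:* (z ℝ.:* w) ℝ.:= (p ℝ.:* z) ℝ.:* (q ℝ.:* w)) ℝ.refl _ _ _ _ ⟩
          (∣ det γ ∣ ℝ.* ∣ at β f ∣) ℝ.* (C ℝ.* ∥ vanishingAt α ∥)
            ≈⟨ ℝ.*-cong (ℝ.trans (ℝ.sym (∣∣-* _ _)) (ℝ.trans (∣∣-cong image) (∣∣-* _ _))) (ℝ.trans (linear (vanishingAt α)) (vanishing-max a)) ⟩
          (∣ dₙ b ∣ ℝ.* ∣ value (xₙ b) * eval f m₁₁ m₂₁ + value (yₙ b) * eval f m₁₂ m₂₂ ∣) ℝ.* ∣ dₙ a ∣
            ≈⟨ ℝ.solve 3 (λ p z q → (p ℝ.:* z) ℝ.:* q ℝ.:= (q ℝ.:* p) ℝ.:* z) ℝ.refl _ _ _ ⟩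
          (∣ dₙ a ∣ ℝ.* ∣ dₙ b ∣) ℝ.* ∣ value (xₙ b) * eval f m₁₁ m₂₁ + value (yₙ b) * eval f m₁₂ m₂₂ ∣
            ≤⟨ ℝ.*-monoˡ-≤ (ℝ.*-nonneg (∣∣-nonneg _) (∣∣-nonneg _))
                 (∣+∣≤ (≤-trans (product≤ (proj₂ (xₙ b))) (ℝ.x≤x⊔y _ _)) (≤-trans (product≤ (proj₂ (yₙ b))) (ℝ.x≤y⊔x _ _))) ⟩
          (∣ dₙ a ∣ ℝ.* ∣ dₙ b ∣) ℝ.* linear-max (möbius γ) f
            ≈⟨ ℝ.*-cong (ℝ.sym (ℝ.trans (∣det-bracket∣ a b) (ℝ.trans (ℝ.*-congˡ u) (ℝ.*-identityʳ _)))) (ℝ.sym (linear f)) ⟩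
          (∣ det γ ∣ ℝ.* ∣ bracket α β ∣) ℝ.* (C ℝ.* ∥ f ∥)
            ≈⟨ ℝ.solve 4 (λ p q z w → (p ℝ.:* q) ℝ.:* (z ℝ.:* w) ℝ.:= (p ℝ.:* z) ℝ.:* (q ℝ.:* w)) ℝ.refl _ _ _ _ ⟩
          (∣ det γ ∣ ℝ.* C) ℝ.* (∣ bracket α β ∣ ℝ.* ∥ f ∥) ∎)
          where
          image : det γ * at β f ≈ dₙ b * (value (xₙ b) * eval f m₁₁ m₂₁ + value (yₙ b) * eval f m₁₂ m₂₂)
          image = trans (solve 8 (λ m n p q x y s t → let I = con (+ 1) in
              (m :* q :- n :* p) :* (s :* (y :* I) :+ x :* t) :=
                (q :* x :- n :* y) :* (s :* (p :* I) :+ m :* t) :+ (m :* y :- p :* x) :* (s :* (q :* I) :+ n :* t))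
              refl m₁₁ m₁₂ m₂₁ m₂₂ (xᶜ β) (yᶜ β) s t)
            (trans (+-cong (*-congʳ (x-coord b)) (*-congʳ (y-coord b)))
              (solve 5 (λ d x y e e′ → (d :* x) :* e :+ (d :* y) :* e′ := d :* (x :* e :+ y :* e′))
                refl (dₙ b) (value (xₙ b)) (value (yₙ b)) _ _))

  -- Reduction of a map at a type II point

  module 𝕜 where
    open FormProperties residueField public
    open FieldProperties em residueField public
    open QuadraticMaps em residueField public
    open IntegerSolver k.commutativeRing public

  private
    Bounded : ∀ {n} → ℝ.Carrier → Vec Carrier n → Set _
    Bounded s = VecAll.All (λ a → ∣ a ∣ ≤ s)

    identity : Lift 1
    identity = [ X , Y ]

    along-identity : ∀ {d} (f : Form d) t → along identity f t ≈ eval f (value t) 1#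
    along-identity f t = eval-arg f
      (solve 1 (λ t → con (+ 0) :* (con (+ 1) :* con (+ 1)) :+ t :* con (+ 1) := t) refl (value t))
      (solve 1 (λ t → con (+ 1) :* (con (+ 1) :* con (+ 1)) :+ t :* con (+ 0) := con (+ 1)) refl (value t))

    bounded-shifted : ∀ {n s t} p q r (g : Vec Carrier n) → ℝ.0# ≤ s → ℝ.0# ≤ t → ∣ p ∣ ≤ s → ∣ q ∣ ≤ s → ∣ r ∣ ≤ s ℝ.* t → Bounded t g →
      Bounded (s ℝ.* t) (zipWith _+_ (map (p *_) g ∷ʳ 0#) (r ∷ map (q *_) g))
    bounded-shifted p q r []      0≤s 0≤t bp bq br []       = ∣+∣≤ (≤-trans (≤-reflexive ∣0∣) (ℝ.*-nonneg 0≤s 0≤t)) br ∷ []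
    bounded-shifted p q r (a ∷ g) 0≤s 0≤t bp bq br (ba ∷ b) =
      ∣+∣≤ (times bp) br ∷ bounded-shifted p q (q * a) g 0≤s 0≤t bp bq (times bq) b
      where
      times : ∀ {p} → ∣ p ∣ ≤ _ → ∣ p * a ∣ ≤ _
      times bp = ≤-respˡ-≈ (ℝ.sym (∣∣-* _ a)) (ℝ.*-mono-≤ 0≤s (∣∣-nonneg a) bp ba)

    bounded-resp : ∀ {n s t} {f g : Vec Carrier n} → Pointwise _≈_ f g → s ℝ.≈ t → Bounded s f → Bounded t g
    bounded-resp []       e []       = []
    bounded-resp (p ∷ ps) e (b ∷ bs) = ≤-respˡ-≈ (∣∣-cong p) (≤-respʳ-≈ e b) ∷ bounded-resp ps e bs

    height-unique : ∀ {d e} {f : Form d} {g : Form e} {s} (v : GenericValue identity f) →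
      (∀ t → ∣ along identity f t ∣ ℝ.≈ ∣ along identity g t ∣) → Generic (λ t → ∣ along identity g t ∣ ℝ.≈ s) → height v ℝ.≈ s
    height-unique v e gen = proj₂ (generic-witness
      (generic-map₂ (λ t p q → ℝ.trans (ℝ.sym p) (ℝ.trans (e t) q)) (generic v) gen))

    -- Gauss's lemma.
    coefficients-bounded : ∀ {d} (f : Form d) (v : GenericValue identity f) → Bounded (height v) f
    coefficients-bounded = form-induction algClosed (λ f → (v : GenericValue identity f) → Bounded (height v) f)
      (λ {d} {f} {g} e b v → let w = genericValue identity f in
        bounded-resp e (height-unique {g = g} w (λ t → ∣∣-cong (eval-cong e refl refl)) (generic v)) (b w))
      (λ a v → upper v k.0# ∷ [])
      (λ { l@(p ∷ q ∷ []) g bl bg v → let lv = genericValue identity l ; gv = genericValue identity g in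
        bounded-resp ≋-refl
          (ℝ.sym (height-unique {g = l ⊛ g} v (λ t → ℝ.refl) (generic-map₂ (λ t e₁ e₂ → ℝ.trans (along-⊛ identity l g t) (ℝ.*-cong e₁ e₂)) (generic lv) (generic gv))))
          (bounded-shifted p q 0# g (nonneg lv) (nonneg gv) (VecAll.head (bl lv)) (VecAll.head (VecAll.tail (bl lv)))
            (≤-trans (≤-reflexive ∣0∣) (ℝ.*-nonneg (nonneg lv) (nonneg gv))) (bg gv)) })
      (λ { l@(p ∷ q ∷ []) v → let h = height-unique {g = l} v (λ t → ℝ.refl) (linear-generic identity l) in
          ≤-trans (≤-trans (≤-reflexive (∣∣-cong (at₀ p q))) (ℝ.x≤y⊔x _ _)) (≤-reflexive (ℝ.sym h))
        ∷ ≤-trans (≤-trans (≤-reflexive (∣∣-cong (at₁ p q))) (ℝ.x≤x⊔y _ _)) (≤-reflexive (ℝ.sym h)) ∷ [] })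
      where
      at₀ : ∀ p q → p ≈ eval (p ∷ q ∷ []) 0# 1#
      at₀ = solve 2 (λ p q → p := p :* (con (+ 1) :* con (+ 1)) :+ con (+ 0) :* q) refl
      at₁ : ∀ p q → q ≈ eval (p ∷ q ∷ []) 1# 0#
      at₁ = solve 2 (λ p q → q := p :* (con (+ 0) :* con (+ 1)) :+ con (+ 1) :* q) refl

  form-ext : ∀ {d} (f g : Form d) → (∀ x y → eval f x y ≈ eval g x y) → f ≋ g
  form-ext f g h = differences f g (bounded-resp ≋-refl v≈0 (coefficients-bounded (f ⊖ g) v))
    where
    v : GenericValue identity (f ⊖ g)
    v = genericValue identity (f ⊖ g)
    v≈0 : height v ℝ.≈ ℝ.0#
    v≈0 = height-unique {g = 0# ∷ []} v (λ t → ∣∣-cong (trans (eval-⊖ f g _ _) (x≈y⇒x-y≈0 (h _ _)))) (always λ t → ∣0∣)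
    differences : ∀ {n} (f g : Vec Carrier n) → Bounded ℝ.0# (zipWith _-_ f g) → Pointwise _≈_ f g
    differences []      []      []       = []
    differences (a ∷ f) (b ∷ g) (p ∷ ps) = x-y≈0⇒x≈y (∣x∣≤0⇒x≈0 p) ∷ differences f g ps

  values : ∀ {n} → Vec 𝒪 n → Vec Carrier n
  values = map value

  value-eval : ∀ {d} (f : k.Form d) x y → value (k.eval f x y) ≈ eval (values f) (value x) (value y)
  value-eval {zero}  (a ∷ []) x y = refl
  value-eval {suc d} (a ∷ f)  x y = +-cong (*-congˡ (value-^ (suc d))) (*-congˡ (value-eval f x y))
    where
    value-^ : ∀ n → value (y k.^ n) ≈ value y ^ n
    value-^ zero    = refl
    value-^ (suc n) = *-congˡ (value-^ n)

  residue-nonvanishing : ∀ {d} (f : k.Form d) → Any (k._≉ k.0#) f → Generic (λ t → k.eval f t k.1# k.≉ k.0#)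
  residue-nonvanishing f nz = generic-map
    (λ t e → unit⇒≉0 {k.eval f t k.1#} (ℝ.trans (∣∣-cong (agree t)) (antisym
      (≤-respˡ-≈ (∣∣-cong (agree t)) (proj₂ (k.eval f t k.1#)))
      (≤-trans (large (coefficients-bounded (values f) v) nz) (≤-reflexive (ℝ.sym e))))))
    (generic v)
    where
    v : GenericValue identity (values f)
    v = genericValue identity (values f)
    agree : ∀ t → value (k.eval f t k.1#) ≈ along identity (values f) t
    agree t = trans (value-eval f t k.1#) (sym (along-identity (values f) t))
    large : ∀ {n s} {f : Vec 𝒪 n} → Bounded s (values f) → Any (k._≉ k.0#) f → ℝ.1# ≤ s
    large {f = a ∷ f} (b ∷ bs) (here a≉0) = ≤-respˡ-≈ (≉0⇒unit {a} a≉0) b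
    large {f = a ∷ f} (b ∷ bs) (there p)  = large bs p

  module _ (γ : GL₂) where
    open GL₂ γ

    kpoint : ∀ {α} → Normalised γ α → 𝕜.Point
    kpoint n = xₙ n , yₙ n

    kpoint-nonzero : ∀ {α} (n : Normalised γ α) → 𝕜.Nonzero (kpoint n)
    kpoint-nonzero n = unimodular n

    vpoint : ∀ {α} → Normalised γ α → Point
    vpoint n = value (xₙ n) , value (yₙ n)

    value≉0 : ∀ {a : 𝒪} → a k.≉ k.0# → value a ≉ 0#
    value≉0 a≉0 e = a≉0 (≈⇒≡ₘ e)

    vpoint-nonzero : ∀ {α} (n : Normalised γ α) → Nonzero (vpoint n)
    vpoint-nonzero n = [ inj₁ ∘ value≉0 {xₙ n} , inj₂ ∘ value≉0 {yₙ n} ]′ (unimodular n)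

    private
      cross-generic : ∀ {α} (n : Normalised γ α) → Generic (λ t → ∣ cross (value t , 1#) (vpoint n) ∣ ℝ.≈ ℝ.1#)
      cross-generic n = generic-map
        (λ t e → ℝ.trans (∣∣-cong (solve 3 (λ x y t → y :* t :- x :* con (+ 1) := y :* t :+ (:- x)) refl (value (xₙ n)) (value (yₙ n)) (value t)))
          (ℝ.trans e (ℝ.trans (ℝ.⊔-cong ℝ.refl (∣-∣ _)) (max-unit γ {xₙ n} {yₙ n} (unimodular n)))))
        (affine-generic (value (yₙ n)) (- value (xₙ n)))

      γx γy : Carrier → Carrier → Carrier
      γx x y = eval (num (möbius γ)) x y
      γy x y = eval (den (möbius γ)) x y

      γx≈ : ∀ x y → γx x y ≈ m₁₁ * x + m₁₂ * y
      γx≈ x y = solve 4 (λ m n x y → n :* (y :* con (+ 1)) :+ x :* m := m :* x :+ n :* y) refl m₁₁ m₁₂ x y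

      γy≈ : ∀ x y → γy x y ≈ m₂₁ * x + m₂₂ * y
      γy≈ x y = solve 4 (λ m n x y → n :* (y :* con (+ 1)) :+ x :* m := m :* x :+ n :* y) refl m₂₁ m₂₂ x y

      cross-γ : ∀ {α} (n : Normalised γ α) x y → cross (γx x y , γy x y) (point α) ≈ dₙ n * cross (x , y) (vpoint n)
      cross-γ {α} n s t = trans (+-cong (*-congˡ (γx≈ s t)) (-‿cong (*-congˡ (γy≈ s t))))
        (trans (solve 8 (λ m n p q x y s t → y :* (m :* s :+ n :* t) :- x :* (p :* s :+ q :* t) := (m :* y :- p :* x) :* s :- (q :* x :- n :* y) :* t)
            refl m₁₁ m₁₂ m₂₁ m₂₂ (xᶜ α) (yᶜ α) s t)
          (trans (+-cong (*-congʳ (y-coord n)) (-‿cong (*-congʳ (x-coord n))))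
            (solve 5 (λ d x y s t → (d :* y) :* s :- (d :* x) :* t := d :* (y :* s :- x :* t)) refl (dₙ n) (value (xₙ n)) (value (yₙ n)) s t)))

    conjugate-num-eval : ∀ {e} (φ : Lift e) x y → eval (num (conjugate γ φ)) x y ≈
      m₂₂ * eval (num φ) (γx x y) (γy x y) - m₁₂ * eval (den φ) (γx x y) (γy x y)
    conjugate-num-eval φ x y = trans (eval-⊖ (m₂₂ · substitute (num φ) (möbius γ)) (m₁₂ · substitute (den φ) (möbius γ)) x y)
      (+-cong (trans (eval-· m₂₂ (substitute (num φ) (möbius γ)) x y) (*-congˡ (eval-substitute (num φ) (möbius γ) x y)))
        (-‿cong (trans (eval-· m₁₂ (substitute (den φ) (möbius γ)) x y) (*-congˡ (eval-substitute (den φ) (möbius γ) x y)))))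

    conjugate-den-eval : ∀ {e} (φ : Lift e) x y → eval (den (conjugate γ φ)) x y ≈
      m₁₁ * eval (den φ) (γx x y) (γy x y) - m₂₁ * eval (num φ) (γx x y) (γy x y)
    conjugate-den-eval φ x y = trans (eval-⊖ (m₁₁ · substitute (den φ) (möbius γ)) (m₂₁ · substitute (num φ) (möbius γ)) x y)
      (+-cong (trans (eval-· m₁₁ (substitute (den φ) (möbius γ)) x y) (*-congˡ (eval-substitute (den φ) (möbius γ) x y)))
        (-‿cong (trans (eval-· m₂₁ (substitute (num φ) (möbius γ)) x y) (*-congˡ (eval-substitute (num φ) (möbius γ) x y)))))

    -- The normalised lift L of γ⁻¹ ∘ φ ∘ γ in terms of the fixed points γ⁻¹(αᵢ).
    module Model (φ : RationalMap 2) (L : k.Lift 2) (e : Carrier) (e≉0 : e ≉ 0#)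
                 (num-lift : Pointwise (λ x y → e * x ≈ value y) (num (conjugate γ (lift φ))) (k.num L))
                 (den-lift : Pointwise (λ x y → e * x ≈ value y) (den (conjugate γ (lift φ))) (k.den L)) where

      private
        f′ = values (k.num L)
        g′ = values (k.den L)
        F = num (lift φ)
        G = den (lift φ)

        scaled-eval : ∀ {n} {f : Form n} {g : Vec 𝒪 (suc n)} → Pointwise (λ x y → e * x ≈ value y) f g → ∀ x y → eval (values g) x y ≈ e * eval f x y
        scaled-eval {f = f} h x y = trans (eval-cong (pointwise h) refl refl) (eval-· e f x y)
          where
          pointwise : ∀ {n} {f : Vec Carrier n} {g : Vec 𝒪 n} → Pointwise (λ x y → e * x ≈ value y) f g → Pointwise _≈_ (values g) (map (e *_) f)
          pointwise []       = []
          pointwise (p ∷ ps) = sym p ∷ pointwise ps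

      num-eval : ∀ x y → eval f′ x y ≈ e * (m₂₂ * eval F (γx x y) (γy x y) - m₁₂ * eval G (γx x y) (γy x y))
      num-eval x y = trans (scaled-eval num-lift x y) (*-congˡ (conjugate-num-eval (lift φ) x y))

      den-eval : ∀ x y → eval g′ x y ≈ e * (m₁₁ * eval G (γx x y) (γy x y) - m₂₁ * eval F (γx x y) (γy x y))
      den-eval x y = trans (scaled-eval den-lift x y) (*-congˡ (conjugate-den-eval (lift φ) x y))

      module _ {α₁ α₂ α₃ a} (form : HasFixedForm F G a (point α₁) (point α₂) (point α₃))
               (n₁ : Normalised γ α₁) (n₂ : Normalised γ α₂) (n₃ : Normalised γ α₃) where

        private
          p₁ = vpoint n₁
          p₂ = vpoint n₂
          p₃ = vpoint n₃

        leading : Carrier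
        leading = (e * a) * (dₙ n₁ * (dₙ n₂ * dₙ n₃))

        private
          fixed-eval : ∀ x y → eval f′ x y * y - eval g′ x y * x ≈
            leading * (cross (x , y) p₁ * (cross (x , y) p₂ * cross (x , y) p₃))
          fixed-eval x y = begin
            eval f′ x y * y - eval g′ x y * x
              ≈⟨ +-cong (*-congʳ (num-eval x y)) (-‿cong (*-congʳ (den-eval x y))) ⟩
            e * (m₂₂ * u - m₁₂ * w) * y - e * (m₁₁ * w - m₂₁ * u) * x
              ≈⟨ solve 9 (λ e m n p q u w x y → e :* (q :* u :- n :* w) :* y :- e :* (m :* w :- p :* u) :* x :=
                   e :* (u :* (p :* x :+ q :* y) :- w :* (m :* x :+ n :* y))) refl e m₁₁ m₁₂ m₂₁ m₂₂ u w x y ⟩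
            e * (u * (m₂₁ * x + m₂₂ * y) - w * (m₁₁ * x + m₁₂ * y))
              ≈⟨ *-congˡ (+-cong (*-congˡ (sym (γy≈ x y))) (-‿cong (*-congˡ (sym (γx≈ x y))))) ⟩
            e * (u * γy x y - w * γx x y)
              ≈⟨ *-congˡ (fixed-equation F G (point α₁) (point α₂) (point α₃) form (γx x y , γy x y)) ⟩
            e * (a * (cross γp (point α₁) * (cross γp (point α₂) * cross γp (point α₃))))
              ≈⟨ *-congˡ (*-congˡ (*-cong (cross-γ n₁ x y) (*-cong (cross-γ n₂ x y) (cross-γ n₃ x y)))) ⟩
            e * (a * ((dₙ n₁ * cross (x , y) p₁) * ((dₙ n₂ * cross (x , y) p₂) * (dₙ n₃ * cross (x , y) p₃))))
              ≈⟨ solve 8 (λ e a r s t u v w → e :* (a :* ((r :* u) :* ((s :* v) :* (t :* w)))) := ((e :* a) :* (r :* (s :* t))) :* (u :* (v :* w)))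
                   refl e a (dₙ n₁) (dₙ n₂) (dₙ n₃) _ _ _ ⟩
            leading * (cross (x , y) p₁ * (cross (x , y) p₂ * cross (x , y) p₃)) ∎
            where
            open import Relation.Binary.Reasoning.Setoid setoid
            u = eval F (γx x y) (γy x y)
            w = eval G (γx x y) (γy x y)
            γp = γx x y , γy x y

          line-eval : ∀ p x y → eval (line p) x y ≈ cross (x , y) p
          line-eval (x′ , y′) x y = solve 4 (λ x y x′ y′ → (:- x′) :* (y :* con (+ 1)) :+ x :* y′ := y′ :* x :- x′ :* y) refl x y x′ y′

        value-form : HasFixedForm f′ g′ leading p₁ p₂ p₃
        value-form = fixedForm f′ g′ p₁ p₂ p₃ (form-ext _ _ λ x y → begin
          eval (timesY f′ ⊖ timesX g′) x y
            ≈⟨ eval-⊖ (timesY f′) (timesX g′) x y ⟩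
          eval (timesY f′) x y - eval (timesX g′) x y
            ≈⟨ +-cong (trans (eval-timesY f′ x y) (*-comm _ _)) (-‿cong (trans (eval-timesX g′ x y) (*-comm _ _))) ⟩
          eval f′ x y * y - eval g′ x y * x
            ≈⟨ fixed-eval x y ⟩
          leading * (cross (x , y) p₁ * (cross (x , y) p₂ * cross (x , y) p₃))
            ≈⟨ *-congˡ (*-cong (line-eval p₁ x y) (*-cong (line-eval p₂ x y) (line-eval p₃ x y))) ⟨
          leading * (eval (line p₁) x y * (eval (line p₂) x y * eval (line p₃) x y))
            ≈⟨ *-congˡ (trans (eval-⊛ (line p₁) (line p₂ ⊛ line p₃) x y) (*-congˡ (eval-⊛ (line p₂) (line p₃) x y))) ⟨
          leading * eval (line p₁ ⊛ (line p₂ ⊛ line p₃)) x y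
            ≈⟨ eval-· leading (line p₁ ⊛ (line p₂ ⊛ line p₃)) x y ⟨
          eval (leading · (line p₁ ⊛ (line p₂ ⊛ line p₃))) x y ∎)
          where open import Relation.Binary.Reasoning.Setoid setoid

        -- Abstract, so that values in 𝒪 are compared without unfolding this proof.
        abstract
          leading-integral : Integral leading
          leading-integral =
            let (t , (e₁ , e₂) , e₃) = generic-witness (generic-map₂ (λ t p q → p , q)
                  (generic-map₂ (λ t p q → p , q) (cross-generic n₁) (cross-generic n₂)) (cross-generic n₃))
                w = k.eval (k.num L) t k.1# k.* k.1# k.- k.eval (k.den L) t k.1# k.* t
            in ≤-respˡ-≈ (ℝ.trans (∣∣-cong (trans (+-cong (*-congʳ (value-eval (k.num L) t k.1#)) (-‿cong (*-congʳ (value-eval (k.den L) t k.1#))))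
                    (trans (fixed-eval (value t) 1#) (*-comm _ _))))
                 (ℝ.trans (∣∣-* _ _) (ℝ.trans (ℝ.*-congʳ (ℝ.trans (∣∣-* _ _) (ℝ.trans (ℝ.*-cong e₁ (ℝ.trans (∣∣-* _ _) (ℝ.trans (ℝ.*-cong e₂ e₃) (ℝ.*-identityˡ _)))) (ℝ.*-identityˡ _)))) (ℝ.*-identityˡ _))))
               (proj₂ w)

        leadingₖ : 𝒪
        leadingₖ = leading , leading-integral

        residue-form : 𝕜.HasFixedForm (k.num L) (k.den L) leadingₖ (kpoint n₁) (kpoint n₂) (kpoint n₃)
        residue-form = go (k.num L) (k.den L) value-form
          where
          go : ∀ (f g : k.Form 2) → HasFixedForm (values f) (values g) leading p₁ p₂ p₃ →
               𝕜.HasFixedForm f g leadingₖ (kpoint n₁) (kpoint n₂) (kpoint n₃)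
          go (_ ∷ _ ∷ _ ∷ []) (_ ∷ _ ∷ _ ∷ []) (e₀ , e₁ , e₂ , e₃) = ≈⇒≡ₘ e₀ , ≈⇒≡ₘ e₁ , ≈⇒≡ₘ e₂ , ≈⇒≡ₘ e₃

        scalingₖ : 𝒪
        scalingₖ = 𝕜.scaling (k.den L) leadingₖ (kpoint n₁) (kpoint n₂) (kpoint n₃)

        private
          value-scaling : value scalingₖ ≈ scaling g′ leading p₁ p₂ p₃
          value-scaling = go (k.den L)
            where
            go : ∀ (g : k.Form 2) → value (𝕜.scaling g leadingₖ (kpoint n₁) (kpoint n₂) (kpoint n₃)) ≈ scaling (values g) leading p₁ p₂ p₃
            go (_ ∷ _ ∷ _ ∷ []) = refl

          μ = scaling G a (point α₁) (point α₂) (point α₃)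
          s = scaling g′ leading p₁ p₂ p₃
          Δ = det γ

          γ-adjugate-x : γx (dₙ n₁ * value (xₙ n₁)) (dₙ n₁ * value (yₙ n₁)) ≈ Δ * xᶜ α₁
          γ-adjugate-x = trans (γx≈ _ _) (trans (+-cong (*-congˡ (sym (x-coord n₁))) (*-congˡ (sym (y-coord n₁))))
            (solve 6 (λ m n p q x y → m :* (q :* x :- n :* y) :+ n :* (m :* y :- p :* x) := (m :* q :- n :* p) :* x) refl m₁₁ m₁₂ m₂₁ m₂₂ (xᶜ α₁) (yᶜ α₁)))
          γ-adjugate-y : γy (dₙ n₁ * value (xₙ n₁)) (dₙ n₁ * value (yₙ n₁)) ≈ Δ * yᶜ α₁
          γ-adjugate-y = trans (γy≈ _ _) (trans (+-cong (*-congˡ (sym (x-coord n₁))) (*-congˡ (sym (y-coord n₁))))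
            (solve 6 (λ m n p q x y → p :* (q :* x :- n :* y) :+ q :* (m :* y :- p :* x) := (m :* q :- n :* p) :* y) refl m₁₁ m₁₂ m₂₁ m₂₂ (xᶜ α₁) (yᶜ α₁)))

          at-γ : ∀ (f : Form 2) → eval f (γx (dₙ n₁ * value (xₙ n₁)) (dₙ n₁ * value (yₙ n₁))) (γy (dₙ n₁ * value (xₙ n₁)) (dₙ n₁ * value (yₙ n₁))) ≈
                 Δ ^ 2 * eval f (xᶜ α₁) (yᶜ α₁)
          at-γ f = trans (eval-arg f γ-adjugate-x γ-adjugate-y) (eval-homogeneous f Δ _ _)

          F≈ : eval F (xᶜ α₁) (yᶜ α₁) ≈ μ * xᶜ α₁
          F≈ = num-scaling F G (point α₁) (point α₂) (point α₃) form
          G≈ : eval G (xᶜ α₁) (yᶜ α₁) ≈ μ * yᶜ α₁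
          G≈ = den-scaling F G (point α₁) (point α₂) (point α₃) form

          x-equation : (dₙ n₁ * value (xₙ n₁)) * (dₙ n₁ * s) ≈ (dₙ n₁ * value (xₙ n₁)) * (e * (Δ * Δ) * μ)
          x-equation = begin
            (dₙ n₁ * value (xₙ n₁)) * (dₙ n₁ * s)
              ≈⟨ solve 3 (λ d x s → (d :* x) :* (d :* s) := (d :* (d :* con (+ 1))) :* (s :* x)) refl (dₙ n₁) (value (xₙ n₁)) s ⟩
            dₙ n₁ ^ 2 * (s * value (xₙ n₁))
              ≈⟨ *-congˡ (num-scaling f′ g′ p₁ p₂ p₃ value-form) ⟨
            dₙ n₁ ^ 2 * eval f′ (value (xₙ n₁)) (value (yₙ n₁))
              ≈⟨ eval-homogeneous f′ (dₙ n₁) _ _ ⟨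
            eval f′ (dₙ n₁ * value (xₙ n₁)) (dₙ n₁ * value (yₙ n₁))
              ≈⟨ num-eval _ _ ⟩
            _ ≈⟨ *-congˡ (+-cong (*-congˡ (trans (at-γ F) (*-congˡ F≈))) (-‿cong (*-congˡ (trans (at-γ G) (*-congˡ G≈))))) ⟩
            e * (m₂₂ * (Δ ^ 2 * (μ * xᶜ α₁)) - m₁₂ * (Δ ^ 2 * (μ * yᶜ α₁)))
              ≈⟨ solve 7 (λ e q n D μ x y → e :* (q :* ((D :* (D :* con (+ 1))) :* (μ :* x)) :- n :* ((D :* (D :* con (+ 1))) :* (μ :* y))) :=
                   (q :* x :- n :* y) :* (e :* (D :* D) :* μ)) refl e m₂₂ m₁₂ Δ μ (xᶜ α₁) (yᶜ α₁) ⟩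
            (m₂₂ * xᶜ α₁ - m₁₂ * yᶜ α₁) * (e * (Δ * Δ) * μ)
              ≈⟨ *-congʳ (x-coord n₁) ⟩
            (dₙ n₁ * value (xₙ n₁)) * (e * (Δ * Δ) * μ) ∎
            where open import Relation.Binary.Reasoning.Setoid setoid

          y-equation : (dₙ n₁ * value (yₙ n₁)) * (dₙ n₁ * s) ≈ (dₙ n₁ * value (yₙ n₁)) * (e * (Δ * Δ) * μ)
          y-equation = begin
            (dₙ n₁ * value (yₙ n₁)) * (dₙ n₁ * s)
              ≈⟨ solve 3 (λ d x s → (d :* x) :* (d :* s) := (d :* (d :* con (+ 1))) :* (s :* x)) refl (dₙ n₁) (value (yₙ n₁)) s ⟩
            dₙ n₁ ^ 2 * (s * value (yₙ n₁))
              ≈⟨ *-congˡ (den-scaling f′ g′ p₁ p₂ p₃ value-form) ⟨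
            dₙ n₁ ^ 2 * eval g′ (value (xₙ n₁)) (value (yₙ n₁))
              ≈⟨ eval-homogeneous g′ (dₙ n₁) _ _ ⟨
            eval g′ (dₙ n₁ * value (xₙ n₁)) (dₙ n₁ * value (yₙ n₁))
              ≈⟨ den-eval _ _ ⟩
            _ ≈⟨ *-congˡ (+-cong (*-congˡ (trans (at-γ G) (*-congˡ G≈))) (-‿cong (*-congˡ (trans (at-γ F) (*-congˡ F≈))))) ⟩
            e * (m₁₁ * (Δ ^ 2 * (μ * yᶜ α₁)) - m₂₁ * (Δ ^ 2 * (μ * xᶜ α₁)))
              ≈⟨ solve 7 (λ e q n D μ x y → e :* (q :* ((D :* (D :* con (+ 1))) :* (μ :* x)) :- n :* ((D :* (D :* con (+ 1))) :* (μ :* y))) :=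
                   (q :* x :- n :* y) :* (e :* (D :* D) :* μ)) refl e m₁₁ m₂₁ Δ μ (yᶜ α₁) (xᶜ α₁) ⟩
            (m₁₁ * yᶜ α₁ - m₂₁ * xᶜ α₁) * (e * (Δ * Δ) * μ)
              ≈⟨ *-congʳ (y-coord n₁) ⟩
            (dₙ n₁ * value (yₙ n₁)) * (e * (Δ * Δ) * μ) ∎
            where open import Relation.Binary.Reasoning.Setoid setoid

          scaling-conjugate : dₙ n₁ * s ≈ e * (Δ * Δ) * μ
          scaling-conjugate = [ (λ x≉0 → *-cancelˡ (*≉0 (dₙ≉0 n₁) x≉0) x-equation)
                              , (λ y≉0 → *-cancelˡ (*≉0 (dₙ≉0 n₁) y≉0) y-equation) ]′ (vpoint-nonzero n₁)

        multiplier-equation : ∀ {λ′} → IsMultiplier φ α₁ λ′ →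
          value scalingₖ * (λ′ - 1#) ≈ leading * (value (bracketₖ γ n₁ n₂) * value (bracketₖ γ n₁ n₃))
        multiplier-equation {l} m = trans (*-congʳ value-scaling) (*-cancelˡ (dₙ≉0 n₁) (begin
          dₙ n₁ * (s * (l - 1#))                       ≈⟨ *-assoc _ _ _ ⟨
          (dₙ n₁ * s) * (l - 1#)                       ≈⟨ *-congʳ scaling-conjugate ⟩
          (e * (Δ * Δ) * μ) * (l - 1#)                ≈⟨ *-assoc _ _ _ ⟩
          e * (Δ * Δ) * (μ * (l - 1#))                ≈⟨ *-congˡ (multiplier-formula φ α₁ α₂ α₃ form m) ⟩
          e * (Δ * Δ) * (a * (bracket α₁ α₂ * bracket α₁ α₃))
            ≈⟨ solve 5 (λ e D a s t → e :* (D :* D) :* (a :* (s :* t)) := e :* a :* ((D :* s) :* (D :* t))) refl e Δ a _ _ ⟩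
          e * a * ((Δ * bracket α₁ α₂) * (Δ * bracket α₁ α₃))
            ≈⟨ *-congˡ (*-cong (det-bracket γ n₁ n₂) (det-bracket γ n₁ n₃)) ⟩
          e * a * ((dₙ n₁ * dₙ n₂ * value (bracketₖ γ n₁ n₂)) * (dₙ n₁ * dₙ n₃ * value (bracketₖ γ n₁ n₃)))
            ≈⟨ solve 7 (λ e a r s t u v → e :* a :* ((r :* s :* u) :* (r :* t :* v)) := r :* (((e :* a) :* (r :* (s :* t))) :* (u :* v)))
                 refl e a (dₙ n₁) (dₙ n₂) (dₙ n₃) _ _ ⟩
          dₙ n₁ * (leading * (value (bracketₖ γ n₁ n₂) * value (bracketₖ γ n₁ n₃))) ∎))
          where open import Relation.Binary.Reasoning.Setoid setoid

  -- Specialization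

  specializes-unique : ∀ {n} {v : Vec Carrier n} {w w′ : Vec 𝒪 n} →
    Specializes v w → Specializes v w′ → k.Proportional w w′
  specializes-unique {v = v} {w} {w′} (o , ((a , a≉0 , h) , u) , (c₁ , c₁≉0 , q)) (o′ , ((a′ , a′≉0 , h′) , u′) , (c₂ , c₂≉0 , q′)) =
    (c₂ k.* tₖ) k.* c₁≉0 𝕜.⁻¹ , 𝕜.*≉0 (𝕜.*≉0 c₂≉0 (unit⇒≉0 {tₖ} ∣t∣≈1)) (𝕜.x⁻¹≉0 c₁≉0) , combine h h′ q q′
    where
    t : Carrier
    t = a≉0 ⁻¹ * a′
    at≈a′ : a * t ≈ a′
    at≈a′ = divide a≉0 a′
    rescaled : ∀ {x} {y y′ : 𝒪} → a * x ≈ value y → a′ * x ≈ value y′ → t * value y ≈ value y′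
    rescaled {x} e e′ = trans (*-congˡ (sym e)) (trans (solve 3 (λ t a x → t :* (a :* x) := (a :* t) :* x) refl t a x) (trans (*-congʳ at≈a′) e′))
    large : ∀ {n} {v : Vec Carrier n} {o o′ : Vec 𝒪 n} → Pointwise (λ x y → a * x ≈ value y) v o → Pointwise (λ x y → a′ * x ≈ value y) v o′ →
      Any (λ y → ∣ value y ∣ ℝ.≈ ℝ.1#) o′ → ℝ.1# ≤ ∣ t ∣
    large {o = y ∷ _} {y′ ∷ _} (e ∷ _) (e′ ∷ _) (here p) = ≤-trans (≤-reflexive (ℝ.sym p))
      (≤-trans (≤-reflexive (∣∣-cong (trans (sym (rescaled {y = y} {y′} e e′)) (*-comm _ _)))) (product≤ (proj₂ y)))
    large (_ ∷ es) (_ ∷ es′) (there p) = large es es′ p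
    small : ∀ {n} {v : Vec Carrier n} {o o′ : Vec 𝒪 n} → Pointwise (λ x y → a * x ≈ value y) v o → Pointwise (λ x y → a′ * x ≈ value y) v o′ →
      Any (λ y → ∣ value y ∣ ℝ.≈ ℝ.1#) o → ∣ t ∣ ≤ ℝ.1#
    small {o = y ∷ _} {y′ ∷ _} (e ∷ _) (e′ ∷ _) (here p) = ≤-trans (≤-reflexive
      (ℝ.trans (ℝ.sym (∣unit*∣ p)) (∣∣-cong (trans (*-comm _ _) (rescaled {y = y} {y′} e e′))))) (proj₂ y′)
    small (_ ∷ es) (_ ∷ es′) (there p) = small es es′ p
    ∣t∣≈1 : ∣ t ∣ ℝ.≈ ℝ.1#
    ∣t∣≈1 = antisym (small h h′ u) (large h h′ u′)
    tₖ : 𝒪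
    tₖ = t , ≤-reflexive ∣t∣≈1
    combine : ∀ {n} {v : Vec Carrier n} {o o′ w w′ : Vec 𝒪 n} →
      Pointwise (λ x y → a * x ≈ value y) v o → Pointwise (λ x y → a′ * x ≈ value y) v o′ →
      Pointwise (λ x y → c₁ k.* x k.≈ y) o w → Pointwise (λ x y → c₂ k.* x k.≈ y) o′ w′ →
      Pointwise (λ x y → ((c₂ k.* tₖ) k.* c₁≉0 𝕜.⁻¹) k.* x k.≈ y) w w′
    combine [] [] [] [] = []
    combine {o = y ∷ _} {y′ ∷ _} {z ∷ _} {z′ ∷ _} (e ∷ es) (e′ ∷ es′) (p ∷ ps) (p′ ∷ ps′) =
      𝕜.transfer-proportion c₁ c₂ tₖ y y′ z z′ c₁≉0 (≈⇒≡ₘ (rescaled {y = y} {y′} e e′)) p p′ ∷ combine es es′ ps ps′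

  specializes-resp : ∀ {n} {v v′ : Vec Carrier n} {w} → Pointwise _≈_ v v′ → Specializes v w → Specializes v′ w
  specializes-resp eq (o , ((a , a≉0 , h) , u) , q) = o , ((a , a≉0 , go eq h) , u) , q
    where
    go : ∀ {n} {v v′ : Vec Carrier n} {o : Vec 𝒪 n} → Pointwise _≈_ v v′ → Pointwise (λ x y → a * x ≈ value y) v o → Pointwise (λ x y → a * x ≈ value y) v′ o
    go []       []       = []
    go (p ∷ ps) (q ∷ qs) = trans (*-congˡ (sym p)) q ∷ go ps qs

  2ₖ : 𝒪
  2ₖ = k.1# k.+ k.1#

  specializes-finite : ∀ (l₁ l₂ l₃ : 𝒪) {λ₁ λ₂ λ₃} → value l₁ ≈ λ₁ → value l₂ ≈ λ₂ → value l₃ ≈ λ₃ →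
    ∃[ x ] ∃[ y ] Specializes (sigmaPoint λ₁ λ₂ λ₃) (x ∷ y ∷ k.1# ∷ [])
  specializes-finite l₁ l₂ l₃ {λ₁} {λ₂} {λ₃} e₁ e₂ e₃ = x , y , (x ∷ y ∷ k.1# ∷ []) ,
    ((1# , 1≉0 , trans (*-identityˡ _) (+-cong (+-cong (sym e₁) (sym e₂)) (sym e₃))
               ∷ trans (*-identityˡ _) (+-cong (+-cong (*-cong (sym e₁) (sym e₂)) (*-cong (sym e₁) (sym e₃))) (*-cong (sym e₂) (sym e₃)))
               ∷ *-identityˡ _ ∷ []) , there (there (here ∣1∣))) ,
    (k.1# , 𝕜.1≉0 , k.*-identityˡ x ∷ k.*-identityˡ y ∷ k.*-identityˡ k.1# ∷ [])
    where
    x y : 𝒪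
    x = l₁ k.+ l₂ k.+ l₃
    y = l₁ k.* l₂ k.+ l₁ k.* l₃ k.+ l₂ k.* l₃

  -- λ₃ = 1/ν is large and the other two multipliers are integral.
  specializes-line : ∀ (l₁ l₂ ν : 𝒪) {λ₁ λ₂ λ₃} → value l₁ ≈ λ₁ → value l₂ ≈ λ₂ → value ν * λ₃ ≈ 1# → ν k.≈ k.0# →
    Specializes (sigmaPoint λ₁ λ₂ λ₃) (k.1# ∷ l₁ k.+ l₂ ∷ k.0# ∷ [])
  specializes-line l₁ l₂ ν {λ₁} {λ₂} {λ₃} e₁ e₂ eν ν≈0 = (x ∷ y ∷ ν ∷ []) ,
    ((value ν , *≉0ˡ (λ e → 1≉0 (trans (sym eν) e)) ,
      trans (solve 4 (λ n a b c → n :* (a :+ b :+ c) := n :* (a :+ b) :+ n :* c) refl (value ν) λ₁ λ₂ λ₃)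
        (+-cong (*-congˡ (+-cong (sym e₁) (sym e₂))) eν)
      ∷ trans (solve 4 (λ n a b c → n :* (a :* b :+ a :* c :+ b :* c) := n :* (a :* b) :+ (a :+ b) :* (n :* c)) refl (value ν) λ₁ λ₂ λ₃)
        (trans (+-cong (*-congˡ (*-cong (sym e₁) (sym e₂))) (*-cong (+-cong (sym e₁) (sym e₂)) eν)) (+-congˡ (*-identityʳ _)))
      ∷ *-identityʳ _ ∷ []) , here (≉0⇒unit {x} λ e → 𝕜.1≉0 (k.trans (k.sym x≈1) e))) ,
    (k.1# , 𝕜.1≉0 , k.trans (k.*-identityˡ x) x≈1 ∷ k.trans (k.*-identityˡ y) y≈ ∷ k.trans (k.*-identityˡ ν) ν≈0 ∷ [])
    where
    x y : 𝒪
    x = ν k.* (l₁ k.+ l₂) k.+ k.1#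
    y = ν k.* (l₁ k.* l₂) k.+ (l₁ k.+ l₂)
    kill : ∀ t → ν k.* t k.≈ k.0#
    kill t = k.trans (k.*-congʳ ν≈0) (k.zeroˡ t)
    x≈1 : x k.≈ k.1#
    x≈1 = k.trans (k.+-congʳ (kill (l₁ k.+ l₂))) (k.+-identityˡ k.1#)
    y≈ : y k.≈ l₁ k.+ l₂
    y≈ = k.trans (k.+-congʳ (kill (l₁ k.* l₂))) (k.+-identityˡ _)

  specializes-vertex : ∀ (ν₁ ν₂ l₃ : 𝒪) {λ₁ λ₂ λ₃} → value ν₁ * λ₁ ≈ 1# → value ν₂ * λ₂ ≈ 1# → value l₃ ≈ λ₃ →
    ν₁ k.≈ k.0# → ν₂ k.≈ k.0# → Specializes (sigmaPoint λ₁ λ₂ λ₃) (k.0# ∷ k.1# ∷ k.0# ∷ [])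
  specializes-vertex ν₁ ν₂ l₃ {λ₁} {λ₂} {λ₃} e₁ e₂ e₃ z₁ z₂ = (x ∷ y ∷ ν₁ k.* ν₂ ∷ []) ,
    ((value ν₁ * value ν₂ , *≉0 (*≉0ˡ (λ e → 1≉0 (trans (sym e₁) e))) (*≉0ˡ (λ e → 1≉0 (trans (sym e₂) e))) ,
      trans (solve 5 (λ m n a b c → (m :* n) :* (a :+ b :+ c) := n :* (m :* a) :+ m :* (n :* b) :+ (m :* n) :* c) refl (value ν₁) (value ν₂) λ₁ λ₂ λ₃)
        (+-cong (+-cong (trans (*-congˡ e₁) (*-identityʳ _)) (trans (*-congˡ e₂) (*-identityʳ _))) (*-congˡ (sym e₃)))
      ∷ trans (solve 5 (λ m n a b c → (m :* n) :* (a :* b :+ a :* c :+ b :* c) := (m :* a) :* (n :* b) :+ (n :* c) :* (m :* a) :+ (m :* c) :* (n :* b)) refl (value ν₁) (value ν₂) λ₁ λ₂ λ₃)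
        (+-cong (+-cong (trans (*-cong e₁ e₂) (*-identityʳ _)) (trans (*-congˡ e₁) (trans (*-identityʳ _) (*-congˡ (sym e₃)))))
          (trans (*-congˡ e₂) (trans (*-identityʳ _) (*-congˡ (sym e₃)))))
      ∷ *-identityʳ _ ∷ []) , there (here (≉0⇒unit {y} λ e → 𝕜.1≉0 (k.trans (k.sym y≈1) e)))) ,
    (k.1# , 𝕜.1≉0 , k.trans (k.*-identityˡ x) x≈0 ∷ k.trans (k.*-identityˡ y) y≈1 ∷ k.trans (k.*-identityˡ _) (kill z₁ ν₂) ∷ [])
    where
    x y : 𝒪
    x = ν₂ k.+ ν₁ k.+ (ν₁ k.* ν₂) k.* l₃
    y = k.1# k.+ ν₂ k.* l₃ k.+ ν₁ k.* l₃
    kill : ∀ {ν} → ν k.≈ k.0# → ∀ t → ν k.* t k.≈ k.0#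
    kill z t = k.trans (k.*-congʳ z) (k.zeroˡ t)
    x≈0 : x k.≈ k.0#
    x≈0 = k.trans (k.+-cong (k.+-cong z₂ z₁) (kill (kill z₁ ν₂) l₃)) (k.trans (k.+-identityʳ _) (k.+-identityʳ _))
    y≈1 : y k.≈ k.1#
    y≈1 = k.trans (k.+-cong (k.+-congˡ (kill z₂ l₃)) (kill z₁ l₃)) (k.trans (k.+-identityʳ _) (k.+-identityʳ _))

  integral-multiplier : ∀ (m s : 𝒪) {λ′} → m k.≉ k.0# → value m * (λ′ - 1#) ≈ value s →
    ∃[ l ] (value l ≈ λ′ × m k.* (l k.- k.1#) k.≈ s)
  integral-multiplier m s {λ′} m≉0 e = l , l≈ , ≈⇒≡ₘ (trans (*-congˡ (+-congʳ l≈)) e)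
    where
    vm≉0 : value m ≉ 0#
    vm≉0 e′ = m≉0 (≈⇒≡ₘ e′)
    quotientₖ : 𝒪
    quotientₖ = vm≉0 ⁻¹ * value s , quotient-integral vm≉0 (≤-trans (proj₂ s) (≤-reflexive (ℝ.sym (≉0⇒unit {m} m≉0))))
    l : 𝒪
    l = quotientₖ k.+ k.1#
    l≈ : value l ≈ λ′
    l≈ = trans (+-congʳ (*-cancelˡ vm≉0 (trans (divide vm≉0 (value s)) (sym e)))) (solve 1 (λ l → (l :- con (+ 1)) :+ con (+ 1) := l) refl λ′)

  large-multiplier : ∀ (m s : 𝒪) {λ′} → m k.≈ k.0# → s k.≉ k.0# → value m * (λ′ - 1#) ≈ value s →
    ∃[ ν ] (value ν * λ′ ≈ 1# × ν k.≈ k.0#)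
  large-multiplier m s {λ′} m≈0 s≉0 e = ν , νλ≈1 , 𝕜.x*y≈0⇒y≈0 t≉0 (k.trans (≈⇒≡ₘ (divide vt≉0 (value m))) m≈0)
    where
    t : 𝒪
    t = s k.+ m
    t≉0 : t k.≉ k.0#
    t≉0 t≈0 = s≉0 (k.trans (k.sym (k.trans (k.+-congˡ m≈0) (k.+-identityʳ s))) t≈0)
    vt≉0 : value t ≉ 0#
    vt≉0 e′ = t≉0 (≈⇒≡ₘ e′)
    ν : 𝒪
    ν = vt≉0 ⁻¹ * value m , quotient-integral vt≉0 (≤-trans (proj₂ m) (≤-reflexive (ℝ.sym (≉0⇒unit {t} t≉0))))
    νλ≈1 : value ν * λ′ ≈ 1#
    νλ≈1 = *-cancelˡ vt≉0 (trans (sym (*-assoc _ _ _)) (trans (*-congʳ (divide vt≉0 (value m)))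
      (trans (solve 2 (λ m l → m :* l := m :* (l :- con (+ 1)) :+ m) refl (value m) λ′) (trans (+-congʳ e) (sym (*-identityʳ _))))))

  -- L is a normalised lift of γ⁻¹ ∘ φ ∘ γ.
  record NormalLift (γ : GL₂) (φ : RationalMap 2) (L : k.Lift 2) : Set (r ⊔ ℓ₁ ⊔ ℓ₂ ⊔ c ⊔ ℓ) where
    field
      e        : Carrier
      e≉0      : e ≉ 0#
      num-lift : Pointwise (λ x y → e * x ≈ value y) (num (conjugate γ (lift φ))) (k.num L)
      den-lift : Pointwise (λ x y → e * x ≈ value y) (den (conjugate γ (lift φ))) (k.den L)
      nonzero  : Any (k._≉ k.0#) (k.num L) ⊎ Any (k._≉ k.0#) (k.den L)

  normalLift : ∀ γ (φ : RationalMap 2) L →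
    Normalizes (k.num L ++ k.den L) (num (conjugate γ (lift φ)) ++ den (conjugate γ (lift φ))) → NormalLift γ φ L
  normalLift γ φ L ((e , e≉0 , h) , u) = record
    { e = e ; e≉0 = e≉0
    ; num-lift = Pointwise.++ˡ⁻ (num (conjugate γ (lift φ))) (k.num L) h
    ; den-lift = Pointwise.++ʳ⁻ (num (conjugate γ (lift φ))) (k.num L) h
    ; nonzero  = Anyₚ.++⁻ (k.num L) (Any.map (λ {y} p → unit⇒≉0 {y} p) u) }

  Dependent : k.Lift 2 → Set _
  Dependent L = ∃[ p ] (𝕜.Nonzero p ×
    (∀ x y → proj₂ p k.* k.eval (k.num L) x y k.≈ proj₁ p k.* k.eval (k.den L) x y))

  multiplier-resp : ∀ (φ : RationalMap 2) {α l l′} → l ≈ l′ → IsMultiplier φ α l → IsMultiplier φ α l′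
  multiplier-resp φ e (finite h y≉0 z zy≈x der) = finite h y≉0 z zy≈x (trans (*-congʳ (sym e)) der)
  multiplier-resp φ e (infinite h y≈0 der)      = infinite h y≈0 (trans (*-congʳ (sym e)) der)

  Indifference : RationalMap 2 → 𝒪 → Set _
  Indifference φ x = (∃[ α ] ∃[ l ] IsIndifferent φ α l) ×
    (∀ α l → IsIndifferent φ α l → ∃[ m ] (l k.* m k.≈ k.1# × x k.≈ l k.+ m))

  value-scaling : ∀ (g : k.Form 2) A p₁ p₂ p₃ → value (𝕜.scaling g A p₁ p₂ p₃) ≈
    scaling (values g) (value A) (value (proj₁ p₁) , value (proj₂ p₁)) (value (proj₁ p₂) , value (proj₂ p₂)) (value (proj₁ p₃) , value (proj₂ p₃))
  value-scaling (_ ∷ _ ∷ _ ∷ []) A p₁ p₂ p₃ = refl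

  scaling-cong : ∀ (g : Form 2) {A B} p₁ p₂ p₃ → A ≈ B → scaling g A p₁ p₂ p₃ ≈ scaling g B p₁ p₂ p₃
  scaling-cong (_ ∷ _ ∷ _ ∷ []) p₁ p₂ p₃ e = +-congˡ (-‿cong (*-congʳ e))

  -- The reduction (f , g) of φ in some coordinates, with the reductions pᵢ of its fixed points.
  record ModelData (φ : RationalMap 2) {λ₁ λ₂ λ₃} (M : Marked φ λ₁ λ₂ λ₃) : Set (r ⊔ ℓ₁ ⊔ ℓ₂ ⊔ c ⊔ ℓ) where
    open Marked M
    field
      f g      : k.Form 2
      nonzero  : Any (k._≉ k.0#) f ⊎ Any (k._≉ k.0#) g
      A        : 𝒪
      p₁ p₂ p₃ : 𝕜.Point
      nz₁      : 𝕜.Nonzero p₁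
      nz₂      : 𝕜.Nonzero p₂
      nz₃      : 𝕜.Nonzero p₃
      ff       : 𝕜.HasFixedForm f g A p₁ p₂ p₃

      equation₁ : ∀ {λ′} → IsMultiplier φ α₁ λ′ → value (𝕜.scaling g A p₁ p₂ p₃) * (λ′ - 1#) ≈ value (A k.* (𝕜.cross p₁ p₂ k.* 𝕜.cross p₁ p₃))
      equation₂ : ∀ {λ′} → IsMultiplier φ α₂ λ′ → value (𝕜.scaling g A p₂ p₁ p₃) * (λ′ - 1#) ≈ value (A k.* (𝕜.cross p₂ p₁ k.* 𝕜.cross p₂ p₃))
      equation₃ : ∀ {λ′} → IsMultiplier φ α₃ λ′ → value (𝕜.scaling g A p₃ p₁ p₂) * (λ′ - 1#) ≈ value (A k.* (𝕜.cross p₃ p₁ k.* 𝕜.cross p₃ p₂))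

    M₁ M₂ M₃ c₁₂ c₁₃ c₂₃ : 𝒪
    M₁ = 𝕜.scaling g A p₁ p₂ p₃
    M₂ = 𝕜.scaling g A p₂ p₁ p₃
    M₃ = 𝕜.scaling g A p₃ p₁ p₂
    c₁₂ = 𝕜.cross p₁ p₂
    c₁₃ = 𝕜.cross p₁ p₃
    c₂₃ = 𝕜.cross p₂ p₃

  modelData : ∀ {γ φ L} → NormalLift γ φ L → ∀ {λ₁ λ₂ λ₃} (M : Marked φ λ₁ λ₂ λ₃) →
    Normalised γ (Marked.α₁ M) → Normalised γ (Marked.α₂ M) → Normalised γ (Marked.α₃ M) → ModelData φ M
  modelData {γ} {φ} {L} R M n₁ n₂ n₃ = record
    { f = k.num L ; g = k.den L ; nonzero = nonzero ; A = A
    ; p₁ = q₁ ; p₂ = q₂ ; p₃ = q₃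
    ; nz₁ = kpoint-nonzero γ n₁ ; nz₂ = kpoint-nonzero γ n₂ ; nz₃ = kpoint-nonzero γ n₃
    ; ff = N.residue-form form n₁ n₂ n₃
    ; equation₁ = N.multiplier-equation form n₁ n₂ n₃
    ; equation₂ = equation₂
    ; equation₃ = equation₃
    }
    where
    open NormalLift R
    open Marked M
    module N = Model γ φ L e e≉0 num-lift den-lift
    q₁ q₂ q₃ : 𝕜.Point
    q₁ = kpoint γ n₁
    q₂ = kpoint γ n₂
    q₃ = kpoint γ n₃
    A : 𝒪
    A = N.leadingₖ form n₁ n₂ n₃
    form₂ = swap₁₂ (num (lift φ)) (den (lift φ)) (point α₁) (point α₂) (point α₃) form
    form₃ = swap₁₂ (num (lift φ)) (den (lift φ)) (point α₁) (point α₃) (point α₂) (swap₂₃ (num (lift φ)) (den (lift φ)) (point α₁) (point α₂) (point α₃) form)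
    reorder : ∀ (g : k.Form 2) A B q₁ q₂ q₃ → value B ≈ value A → ∀ l t → value (𝕜.scaling g B q₁ q₂ q₃) * l ≈ value B * t →
      value (𝕜.scaling g A q₁ q₂ q₃) * l ≈ value A * t
    reorder g A B q₁ q₂ q₃ e l t h = trans (*-congʳ (trans (value-scaling g A q₁ q₂ q₃) (trans (scaling-cong (values g) _ _ _ (sym e))
      (sym (value-scaling g B q₁ q₂ q₃))))) (trans h (*-congʳ e))
    equation₂ : ∀ {λ′} → IsMultiplier φ α₂ λ′ → value (𝕜.scaling (k.den L) A q₂ q₁ q₃) * (λ′ - 1#) ≈ value A * (value (𝕜.cross q₂ q₁) * value (𝕜.cross q₂ q₃))
    equation₂ {λ′} m = reorder (k.den L) A (N.leadingₖ form₂ n₂ n₁ n₃) q₂ q₁ q₃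
      (solve 4 (λ a u v w → a :* (v :* (u :* w)) := a :* (u :* (v :* w))) refl (e * a) (dₙ n₁) (dₙ n₂) (dₙ n₃))
      (λ′ - 1#) (value (𝕜.cross q₂ q₁) * value (𝕜.cross q₂ q₃)) (N.multiplier-equation form₂ n₂ n₁ n₃ m)
    equation₃ : ∀ {λ′} → IsMultiplier φ α₃ λ′ → value (𝕜.scaling (k.den L) A q₃ q₁ q₂) * (λ′ - 1#) ≈ value A * (value (𝕜.cross q₃ q₁) * value (𝕜.cross q₃ q₂))
    equation₃ {λ′} m = reorder (k.den L) A (N.leadingₖ form₃ n₃ n₁ n₂) q₃ q₁ q₂
      (solve 4 (λ a u v w → a :* (w :* (u :* v)) := a :* (u :* (v :* w))) refl (e * a) (dₙ n₁) (dₙ n₂) (dₙ n₃))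
      (λ′ - 1#) (value (𝕜.cross q₃ q₁) * value (𝕜.cross q₃ q₂)) (N.multiplier-equation form₃ n₃ n₁ n₂ m)

  module _ {φ λ₁ λ₂ λ₃} {M : Marked φ λ₁ λ₂ λ₃} (D : ModelData φ M) where
    open Marked M
    open ModelData D

    finite-case : (∀ p → 𝕜.Nonzero p → ¬ (𝕜.evalAt f p k.≈ k.0# × 𝕜.evalAt g p k.≈ k.0#)) →
      ∃[ x ] ∃[ y ] Specializes (sigmaPoint λ₁ λ₂ λ₃) (x ∷ y ∷ k.1# ∷ [])
    finite-case h =
      let (l₁ , e₁ , _) = integral-multiplier M₁ (A k.* (c₁₂ k.* c₁₃)) (𝕜.scaling₁≉0 f g p₁ p₂ p₃ ff (h p₁ nz₁)) (equation₁ mult₁)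
          (l₂ , e₂ , _) = integral-multiplier M₂ (A k.* (𝕜.cross p₂ p₁ k.* c₂₃)) (𝕜.scaling₂≉0 f g p₁ p₂ p₃ ff (h p₂ nz₂)) (equation₂ mult₂)
          (l₃ , e₃ , _) = integral-multiplier M₃ (A k.* (𝕜.cross p₃ p₁ k.* 𝕜.cross p₃ p₂)) (𝕜.scaling₃≉0 f g p₁ p₂ p₃ ff (h p₃ nz₃)) (equation₃ mult₃)
      in specializes-finite l₁ l₂ l₃ e₁ e₂ e₃

    module _ (ψ : k.RationalMap 1) (h : k.Form 1)
             (num-factor : f k.≋ h k.⊛ k.num (k.lift ψ)) (den-factor : g k.≋ h k.⊛ k.den (k.lift ψ))
             (moved : 𝕜.pairing (k.num (k.lift ψ)) (k.den (k.lift ψ)) p₃ p₃ k.≉ k.0#) where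
      private
        u = k.num (k.lift ψ)
        v = k.den (k.lift ψ)

      reduction-special : 𝕜.Special h u v A p₁ p₂ p₃
      reduction-special = 𝕜.special h u v f g p₁ p₂ p₃ nz₃ ff (𝕜.common-factor≉0 nonzero num-factor den-factor) num-factor den-factor moved

      private
        A≉0 = 𝕜.special-A reduction-special moved
        c₁₃≉0 = 𝕜.special-distinct₁ reduction-special moved
        c₂₃≉0 = 𝕜.special-distinct₂ reduction-special moved

        M₁≉0 : M₁ k.≉ k.0#
        M₁≉0 = 𝕜.special-scaling₁≉0 ψ f g h p₁ p₂ p₃ nz₁ nz₂ nz₃ ff num-factor den-factor reduction-special moved
        M₂≉0 : M₂ k.≉ k.0#
        M₂≉0 = 𝕜.special-scaling₂≉0 ψ f g h p₁ p₂ p₃ nz₁ nz₂ nz₃ ff num-factor den-factor reduction-special moved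
        M₃≈0 : M₃ k.≈ k.0#
        M₃≈0 = 𝕜.special-scaling₃≈0 ψ f g h p₁ p₂ p₃ nz₁ nz₂ nz₃ ff num-factor den-factor reduction-special moved

        integral₁ = integral-multiplier M₁ (A k.* (c₁₂ k.* c₁₃)) M₁≉0 (equation₁ mult₁)
        integral₂ = integral-multiplier M₂ (A k.* (𝕜.cross p₂ p₁ k.* c₂₃)) M₂≉0 (equation₂ mult₂)
        large₃ = large-multiplier M₃ (A k.* (𝕜.cross p₃ p₁ k.* 𝕜.cross p₃ p₂)) M₃≈0 (𝕜.*≉0 A≉0 (𝕜.*≉0 (𝕜.cross-flip≉0 p₁ p₃ c₁₃≉0) (𝕜.cross-flip≉0 p₂ p₃ c₂₃≉0))) (equation₃ mult₃)
        l₁ l₂ : 𝒪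
        l₁ = proj₁ integral₁
        l₂ = proj₁ integral₂
        l₁≈ = proj₁ (proj₂ integral₁)
        l₂≈ = proj₁ (proj₂ integral₂)
        M₁l₁ : M₁ k.* (l₁ k.- k.1#) k.≈ A k.* (c₁₂ k.* c₁₃)
        M₁l₁ = proj₂ (proj₂ integral₁)
        M₂l₂ : M₂ k.* (l₂ k.- k.1#) k.≈ A k.* (𝕜.cross p₂ p₁ k.* c₂₃)
        M₂l₂ = proj₂ (proj₂ integral₂)

        l₁l₂≈1 : l₁ k.* l₂ k.≈ k.1#
        l₁l₂≈1 = 𝕜.scalings-reciprocal g A p₁ p₂ p₃ l₁ l₂ M₁≉0 M₂≉0 M₃≈0 c₁₃≉0 c₂₃≉0 M₁l₁ M₂l₂

        indifference : Indifference φ (l₁ k.+ l₂)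
        indifference = (α₁ , l₁ , multiplier-resp φ (sym l₁≈) mult₁ , ≉0⇒unit {l₁} (𝕜.*≉0ˡ (λ e → 𝕜.1≉0 (k.trans (k.sym l₁l₂≈1) e)))) , all
          where
          all : ∀ α l → IsIndifferent φ α l → ∃[ m ] (l k.* m k.≈ k.1# × l₁ k.+ l₂ k.≈ l k.+ m)
          all α l (m , u) = [ at₁ , [ at₂ , at₃ ]′ ]′ (fixed-is-marked φ M α (fixes φ m))
            where
            transport : ∀ β {λ′} → IsMultiplier φ β λ′ → cross (point α) (point β) ≈ 0# → IsMultiplier φ β (value l)
            transport β mβ e = multiplier-transport φ α β (fixes φ mβ) e m
            value≉0′ : ∀ {a : 𝒪} → a k.≉ k.0# → value a ≉ 0#
            value≉0′ a≉0 e = a≉0 (≈⇒≡ₘ e)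
            same : ∀ {m t l′ λ′} → m k.≉ k.0# → value m * (value l - 1#) ≈ t → value m * (λ′ - 1#) ≈ t → value l′ ≈ λ′ → l k.≈ l′
            same {m} {l′ = l′} {λ′} m≉0 e e′ eq = ≈⇒≡ₘ (trans (x-y≈0⇒x≈y (trans
                (solve 2 (λ a b → a :- b := (a :- con (+ 1)) :- (b :- con (+ 1))) refl (value l) λ′)
                (x≈y⇒x-y≈0 (*-cancelˡ (value≉0′ {m} m≉0) (trans e (sym e′)))))) (sym eq))
            at₁ : cross (point α) (point α₁) ≈ 0# → _
            at₁ e = l₂ , k.trans (k.*-congʳ l≈) l₁l₂≈1 , k.+-congʳ (k.sym l≈)
              where
              l≈ : l k.≈ l₁
              l≈ = same {M₁} {l′ = l₁} M₁≉0 (equation₁ (transport α₁ mult₁ e)) (equation₁ mult₁) l₁≈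
            at₂ : cross (point α) (point α₂) ≈ 0# → _
            at₂ e = l₁ , k.trans (k.*-congʳ l≈) (k.trans (k.*-comm l₂ l₁) l₁l₂≈1) , k.trans (k.+-comm l₁ l₂) (k.+-congʳ (k.sym l≈))
              where
              l≈ : l k.≈ l₂
              l≈ = same {M₂} {l′ = l₂} M₂≉0 (equation₂ (transport α₂ mult₂ e)) (equation₂ mult₂) l₂≈
            at₃ : cross (point α) (point α₃) ≈ 0# → _
            at₃ e = contradiction
              (k.trans (k.sym (≈⇒≡ₘ {M₃ k.* (l k.- k.1#)} (equation₃ (transport α₃ mult₃ e)))) (k.trans (k.*-congʳ M₃≈0) (k.zeroˡ (l k.- k.1#))))
              (𝕜.*≉0 A≉0 (𝕜.*≉0 (𝕜.cross-flip≉0 p₁ p₃ c₁₃≉0) (𝕜.cross-flip≉0 p₂ p₃ c₂₃≉0)))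

      line-case : ∃[ x ] (Specializes (sigmaPoint λ₁ λ₂ λ₃) (k.1# ∷ x ∷ k.0# ∷ []) × Indifference φ x ×
        (c₁₂ k.≉ k.0# → x k.≉ 2ₖ) × (c₁₂ k.≈ k.0# → x k.≈ 2ₖ))
      line-case = l₁ k.+ l₂ ,
        specializes-line l₁ l₂ (proj₁ large₃) l₁≈ l₂≈ (proj₁ (proj₂ large₃)) (proj₂ (proj₂ large₃)) ,
        indifference ,
        𝕜.distinct⇒sum≉2 M₁ A c₁₂ c₁₃ l₁ l₂ M₁≉0 A≉0 c₁₃≉0 l₁l₂≈1 M₁l₁ ,
        𝕜.double⇒sum≈2 M₁ A c₁₂ c₁₃ l₁ l₂ M₁≉0 A≉0 c₁₃≉0 l₁l₂≈1 M₁l₁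

      double-case : ∀ b → ψ k.conjugateTo k.[ k.X k.⊕ b k.· k.Y , k.Y ] →
        Specializes (sigmaPoint λ₁ λ₂ λ₃) (k.1# ∷ 2ₖ ∷ k.0# ∷ [])
      double-case b conj = let (x , (o , h , (t , t≉0 , q)) , _ , _ , x≈2) = line-case in
        o , h , t , t≉0 , Pointwise.trans k.trans q
          (k.refl ∷ x≈2 (𝕜.parabolic-double ψ b conj {p₁ = p₁} {p₂} nz₁ nz₂ A≉0 reduction-special) ∷ k.refl ∷ [])

      special-c₁₃ : c₁₃ k.≉ k.0#
      special-c₁₃ = c₁₃≉0

      special-c₂₃ : c₂₃ k.≉ k.0#
      special-c₂₃ = c₂₃≉0

      dilation : c₁₂ k.≉ k.0# → ∃[ b ] (b k.≉ k.0# × b k.≉ k.1# × ψ k.conjugateTo k.[ b k.· k.X , k.Y ])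
      dilation = 𝕜.hyperbolic-conjugate ψ reduction-special moved nz₁ nz₂

      translation : c₁₂ k.≈ k.0# → ∃[ b ] (b k.≉ k.0# × ψ k.conjugateTo k.[ k.X k.⊕ b k.· k.Y , k.Y ])
      translation = 𝕜.parabolic-conjugate ψ reduction-special moved nz₁ nz₂

    vertex-case : ∀ c → (∀ x y → proj₂ c k.* k.eval f x y k.≈ proj₁ c k.* k.eval g x y) →
      c₁₂ k.≉ k.0# → c₁₃ k.≉ k.0# → c₂₃ k.≉ k.0# → 𝕜.cross p₁ c k.≉ k.0# → 𝕜.cross p₂ c k.≉ k.0# →
      Specializes (sigmaPoint λ₁ λ₂ λ₃) (k.0# ∷ k.1# ∷ k.0# ∷ [])
    vertex-case c dep c₁₂≉0 c₁₃≉0 c₂₃≉0 c₁≉0 c₂≉0 =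
      let (ν₁ , e₁ , z₁) = large-multiplier M₁ (A k.* (c₁₂ k.* c₁₃)) M₁≈0 (𝕜.*≉0 A≉0 (𝕜.*≉0 c₁₂≉0 c₁₃≉0)) (equation₁ mult₁)
          (ν₂ , e₂ , z₂) = large-multiplier M₂ (A k.* (𝕜.cross p₂ p₁ k.* c₂₃)) M₂≈0 (𝕜.*≉0 A≉0 (𝕜.*≉0 (𝕜.cross-flip≉0 p₁ p₂ c₁₂≉0) c₂₃≉0)) (equation₂ mult₂)
          (l₃ , e₃ , _)  = integral-multiplier M₃ (A k.* (𝕜.cross p₃ p₁ k.* 𝕜.cross p₃ p₂)) M₃≉0 (equation₃ mult₃)
      in specializes-vertex ν₁ ν₂ l₃ e₁ e₂ e₃ z₁ z₂
      where
      M₁≈0 : M₁ k.≈ k.0#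
      M₁≈0 = 𝕜.constant-scaling₁ f g p₁ p₂ p₃ ff c dep c₁≉0
      M₂≈0 : M₂ k.≈ k.0#
      M₂≈0 = 𝕜.constant-scaling₂ f g p₁ p₂ p₃ ff c dep c₂≉0
      M₃≉0 : M₃ k.≉ k.0#
      M₃≉0 = 𝕜.vertex-scaling₃≉0 f g p₁ p₂ p₃ ff c₁₂≉0 c₁₃≉0 c₂₃≉0 M₁≈0 M₂≈0 nonzero
      A≉0 : A k.≉ k.0#
      A≉0 = 𝕜.vertex-A≉0 f g p₁ p₂ p₃ ff c₁₂≉0 c₁₃≉0 c₂₃≉0 M₁≈0 M₂≈0 nonzero

  -- Directions and paths at a type II point

  module _ (γ : GL₂) {ξ} (G : GaussAlong (möbius γ) ξ) where
    open GaussAlong G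

    distinct⇒bracket≉0 : ∀ {α β} (a : Normalised γ α) (b : Normalised γ β) → bracketₖ γ a b k.≉ k.0# → bracket α β ≉ 0#
    distinct⇒bracket≉0 a b ne = *≉0ʳ {det γ} λ e → *≉0 (*≉0 (dₙ≉0 a) (dₙ≉0 b)) (λ e′ → ne (≈⇒≡ₘ e′)) (trans (sym (det-bracket γ a b)) e)

    distinct⇒onPath : ∀ α β → bracketₖ γ (normalForm γ α) (normalForm γ β) k.≉ k.0# →
      OnPath (classicalPoint α) (classicalPoint β) ξ
    distinct⇒onPath α β ne = Between⇒OnPath {classicalPoint α} {classicalPoint β} {ξ}
      (orthogonal⇒between α β (classicalPoint-classical α) (classicalPoint-classical β)
        (distinct⇒bracket≉0 (normalForm γ α) (normalForm γ β) ne) (distinct⇒orthogonal γ G (normalForm γ α) (normalForm γ β) ne))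

    gauss-finite : norm ξ Y ℝ.≉ ℝ.0#
    gauss-finite e = linear-max≉0 γ 1# 0# (inj₁ 1≉0) (ℝ.trans (ℝ.sym (linear Y)) (ℝ.trans (ℝ.*-congˡ e) (ℝ.zeroʳ C)))

    gauss⋢classical : ∀ α {η} → IsClassical α η → η ⊑ ξ → ¬ ξ ⊑ η
    gauss⋢classical α {η} (D , 0<D , h) η⊑ξ (onLines le) = gauss-finite (∞-maximal η⊑ξ (ℝ.x*y≈0⇒y≈0 ξα≉0
      (antisym (≤-trans (le (vanishingAt α)) (≤-reflexive (ℝ.trans (ℝ.*-congʳ ηα≈0) (ℝ.zeroˡ _))))
        (ℝ.*-nonneg (ℙ¹ᴮᵉʳᵏ.∥∥-nonneg ξ (vanishingAt α)) (ℙ¹ᴮᵉʳᵏ.∥∥-nonneg η Y)))))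
      where
      ηα≈0 : norm η (vanishingAt α) ℝ.≈ ℝ.0#
      ηα≈0 = ℝ.trans (h (vanishingAt α)) (ℝ.trans (ℝ.*-congˡ (∣≈0∣ (trans (at-vanishing α α) (cross-self (point α))))) (ℝ.zeroʳ _))
      ξα≉0 : norm ξ (vanishingAt α) ℝ.≉ ℝ.0#
      ξα≉0 e = linear-max≉0 γ (- xᶜ α) (yᶜ α) ([ inj₁ ∘ -‿≉0 , inj₂ ]′ (point-nonzero α))
        (ℝ.trans (ℝ.sym (linear (vanishingAt α))) (ℝ.trans (ℝ.*-congˡ e) (ℝ.zeroʳ C)))

    ≈ᴮ⇒⊒ : ∀ {η} → η ≈ᴮ ξ → η ⊑ ξ × ξ ⊑ η
    ≈ᴮ⇒⊒ {η} (D , 0<D , h) = onLines (λ l → ≤-reflexive (same l)) , onLines (λ l → ≤-reflexive (ℝ.sym (same l)))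
      where
      same : ∀ (l : Form 1) → norm η l ℝ.* norm ξ Y ℝ.≈ norm ξ l ℝ.* norm η Y
      same l = ℝ.trans (ℝ.*-congˡ (h Y)) (ℝ.trans (ℝ.solve 3 (λ a b c → a ℝ.:* (b ℝ.:* c) ℝ.:= (b ℝ.:* a) ℝ.:* c) ℝ.refl _ _ _) (ℝ.*-congʳ (ℝ.sym (h l))))

    module _ {d} (φ : RationalMap d) where

      isFixedClassical : ∀ α → Fixes φ α → IsFixedClassical φ (classicalPoint α)
      isFixedClassical α fix = α , fix , classicalPoint-classical α

      distinct⇒ΓFix : ∀ α β → Fixes φ α → Fixes φ β → bracketₖ γ (normalForm γ α) (normalForm γ β) k.≉ k.0# → ΓFix φ ξ
      distinct⇒ΓFix α β fα fβ ne = classicalPoint α , classicalPoint β , isFixedClassical α fα , isFixedClassical β fβ , distinct⇒onPath α β ne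

      distinct⇒branch : ∀ α₁ α₂ α₃ → Fixes φ α₁ → Fixes φ α₂ → Fixes φ α₃ →
        bracketₖ γ (normalForm γ α₁) (normalForm γ α₂) k.≉ k.0# → bracketₖ γ (normalForm γ α₁) (normalForm γ α₃) k.≉ k.0# →
        bracketₖ γ (normalForm γ α₂) (normalForm γ α₃) k.≉ k.0# → IsBranchPoint (ΓFix φ) ξ
      distinct⇒branch α₁ α₂ α₃ f₁ f₂ f₃ n₁₂ n₁₃ n₂₃ = distinct⇒ΓFix α₁ α₂ f₁ f₂ n₁₂ ,
          (λ i → classicalPoint (α i)) ,
          (λ i → (classicalPoint (α i) , classicalPoint (α i) , isFixedClassical (α i) (fixed-α i) , isFixedClassical (α i) (fixed-α i) ,
                    Between⇒OnPath {classicalPoint (α i)} {classicalPoint (α i)} {classicalPoint (α i)} (inj₁ ⊑-refl , λ ω p _ → p)) ,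
                 λ e → let (p , q) = ≈ᴮ⇒⊒ {classicalPoint (α i)} e in gauss⋢classical (α i) (classicalPoint-classical (α i)) p q) ,
          λ {i} {j} same → stable λ i≢j → same (paths i j i≢j)
        where
        α : Fin 3 → ℙ 1
        α zero             = α₁
        α (suc zero)       = α₂
        α (suc (suc zero)) = α₃
        fixed-α : ∀ i → Fixes φ (α i)
        fixed-α zero             = f₁
        fixed-α (suc zero)       = f₂
        fixed-α (suc (suc zero)) = f₃
        reverse : ∀ {β δ} → OnPath (classicalPoint β) (classicalPoint δ) ξ → OnPath (classicalPoint δ) (classicalPoint β) ξ
        reverse {β} {δ} p = Between⇒OnPath {classicalPoint δ} {classicalPoint β} {ξ}
          (Between-sym (OnPath⇒Between {classicalPoint β} {classicalPoint δ} {ξ} p))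
        p₁₂ = distinct⇒onPath α₁ α₂ n₁₂
        p₁₃ = distinct⇒onPath α₁ α₃ n₁₃
        p₂₃ = distinct⇒onPath α₂ α₃ n₂₃
        paths : ∀ i j → i ≡.≢ j → OnPath (classicalPoint (α i)) (classicalPoint (α j)) ξ
        paths zero             zero             i≢j = contradiction ≡.refl i≢j
        paths zero             (suc zero)       _   = p₁₂
        paths zero             (suc (suc zero)) _   = p₁₃
        paths (suc zero)       zero             _   = reverse {α₁} {α₂} p₁₂
        paths (suc zero)       (suc zero)       i≢j = contradiction ≡.refl i≢j
        paths (suc zero)       (suc (suc zero)) _   = p₂₃
        paths (suc (suc zero)) zero             _   = reverse {α₁} {α₃} p₁₃
        paths (suc (suc zero)) (suc zero)       _   = reverse {α₂} {α₃} p₂₃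
        paths (suc (suc zero)) (suc (suc zero)) i≢j = contradiction ≡.refl i≢j

      ΓFix⇒distinct : ΓFix φ ξ → ∃[ α ] ∃[ β ] (Fixes φ α × Fixes φ β × bracketₖ γ (normalForm γ α) (normalForm γ β) k.≉ k.0#)
      ΓFix⇒distinct (η , ζ , (α , fα , cα) , (β , fβ , cβ) , path) = α , β , fα , fβ ,
        orthogonal⇒distinct γ G (normalForm γ α) (normalForm γ β) (between⇒orthogonal α β cα cβ bracket≉0 between)
        where
        between : Between η ζ ξ
        between = OnPath⇒Between {η} {ζ} {ξ} path
        bracket≉0 : bracket α β ≉ 0#
        bracket≉0 e = gauss⋢classical α cα ([ id , ⊑-trans η⊑ζ ]′ (proj₁ between)) (proj₂ between η ⊑-refl ζ⊑η)
          where
          η⊑ζ : η ⊑ ζ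
          η⊑ζ = classical-⊑ α β e cα cβ
          ζ⊑η : ζ ⊑ η
          ζ⊑η = classical-⊑ β α (∣∣-definite (ℝ.trans (bracket-flip β α) (∣≈0∣ e))) cβ cα

    module _ {φ : RationalMap 2} {L} (R : NormalLift γ φ L) where
      open GL₂ γ
      open NormalLift R

      private
        module N = Model γ φ L e e≉0 num-lift den-lift
        F′ = num (lift φ)
        G′ = den (lift φ)
        Δ = det γ
        κ = ∣ e * Δ ∣
        κ-pos : ℝ.0# < κ
        κ-pos = ∣∣-pos (*≉0 e≉0 det≉0)
        Px Py : 𝒪 → Carrier
        Px t = eval (num (möbius γ)) (value t) 1#
        Py t = eval (den (möbius γ)) (value t) 1#
        f g : 𝒪 → Carrier
        f t = eval (values (k.num L)) (value t) 1#
        g t = eval (values (k.den L)) (value t) 1#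

        image : ∀ {d} → Form d → 𝒪 → Carrier
        image h t = eval h (eval F′ (Px t) (Py t)) (eval G′ (Px t) (Py t))

        linear-image : ∀ (l : Form 1) t → (e * Δ) * image l t ≈ eval l m₁₁ m₂₁ * f t + eval l m₁₂ m₂₂ * g t
        linear-image (v ∷ u ∷ []) t = sym (trans (+-cong (*-congˡ (N.num-eval (value t) 1#)) (*-congˡ (N.den-eval (value t) 1#)))
          (solve 9 (λ e m n p q v u F G → let I = con (+ 1) in
              (v :* (p :* I) :+ m :* u) :* (e :* (q :* F :- n :* G)) :+ (v :* (q :* I) :+ n :* u) :* (e :* (m :* G :- p :* F))
              := (e :* (m :* q :- n :* p)) :* (v :* (G :* I) :+ F :* u)) refl e m₁₁ m₁₂ m₂₁ m₂₂ v u _ _))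

        ∣linear-image∣ : ∀ (l : Form 1) t → κ ℝ.* ∣ image l t ∣ ℝ.≈ ∣ eval l m₁₁ m₂₁ * f t + eval l m₁₂ m₂₂ * g t ∣
        ∣linear-image∣ l t = ℝ.trans (ℝ.sym (∣∣-* _ _)) (∣∣-cong (linear-image l t))

        combination : ∀ (a b t : 𝒪) → value (a k.* k.eval (k.num L) t k.1# k.+ b k.* k.eval (k.den L) t k.1#) ≈ value a * f t + value b * g t
        combination a b t = +-cong (*-congˡ (value-eval (k.num L) t k.1#)) (*-congˡ (value-eval (k.den L) t k.1#))

      module _ (independent : ¬ Dependent L) where
        private
          unimodular-combination : ∀ (a b : 𝒪) → a k.≉ k.0# ⊎ b k.≉ k.0# → Generic (λ t → ∣ value a * f t + value b * g t ∣ ℝ.≈ ℝ.1#)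
          unimodular-combination a b nz = generic-map
            (λ t ne → ℝ.trans (∣∣-cong (sym (combination a b t)))
              (≉0⇒unit {a k.* k.eval (k.num L) t k.1# k.+ b k.* k.eval (k.den L) t k.1#} λ e → ne (k.trans (expand t k.1#) e)))
            (residue-nonvanishing q (stable λ ¬nz → independent ((k.- b , a) , [ inj₂ , inj₁ ∘ 𝕜.-‿≉0 ]′ nz , λ x y →
              𝕜.x-y≈0⇒x≈y (k.trans (𝕜.solve 4 (λ a b f g → a 𝕜.:* f 𝕜.:- (𝕜.:- b) 𝕜.:* g 𝕜.:= a 𝕜.:* f 𝕜.:+ b 𝕜.:* g) k.refl a b _ _)
                (k.trans (k.sym (expand x y)) (𝕜.vanishing-form q ¬nz x y))))))
            where
            q : k.Form 2
            q = a k.· k.num L k.⊕ b k.· k.den L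
            expand : ∀ x y → k.eval q x y k.≈ a k.* k.eval (k.num L) x y k.+ b k.* k.eval (k.den L) x y
            expand x y = k.trans (𝕜.eval-⊕ (a k.· k.num L) (b k.· k.den L) x y) (k.+-cong (𝕜.eval-· a (k.num L) x y) (𝕜.eval-· b (k.den L) x y))

          scaled : ∀ a b m (m≉0 : m ≉ 0#) → ∣ a ∣ ≤ ∣ m ∣ → ∣ b ∣ ≤ ∣ m ∣ → ∣ a ∣ ℝ.⊔ᴿ ∣ b ∣ ℝ.≈ ∣ m ∣ → ∣ m ∣ ≤ ∣ a ∣ ⊎ ∣ m ∣ ≤ ∣ b ∣ →
            Generic (λ t → ∣ a * f t + b * g t ∣ ℝ.≈ ∣ a ∣ ℝ.⊔ᴿ ∣ b ∣)
          scaled a b m m≉0 a≤m b≤m max attained = generic-map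
            (λ t e → ℝ.trans (ℝ.trans (∣∣-cong (trans (+-cong (*-congʳ (sym (divide m≉0 a))) (*-congʳ (sym (divide m≉0 b))))
                (solve 5 (λ m a b f g → (m :* a) :* f :+ (m :* b) :* g := m :* (a :* f :+ b :* g)) refl m (m≉0 ⁻¹ * a) (m≉0 ⁻¹ * b) (f t) (g t)))) (∣∣-* _ _))
              (ℝ.trans (ℝ.*-congˡ e) (ℝ.trans (ℝ.*-identityʳ _) (ℝ.sym max))))
            (unimodular-combination a′ b′ ([ (λ p → inj₁ (unit⇒≉0 {a′} (normalised a p a≤m))) , (λ p → inj₂ (unit⇒≉0 {b′} (normalised b p b≤m))) ]′ attained))
            where
            a′ b′ : 𝒪
            a′ = m≉0 ⁻¹ * a , quotient-integral m≉0 a≤m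
            b′ = m≉0 ⁻¹ * b , quotient-integral m≉0 b≤m
            normalised : ∀ a → ∣ m ∣ ≤ ∣ a ∣ → ∣ a ∣ ≤ ∣ m ∣ → ∣ m≉0 ⁻¹ * a ∣ ℝ.≈ ℝ.1#
            normalised a p q = ℝ.*-cancelˡ (∣∣≉0 m≉0) (ℝ.trans (ℝ.sym (∣∣-* _ _)) (ℝ.trans (∣∣-cong (divide m≉0 a))
              (ℝ.trans (antisym q p) (ℝ.sym (ℝ.*-identityʳ _)))))

          any-combination : ∀ a b → Generic (λ t → ∣ a * f t + b * g t ∣ ℝ.≈ ∣ a ∣ ℝ.⊔ᴿ ∣ b ∣)
          any-combination a b with total ∣ a ∣ ∣ b ∣ | em {P = a ≈ 0#} | em {P = b ≈ 0#}
          ... | inj₁ a≤b | _ | no b≉0 = scaled a b b b≉0 a≤b ≤-refl (ℝ.x≤y⇒x⊔y≈y a≤b) (inj₂ ≤-refl)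
          ... | inj₂ b≤a | no a≉0 | _ = scaled a b a a≉0 ≤-refl b≤a (ℝ.x≤y⇒y⊔x≈y b≤a) (inj₁ ≤-refl)
          ... | inj₁ a≤b | _ | yes b≈0 = both-zero a b (∣x∣≤0⇒x≈0 (≤-respʳ-≈ (∣≈0∣ b≈0) a≤b)) b≈0
            where
            both-zero : ∀ a b → a ≈ 0# → b ≈ 0# → Generic (λ t → ∣ a * f t + b * g t ∣ ℝ.≈ ∣ a ∣ ℝ.⊔ᴿ ∣ b ∣)
            both-zero a b a≈0 b≈0 = always λ t → ℝ.trans (∣≈0∣ (trans (+-cong (trans (*-congʳ a≈0) (zeroˡ _)) (trans (*-congʳ b≈0) (zeroˡ _))) (+-identityʳ 0#)))
              (ℝ.sym (ℝ.trans (ℝ.⊔-cong (∣≈0∣ a≈0) (∣≈0∣ b≈0)) (ℝ.x≤y⇒x⊔y≈y ≤-refl)))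
          ... | inj₂ b≤a | yes a≈0 | _ = always λ t → ℝ.trans (∣≈0∣ (trans (+-cong (trans (*-congʳ a≈0) (zeroˡ _)) (trans (*-congʳ b≈0) (zeroˡ _))) (+-identityʳ 0#)))
              (ℝ.sym (ℝ.trans (ℝ.⊔-cong (∣≈0∣ a≈0) (∣≈0∣ b≈0)) (ℝ.x≤y⇒x⊔y≈y ≤-refl)))
            where
            b≈0 : b ≈ 0#
            b≈0 = ∣x∣≤0⇒x≈0 (≤-respʳ-≈ (∣≈0∣ a≈0) b≤a)

          image-norm : ∀ {d} (h : Form d) → Generic (λ t → κ ℝ.^ d ℝ.* ∣ image h t ∣ ℝ.≈ ∣ along (möbius γ) h t ∣)
          image-norm = form-induction algClosed (λ {d} h → Generic (λ t → κ ℝ.^ d ℝ.* ∣ image h t ∣ ℝ.≈ ∣ along (möbius γ) h t ∣))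
            (λ e → generic-map λ t p → ℝ.trans (ℝ.*-congˡ (∣∣-cong (eval-cong (≋-sym e) refl refl))) (ℝ.trans p (∣∣-cong (eval-cong e refl refl))))
            (λ a → always λ t → ℝ.*-identityˡ _)
            (λ {d} l h → generic-map₂ λ t p q → ℝ.trans (ℝ.*-congˡ (ℝ.trans (∣∣-cong (eval-⊛ l h _ _)) (∣∣-* _ _)))
              (ℝ.trans (ℝ.solve 4 (λ κ κᵈ a b → (κ ℝ.:* κᵈ) ℝ.:* (a ℝ.:* b) ℝ.:= ((κ ℝ.:* ℝ.con (+ 1)) ℝ.:* a) ℝ.:* (κᵈ ℝ.:* b)) ℝ.refl κ (κ ℝ.^ d) _ _)
                (ℝ.trans (ℝ.*-cong p q) (ℝ.sym (along-⊛ (möbius γ) l h t)))))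
            (λ l → generic-map₂ (λ t p q → ℝ.trans (ℝ.*-congʳ (ℝ.*-identityʳ κ)) (ℝ.trans (∣linear-image∣ l t) (ℝ.trans p (ℝ.sym q))))
              (any-combination (eval l m₁₁ m₂₁) (eval l m₁₂ m₂₂)) (linear-generic (möbius γ) l))

        independent⇒fixed : FixedBy φ ξ
        independent⇒fixed = κ ℝ.* C , ℝ.*-pos κ-pos C-pos , λ {d} h → ℝ.*-cancelˡ (ℝ.<⇒≉0 (ℝ.^-pos d C-pos))
          (proj₂ (generic-witness (generic-map₂ (λ t p q → ℝ.trans (ℝ.sym p) q)
            (proj₂ (along-norm h))
            (generic-map₂ (λ t p q → ℝ.trans (ℝ.sym p) (ℝ.trans (ℝ.*-congˡ (ℝ.trans (∣∣-cong (sym (eval-substitute h (lift φ) _ _))) q))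
                (ℝ.trans (ℝ.*-congˡ (ℝ.*-congʳ (double d))) (ℝ.trans
                  (ℝ.solve 3 (λ k c n → k ℝ.:* ((c ℝ.:* c) ℝ.:* n) ℝ.:= c ℝ.:* ((k ℝ.:* c) ℝ.:* n)) ℝ.refl _ _ _)
                  (ℝ.*-congˡ (ℝ.*-congʳ (product d)))))))
              (image-norm h) (proj₂ (along-norm (substitute h (lift φ))))))))
          where
          double : ∀ d → C ℝ.^ (d ℕ.* 2) ℝ.≈ C ℝ.^ d ℝ.* C ℝ.^ d
          double zero    = ℝ.sym (ℝ.*-identityˡ _)
          double (suc d) = ℝ.trans (ℝ.*-congˡ (ℝ.*-congˡ (double d)))
            (ℝ.solve 2 (λ c x → c ℝ.:* (c ℝ.:* (x ℝ.:* x)) ℝ.:= (c ℝ.:* x) ℝ.:* (c ℝ.:* x)) ℝ.refl C (C ℝ.^ d))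
          product : ∀ d → κ ℝ.^ d ℝ.* C ℝ.^ d ℝ.≈ (κ ℝ.* C) ℝ.^ d
          product zero    = ℝ.*-identityˡ _
          product (suc d) = ℝ.trans (ℝ.solve 4 (λ k c x y → (k ℝ.:* x) ℝ.:* (c ℝ.:* y) ℝ.:= (k ℝ.:* c) ℝ.:* (x ℝ.:* y)) ℝ.refl κ C (κ ℝ.^ d) (C ℝ.^ d))
            (ℝ.*-congˡ (product d))

      fixed⇒independent : FixedBy φ ξ → ¬ Dependent L
      fixed⇒independent (C′ , 0<C′ , h) ((c₀ , c₁) , nz , dep) = [ contradictory k.1# k.0# ∘ first , contradictory k.0# k.1# ∘ second ]′ nonzero
        where
        -- (a , b) are the values at the columns of γ of a linear form, up to the factor det γ.
        balance : ∀ (a b : 𝒪) → Generic (λ t → κ ℝ.* C ℝ.* (∣ value a ∣ ℝ.⊔ᴿ ∣ value b ∣) ℝ.≈ C′ ℝ.* ∣ value a * f t + value b * g t ∣)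
        balance (a , _) (b , _) = generic-map (λ t p → ℝ.*-cancelˡ (∣∣≉0 det≉0) (begin
            ∣ Δ ∣ ℝ.* (κ ℝ.* C ℝ.* (∣ a ∣ ℝ.⊔ᴿ ∣ b ∣))
              ≈⟨ ℝ.solve 4 (λ d k c m → d ℝ.:* (k ℝ.:* c ℝ.:* m) ℝ.:= k ℝ.:* (c ℝ.:* (d ℝ.:* m))) ℝ.refl _ _ _ _ ⟩
            κ ℝ.* (C ℝ.* (∣ Δ ∣ ℝ.* (∣ a ∣ ℝ.⊔ᴿ ∣ b ∣)))
              ≈⟨ ℝ.*-congˡ (ℝ.*-congˡ (ℝ.trans (ℝ.*-distribˡ-⊔ _ _ (∣∣-nonneg Δ)) (ℝ.⊔-cong (ℝ.trans (ℝ.sym (∣∣-* _ _)) (∣∣-cong (sym at₁))) (ℝ.trans (ℝ.sym (∣∣-* _ _)) (∣∣-cong (sym at₂)))))) ⟩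
            κ ℝ.* (C ℝ.* linear-max (möbius γ) l)
              ≈⟨ ℝ.*-congˡ (ℝ.*-congˡ (ℝ.trans (ℝ.sym (linear l)) (ℝ.*-congˡ (h l)))) ⟩
            κ ℝ.* (C ℝ.* (C ℝ.* (C′ ℝ.^ 1 ℝ.* norm ξ (substitute l (lift φ)))))
              ≈⟨ ℝ.solve 4 (λ k c d n → k ℝ.:* (c ℝ.:* (c ℝ.:* ((d ℝ.:* ℝ.con (+ 1)) ℝ.:* n))) ℝ.:= (d ℝ.:* k) ℝ.:* ((c ℝ.:* (c ℝ.:* ℝ.con (+ 1))) ℝ.:* n)) ℝ.refl _ _ _ _ ⟩
            (C′ ℝ.* κ) ℝ.* (C ℝ.^ 2 ℝ.* norm ξ (substitute l (lift φ)))
              ≈⟨ ℝ.*-congˡ (ℝ.trans (ℝ.sym p) (∣∣-cong (eval-substitute l (lift φ) _ _))) ⟩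
            (C′ ℝ.* κ) ℝ.* ∣ image l t ∣
              ≈⟨ ℝ.trans (ℝ.*-assoc _ _ _) (ℝ.*-congˡ (∣linear-image∣ l t)) ⟩
            C′ ℝ.* ∣ eval l m₁₁ m₂₁ * f t + eval l m₁₂ m₂₂ * g t ∣
              ≈⟨ ℝ.*-congˡ (ℝ.trans (∣∣-cong (trans (+-cong (*-congʳ at₁) (*-congʳ at₂))
                   (solve 5 (λ d a b f g → (d :* a) :* f :+ (d :* b) :* g := d :* (a :* f :+ b :* g)) refl Δ a b (f t) (g t)))) (∣∣-* _ _)) ⟩
            C′ ℝ.* (∣ Δ ∣ ℝ.* ∣ a * f t + b * g t ∣)
              ≈⟨ ℝ.solve 3 (λ c d x → c ℝ.:* (d ℝ.:* x) ℝ.:= d ℝ.:* (c ℝ.:* x)) ℝ.refl _ _ _ ⟩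
            ∣ Δ ∣ ℝ.* (C′ ℝ.* ∣ a * f t + b * g t ∣) ∎))
          (proj₂ (along-norm (substitute l (lift φ))))
          where
          open import Relation.Binary.Reasoning.Setoid ℝ.setoid
          l : Form 1
          l = b * m₁₁ - a * m₁₂ ∷ a * m₂₂ - b * m₂₁ ∷ []
          at₁ : eval l m₁₁ m₂₁ ≈ Δ * a
          at₁ = solve 6 (λ m n p q a b → (b :* m :- a :* n) :* (p :* con (+ 1)) :+ m :* (a :* q :- b :* p) := (m :* q :- n :* p) :* a) refl m₁₁ m₁₂ m₂₁ m₂₂ a b
          at₂ : eval l m₁₂ m₂₂ ≈ Δ * b
          at₂ = solve 6 (λ m n p q a b → (b :* m :- a :* n) :* (q :* con (+ 1)) :+ n :* (a :* q :- b :* p) := (m :* q :- n :* p) :* b) refl m₁₁ m₁₂ m₂₁ m₂₂ a b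

        unit-max : ∀ (a b : 𝒪) → a k.≉ k.0# ⊎ b k.≉ k.0# → ∣ value a ∣ ℝ.⊔ᴿ ∣ value b ∣ ℝ.≈ ℝ.1#
        unit-max a b nz = max-unit γ {b} {a} ([ inj₂ , inj₁ ]′ nz)

        small-value : ∃[ s ] (ℝ.0# ≤ s × ¬ (s ℝ.≈ ℝ.1#) × κ ℝ.* C ℝ.≈ C′ ℝ.* s)
        small-value = let (t , p) = generic-witness (balance c₁ (k.- c₀)) in
          ∣ value c₁ * f t + (- value c₀) * g t ∣ , ∣∣-nonneg _ ,
          (λ e → proj₂ (≈0⇒small {c₁ k.* k.eval (k.num L) t k.1# k.+ (k.- c₀) k.* k.eval (k.den L) t k.1#}
              (k.trans (𝕜.solve 4 (λ a b f g → a 𝕜.:* f 𝕜.:+ (𝕜.:- b) 𝕜.:* g 𝕜.:= a 𝕜.:* f 𝕜.:- b 𝕜.:* g) k.refl c₁ c₀ _ _) (𝕜.x≈y⇒x-y≈0 (dep t k.1#))))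
            (ℝ.trans (∣∣-cong (combination c₁ (k.- c₀) t)) e)) ,
          ℝ.trans (ℝ.sym (ℝ.*-identityʳ _)) (ℝ.trans (ℝ.*-congˡ (ℝ.sym (unit-max c₁ (k.- c₀) ([ inj₂ ∘ 𝕜.-‿≉0 , inj₁ ]′ nz)))) p)

        contradictory : ∀ a b → ¬ ((a k.≉ k.0# ⊎ b k.≉ k.0#) × Generic (λ t → ∣ value a * f t + value b * g t ∣ ℝ.≈ ℝ.1#))
        contradictory a b (ab≉0 , gen) =
          let (s , _ , s≉1 , e) = small-value
              (t , p , q) = generic-witness (generic-map₂ (λ t p q → p , q) (balance a b) gen)
          in contradiction (ℝ.*-cancelˡ (ℝ.<⇒≉0 0<C′) (ℝ.trans (ℝ.sym e)
               (ℝ.trans (ℝ.sym (ℝ.*-identityʳ _)) (ℝ.trans (ℝ.*-congˡ (ℝ.sym (unit-max a b ab≉0))) (ℝ.trans p (ℝ.*-congˡ q)))))) s≉1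

        first : Any (k._≉ k.0#) (k.num L) → (k.1# k.≉ k.0# ⊎ k.0# k.≉ k.0#) × Generic (λ t → ∣ 1# * f t + 0# * g t ∣ ℝ.≈ ℝ.1#)
        first nz = inj₁ 𝕜.1≉0 , generic-map (λ t ne → ℝ.trans (∣∣-cong (trans (solve 2 (λ f g → con (+ 1) :* f :+ con (+ 0) :* g := f) refl (f t) (g t)) (sym (value-eval (k.num L) t k.1#)))) (≉0⇒unit {k.eval (k.num L) t k.1#} ne))
          (residue-nonvanishing (k.num L) nz)

        second : Any (k._≉ k.0#) (k.den L) → (k.0# k.≉ k.0# ⊎ k.1# k.≉ k.0#) × Generic (λ t → ∣ 0# * f t + 1# * g t ∣ ℝ.≈ ℝ.1#)
        second nz = inj₂ 𝕜.1≉0 , generic-map (λ t ne → ℝ.trans (∣∣-cong (trans (solve 2 (λ f g → con (+ 0) :* f :+ con (+ 1) :* g := g) refl (f t) (g t)) (sym (value-eval (k.den L) t k.1#)))) (≉0⇒unit {k.eval (k.den L) t k.1#} ne))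
          (residue-nonvanishing (k.den L) nz)

  normaliseVector : ∀ {n} (v : Vec Carrier n) → Any (_≉ 0#) v → ∃[ o ] Normalizes o v
  normaliseVector v nz = let (m , m≉0 , bound , attained) = largest v nz in
      divided m m≉0 bound , (m≉0 ⁻¹ , x⁻¹≉0 m≉0 , pointwise m m≉0 bound) , unit-coordinate m m≉0 bound attained
    where
    largest : ∀ {n} (v : Vec Carrier n) → Any (_≉ 0#) v → ∃[ m ] (m ≉ 0# × VecAll.All (λ x → ∣ x ∣ ≤ ∣ m ∣) v × Any (_≈ m) v)
    largest (x ∷ v) nz with em {P = Any (_≉ 0#) v}
    ... | no ¬nz = x , x≉0 nz , ≤-refl ∷ zeros v ¬nz , here refl
      where
      x≉0 : Any (_≉ 0#) (x ∷ v) → x ≉ 0#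
      x≉0 (here ne) = ne
      x≉0 (there p) = contradiction p ¬nz
      zeros : ∀ {n} (v : Vec Carrier n) → ¬ Any (_≉ 0#) v → VecAll.All (λ y → ∣ y ∣ ≤ ∣ x ∣) v
      zeros []      ¬nz = []
      zeros (y ∷ v) ¬nz = ≤-trans (≤-reflexive (∣≈0∣ (stable (λ ne → ¬nz (here ne))))) (∣∣-nonneg x) ∷ zeros v (¬nz ∘ there)
    ... | yes nz′ with largest v nz′
    ...   | m , m≉0 , bound , attained with total ∣ x ∣ ∣ m ∣
    ...     | inj₁ x≤m = m , m≉0 , x≤m ∷ bound , there attained
    ...     | inj₂ m≤x = x , (λ x≈0 → m≉0 (∣x∣≤0⇒x≈0 (≤-respʳ-≈ (∣≈0∣ x≈0) m≤x))) , ≤-refl ∷ VecAll.map (λ p → ≤-trans p m≤x) bound , here refl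
    divided : ∀ {n} {v : Vec Carrier n} m (m≉0 : m ≉ 0#) → VecAll.All (λ x → ∣ x ∣ ≤ ∣ m ∣) v → Vec 𝒪 n
    divided m m≉0 []                = []
    divided m m≉0 (_∷_ {x = x} p b) = (m≉0 ⁻¹ * x , quotient-integral m≉0 p) ∷ divided m m≉0 b
    pointwise : ∀ {n} {v : Vec Carrier n} m (m≉0 : m ≉ 0#) (b : VecAll.All (λ x → ∣ x ∣ ≤ ∣ m ∣) v) →
      Pointwise (λ x y → m≉0 ⁻¹ * x ≈ value y) v (divided m m≉0 b)
    pointwise m m≉0 []      = []
    pointwise m m≉0 (p ∷ b) = refl ∷ pointwise m m≉0 b
    unit-coordinate : ∀ {n} {v : Vec Carrier n} m (m≉0 : m ≉ 0#) (b : VecAll.All (λ x → ∣ x ∣ ≤ ∣ m ∣) v) → Any (_≈ m) v →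
      Any (λ y → ∣ value y ∣ ℝ.≈ ℝ.1#) (divided m m≉0 b)
    unit-coordinate m m≉0 (p ∷ b) (here e)  = here (ℝ.trans (∣∣-cong (trans (*-congˡ e) (trans (*-comm _ _) (x*x⁻¹ m≉0)))) ∣1∣)
    unit-coordinate m m≉0 (p ∷ b) (there a) = there (unit-coordinate m m≉0 b a)

  conjugate-nonzero : ∀ γ (φ : RationalMap 2) → ℙ 1 → Any (_≉ 0#) (num (conjugate γ (lift φ)) ++ den (conjugate γ (lift φ)))
  conjugate-nonzero γ φ α = stable λ ¬nz → nonvanishing φ (det γ * xᶜ α) (det γ * yᶜ α)
      ([ inj₁ ∘ *≉0 det≉0 , inj₂ ∘ *≉0 det≉0 ]′ (point-nonzero α))
      (vanish ¬nz)
    where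
    open GL₂ γ
    χ = conjugate γ (lift φ)
    s = m₂₂ * xᶜ α - m₁₂ * yᶜ α
    t = m₁₁ * yᶜ α - m₂₁ * xᶜ α
    at-adjugate : ∀ (h : Form 2) → eval h (eval (num (möbius γ)) s t) (eval (den (möbius γ)) s t) ≈ eval h (det γ * xᶜ α) (det γ * yᶜ α)
    at-adjugate h = eval-arg h
      (solve 6 (λ m n p q x y → let s = q :* x :- n :* y ; t = m :* y :- p :* x in n :* (t :* con (+ 1)) :+ s :* m := (m :* q :- n :* p) :* x) refl m₁₁ m₁₂ m₂₁ m₂₂ (xᶜ α) (yᶜ α))
      (solve 6 (λ m n p q x y → let s = q :* x :- n :* y ; t = m :* y :- p :* x in q :* (t :* con (+ 1)) :+ s :* p := (m :* q :- n :* p) :* y) refl m₁₁ m₁₂ m₂₁ m₂₂ (xᶜ α) (yᶜ α))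
    F₀ G₀ : Carrier
    F₀ = eval (num (lift φ)) (eval (num (möbius γ)) s t) (eval (den (möbius γ)) s t)
    G₀ = eval (den (lift φ)) (eval (num (möbius γ)) s t) (eval (den (möbius γ)) s t)
    vanish : ¬ Any (_≉ 0#) (num χ ++ den χ) → eval (num (lift φ)) (det γ * xᶜ α) (det γ * yᶜ α) ≈ 0# × eval (den (lift φ)) (det γ * xᶜ α) (det γ * yᶜ α) ≈ 0#
    vanish ¬nz = trans (sym (at-adjugate (num (lift φ)))) (solved m₁₁ m₁₂ F₀ (solve 6 (λ m n p q F G → (m :* q :- n :* p) :* F := m :* (q :* F :- n :* G) :+ n :* (m :* G :- p :* F)) refl m₁₁ m₁₂ m₂₁ m₂₂ F₀ G₀))
               , trans (sym (at-adjugate (den (lift φ)))) (solved m₂₁ m₂₂ G₀ (solve 6 (λ m n p q F G → (m :* q :- n :* p) :* G := p :* (q :* F :- n :* G) :+ q :* (m :* G :- p :* F)) refl m₁₁ m₁₂ m₂₁ m₂₂ F₀ G₀))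
      where
      num≈0 : m₂₂ * F₀ - m₁₂ * G₀ ≈ 0#
      num≈0 = trans (sym (conjugate-num-eval γ (lift φ) s t)) (vanishing-form (num χ) (λ p → ¬nz (Anyₚ.++⁺ˡ p)) s t)
      den≈0 : m₁₁ * G₀ - m₂₁ * F₀ ≈ 0#
      den≈0 = trans (sym (conjugate-den-eval γ (lift φ) s t)) (vanishing-form (den χ) (λ p → ¬nz (Anyₚ.++⁺ʳ (num χ) p)) s t)
      solved : ∀ a b u → det γ * u ≈ a * (m₂₂ * F₀ - m₁₂ * G₀) + b * (m₁₁ * G₀ - m₂₁ * F₀) → u ≈ 0#
      solved a b u e = x*y≈0⇒y≈0 det≉0 (trans e (trans (+-cong (trans (*-congˡ num≈0) (zeroʳ a)) (trans (*-congˡ den≈0) (zeroʳ b))) (+-identityʳ 0#)))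

  private
    pair : ∀ {p} {R : 𝒪 → 𝒪 → Set p} {a b} {v : Vec 𝒪 2} → Pointwise R (a ∷ b ∷ []) v → R a (head v) × R b (head (tail v))
    pair (p ∷ q ∷ []) = p , q

  direction-point : ∀ γ α (v : k.ℙ 1) → Specializes (applyInverse γ (coords α)) (k.coords v) →
    ∃[ s ] (s k.≉ k.0# × s k.* xₙ (normalForm γ α) k.≈ k.xᶜ v × s k.* yₙ (normalForm γ α) k.≈ k.yᶜ v)
  direction-point γ α v S = let (s , s≉0 , p) = specializes-unique normal S ; (px , py) = pair p in s , s≉0 , px , py
    where
    open GL₂ γ
    n = normalForm γ α
    x = xₙ n
    y = yₙ n
    d = dₙ n
    d≉0 = dₙ≉0 n
    has-unit : Any (λ z → ∣ value z ∣ ℝ.≈ ℝ.1#) (x ∷ y ∷ [])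
    has-unit = [ (λ ne → here (≉0⇒unit {x} ne)) , (λ ne → there (here (≉0⇒unit {y} ne))) ]′ (unimodular n)
    cancel : ∀ {u z} → u ≈ d * z → d≉0 ⁻¹ * u ≈ z
    cancel e = trans (*-congˡ e) (trans (solve 3 (λ i d z → i :* (d :* z) := d :* (i :* z)) refl (d≉0 ⁻¹) d _) (divide d≉0 _))
    inverse-coordinates : ∀ (w : Vec Carrier 2) →
      Pointwise _≈_ (m₂₂ * head w - m₁₂ * head (tail w) ∷ m₁₁ * head (tail w) - m₂₁ * head w ∷ []) (applyInverse γ w)
    inverse-coordinates (_ ∷ _ ∷ []) = refl ∷ refl ∷ []
    normal : Specializes (applyInverse γ (coords α)) (x ∷ y ∷ [])
    normal = specializes-resp (inverse-coordinates (coords α))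
      ((x ∷ y ∷ []) , ((d≉0 ⁻¹ , x⁻¹≉0 d≉0 , cancel (x-coord n) ∷ cancel (y-coord n) ∷ []) , has-unit) ,
       (k.1# , 𝕜.1≉0 , k.*-identityˡ x ∷ k.*-identityˡ y ∷ []))

  no-form-vanishes : ∀ {f : k.Form 2} → (∀ x y → k.eval f x y k.≈ k.0#) → ¬ Any (k._≉ k.0#) f
  no-form-vanishes {f} h nz = go f (𝕜.quadratic-ext {f} {k.0# ∷ k.0# ∷ k.0# ∷ []} λ x y → k.trans (h x y)
      (𝕜.solve 2 (λ x y → 𝕜.con (+ 0) 𝕜.:= 𝕜.con (+ 0) 𝕜.:* (y 𝕜.:* (y 𝕜.:* 𝕜.con (+ 1))) 𝕜.:+ x 𝕜.:* (𝕜.con (+ 0) 𝕜.:* (y 𝕜.:* 𝕜.con (+ 1)) 𝕜.:+ x 𝕜.:* 𝕜.con (+ 0))) k.refl x y)) nz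
    where
    go : ∀ (f : k.Form 2) → f k.≋ k.0# ∷ k.0# ∷ k.0# ∷ [] → ¬ Any (k._≉ k.0#) f
    go (_ ∷ _ ∷ _ ∷ []) (e ∷ _)         (here ne)                 = ne e
    go (_ ∷ _ ∷ _ ∷ []) (_ ∷ e ∷ _)     (there (here ne))         = ne e
    go (_ ∷ _ ∷ _ ∷ []) (_ ∷ _ ∷ e ∷ _) (there (there (here ne))) = ne e

  good-reduction : ∀ {m e} (h : k.Form m) (ψ : k.RationalMap e) (f g : k.Form 2) → 2 ℕ.≤ e →
    f k.≋ h k.⊛ k.num (k.lift ψ) → g k.≋ h k.⊛ k.den (k.lift ψ) → Any (k._≉ k.0#) f ⊎ Any (k._≉ k.0#) g →
    ∀ p → 𝕜.Nonzero p → ¬ (𝕜.evalAt f p k.≈ k.0# × 𝕜.evalAt g p k.≈ k.0#)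
  good-reduction {zero} {suc e} (h₀ ∷ []) ψ f g _ ef eg nz (x , y) nzp (f≈0 , g≈0) =
    𝕜.nonvanishing ψ x y nzp (divided ef f≈0 , divided eg g≈0)
    where
    factor-eval : ∀ {f : k.Form 2} {u : k.Form (suc e)} → f k.≋ (h₀ ∷ []) k.⊛ u → ∀ x y → k.eval f x y k.≈ h₀ k.* k.eval u x y
    factor-eval {u = u} ef x y = k.trans (𝕜.eval-≋ ef x y) (𝕜.eval-⊛ (h₀ ∷ []) u x y)
    h₀≉0 : h₀ k.≉ k.0#
    h₀≉0 e = [ no-form-vanishes (λ x y → k.trans (factor-eval ef x y) (k.trans (k.*-congʳ e) (k.zeroˡ _)))
             , no-form-vanishes (λ x y → k.trans (factor-eval eg x y) (k.trans (k.*-congʳ e) (k.zeroˡ _))) ]′ nz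
    divided : ∀ {f : k.Form 2} {u : k.Form (suc e)} → f k.≋ (h₀ ∷ []) k.⊛ u → k.eval f x y k.≈ k.0# → k.eval u x y k.≈ k.0#
    divided ef f≈0 = 𝕜.x*y≈0⇒y≈0 h₀≉0 (k.trans (k.sym (factor-eval ef x y)) f≈0)
  good-reduction {suc m} {e} h ψ f g 2≤e ef _ _ _ _ _ =
    ℕₚ.<-irrefl (𝕜.≋-degree ef) (ℕ.s≤s (ℕₚ.≤-trans 2≤e (ℕₚ.m≤n+m e m)))

  module _ (s : Vec Carrier 3) where

    third-coordinate : ∀ {x y a b} → Specializes s (x ∷ y ∷ k.1# ∷ []) → ¬ Specializes s (a ∷ b ∷ k.0# ∷ [])
    third-coordinate {x} {y} {a} {b} S S′ = go (specializes-unique {v = s} {x ∷ y ∷ k.1# ∷ []} {a ∷ b ∷ k.0# ∷ []} S S′)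
      where
      go : ¬ k.Proportional (x ∷ y ∷ k.1# ∷ []) (a ∷ b ∷ k.0# ∷ [])
      go (u , u≉0 , _ ∷ _ ∷ e ∷ []) = u≉0 (k.trans (k.sym (k.*-identityʳ u)) e)

    first-coordinate : ∀ {x y a b} → Specializes s (k.1# ∷ x ∷ y ∷ []) → ¬ Specializes s (k.0# ∷ a ∷ b ∷ [])
    first-coordinate {x} {y} {a} {b} S S′ = go (specializes-unique {v = s} {k.1# ∷ x ∷ y ∷ []} {k.0# ∷ a ∷ b ∷ []} S S′)
      where
      go : ¬ k.Proportional (k.1# ∷ x ∷ y ∷ []) (k.0# ∷ a ∷ b ∷ [])
      go (u , u≉0 , e ∷ _) = u≉0 (k.trans (k.sym (k.*-identityʳ u)) e)

    second-coordinate : ∀ {x y} → Specializes s (k.1# ∷ x ∷ k.0# ∷ []) → Specializes s (k.1# ∷ y ∷ k.0# ∷ []) → x k.≈ y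
    second-coordinate {x} {y} S S′ = go (specializes-unique {v = s} {k.1# ∷ x ∷ k.0# ∷ []} {k.1# ∷ y ∷ k.0# ∷ []} S S′)
      where
      go : k.Proportional (k.1# ∷ x ∷ k.0# ∷ []) (k.1# ∷ y ∷ k.0# ∷ []) → x k.≈ y
      go (u , _ , e ∷ e′ ∷ _) = k.trans (k.sym (k.trans (k.*-congʳ (k.trans (k.sym (k.*-identityʳ u)) e)) (k.*-identityˡ x))) e′

  residue : GL₂ → ℙ 1 → 𝕜.Point
  residue γ α = kpoint γ (normalForm γ α)

  record Apart (γ : GL₂) (α β : ℙ 1) : Set (r ⊔ ℓ₁ ⊔ ℓ₂ ⊔ c ⊔ ℓ) where
    constructor apart
    field
      crosses : 𝕜.cross (residue γ α) (residue γ β) k.≉ k.0#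

  open Apart

  bracket⇒apart : ∀ γ α β → bracketₖ γ (normalForm γ α) (normalForm γ β) k.≉ k.0# → Apart γ α β
  bracket⇒apart γ α β ne = apart ne

  apart⇒bracket : ∀ {γ α β} → Apart γ α β → bracketₖ γ (normalForm γ α) (normalForm γ β) k.≉ k.0#
  apart⇒bracket (apart ne) = ne

  apart-flip : ∀ {γ α β} → Apart γ α β → Apart γ β α
  apart-flip {γ} {α} {β} (apart ne) = apart (𝕜.cross-flip≉0 (residue γ α) (residue γ β) ne)

  -- The direction of α at a Gauss point is moved by the reduction ψ.
  record Moved (γ : GL₂) (ψ : k.RationalMap 1) (α : ℙ 1) : Set (r ⊔ ℓ₁ ⊔ ℓ₂ ⊔ c ⊔ ℓ) where
    constructor moves
    field
      pairs : 𝕜.pairing (k.num (k.lift ψ)) (k.den (k.lift ψ)) (residue γ α) (residue γ α) k.≉ k.0#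

  open Moved

  module _ (φ : RationalMap 2) (ξ : ℙ¹ᴮᵉʳᵏ) where

    InPlane OnLine AtDouble AtVertex : Carrier → Carrier → Carrier → Set _
    InPlane λ₁ λ₂ λ₃  = ∃[ x ] ∃[ y ] Specializes (sigmaPoint λ₁ λ₂ λ₃) (x ∷ y ∷ k.1# ∷ [])
    OnLine λ₁ λ₂ λ₃   = ∃[ x ] (x k.≉ 2ₖ × Specializes (sigmaPoint λ₁ λ₂ λ₃) (k.1# ∷ x ∷ k.0# ∷ []) × Indifference φ x)
    AtDouble λ₁ λ₂ λ₃ = Specializes (sigmaPoint λ₁ λ₂ λ₃) (k.1# ∷ 2ₖ ∷ k.0# ∷ [])
    AtVertex λ₁ λ₂ λ₃ = Specializes (sigmaPoint λ₁ λ₂ λ₃) (k.0# ∷ k.1# ∷ k.0# ∷ [])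

    private
      sigma₁₂ : ∀ a b c → Pointwise _≈_ (sigmaPoint b a c) (sigmaPoint a b c)
      sigma₁₂ a b c = solve 3 (λ a b c → b :+ a :+ c := a :+ b :+ c) refl a b c
                    ∷ solve 3 (λ a b c → b :* a :+ b :* c :+ a :* c := a :* b :+ a :* c :+ b :* c) refl a b c ∷ refl ∷ []

      sigma₂₃ : ∀ a b c → Pointwise _≈_ (sigmaPoint a c b) (sigmaPoint a b c)
      sigma₂₃ a b c = solve 3 (λ a b c → a :+ c :+ b := a :+ b :+ c) refl a b c
                    ∷ solve 3 (λ a b c → a :* c :+ a :* b :+ c :* b := a :* b :+ a :* c :+ b :* c) refl a b c ∷ refl ∷ []

      module OnLineSymmetric = Symmetric φ OnLine
        (λ {a} {b} {c} (x , ne , S , i) → x , ne , specializes-resp (sigma₁₂ a b c) S , i)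
        (λ {a} {b} {c} (x , ne , S , i) → x , ne , specializes-resp (sigma₂₃ a b c) S , i)
      module AtDoubleSymmetric = Symmetric φ AtDouble
        (λ {a} {b} {c} → specializes-resp (sigma₁₂ a b c)) (λ {a} {b} {c} → specializes-resp (sigma₂₃ a b c))
      module AtVertexSymmetric = Symmetric φ AtVertex
        (λ {a} {b} {c} → specializes-resp (sigma₁₂ a b c)) (λ {a} {b} {c} → specializes-resp (sigma₂₃ a b c))

      data-at : ∀ {γ L} → NormalLift γ φ L → ∀ {λ₁ λ₂ λ₃} (M : Marked φ λ₁ λ₂ λ₃) → ModelData φ M
      data-at {γ} R M = modelData R M (normalForm γ (Marked.α₁ M)) (normalForm γ (Marked.α₂ M)) (normalForm γ (Marked.α₃ M))

    module _ (fr : Frame ξ) where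
      open Frame fr

      private
        G : GaussAlong (möbius γ) ξ
        G = frame⇒gauss γ {ζᴳ} isGauss maps

      module _ {e} {ψ : k.RationalMap e} (via : ReductionVia fr φ ψ) where
        open ReducesTo via renaming (factor to common)

        private
          R : NormalLift γ φ normalizedLift
          R = normalLift γ φ normalizedLift isNormalized

        plane : 2 ℕ.≤ e → ∀ {λ₁ λ₂ λ₃} → Marked φ λ₁ λ₂ λ₃ → InPlane λ₁ λ₂ λ₃
        plane 2≤e M = finite-case (data-at R M)
          (good-reduction common ψ (k.num normalizedLift) (k.den normalizedLift) 2≤e num-factors den-factors (NormalLift.nonzero R))

      not-constant : ∀ {ψ : k.RationalMap 0} → ReductionVia fr φ ψ → ¬ FixedBy φ ξ
      not-constant {ψ} via fix = go (k.lift ψ) (k.IsReduced.nonzero (k.reduced ψ)) num-factors den-factors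
        where
        open ReducesTo via renaming (factor to common)
        L = normalizedLift
        go : ∀ (χ : k.Lift 0) → Any (k._≉ k.0#) (k.num χ) ⊎ Any (k._≉ k.0#) (k.den χ) →
          k.num L k.≋ common k.⊛ k.num χ → ¬ (k.den L k.≋ common k.⊛ k.den χ)
        go k.[ c₀ ∷ [] , c₁ ∷ [] ] nz ef eg = fixed⇒independent γ G (normalLift γ φ L isNormalized) fix
          ((c₀ , c₁) , [ (λ { (here ne) → inj₁ ne }) , (λ { (here ne) → inj₂ ne }) ]′ nz , λ x y →
            k.trans (k.*-congˡ (k.trans (𝕜.eval-≋ ef x y) (𝕜.eval-⊛ common (c₀ ∷ []) x y)))
              (k.trans (𝕜.solve 3 (λ a b h → b 𝕜.:* (h 𝕜.:* a) 𝕜.:= a 𝕜.:* (h 𝕜.:* b)) k.refl c₀ c₁ (k.eval common x y))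
                (k.*-congˡ (k.sym (k.trans (𝕜.eval-≋ eg x y) (𝕜.eval-⊛ common (c₁ ∷ []) x y))))))

      module _ (ψ : k.RationalMap 1) (via : ReductionVia fr φ ψ) where
        open ReducesTo via renaming (factor to common)

        private
          L = normalizedLift
          R : NormalLift γ φ L
          R = normalLift γ φ L isNormalized
          u = k.num (k.lift ψ)
          v = k.den (k.lift ψ)

          linear-factor : Σ[ h ∈ k.Form 1 ] (k.num L k.≋ h k.⊛ u × k.den L k.≋ h k.⊛ v)
          linear-factor = go degree common num-factors den-factors
            where
            go : ∀ m (h : k.Form m) → k.num L k.≋ h k.⊛ u → k.den L k.≋ h k.⊛ v → Σ[ h ∈ k.Form 1 ] (k.num L k.≋ h k.⊛ u × k.den L k.≋ h k.⊛ v)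
            go zero          h ef eg with 𝕜.≋-degree ef
            ... | ()
            go (suc zero)    h ef eg = h , ef , eg
            go (suc (suc m)) h ef eg = contradiction (≡.trans (𝕜.≋-degree ef) (ℕₚ.+-comm (suc (suc m)) 1)) λ ()

          h = proj₁ linear-factor
          ef = proj₁ (proj₂ linear-factor)
          eg = proj₂ (proj₂ linear-factor)

        hyperbolic : Trident φ ξ → (∃[ b ] b k.≉ k.0# × b k.≉ k.1# × ψ k.conjugateTo k.[ b k.· k.X , k.Y ]) →
          ∀ {λ₁ λ₂ λ₃} → Marked φ λ₁ λ₂ λ₃ → OnLine λ₁ λ₂ λ₃
        hyperbolic T (b , b≉0 , b≉1 , conj) {λ₁} {λ₂} {λ₃} M = choose
            (𝕜.hyperbolic-moves ψ b b≉0 b≉1 conj (residue γ α₁) (residue γ α₂) (residue γ α₃) (crosses n₁₂) (crosses n₁₃) (crosses n₂₃))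
          where
          open Trident T
          n₁₂ : Apart γ α₁ α₂
          n₁₂ = bracket⇒apart γ α₁ α₂ (orthogonal⇒distinct γ G (normalForm γ α₁) (normalForm γ α₂) orthogonal₁₂)
          n₁₃ : Apart γ α₁ α₃
          n₁₃ = bracket⇒apart γ α₁ α₃ (orthogonal⇒distinct γ G (normalForm γ α₁) (normalForm γ α₃) orthogonal₁₃)
          n₂₃ : Apart γ α₂ α₃
          n₂₃ = bracket⇒apart γ α₂ α₃ (orthogonal⇒distinct γ G (normalForm γ α₂) (normalForm γ α₃) orthogonal₂₃)
          with-special : ∀ β δ ε → Fixes φ β → Fixes φ δ → Fixes φ ε →
            cross (point β) (point δ) ≉ 0# → cross (point β) (point ε) ≉ 0# → cross (point δ) (point ε) ≉ 0# →
            Apart γ δ ε → Moved γ ψ β → OnLine λ₁ λ₂ λ₃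
          with-special β δ ε fβ fδ fε ne₁ ne₂ ne₃ ne mv = OnLineSymmetric.with-triple β δ ε fβ fδ fε ne₁ ne₂ ne₃
            (λ { M ≡.refl ≡.refl ≡.refl → let (x , S , i , x≉2 , _) = line-case (data-at R M) ψ h ef eg (pairs mv) in
                 x , x≉2 (crosses (apart-flip ne)) , S , i }) M
          choose : 𝕜.pairing u v (residue γ α₁) (residue γ α₁) k.≉ k.0# ⊎ 𝕜.pairing u v (residue γ α₂) (residue γ α₂) k.≉ k.0# ⊎
            𝕜.pairing u v (residue γ α₃) (residue γ α₃) k.≉ k.0# → OnLine λ₁ λ₂ λ₃
          choose (inj₁ mv)        = with-special α₁ α₂ α₃ fixes₁ fixes₂ fixes₃ distinct₁₂ distinct₁₃ distinct₂₃ n₂₃ (moves mv)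
          choose (inj₂ (inj₁ mv)) = with-special α₂ α₁ α₃ fixes₂ fixes₁ fixes₃ (cross-flip≉0 (point α₁) (point α₂) distinct₁₂) distinct₂₃ distinct₁₃ n₁₃ (moves mv)
          choose (inj₂ (inj₂ mv)) = with-special α₃ α₁ α₂ fixes₃ fixes₁ fixes₂ (cross-flip≉0 (point α₁) (point α₃) distinct₁₃) (cross-flip≉0 (point α₂) (point α₃) distinct₂₃) distinct₁₂ n₁₂ (moves mv)

        parabolic : ΓFix φ ξ → (∃[ b ] b k.≉ k.0# × ψ k.conjugateTo k.[ k.X k.⊕ b k.· k.Y , k.Y ]) →
          ∀ {λ₁ λ₂ λ₃} → Marked φ λ₁ λ₂ λ₃ → AtDouble λ₁ λ₂ λ₃
        parabolic onΓ (b , b≉0 , conj) {λ₁} {λ₂} {λ₃} M = split (ΓFix⇒distinct γ G φ onΓ)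
          where
          with-special : ∀ β → Fixes φ β → Moved γ ψ β → AtDouble λ₁ λ₂ λ₃
          with-special β fβ mv = AtDoubleSymmetric.with-third β fβ
            (λ { M ≡.refl → double-case (data-at R M) ψ h ef eg (pairs mv) b conj }) M
          choose : ∀ α β → Fixes φ α → Fixes φ β → 𝕜.pairing u v (residue γ α) (residue γ α) k.≉ k.0# ⊎ 𝕜.pairing u v (residue γ β) (residue γ β) k.≉ k.0# → AtDouble λ₁ λ₂ λ₃
          choose α β fα fβ (inj₁ mv) = with-special α fα (moves mv)
          choose α β fα fβ (inj₂ mv) = with-special β fβ (moves mv)
          split : ∃[ α ] ∃[ β ] (Fixes φ α × Fixes φ β × bracketₖ γ (normalForm γ α) (normalForm γ β) k.≉ k.0#) → AtDouble λ₁ λ₂ λ₃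
          split (α , β , fα , fβ , ne) = choose α β fα fβ
            (𝕜.parabolic-moves ψ b b≉0 conj (residue γ α) (residue γ β) (crosses (bracket⇒apart γ α β ne)))

        classify : IsTypeII ξ → FixedBy φ ξ → ∀ {λ₁ λ₂ λ₃} (M : Marked φ λ₁ λ₂ λ₃) → Moved γ ψ (Marked.α₃ M) → W2 φ ξ ⊎ W3 φ ξ
        classify typeII fix M (moves mv) = choose em
          where
          open Marked M
          n₁₃ = apart⇒bracket {γ} {α₁} {α₃} (apart (special-c₁₃ (data-at R M) ψ h ef eg mv))
          n₂₃ = apart⇒bracket {γ} {α₂} {α₃} (apart (special-c₂₃ (data-at R M) ψ h ef eg mv))
          choose : Dec (Apart γ α₁ α₂) → W2 φ ξ ⊎ W3 φ ξ
          choose (yes n₁₂) = inj₁ (typeII , fix , (ψ , (fr , via) , dilation (data-at R M) ψ h ef eg mv (crosses n₁₂)) ,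
            distinct⇒branch γ G φ α₁ α₂ α₃ (fixes φ mult₁) (fixes φ mult₂) (fixes φ mult₃) (apart⇒bracket {γ} {α₁} {α₂} n₁₂) n₁₃ n₂₃)
          choose (no ¬n₁₂) = inj₂ (typeII , fix , (ψ , (fr , via) , translation (data-at R M) ψ h ef eg mv (stable λ ne → ¬n₁₂ (apart ne))) ,
            distinct⇒ΓFix γ G φ α₁ α₃ (fixes φ mult₁) (fixes φ mult₃) n₁₃)

        moved-direction : ∀ {d} → MovedFixedPointDirection fr φ ψ d → IsTypeII ξ → FixedBy φ ξ → ∀ {λ₁ λ₂ λ₃} → Marked φ λ₁ λ₂ λ₃ → W2 φ ξ ⊎ W3 φ ξ
        moved-direction {d} ((α , fα , dir) , ¬fixes) typeII fix M = Constant.with-third α fα (λ { M ≡.refl → classify typeII fix M is-moved }) M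
          where
          module Constant = Symmetric φ (λ _ _ _ → W2 φ ξ ⊎ W3 φ ξ) id id
          found = direction-point γ α d dir
          s = proj₁ found
          sx = proj₁ (proj₂ (proj₂ found))
          sy = proj₂ (proj₂ (proj₂ found))
          is-moved : Moved γ ψ α
          is-moved = moves λ e → ¬fixes (𝕜.pairing-scale u v s (residue γ α) (k.xᶜ d) (k.yᶜ d) (k.sym sx) (k.sym sy) e)

    -- The constant reduction c₀ agrees with at most one of the three fixed points.
    vertex-classify : ∀ γ {L} → NormalLift γ φ L → Dependent L → (T : Trident φ ξ) → let open Trident T in
      Apart γ α₁ α₂ → Apart γ α₁ α₃ → Apart γ α₂ α₃ → ∀ {λ₁ λ₂ λ₃} → Marked φ λ₁ λ₂ λ₃ → AtVertex λ₁ λ₂ λ₃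
    vertex-classify γ {L} R (c₀ , c₀≉0 , dependent) T n₁₂ n₁₃ n₂₃ {λ₁} {λ₂} {λ₃} M = at-vertex
      where
      open Trident T
      record Off (α : ℙ 1) : Set (r ⊔ ℓ₁ ⊔ ℓ₂ ⊔ c ⊔ ℓ) where
        constructor off
        field
          misses : 𝕜.cross (residue γ α) c₀ k.≉ k.0#
      open Off
      with-special : ∀ β δ ε → Fixes φ β → Fixes φ δ → Fixes φ ε →
        cross (point β) (point δ) ≉ 0# → cross (point β) (point ε) ≉ 0# → cross (point δ) (point ε) ≉ 0# →
        Apart γ ε δ → Apart γ ε β → Apart γ δ β → Off ε → Off δ → AtVertex λ₁ λ₂ λ₃
      with-special β δ ε fβ fδ fε ne₁ ne₂ ne₃ nεδ nεβ nδβ nε nδ = AtVertexSymmetric.with-triple β δ ε fβ fδ fε ne₁ ne₂ ne₃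
        (λ { M ≡.refl ≡.refl ≡.refl → vertex-case (data-at R M) c₀ dependent (crosses nεδ) (crosses nεβ) (crosses nδβ) (misses nε) (misses nδ) }) M
      others : ∀ {α β} → Apart γ α β → ¬ Off α → Off β
      others {α} {β} (apart ne) ¬off = off λ e → ne (𝕜.cross-trans (residue γ α) c₀ (residue γ β) c₀≉0 (stable λ ne′ → ¬off (off ne′)) e)
      at-vertex : AtVertex λ₁ λ₂ λ₃
      at-vertex with em {P = Off α₁} | em {P = Off α₂}
      ... | no ¬n | _ = with-special α₁ α₂ α₃ fixes₁ fixes₂ fixes₃ distinct₁₂ distinct₁₃ distinct₂₃
        (apart-flip n₂₃) (apart-flip n₁₃) (apart-flip n₁₂) (others n₁₃ ¬n) (others n₁₂ ¬n)
      ... | yes n | no ¬n = with-special α₂ α₁ α₃ fixes₂ fixes₁ fixes₃ (cross-flip≉0 (point α₁) (point α₂) distinct₁₂) distinct₂₃ distinct₁₃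
        (apart-flip n₁₃) (apart-flip n₂₃) n₁₂ (others n₂₃ ¬n) n
      ... | yes n | yes n′ = with-special α₃ α₁ α₂ fixes₃ fixes₁ fixes₂ (cross-flip≉0 (point α₁) (point α₃) distinct₁₃) (cross-flip≉0 (point α₂) (point α₃) distinct₂₃) distinct₁₂
        (apart-flip n₁₂) n₂₃ n₁₃ n′ n

    moved-trident : Trident φ ξ → ¬ FixedBy φ ξ → ∀ {λ₁ λ₂ λ₃} → Marked φ λ₁ λ₂ λ₃ → AtVertex λ₁ λ₂ λ₃
    moved-trident T ¬fixed {λ₁} {λ₂} {λ₃} M = at-vertex (trident⇒gauss T)
      where
      open Trident T
      normal : ∀ γ → Σ[ L ∈ k.Lift 2 ] NormalLift γ φ L
      normal γ = let (o , N) = normaliseVector (num χ ++ den χ) (conjugate-nonzero γ φ α₁) in split o N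
        where
        χ = conjugate γ (lift φ)
        split : ∀ o → Normalizes o (num χ ++ den χ) → Σ[ L ∈ k.Lift 2 ] NormalLift γ φ L
        split o N with splitAt 3 o
        ... | f , g , ≡.refl = k.[ f , g ] , normalLift γ φ k.[ f , g ] N
      with-lift : ∀ γ → GaussAlong (möbius γ) ξ → Σ[ L ∈ k.Lift 2 ] NormalLift γ φ L → AtVertex λ₁ λ₂ λ₃
      with-lift γ G (L , R) = vertex-classify γ R (stable λ ¬dep → ¬fixed (independent⇒fixed γ G R ¬dep)) T
        (bracket⇒apart γ α₁ α₂ (orthogonal⇒distinct γ G (normalForm γ α₁) (normalForm γ α₂) orthogonal₁₂))
        (bracket⇒apart γ α₁ α₃ (orthogonal⇒distinct γ G (normalForm γ α₁) (normalForm γ α₃) orthogonal₁₃))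
        (bracket⇒apart γ α₂ α₃ (orthogonal⇒distinct γ G (normalForm γ α₂) (normalForm γ α₃) orthogonal₂₃)) M
      at-vertex : ∃[ γ ] GaussAlong (möbius γ) ξ → AtVertex λ₁ λ₂ λ₃
      at-vertex (γ , G) = with-lift γ G (normal γ)

    module _ {λ₁ λ₂ λ₃} (M : Marked φ λ₁ λ₂ λ₃) where

      W1⇒inPlane : W1 φ ξ → InPlane λ₁ λ₂ λ₃
      W1⇒inPlane (_ , _ , _ , ψ , (fr , via) , 2≤e) = plane fr via 2≤e M

      W2⇒onLine : W2 φ ξ → OnLine λ₁ λ₂ λ₃
      W2⇒onLine (_ , _ , (ψ , (fr , via) , conj) , branch) = hyperbolic fr ψ via (branch⇒trident φ branch) conj M

      W3⇒atDouble : W3 φ ξ → AtDouble λ₁ λ₂ λ₃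
      W3⇒atDouble (_ , _ , (ψ , (fr , via) , conj) , onΓ) = parabolic fr ψ via onΓ conj M

      W4⇒atVertex : W4 φ ξ → AtVertex λ₁ λ₂ λ₃
      W4⇒atVertex (_ , branch , ¬fixed) = moved-trident (branch⇒trident φ branch) ¬fixed M

      weight⇒W : HasPositiveWeight φ ξ → W1 φ ξ ⊎ W2 φ ξ ⊎ W3 φ ξ ⊎ W4 φ ξ
      weight⇒W (_ , fixed {zero} typeII fix fr via _ _ , _) = contradiction fix (not-constant fr via)
      weight⇒W (suc w , fixed {suc zero} {ψ = ψ} typeII fix fr via count ≡.refl , _) =
        inj₂ ([ inj₁ , inj₂ ∘ inj₁ ]′ (moved-direction fr ψ via {Count.element count zero} (Count.member count zero) typeII fix M))
      weight⇒W (_ , fixed {suc (suc e)} {ψ = ψ} typeII fix fr via _ _ , _) =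
        inj₁ (typeII , fix , suc (suc e) , ψ , (fr , via) , ℕ.s≤s (ℕ.s≤s ℕ.z≤n))
      weight⇒W (_ , moved branch _ _ , _) =
        let (γ , G) = trident⇒gauss {φ = φ} {ξ} (branch⇒trident φ {ξ} (proj₁ branch)) in inj₂ (inj₂ (inj₂ (gauss⇒typeII γ G , branch)))
      weight⇒W (_ , other _ _ , ())

    classification : HasPositiveWeight φ ξ → ∀ {λ₁ λ₂ λ₃} → Marked φ λ₁ λ₂ λ₃ →
      let s = sigmaPoint λ₁ λ₂ λ₃ in
      ((∃[ x ] ∃[ y ] Specializes s (x ∷ y ∷ k.1# ∷ [])) ⇔ W1 φ ξ) ×
      ((∃[ x ] (x k.≉ 2ₖ × Specializes s (k.1# ∷ x ∷ k.0# ∷ []))) ⇔ W2 φ ξ) ×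
      (∀ x → x k.≉ 2ₖ → Specializes s (k.1# ∷ x ∷ k.0# ∷ []) → Indifference φ x) ×
      (Specializes s (k.1# ∷ 2ₖ ∷ k.0# ∷ []) ⇔ W3 φ ξ) ×
      (Specializes s (k.0# ∷ k.1# ∷ k.0# ∷ []) ⇔ W4 φ ξ)
    classification weight {λ₁} {λ₂} {λ₃} M =
        mk⇔ to₁ (W1⇒inPlane M) , mk⇔ to₂ from₂ , indifferent , mk⇔ to₃ (W3⇒atDouble M) , mk⇔ to₄ (W4⇒atVertex M)
      where
      s = sigmaPoint λ₁ λ₂ λ₃
      cases = weight⇒W M weight
      Line : 𝒪 → Set _
      Line x = Specializes s (k.1# ∷ x ∷ k.0# ∷ [])
      not₁ : ∀ {a b} → Specializes s (a ∷ b ∷ k.0# ∷ []) → ¬ W1 φ ξ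
      not₁ {a} {b} S w = let (x , y , S′) = W1⇒inPlane M w in third-coordinate s {x} {y} {a} {b} S′ S
      to₁ : InPlane λ₁ λ₂ λ₃ → W1 φ ξ
      to₁ (x , y , S) = [ id , [ (λ w → contradiction (W2⇒onLine M w) not₂) , [ (λ w → contradiction (W3⇒atDouble M w) not₃) , (λ w → contradiction (W4⇒atVertex M w) not₄) ]′ ]′ ]′ cases
        where
        not₂ : ¬ OnLine λ₁ λ₂ λ₃
        not₂ (x′ , _ , S′ , _) = third-coordinate s {x} {y} {k.1#} {x′} S S′
        not₃ : ¬ AtDouble λ₁ λ₂ λ₃
        not₃ = third-coordinate s {x} {y} {k.1#} {2ₖ} S
        not₄ : ¬ AtVertex λ₁ λ₂ λ₃
        not₄ = third-coordinate s {x} {y} {k.0#} {k.1#} S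
      on-line : ∀ x → x k.≉ 2ₖ → Line x → W2 φ ξ
      on-line x x≉2 S = [ (λ w → contradiction w (not₁ {k.1#} {x} S))
        , [ id , [ (λ w → contradiction (second-coordinate s {x} {2ₖ} S (W3⇒atDouble M w)) x≉2)
        , (λ w → contradiction (W4⇒atVertex M w) (first-coordinate s {x} {k.0#} {k.1#} {k.0#} S)) ]′ ]′ ]′ cases
      to₂ : ∃[ x ] (x k.≉ 2ₖ × Line x) → W2 φ ξ
      to₂ (x , x≉2 , S) = on-line x x≉2 S
      from₂ : W2 φ ξ → ∃[ x ] (x k.≉ 2ₖ × Line x)
      from₂ w = let (x , x≉2 , S , _) = W2⇒onLine M w in x , x≉2 , S
      indifference-resp : ∀ {x y} → x k.≈ y → Indifference φ x → Indifference φ y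
      indifference-resp e (some , all) = some , λ α l i → let (m , lm≈1 , x≈) = all α l i in m , lm≈1 , k.trans (k.sym e) x≈
      indifferent : ∀ x → x k.≉ 2ₖ → Line x → Indifference φ x
      indifferent x x≉2 S = go (W2⇒onLine M (on-line x x≉2 S))
        where
        go : OnLine λ₁ λ₂ λ₃ → Indifference φ x
        go (x′ , _ , S′ , i) = indifference-resp {x′} {x} (second-coordinate s {x′} {x} S′ S) i
      not₂ : ∀ {a b} → Specializes s (k.0# ∷ a ∷ b ∷ []) → ¬ OnLine λ₁ λ₂ λ₃
      not₂ {a} {b} S (x′ , _ , S′ , _) = first-coordinate s {x′} {k.0#} {a} {b} S′ S
      to₃ : AtDouble λ₁ λ₂ λ₃ → W3 φ ξ
      to₃ S = [ (λ w → contradiction w (not₁ {k.1#} {2ₖ} S)) , [ (λ w → contradiction (W2⇒onLine M w) not-simple)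
        , [ id , (λ w → contradiction (W4⇒atVertex M w) (first-coordinate s {2ₖ} {k.0#} {k.1#} {k.0#} S)) ]′ ]′ ]′ cases
        where
        not-simple : ¬ OnLine λ₁ λ₂ λ₃
        not-simple (x′ , x≉2 , S′ , _) = x≉2 (second-coordinate s {x′} {2ₖ} S′ S)
      to₄ : AtVertex λ₁ λ₂ λ₃ → W4 φ ξ
      to₄ S = [ (λ w → contradiction w (not₁ {k.0#} {k.1#} S)) , [ (λ w → contradiction (W2⇒onLine M w) (not₂ {k.1#} {k.0#} S))
        , [ (λ w → contradiction S (first-coordinate s {2ₖ} {k.0#} {k.1#} {k.0#} (W3⇒atDouble M w))) , id ]′ ]′ ]′ cases

theorem1p1 :
    (∀ {a} → ExcludedMiddle a) →
    ∀ {r ℓ₁ ℓ₂} (ℝ : RealField r ℓ₁ ℓ₂) {c ℓ} (K : NonArchimedeanField ℝ c ℓ) →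
    let open Berkovich ℝ K in
    (φ : RationalMap 2) (ξ : ℙ¹ᴮᵉʳᵏ) → HasPositiveWeight φ ξ →
    (α₁ α₂ α₃ : ℙ 1) → HasFixedPoints φ α₁ α₂ α₃ →
    (λ₁ λ₂ λ₃ : Carrier) →
    IsMultiplier φ α₁ λ₁ → IsMultiplier φ α₂ λ₂ → IsMultiplier φ α₃ λ₃ →
    let s = sigmaPoint λ₁ λ₂ λ₃
        2ₖ = k.1# k.+ k.1#
    in
    ((∃[ x ] ∃[ y ] Specializes s (x ∷ y ∷ k.1# ∷ [])) ⇔ W1 φ ξ)
    ×
    ((∃[ x ] (x k.≉ 2ₖ × Specializes s (k.1# ∷ x ∷ k.0# ∷ []))) ⇔ W2 φ ξ)
    ×
    (∀ x → x k.≉ 2ₖ → Specializes s (k.1# ∷ x ∷ k.0# ∷ []) →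
      (∃[ α ] ∃[ l ] IsIndifferent φ α l) ×
      (∀ α l → IsIndifferent φ α l → ∃[ m ] (l k.* m k.≈ k.1# × x k.≈ l k.+ m)))
    ×
    (Specializes s (k.1# ∷ 2ₖ ∷ k.0# ∷ []) ⇔ W3 φ ξ)
    ×
    (Specializes s (k.0# ∷ k.1# ∷ k.0# ∷ []) ⇔ W4 φ ξ)
theorem1p1 em ℝ K φ ξ weight α₁ α₂ α₃ (a , a≉0 , form) λ₁ λ₂ λ₃ m₁ m₂ m₃ =
  Classification.classification record { em = em ; ℝ′ = ℝ ; K = K } φ ξ weight record
    { α₁ = α₁ ; α₂ = α₂ ; α₃ = α₃ ; a = a ; a≉0 = a≉0
    ; form = QuadraticMaps.fixedForm em baseField (num (lift φ)) (den (lift φ)) (point α₁) (point α₂) (point α₃)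
               form
    ; mult₁ = m₁ ; mult₂ = m₂ ; mult₃ = m₃ }
  where
  open Berkovich ℝ K
  open QuadraticMaps em baseField using (point)
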